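{- Let $L$ be an alternating oriented link diagram, let $C$ be a type 2 Seifert circle of $L$, and let $L=L'*_C L''$ be the corresponding diagrammatic Murasugi sum. - If $C$ has length $1$, then $|\widetilde\Delta_L|=|\widetilde\Delta_{L'}|\,|\widetilde\Delta_{L''}|$. - If $C$ has length $l\ge 2$, then, coefficient-wise, $|\widetilde\Delta_L|\ \ge\ |\widetilde\Delta_{L'}|\,|\widetilde\Delta_{L''}|+|\widetilde\Delta_{\widetilde{L'}}|\,|\widetilde\Delta_{\widetilde{L''}}|$, where $\widetilde{L'},\widetilde{L''}$ are the diagrams obtained from $L',L''$ by swap moves.
   Context: **Diagrams.** An oriented link diagram $L$ is drawn on $S^2$, with over/under information at crossings. A region of $L$ is a connected component of $S^2\setminus L$. A segment is an arc of $L$ between two consecutive crossings (a closed component without crossings counts as one segment). $L$ is alternating if, tracing along any strand, one alternates between going over and under at crossings. Draw a crossing with both strands oriented upward; its four corners are called top (between the two outgoing ends), bottom (between the two incoming ends), left and right. **Symmetrized Alexander polynomial.** Fix a segment $i$ of $L$. The two regions adjacent to $i$ are absent, all others are present. Weights of corners: left and right corners have weight $1$; if the overstrand goes from bottom-left to top-right, the top corner has weight $t^{1/2}$ and the bottom corner $-t^{ -1/2}$; if the overstrand goes from bottom-right to top-left, the top corner has weight $t^{ -1/2}$ and the bottom corner $-t^{1/2}$. A state assigns to each crossing one of its corners lying in a present region, so that every present region is used exactly once; its weight is the product of the weights of the chosen corners. $\widetilde{\Delta}_L\in\mathbb{Z}[t^{\pm 1/2}]$ is the sum of the weights of all states; by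 a theorem of Kauffman it does not depend on $i$. For $f=\sum_i a_it^i\in\mathbb{Z}[t^{\pm1/2}]$, $|f|:=\sum_i|a_i|t^i$. **Seifert circles.** Smoothing every crossing of $L$ according to orientation (connecting bottom-left to top-left, and bottom-right to top-right) gives a collection of oriented circles; each specifies a collection of segments of $L$, called a Seifert circle (a simple closed curve in $S^2$ that turns at each of its crossings). A Seifert circle is type 1 if it bounds a region of $L$ and type 2 otherwise. **Diagrammatic Murasugi sum and length.** Let $C$ be a type 2 Seifert circle; $S^2\setminus C$ has two components $R',R''$. A crossing belongs to $R'$ (resp. $R''$) if at least two of the regions adjacent to it are contained in $R'$ (resp. $R''$). (Each crossing belongs to exactly one of them; for a crossing on $C$ three of its corners lie on the side it belongs to.) $L'$ is the diagram obtained by smoothing the crossings of $C$ that do not belong to $R'$ and then removing the portion of the resulting diagram contained in $R''$; $L''$ is defined analogously with $R',R''$ exchanged. One writes $L=L'*_CL''$. $C$ is a type 1 Seifert circle of both $L'$ (bounding the face $R''$) and $L''$ (bounding the face $R'$). The length of $C$ is $l=\frac12\,\#\{$segments of $C$ which connect a crossing belonging to $R'$ and a crossing belonging to $R''\}$. **The diagrams $\widetilde{L'},\widetilde{L''}$ (for $l\ge2$).** Choose a segment $i$ of $C$ connecting a crossing belonging to $R'$ to one belonging to $R''$. Tracing $C$ from a point of $i$ (in the direction that meets the $R'$ crossing of $i$ first) one meets consecutive nonempty groups of crossings $X_1,Y_1,X_2,Y_2,\dots,X_l,Y_l$, where the crossings in $X_j$ belong to $R'$ and those in $Y_j$ belong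 to $R''$. A swap move takes two oppositely oriented parallel strands bordering a common face, cuts each, and reconnects the four ends across the face, compatibly with orientation, in the other planar way. $\widetilde{L'}$ is obtained from $L'$ by performing swap moves, inside the face $R''$ bounded by $C$, on the segment $i'$ of $L'$ containing $i$ (it separates $X_l$ from $X_1$) and the segments of $C$ separating $X_j$ from $X_{j+1}$, $1\le j\le l-1$. The net effect is that each of these $l$ segments of $C$ is cut and, for each $j$, the two ends of the arc of $C$ running through the crossings of $X_j$ are joined by an arc inside the face, so that $C$ is replaced by $l$ circles, the $j$-th of which contains exactly the crossings $X_j$ and bounds a new face; everything else is unchanged. $\widetilde{L''}$ is obtained from $L''$ in the same way, inside the face $R'$, using the groups $Y_1,\dots,Y_l$. -}

module Defs where

open import Data.Bool.Base using (Bool; true; false; not; T; if_then_else_)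
import Data.Bool.Properties as Bool
open import Data.Empty using (⊥)
open import Data.Integer.Base as ℤ using (ℤ; +_; 0ℤ; 1ℤ; -1ℤ)
import Data.Integer.Properties as ℤ
open import Data.List.Base
  using (List; []; _∷_; _++_; [_]; map; concatMap; mapMaybe; head; filter; foldr; length;
         iterate; deduplicate; cartesianProduct; cartesianProductWith)
import Data.List.Membership.DecPropositional as DecMembership
open import Data.List.Membership.Propositional using (_∈_)
import Data.List.Membership.Propositional.Properties as Mem
open import Data.List.Relation.Unary.All as All using (All; []; _∷_; all?)
open import Data.List.Relation.Unary.AllPairs using ([]; _∷_)
open import Data.List.Relation.Unary.Any using (here; there; any?)
open import Data.List.Relation.Unary.Unique.Propositional using (Unique)
import Data.List.Relation.Unary.Unique.Propositional.Properties as Uniq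
open import Data.Maybe.Base using (Maybe; just; nothing; maybe′; fromMaybe)
open import Data.Nat.Base as ℕ using (ℕ; ⌊_/2⌋)
import Data.Nat.Properties as ℕ
open import Data.Product.Base using (Σ; ∃-syntax; _×_; _,_; proj₁; proj₂)
import Data.Product.Properties as Prod
open import Data.Sum.Base using (_⊎_; inj₁; inj₂)
import Data.Sum.Properties as Sum
open import Data.Unit.Base using (⊤; tt)
import Data.Unit.Properties as Unit
open import Function.Base using (_∘_)
open import Function.Bundles using (_⇔_)
open import Relation.Binary.Construct.Closure.Equivalence using (EqClosure)
open import Relation.Binary.Definitions using (DecidableEquality)
open import Relation.Binary.PropositionalEquality using (_≡_; _≢_; refl; cong)
open import Relation.Nullary using (¬_; Dec; yes; no; does; ¬?; _×-dec_; _⊎-dec_; _→-dec_; map′; T?)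

record FinSet : Set₁ where
  field
    Carrier  : Set
    _≟_      : DecidableEquality Carrier
    elements : List Carrier
    complete : ∀ x → x ∈ elements
    unique   : Unique elements

open FinSet using (Carrier; elements)

size : FinSet → ℕ
size A = length (elements A)

⊤ᶠ : FinSet
⊤ᶠ = record
  { Carrier = ⊤ ; _≟_ = Unit._≟_ ; elements = [ tt ]
  ; complete = λ _ → here refl ; unique = [] ∷ [] }

infixr 1 _⊎ᶠ_

_⊎ᶠ_ : FinSet → FinSet → FinSet
A ⊎ᶠ B = record
  { Carrier  = Carrier A ⊎ Carrier B
  ; _≟_      = Sum.≡-dec A._≟_ B._≟_
  ; elements = map inj₁ A.elements ++ map inj₂ B.elements
  ; complete = λ where
      (inj₁ a) → Mem.∈-++⁺ˡ (Mem.∈-map⁺ inj₁ (A.complete a))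
      (inj₂ b) → Mem.∈-++⁺ʳ _ (Mem.∈-map⁺ inj₂ (B.complete b))
  ; unique   = Uniq.++⁺ (Uniq.map⁺ Sum.inj₁-injective A.unique)
                        (Uniq.map⁺ Sum.inj₂-injective B.unique) disjoint
  }
  where
  module A = FinSet A
  module B = FinSet B
  disjoint : ∀ {v} → v ∈ map inj₁ A.elements × v ∈ map inj₂ B.elements → ⊥
  disjoint (p , q) with Mem.∈-map⁻ inj₁ p | Mem.∈-map⁻ inj₂ q
  ... | _ , _ , refl | _ , _ , ()

infixr 2 _×ᶠ_

_×ᶠ_ : FinSet → FinSet → FinSet
A ×ᶠ B = record
  { Carrier  = Carrier A × Carrier B
  ; _≟_      = Prod.≡-dec A._≟_ B._≟_
  ; elements = cartesianProduct A.elements B.elements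
  ; complete = λ (a , b) → Mem.∈-cartesianProduct⁺ (A.complete a) (B.complete b)
  ; unique   = Uniq.cartesianProduct⁺ A.unique B.unique
  }
  where
  module A = FinSet A
  module B = FinSet B

module _ {A : Set} (p : A → Bool) where

  toSubset : A → Maybe (Σ A (T ∘ p))
  toSubset x with T? (p x)
  ... | yes px = just (x , px)
  ... | no  _  = nothing

  private
    ext : ∀ {x y : Σ A (T ∘ p)} → proj₁ x ≡ proj₁ y → x ≡ y
    ext {x , px} {.x , py} refl = cong (x ,_) (Bool.T-irrelevant px py)

    restrict : List A → List (Σ A (T ∘ p))
    restrict []       = []
    restrict (x ∷ xs) with T? (p x)
    ... | yes px = (x , px) ∷ restrict xs
    ... | no  _  = restrict xs

    restrict⁺ : ∀ {xs} ((x , px) : Σ A (T ∘ p)) → x ∈ xs → (x , px) ∈ restrict xs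
    restrict⁺ {y ∷ _} (x , px) i with T? (p y) | i
    ... | yes _  | here eq = here (ext eq)
    ... | yes _  | there j = there (restrict⁺ (x , px) j)
    ... | no ¬py | here refl with () ← ¬py px
    ... | no _   | there j = restrict⁺ (x , px) j

    restrict-all : ∀ {x px xs} → All (x ≢_) xs → All ((x , px) ≢_) (restrict xs)
    restrict-all [] = []
    restrict-all {xs = y ∷ _} (x≢y ∷ x≢) with T? (p y)
    ... | yes _ = (x≢y ∘ cong proj₁) ∷ restrict-all x≢
    ... | no  _ = restrict-all x≢

    restrict-unique : ∀ {xs} → Unique xs → Unique (restrict xs)
    restrict-unique [] = []
    restrict-unique {x ∷ _} (x∉ ∷ u) with T? (p x)
    ... | yes _ = restrict-all x∉ ∷ restrict-unique u
    ... | no  _ = restrict-unique u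

  subset-≟ : DecidableEquality A → DecidableEquality (Σ A (T ∘ p))
  subset-≟ _≟_ x y = map′ ext (cong proj₁) (proj₁ x ≟ proj₁ y)

  subset-elements : List A → List (Σ A (T ∘ p))
  subset-elements = restrict

  subset-complete : ∀ {xs} → (∀ x → x ∈ xs) → ∀ x → x ∈ subset-elements xs
  subset-complete c x = restrict⁺ x (c (proj₁ x))

  subset-unique : ∀ {xs} → Unique xs → Unique (subset-elements xs)
  subset-unique = restrict-unique

subsetᶠ : (A : FinSet) → (Carrier A → Bool) → FinSet
subsetᶠ A p = record
  { Carrier  = Σ (Carrier A) (T ∘ p)
  ; _≟_      = subset-≟ p (FinSet._≟_ A)
  ; elements = subset-elements p (elements A)
  ; complete = subset-complete p (FinSet.complete A)
  ; unique   = subset-unique p (FinSet.unique A)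
  }

-- A list of terms; (a , n) stands for a t^{n/2}, and equal exponents may recur.
Term Laurent : Set
Term    = ℤ × ℤ
Laurent = List Term

coeff : Laurent → ℤ → ℤ
coeff p n = foldr (λ (a , m) s → (if does (m ℤ.≟ n) then a else 0ℤ) ℤ.+ s) 0ℤ p

infixl 7 _·_ _⊛_
infixl 6 _⊞_
infix  4 _≈_ _≽_

_·_ : Term → Term → Term
(a , m) · (b , n) = a ℤ.* b , m ℤ.+ n

_⊞_ _⊛_ : Laurent → Laurent → Laurent
_⊞_ = _++_
_⊛_ = cartesianProductWith _·_

∣_∣ : Laurent → Laurent
∣ p ∣ = map (λ n → + ℤ.∣ coeff p n ∣ , n) (deduplicate ℤ._≟_ (map proj₂ p))

_≈_ _≽_ : Laurent → Laurent → Set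
p ≈ q = ∀ n → coeff p n ≡ coeff q n
p ≽ q = ∀ n → coeff q n ℤ.≤ coeff p n

-- Crossings are drawn with both strands oriented upward; bl→tr means that the
-- overstrand runs from bottom-left to top-right.
data Over : Set where
  bl→tr br→tl : Over

data Side : Set where
  left right : Side

data Corner : Set where
  top bottom left right : Corner

sides : List Side
sides = left ∷ right ∷ []

sideᶠ : FinSet
sideᶠ = record
  { Carrier = Side ; _≟_ = _≟_ ; elements = sides ; complete = complete
  ; unique = ((λ ()) ∷ []) ∷ [] ∷ [] }
  where
  _≟_ : DecidableEquality Side
  left  ≟ left  = yes refl
  left  ≟ right = no λ ()
  right ≟ left  = no λ ()
  right ≟ right = yes refl
  complete : ∀ s → s ∈ sides
  complete left  = here refl
  complete right = there (here refl)

corners : List Corner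
corners = top ∷ bottom ∷ left ∷ right ∷ []

cornerᶠ : FinSet
cornerᶠ = record
  { Carrier = Corner ; _≟_ = _≟_ ; elements = corners ; complete = complete
  ; unique = ((λ ()) ∷ (λ ()) ∷ (λ ()) ∷ []) ∷ ((λ ()) ∷ (λ ()) ∷ [])
           ∷ ((λ ()) ∷ []) ∷ [] ∷ [] }
  where
  _≟_ : DecidableEquality Corner
  top    ≟ top    = yes refl
  top    ≟ bottom = no λ ()
  top    ≟ left   = no λ ()
  top    ≟ right  = no λ ()
  bottom ≟ top    = no λ ()
  bottom ≟ bottom = yes refl
  bottom ≟ left   = no λ ()
  bottom ≟ right  = no λ ()
  left   ≟ top    = no λ ()
  left   ≟ bottom = no λ ()
  left   ≟ left   = yes refl
  left   ≟ right  = no λ ()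
  right  ≟ top    = no λ ()
  right  ≟ bottom = no λ ()
  right  ≟ left   = no λ ()
  right  ≟ right  = yes refl
  complete : ∀ k → k ∈ corners
  complete top    = here refl
  complete bottom = there (here refl)
  complete left   = there (there (here refl))
  complete right  = there (there (there (here refl)))

-- The combinatorial data of an oriented diagram on a surface.  An element (c , s)
-- of End is read either as the outgoing or as the incoming end of c on side s.
-- The segment leaving c at its outgoing end e arrives at the incoming end next e;
-- prev is the inverse of next.  Because smoothing joins the incoming end (c , s)
-- to the outgoing end (c , s), the orbits of next are the Seifert circles that
-- meet a crossing.  Closed components without crossings form Circle.  Regions are
-- part of the data, since for a disconnected diagram they are not determined by
-- the gluing of the crossings.
record Diagram : Set₁ where
  field
    crossingᶠ circleᶠ regionᶠ : FinSet
    over                      : Carrier crossingᶠ → Over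
    next prev                 : Carrier crossingᶠ × Side → Carrier crossingᶠ × Side
    corner                    : Carrier crossingᶠ → Corner → Carrier regionᶠ
    circleLeft circleRight    : Carrier circleᶠ → Carrier regionᶠ

  Crossing Circle Region End Segment : Set
  Crossing = Carrier crossingᶠ
  Circle   = Carrier circleᶠ
  Region   = Carrier regionᶠ
  End      = Crossing × Side
  Segment  = End ⊎ Circle

  endᶠ : FinSet
  endᶠ = crossingᶠ ×ᶠ sideᶠ

  _≟ᴿ_ : DecidableEquality Region
  _≟ᴿ_ = FinSet._≟_ regionᶠ

  -- A segment of the form inj₁ e is the one leaving the outgoing end e; left and
  -- right are taken with respect to the orientation.
  leftOf rightOf : Segment → Region
  leftOf  (inj₁ (c , left))  = corner c left
  leftOf  (inj₁ (c , right)) = corner c top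
  leftOf  (inj₂ o)           = circleLeft o
  rightOf (inj₁ (c , left))  = corner c top
  rightOf (inj₁ (c , right)) = corner c right
  rightOf (inj₂ o)           = circleRight o

  regionAt : Crossing × Corner → Region
  regionAt (c , k) = corner c k

  -- The corners to the left and right of the strand at an incoming end.
  leftOfIn rightOfIn : End → Crossing × Corner
  leftOfIn  (c , left)  = c , left
  leftOfIn  (c , right) = c , bottom
  rightOfIn (c , left)  = c , bottom
  rightOfIn (c , right) = c , right

  -- The corner to the right of the strand at an outgoing end.
  rightOfOut : End → Crossing × Corner
  rightOfOut (c , left)  = c , top
  rightOfOut (c , right) = c , right

  Adjacent : Segment → Region → Set
  Adjacent e r = r ≡ leftOf e ⊎ r ≡ rightOf e

  adjacent? : ∀ e r → Dec (Adjacent e r)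
  adjacent? e r = (r ≟ᴿ leftOf e) ⊎-dec (r ≟ᴿ rightOf e)

  -- r and r′ can be joined by a path crossing only segments in P.
  Joined : (Segment → Set) → Region → Region → Set
  Joined P = EqClosure (λ r r′ → ∃[ e ] P e × leftOf e ≡ r × rightOf e ≡ r′)

  -- Walks once along the boundary of a region, keeping the region on the left,
  -- from one corner to the following one.
  boundaryStep : Crossing × Corner → Crossing × Corner
  boundaryStep (c , left)   = leftOfIn (next (c , left))
  boundaryStep (c , top)    = leftOfIn (next (c , right))
  boundaryStep (c , right)  = rightOfOut (prev (c , right))
  boundaryStep (c , bottom) = rightOfOut (prev (c , left))

open Diagram

-- For a permutation f: of each orbit only the first listed element is retained.
#orbits : (A : FinSet) → (Carrier A → Carrier A) → ℕ
#orbits A f = length (deduplicate (λ x y → any? (FinSet._≟_ A y) (iterate f x (size A))) (elements A))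

#boundaryCurves : Diagram → ℕ
#boundaryCurves D = #orbits (crossingᶠ D ×ᶠ cornerᶠ) (boundaryStep D) ℕ.+ 2 ℕ.* size (circleᶠ D)

-- D is drawn on the sphere.  Fill in for each region a sphere with one hole per
-- boundary curve.  The resulting closed oriented surface is connected, and its
-- Euler characteristic, which is #crossings − 2 #crossings + Σ_r (2 − #curves of r),
-- equals 2.
record OnSphere (D : Diagram) : Set where
  field
    next-prev : ∀ e → next D (prev D e) ≡ e
    prev-next : ∀ e → prev D (next D e) ≡ e
    left-ok   : ∀ e → regionAt D (leftOfIn D (next D e)) ≡ leftOf D (inj₁ e)
    right-ok  : ∀ e → regionAt D (rightOfIn D (next D e)) ≡ rightOf D (inj₁ e)
    connected : ∀ r r′ → Joined D (λ _ → ⊤) r r′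
    euler     : 2 ℕ.* size (regionᶠ D) ≡ size (crossingᶠ D) ℕ.+ #boundaryCurves D ℕ.+ 2

overAtIn overAtOut : Over → Side → Bool
overAtIn  bl→tr left  = true
overAtIn  bl→tr right = false
overAtIn  br→tl left  = false
overAtIn  br→tl right = true
overAtOut bl→tr left  = false
overAtOut bl→tr right = true
overAtOut br→tl left  = true
overAtOut br→tl right = false

Alternating : Diagram → Set
Alternating D = ∀ e → atIn (next D e) ≡ not (atOut e)
  where
  atIn atOut : End D → Bool
  atIn  (c , s) = overAtIn  (over D c) s
  atOut (c , s) = overAtOut (over D c) s

weight : Over → Corner → Term
weight _     left   = 1ℤ , 0ℤ
weight _     right  = 1ℤ , 0ℤ
weight bl→tr top    = 1ℤ , 1ℤ
weight bl→tr bottom = -1ℤ , -1ℤ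
weight br→tl top    = 1ℤ , -1ℤ
weight br→tl bottom = -1ℤ , 1ℤ

module _ (D : Diagram) where

  private
    Cs = elements (crossingᶠ D)
    Rs = elements (regionᶠ D)

  -- Every function Crossing D → Corner occurs exactly once, up to pointwise
  -- equality, in assignments (elements (crossingᶠ D)).
  assignments : List (Crossing D) → List (Crossing D → Corner)
  assignments []       = [ (λ _ → top) ]
  assignments (c ∷ cs) = concatMap (λ σ → map (λ k → update σ k) corners) (assignments cs)
    where
    update : (Crossing D → Corner) → Corner → Crossing D → Corner
    update σ k c′ = if does (FinSet._≟_ (crossingᶠ D) c′ c) then k else σ c′

  usesOf : (Crossing D → Corner) → Region D → ℕ
  usesOf σ r = length (filter (λ c → _≟ᴿ_ D (corner D c (σ c)) r) Cs)

  Present : Segment D → Region D → Set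
  Present i r = ¬ Adjacent D i r

  IsState : Segment D → (Crossing D → Corner) → Set
  IsState i σ = All (λ c → Present i (corner D c (σ c))) Cs
              × All (λ r → Present i r → usesOf σ r ≡ 1) Rs

  isState? : ∀ i σ → Dec (IsState i σ)
  isState? i σ = all? (λ c → ¬? (adjacent? D i _)) Cs
         ×-dec all? (λ r → ¬? (adjacent? D i r) →-dec (usesOf σ r ℕ.≟ 1)) Rs

  stateWeight : (Crossing D → Corner) → Term
  stateWeight σ = foldr (λ c w → weight (over D c) (σ c) · w) (1ℤ , 0ℤ) Cs

  Δ̃ : Segment D → Laurent
  Δ̃ i = map stateWeight (filter (isState? i) (assignments Cs))

module _ (L : Diagram) where

  -- The Seifert circle through the segment leaving e, as a list (possibly with
  -- repetitions) of the ends its segments leave.  Only Seifert circles meeting a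
  -- crossing are described in this way; the others have length 0.
  circleThrough : End L → List (End L)
  circleThrough e = iterate (next L) e (size (endᶠ L))

module SeifertCircle (L : Diagram) (C : End L) where

  open DecMembership (FinSet._≟_ (endᶠ L)) using (_∈?_)

  OnC : Segment L → Set
  OnC (inj₁ e) = e ∈ circleThrough L C
  OnC (inj₂ _) = ⊥

  Type1 Type2 : Set
  Type1 = ∃[ r ] (∀ e → Adjacent L e r ⇔ OnC e)
  Type2 = ¬ Type1

  -- The two components of S² ∖ C are named by true and false.
  record Complement : Set where
    field
      side      : Region L → Bool
      component : ∀ r r′ → (side r ≡ side r′) ⇔ Joined L (λ e → ¬ OnC e) r r′

  module _ (S : Complement) where
    open Complement S

    module _ (b : Bool) where

      In : Region L → Set
      In r = side r ≡ b

      in? : ∀ r → Dec (In r)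
      in? r = side r Bool.≟ b

      BelongsTo : Crossing L → Set
      BelongsTo c = 2 ℕ.≤ length (filter (λ k → in? (corner L c k)) corners)

      belongsTo? : ∀ c → Dec (BelongsTo c)
      belongsTo? c = 2 ℕ.≤? _

    Connecting : End L → Set
    Connecting e = e ∈ circleThrough L C
                 × ( (BelongsTo true  (proj₁ e) × BelongsTo false (proj₁ (next L e)))
                   ⊎ (BelongsTo false (proj₁ e) × BelongsTo true  (proj₁ (next L e))))

    connecting? : ∀ e → Dec (Connecting e)
    connecting? e = (e ∈? circleThrough L C)
              ×-dec ((belongsTo? true _ ×-dec belongsTo? false _)
               ⊎-dec (belongsTo? false _ ×-dec belongsTo? true _))

    len : ℕ
    len = ⌊ length (filter connecting? (elements (endᶠ L))) /2⌋

    -- The summand on side b.  Following a segment through the smoothed crossings of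
    -- C amounts to iterating next until a kept crossing is met; as this returns
    -- eventually to the starting point, the default in follow is never used.
    factor : Bool → Diagram
    factor b = record
      { crossingᶠ   = subsetᶠ (crossingᶠ L) kept
      ; circleᶠ     = subsetᶠ (circleᶠ L) (λ o → does (in? b (circleLeft L o)))
      ; regionᶠ     = subsetᶠ (regionᶠ L) (λ r → does (in? b r)) ⊎ᶠ ⊤ᶠ
      ; over        = λ c → over L (proj₁ c)
      ; next        = follow (next L)
      ; prev        = follow (prev L)
      ; corner      = λ c k → toRegion (corner L (proj₁ c) k)
      ; circleLeft  = λ o → toRegion (circleLeft L (proj₁ o))
      ; circleRight = λ o → toRegion (circleRight L (proj₁ o))
      }
      where
      kept : Crossing L → Bool
      kept c = does (belongsTo? b c)

      Kept : Set
      Kept = Σ (Crossing L) (T ∘ kept) × Side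

      toKept : End L → Maybe Kept
      toKept (c , s) = maybe′ (λ c′ → just (c′ , s)) nothing (toSubset kept c)

      follow : (End L → End L) → Kept → Kept
      follow f e@((c , _) , s) =
        fromMaybe e (head (mapMaybe toKept (iterate f (f (c , s)) (size (endᶠ L)))))

      -- inj₂ tt is the face of the new diagram bounded by C.
      toRegion : Region L → Σ (Region L) (λ r → T (does (in? b r))) ⊎ ⊤
      toRegion r = maybe′ inj₁ (inj₂ tt) (toSubset _ r)

    outerFace : ∀ b → Region (factor b)
    outerFace _ = inj₂ tt

    -- The segments of C in factor b between consecutive groups of kept crossings:
    -- in L they run through crossings belonging to the other side.
    separating : ∀ b → End (factor b) → Bool
    separating b ((c , _) , s) = does (belongsTo? (not b) (proj₁ (next L (c , s))))

-- The segments marked by cut lie on a type 1 Seifert circle of D bounding the face f.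
-- All of them are cut inside f; for each g with cut g, the arc of the circle which
-- ends by leaving g is closed up inside f by joining g to the beginning of that arc,
-- and bounds a new face, also named g.  The remainder of f merges with the regions on
-- the other side of the cut segments into a single region, inj₂ (inj₁ tt).
swap : (D : Diagram) → Region D → (End D → Bool) → Diagram
swap D f cut = record
  { crossingᶠ   = crossingᶠ D
  ; circleᶠ     = circleᶠ D
  ; regionᶠ     = subsetᶠ (regionᶠ D) survives ⊎ᶠ ⊤ᶠ ⊎ᶠ subsetᶠ (endᶠ D) cut
  ; over        = over D
  ; next        = λ e → if cut e then next D (cutFrom (prev D) (prev D e)) else next D e
  ; prev        = λ e → if cut (prev D e) then cutFrom (next D) e else prev D e
  ; corner      = corner~
  ; circleLeft  = toRegion ∘ circleLeft D
  ; circleRight = toRegion ∘ circleRight D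
  }
  where
  survives : Region D → Bool
  survives r = does (¬? (_≟ᴿ_ D r f)
    ×-dec all? (λ e → T? (cut e) →-dec ¬? (adjacent? D (inj₁ e) r)) (elements (endᶠ D)))

  Region~ : Set
  Region~ = Σ (Region D) (T ∘ survives) ⊎ ⊤ ⊎ Σ (End D) (T ∘ cut)

  firstCut : (End D → End D) → End D → Maybe (Σ (End D) (T ∘ cut))
  firstCut step e = head (mapMaybe (toSubset cut) (iterate step e (size (endᶠ D))))

  cutFrom : (End D → End D) → End D → End D
  cutFrom step e = maybe′ proj₁ e (firstCut step e)

  toRegion : Region D → Region~
  toRegion r = maybe′ inj₁ (inj₂ (inj₁ tt)) (toSubset survives r)

  newFace : End D → Region~
  newFace e = maybe′ (inj₂ ∘ inj₂) (inj₂ (inj₁ tt)) (firstCut (next D) e)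

  -- Seifert circles turn at their crossings, so f occupies only left and right
  -- corners, where its boundary passes through the end on the same side.
  corner~ : Crossing D → Corner → Region~
  corner~ c left  = if does (_≟ᴿ_ D (corner D c left)  f) then newFace (c , left)  else toRegion (corner D c left)
  corner~ c right = if does (_≟ᴿ_ D (corner D c right) f) then newFace (c , right) else toRegion (corner D c right)
  corner~ c k     = toRegion (corner D c k)

module _ (L : Diagram) (C : End L) (S : SeifertCircle.Complement L C) where

  open SeifertCircle L C

  tilde : Bool → Diagram
  tilde b = swap (factor S b) (outerFace S b) (separating S b)

{-# OPTIONS --safe #-}
module Submission where

-- In an alternating diagram all states with the same exponent have the same sign, so the
-- coefficients of |Δ̃| count states.  In a state every present region points to the one
-- opposite to it at its crossing; these pointers form trees.  Fix a crossing c₀.  Summing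
-- a quantity read off the trees over the pairs of a crossing d ≠ c₀ and a state with the
-- pointers of c₀ and d removed gives linear relations between the numbers of states for the
-- four base segments at c₀, and hence their equality.  We may therefore take a segment of C
-- leading from R' to R'' as the base of all diagrams at once.
--
-- The states of L' and L'' with this base combine to states of L in which each crossing uses
-- a region on its own side.  Those of the diagrams obtained by swap moves combine to states of
-- L in which the regions along the swapped segments are used from the opposite side.  For
-- l = 1 the first kind exhausts the states of L; for l ≥ 2 the kinds are disjoint.
--
-- That C separates the sphere in the expected way is the vanishing of the first cohomology
-- with coefficients in F₂, which follows from Euler's formula by counting dimensions.  If the
-- projection of L is disconnected all coefficients vanish, which is seen by comparing the
-- numbers of crossings and regions.

open import Data.Bool.Base using (Bool; true; false; not; T; if_then_else_; _xor_; _∧_; _∨_)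
import Data.Bool.Properties as Bool
open import Data.Empty using (⊥; ⊥-elim)
open import Data.Fin.Base as Fin using ()
import Data.Fin.Properties as Fin
open import Data.Integer.Base as ℤ using (ℤ; +_; 0ℤ; 1ℤ; -1ℤ; _+_; _*_; -_; _-_)
import Data.Integer.Properties as ℤ
open import Algebra.Bundles using (CommutativeRing)
import Algebra.Properties.CommutativeSemigroup (CommutativeRing.+-commutativeSemigroup Bool.xor-∧-commutativeRing) as Xor
import Algebra.Properties.AbelianGroup ℤ.+-0-abelianGroup as ℤ+
open import Data.Integer.Tactic.RingSolver using (solve-∀)
open import Data.Nat.Tactic.RingSolver using () renaming (solve-∀ to solveℕ)
open import Data.List.Base using (List; []; _∷_; _++_; [_]; map; concatMap; mapMaybe; head; foldr; filter; length; iterate; deduplicate; cartesianProduct; lookup)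
import Data.List.Properties as List
open import Data.List.Membership.Propositional using (_∈_; find; lose)
import Data.List.Membership.Propositional.Properties as Mem
open import Data.List.Relation.Unary.All as All using (All; []; _∷_; all?)
open import Data.List.Relation.Unary.AllPairs using ([]; _∷_)
open import Data.List.Relation.Unary.Any as Any using (here; there; any?)
open import Data.List.Relation.Unary.Any.Properties using (lookup-index)
open import Data.List.Relation.Unary.Unique.Propositional using (Unique)
open import Data.List.Relation.Unary.Unique.DecPropositional.Properties using (deduplicate-!)
open import Data.Nat.Base as ℕ using (ℕ; zero; suc; z≤n; s≤s; _≤_)
import Data.Nat.Properties as ℕ
open import Data.Product.Base using (Σ; ∃; ∃-syntax; ∃₂; _×_; _,_; proj₁; proj₂)
open import Data.Sum.Base using (_⊎_; inj₁; inj₂; [_,_]′)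
open import Data.Unit.Base using (tt)
open import Function.Base using (_∘_; case_of_; id)
open import Function.Bundles using (Equivalence)
open import Relation.Binary.Construct.Closure.ReflexiveTransitive using (ε; _◅_)
open import Relation.Binary.Construct.Closure.Symmetric using (fwd; bwd)
open import Relation.Binary.Definitions using (DecidableEquality)
open import Relation.Binary.PropositionalEquality
open import Relation.Nullary using (¬_; Dec; yes; no; does; ¬?; _×-dec_; _⊎-dec_; _→-dec_; contradiction; T?)
open import Data.Maybe.Base using (Maybe; just; nothing; maybe′; fromMaybe)
open import Relation.Nullary.Decidable using (dec-true; dec-false; decidable-stable; toWitness; map′)
open import Defs

-- Only L is given on the sphere, yet L, its summands and the swapped diagrams must all be treated
-- alike. What is needed of any of them is therefore condensed in `Skeleton`: the two ends of a
-- segment see the same regions, the projection is connected, the shading is consistent. Acyclicity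
-- of the pointers and the Alexander index both come from one device, `energy`: a potential along
-- the trees turns the antisymmetric identity `pairing` into a vanishing sum of squares. The index
-- then grades the double count. It is used with two slopes, since the relations for a single slope
-- do not yet separate the ends at the left from those at the right corner.
--
-- The obstacle lies in the swapped diagrams: a priori their projections may be disconnected, and
-- different segments of C may meet the same region. It is overcome by counting. A state bounds the
-- number of regions by the number of crossings plus two. If both swapped diagrams have states,
-- these bounds add up to the number of regions of L, which leaves no room for coincidences; if one
-- has none, the second product is zero and the first one suffices.

variable
  A B 𝒫 𝒬 : Set

-- Finite sums and assignments

∑ : List A → (A → ℤ) → ℤ
∑ xs f = foldr (λ x s → f x + s) 0ℤ xs

infix 10 ⟦_⟧

⟦_⟧ : Dec 𝒫 → ℤ
⟦ d ⟧ = if does d then 1ℤ else 0ℤ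

⟦⟧-yes : (d : Dec 𝒫) → 𝒫 → ⟦ d ⟧ ≡ 1ℤ
⟦⟧-yes d p rewrite dec-true d p = refl

⟦⟧-no : (d : Dec 𝒫) → ¬ 𝒫 → ⟦ d ⟧ ≡ 0ℤ
⟦⟧-no d p rewrite dec-false d p = refl

⟦⟧-cong : (d : Dec 𝒫) (e : Dec 𝒬) → (𝒫 → 𝒬) → (𝒬 → 𝒫) → ⟦ d ⟧ ≡ ⟦ e ⟧
⟦⟧-cong (yes p) e f g = sym (⟦⟧-yes e (f p))
⟦⟧-cong (no ¬p) e f g = sym (⟦⟧-no e (¬p ∘ g))

if-yes : ∀ (d : Dec 𝒫) {x y : A} → 𝒫 → (if does d then x else y) ≡ x
if-yes d p rewrite dec-true d p = refl

if-no : ∀ (d : Dec 𝒫) {x y : A} → ¬ 𝒫 → (if does d then x else y) ≡ y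
if-no d p rewrite dec-false d p = refl

does-true : (d : Dec 𝒫) → does d ≡ true → 𝒫
does-true (yes p) _ = p

⟦⟧-1 : (d : Dec 𝒫) → ⟦ d ⟧ ≡ 1ℤ → 𝒫
⟦⟧-1 (yes p) _ = p

⟦⟧-nonneg : (d : Dec 𝒫) → 0ℤ ℤ.≤ ⟦ d ⟧
⟦⟧-nonneg (yes _) = ℤ.+≤+ z≤n
⟦⟧-nonneg (no _)  = ℤ.+≤+ z≤n

⟦⟧-× : (d : Dec 𝒫) (e : Dec 𝒬) → ⟦ d ×-dec e ⟧ ≡ ⟦ d ⟧ * ⟦ e ⟧
⟦⟧-× (yes _) (yes _) = refl
⟦⟧-× (yes _) (no _)  = refl
⟦⟧-× (no _)  e       = refl

∑-cong : ∀ (xs : List A) {f g : A → ℤ} → (∀ x → f x ≡ g x) → ∑ xs f ≡ ∑ xs g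
∑-cong []       h = refl
∑-cong (x ∷ xs) h = cong₂ _+_ (h x) (∑-cong xs h)

∑-0 : ∀ (xs : List A) → ∑ xs (λ _ → 0ℤ) ≡ 0ℤ
∑-0 []       = refl
∑-0 (x ∷ xs) = trans (ℤ.+-identityˡ _) (∑-0 xs)

∑-zero : ∀ (xs : List A) {f : A → ℤ} → (∀ x → f x ≡ 0ℤ) → ∑ xs f ≡ 0ℤ
∑-zero xs h = trans (∑-cong xs h) (∑-0 xs)

+-exchange : ∀ a b c d → (a + b) + (c + d) ≡ (a + c) + (b + d)
+-exchange = solve-∀

∑-+ : ∀ (xs : List A) (f g : A → ℤ) → ∑ xs (λ x → f x + g x) ≡ ∑ xs f + ∑ xs g
∑-+ []       f g = refl
∑-+ (x ∷ xs) f g = trans (cong (_+_ (f x + g x)) (∑-+ xs f g)) (+-exchange (f x) (g x) _ _)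

∑-*ˡ : ∀ (xs : List A) a (f : A → ℤ) → ∑ xs (λ x → a * f x) ≡ a * ∑ xs f
∑-*ˡ []       a f = sym (ℤ.*-zeroʳ a)
∑-*ˡ (x ∷ xs) a f = trans (cong (_+_ (a * f x)) (∑-*ˡ xs a f)) (sym (ℤ.*-distribˡ-+ a _ _))

∑-*ʳ : ∀ (xs : List A) a (f : A → ℤ) → ∑ xs (λ x → f x * a) ≡ ∑ xs f * a
∑-*ʳ xs a f = trans (∑-cong xs (λ x → ℤ.*-comm (f x) a)) (trans (∑-*ˡ xs a f) (ℤ.*-comm a _))

∑-neg : ∀ (xs : List A) (f : A → ℤ) → ∑ xs (λ x → - f x) ≡ - ∑ xs f
∑-neg []       f = refl
∑-neg (x ∷ xs) f = trans (cong (_+_ (- f x)) (∑-neg xs f)) (sym (ℤ.neg-distrib-+ (f x) _))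

∑-- : ∀ (xs : List A) (f g : A → ℤ) → ∑ xs (λ x → f x - g x) ≡ ∑ xs f - ∑ xs g
∑-- xs f g = trans (∑-+ xs f (λ x → - g x)) (cong (_+_ (∑ xs f)) (∑-neg xs g))

∑-swap : ∀ (xs : List A) (ys : List B) (f : A → B → ℤ) →
         ∑ xs (λ x → ∑ ys (f x)) ≡ ∑ ys (λ y → ∑ xs (λ x → f x y))
∑-swap []       ys f = sym (∑-0 ys)
∑-swap (x ∷ xs) ys f = trans (cong (_+_ (∑ ys (f x))) (∑-swap xs ys f)) (sym (∑-+ ys (f x) _))

∑-++ : ∀ (xs ys : List A) (f : A → ℤ) → ∑ (xs ++ ys) f ≡ ∑ xs f + ∑ ys f
∑-++ []       ys f = sym (ℤ.+-identityˡ _)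
∑-++ (x ∷ xs) ys f = trans (cong (_+_ (f x)) (∑-++ xs ys f)) (sym (ℤ.+-assoc (f x) _ _))

∑-map : ∀ (g : A → B) (xs : List A) (f : B → ℤ) → ∑ (map g xs) f ≡ ∑ xs (f ∘ g)
∑-map g []       f = refl
∑-map g (x ∷ xs) f = cong (_+_ (f (g x))) (∑-map g xs f)

∑-concatMap : ∀ (g : A → List B) (xs : List A) (f : B → ℤ) →
              ∑ (concatMap g xs) f ≡ ∑ xs (λ x → ∑ (g x) f)
∑-concatMap g []       f = refl
∑-concatMap g (x ∷ xs) f =
  trans (∑-++ (g x) (concatMap g xs) f) (cong (_+_ (∑ (g x) f)) (∑-concatMap g xs f))

∑-cartesianProduct : ∀ (xs : List A) (ys : List B) (f : A × B → ℤ) →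
                     ∑ (cartesianProduct xs ys) f ≡ ∑ xs (λ x → ∑ ys (λ y → f (x , y)))
∑-cartesianProduct []       ys f = refl
∑-cartesianProduct (x ∷ xs) ys f =
  trans (∑-++ (map (x ,_) ys) _ f) (cong₂ _+_ (∑-map (x ,_) ys f) (∑-cartesianProduct xs ys f))

∑-mono : ∀ (xs : List A) {f g : A → ℤ} → (∀ x → f x ℤ.≤ g x) → ∑ xs f ℤ.≤ ∑ xs g
∑-mono []       h = ℤ.≤-refl
∑-mono (x ∷ xs) h = ℤ.+-mono-≤ (h x) (∑-mono xs h)

∑-nonneg : ∀ (xs : List A) {f : A → ℤ} → (∀ x → 0ℤ ℤ.≤ f x) → 0ℤ ℤ.≤ ∑ xs f
∑-nonneg xs {f} h = subst (ℤ._≤ ∑ xs f) (∑-0 xs) (∑-mono xs h)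

nonneg-sum-zero : ∀ {a b} → 0ℤ ℤ.≤ a → 0ℤ ℤ.≤ b → a + b ≡ 0ℤ → a ≡ 0ℤ × b ≡ 0ℤ
nonneg-sum-zero {+ zero}  {+ zero}  _ _ _  = refl , refl
nonneg-sum-zero {+ zero}  {+ suc n} _ _ ()
nonneg-sum-zero {+ suc m} {+ n}     _ _ ()

∑-nonneg-zero : ∀ (xs : List A) {f : A → ℤ} → (∀ x → 0ℤ ℤ.≤ f x) → ∑ xs f ≡ 0ℤ →
                ∀ {x} → x ∈ xs → f x ≡ 0ℤ
∑-nonneg-zero (y ∷ ys) h e i with nonneg-sum-zero (h y) (∑-nonneg ys h) e | i
... | p , _ | here refl = p
... | _ , q | there j   = ∑-nonneg-zero ys h q j

square-nonneg : ∀ a → 0ℤ ℤ.≤ a * a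
square-nonneg (+ n)      = subst (0ℤ ℤ.≤_) (ℤ.pos-* n n) (ℤ.+≤+ z≤n)
square-nonneg ℤ.-[1+ n ] = ℤ.+≤+ z≤n

square-zero : ∀ a → a * a ≡ 0ℤ → a ≡ 0ℤ
square-zero a e = [ id , id ]′ (ℤ.i*j≡0⇒i≡0∨j≡0 a e)

∑≢0 : ∀ (xs : List A) (f : A → ℤ) → ∑ xs f ≢ 0ℤ → ∃[ x ] x ∈ xs × f x ≢ 0ℤ
∑≢0 []       f n = contradiction refl n
∑≢0 (x ∷ xs) f n with f x ℤ.≟ 0ℤ
... | no ≢0 = x , here refl , ≢0
... | yes e with ∑≢0 xs f (λ q → n (cong₂ _+_ e q))
...   | y , i , q = y , there i , q

∑-count : ∀ {𝒫 : A → Set} (𝒫? : ∀ x → Dec (𝒫 x)) (xs : List A) →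
          + length (filter 𝒫? xs) ≡ ∑ xs (λ x → ⟦ 𝒫? x ⟧)
∑-count 𝒫? []       = refl
∑-count 𝒫? (x ∷ xs) with 𝒫? x
... | yes _ = cong (_+_ 1ℤ) (∑-count 𝒫? xs)
... | no _  = trans (∑-count 𝒫? xs) (sym (ℤ.+-identityˡ _))

∑-filter : ∀ {𝒫 : A → Set} (𝒫? : ∀ x → Dec (𝒫 x)) (xs : List A) (f : A → ℤ) →
           ∑ (filter 𝒫? xs) f ≡ ∑ xs (λ x → ⟦ 𝒫? x ⟧ * f x)
∑-filter 𝒫? []       f = refl
∑-filter 𝒫? (x ∷ xs) f with 𝒫? x
... | yes _ = cong₂ _+_ (sym (ℤ.*-identityˡ (f x))) (∑-filter 𝒫? xs f)
... | no _  = trans (∑-filter 𝒫? xs f) (sym (ℤ.+-identityˡ _))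

∑-length : ∀ (xs : List A) → ∑ xs (λ _ → 1ℤ) ≡ + length xs
∑-length []       = refl
∑-length (x ∷ xs) = cong (_+_ 1ℤ) (∑-length xs)

module _ {𝒫 : A → Set} (𝒫? : ∀ x → Dec (𝒫 x)) (ψ : A → ℤ) where

  ∑-none : ∀ {xs} → All (¬_ ∘ 𝒫) xs → ∑ xs (λ x → ⟦ 𝒫? x ⟧ * ψ x) ≡ 0ℤ
  ∑-none []              = refl
  ∑-none (_∷_ {x = x} ¬p ps) = cong₂ _+_ (cong (_* ψ x) (⟦⟧-no (𝒫? x) ¬p)) (∑-none ps)

  ∑-single : ∀ {xs x} → x ∈ xs → 𝒫 x → (∀ {y} → y ∈ xs → 𝒫 y → y ≡ x) → Unique xs →
             ∑ xs (λ y → ⟦ 𝒫? y ⟧ * ψ y) ≡ ψ x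
  ∑-single {y ∷ ys} {x} (here refl) p u (y∉ ∷ _) =
    trans (cong₂ _+_ (cong (_* ψ x) (⟦⟧-yes (𝒫? x) p))
                     (∑-none (All.tabulate (λ {z} i q → All.lookup y∉ i (sym (u (there i) q))))))
          (trans (ℤ.+-identityʳ _) (ℤ.*-identityˡ (ψ x)))
  ∑-single {y ∷ ys} {x} (there i) p u (y∉ ∷ uq) =
    trans (cong₂ _+_ (cong (_* ψ y) (⟦⟧-no (𝒫? y) (λ q → All.lookup y∉ i (u (here refl) q))))
                     (∑-single i p (u ∘ there) uq))
          (ℤ.+-identityˡ _)

count-none : ∀ {𝒫 : A → Set} (𝒫? : ∀ x → Dec (𝒫 x)) (xs : List A) →
             ∑ xs (λ x → ⟦ 𝒫? x ⟧) ≡ 0ℤ → ∀ {x} → x ∈ xs → ¬ 𝒫 x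
count-none 𝒫? xs e {x} i p with () ← trans (sym (⟦⟧-yes (𝒫? x) p)) (∑-nonneg-zero xs (⟦⟧-nonneg ∘ 𝒫?) e i)

count-one : ∀ {𝒫 : A → Set} (𝒫? : ∀ x → Dec (𝒫 x)) (xs : List A) → ∑ xs (λ x → ⟦ 𝒫? x ⟧) ≡ 1ℤ →
            ∃[ x ] x ∈ xs × 𝒫 x × (∀ {y} → y ∈ xs → 𝒫 y → y ≡ x)
count-one 𝒫? (x ∷ xs) e with 𝒫? x
... | yes p = x , here refl , p , λ where
      (here refl) _ → refl
      (there i)   q → contradiction q (count-none 𝒫? xs (ℤ+.∙-cancelˡ 1ℤ _ _ e) i)
... | no ¬p with count-one 𝒫? xs (trans (sym (ℤ.+-identityˡ _)) e)
...   | y , i , p , u = y , there i , p , λ where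
        (here refl) q → contradiction q ¬p
        (there j)   q → u j q

private
  ψ-here : ∀ a b → 1ℤ * a + b ≡ a + b
  ψ-here = solve-∀

∑-two : ∀ {𝒫 : A → Set} (𝒫? : ∀ x → Dec (𝒫 x)) (ψ : A → ℤ) {xs} → Unique xs →
        ∑ xs (λ x → ⟦ 𝒫? x ⟧) ≡ + 2 →
        ∃[ x ] ∃[ y ] x ∈ xs × y ∈ xs × x ≢ y × 𝒫 x × 𝒫 y × (∀ {z} → z ∈ xs → 𝒫 z → z ≡ x ⊎ z ≡ y)
          × ∑ xs (λ z → ⟦ 𝒫? z ⟧ * ψ z) ≡ ψ x + ψ y
∑-two 𝒫? ψ {x ∷ xs} (x∉ ∷ u) e with 𝒫? x
... | yes p with count-one 𝒫? xs (ℤ+.∙-cancelˡ 1ℤ _ 1ℤ e)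
...   | y , j , q , un = x , y , here refl , there j , All.lookup x∉ j , p , q ,
        (λ { (here refl) _ → inj₁ refl ; (there k) r → inj₂ (un k r) }) ,
        trans (ψ-here (ψ x) _) (cong (_+_ (ψ x)) (∑-single 𝒫? ψ j q un u))
∑-two 𝒫? ψ {x ∷ xs} (x∉ ∷ u) e | no ¬p with ∑-two 𝒫? ψ u (trans (sym (ℤ.+-identityˡ _)) e)
...   | y , z , i , j , ne , p , q , un , s = y , z , there i , there j , ne , p , q ,
        (λ { (here refl) r → contradiction r ¬p ; (there k) r → un k r }) ,
        trans (ℤ.+-identityˡ _) s

module Finite (A : FinSet) where

  open FinSet A public

  δ : Carrier → Carrier → ℤ
  δ x y = ⟦ x ≟ y ⟧

  δ-sym : ∀ x y → δ x y ≡ δ y x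
  δ-sym x y = ⟦⟧-cong (x ≟ y) (y ≟ x) sym sym

  ∑ᶠ : (Carrier → ℤ) → ℤ
  ∑ᶠ = ∑ elements

  ∑-δ : ∀ x (f : Carrier → ℤ) → ∑ᶠ (λ y → δ y x * f y) ≡ f x
  ∑-δ x f = ∑-single (_≟ x) f (complete x) refl (λ _ e → e) unique

  ∑-δ1 : ∀ x → ∑ᶠ (λ y → δ y x) ≡ 1ℤ
  ∑-δ1 x = trans (∑-cong elements (λ y → sym (ℤ.*-identityʳ (δ y x)))) (∑-δ x (λ _ → 1ℤ))

  reindex : (f g : Carrier → Carrier) → (∀ x → f (g x) ≡ x) → (∀ x → g (f x) ≡ x) →
            (F : Carrier → ℤ) → ∑ᶠ (F ∘ f) ≡ ∑ᶠ F
  reindex f g fg gf F =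
    trans (∑-cong elements (λ x → sym (∑-δ (f x) F)))
   (trans (∑-swap elements elements (λ x y → δ y (f x) * F y))
   (∑-cong elements λ y →
     trans (∑-*ʳ elements (F y) (λ x → δ y (f x)))
    (trans (cong (_* F y) (trans (∑-cong elements (λ x → ⟦⟧-cong (y ≟ f x) (x ≟ g y)
               (λ e → trans (sym (gf x)) (cong g (sym e))) (λ e → trans (sym (fg y)) (cong f (sym e)))))
             (∑-δ1 (g y))))
           (ℤ.*-identityˡ (F y)))))

∑ₖ : (Corner → ℤ) → ℤ
∑ₖ = ∑ corners

module Assignments (X : FinSet) where

  private
    open module X = FinSet X using () renaming (Carrier to C; _≟_ to _≟ₓ_)

  Asg : Set
  Asg = C → Corner

  upd : Asg → C → Corner → Asg
  upd σ c k c′ = if does (c′ ≟ₓ c) then k else σ c′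

  infix 4 _≗ₐ_
  _≗ₐ_ : Asg → Asg → Set
  σ ≗ₐ τ = ∀ c → σ c ≡ τ c

  upd-here : ∀ σ c k → upd σ c k c ≡ k
  upd-here σ c k rewrite dec-true (c ≟ₓ c) refl = refl

  upd-there : ∀ σ {c c′} k → c′ ≢ c → upd σ c k c′ ≡ σ c′
  upd-there σ {c} {c′} k n rewrite dec-false (c′ ≟ₓ c) n = refl

  upd-cong : ∀ {σ τ} c k → σ ≗ₐ τ → upd σ c k ≗ₐ upd τ c k
  upd-cong c k h c′ with c′ ≟ₓ c
  ... | yes _ = refl
  ... | no _  = h c′

  upd-twice : ∀ σ c j k → upd (upd σ c j) c k ≗ₐ upd σ c k
  upd-twice σ c j k c′ with c′ ≟ₓ c
  ... | yes _ = refl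
  ... | no _  = refl

  upd-comm : ∀ σ {c d} j k → c ≢ d → upd (upd σ c j) d k ≗ₐ upd (upd σ d k) c j
  upd-comm σ {c} {d} j k n c′ with c′ ≟ₓ d | c′ ≟ₓ c
  ... | yes refl | yes refl = contradiction refl n
  ... | yes _    | no _     = refl
  ... | no _     | yes _    = refl
  ... | no _     | no _     = refl

  Ext : (Asg → ℤ) → Set
  Ext F = ∀ {σ τ} → σ ≗ₐ τ → F σ ≡ F τ

  -- The sum over `assignments`, taken one crossing at a time by updates. The two agree for summands
  -- that depend only on the values of an assignment (`Ext`).
  S : List C → (Asg → ℤ) → ℤ
  S []       F = F (λ _ → top)
  S (c ∷ cs) F = S cs (λ σ → ∑ₖ (λ k → F (upd σ c k)))

  S-cong : ∀ cs {F G} → (∀ σ → F σ ≡ G σ) → S cs F ≡ S cs G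
  S-cong []       h = h _
  S-cong (c ∷ cs) h = S-cong cs (λ σ → ∑-cong corners (λ k → h (upd σ c k)))

  -- Updates at different crossings commute, so the pointer of c can be summed over first wherever c
  -- stands in the list. Two sums are compared by moving one pointer while all others are frozen.
  S-local : ∀ {cs c F G} → c ∈ cs → Ext F → Ext G →
            (∀ σ → ∑ₖ (λ k → F (upd σ c k)) ≡ ∑ₖ (λ k → G (upd σ c k))) → S cs F ≡ S cs G
  S-local {c ∷ cs} (here refl) _ _ h = S-cong cs h
  S-local {c′ ∷ cs} {c} {F} {G} (there i) eF eG h = S-local i (ext eF) (ext eG) local
    where
    ext : ∀ {H} → Ext H → Ext (λ σ → ∑ₖ (λ k → H (upd σ c′ k)))
    ext eH e = ∑-cong corners (λ k → eH (upd-cong c′ k e))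
    local : ∀ σ → ∑ₖ (λ j → ∑ₖ (λ k → F (upd (upd σ c j) c′ k)))
                ≡ ∑ₖ (λ j → ∑ₖ (λ k → G (upd (upd σ c j) c′ k)))
    local σ with c ≟ₓ c′
    ... | yes refl = ∑-cong corners (λ j →
          trans (∑-cong corners (λ k → eF (upd-twice σ c j k)))
         (trans (h σ) (sym (∑-cong corners (λ k → eG (upd-twice σ c j k))))))
    ... | no c≢c′ =
          trans (∑-cong corners (λ j → ∑-cong corners (λ k → eF (upd-comm σ j k c≢c′))))
         (trans (∑-swap corners corners (λ j k → F (upd (upd σ c′ k) c j)))
         (trans (∑-cong corners (λ k → h (upd σ c′ k)))
         (trans (∑-swap corners corners (λ k j → G (upd (upd σ c′ k) c j)))
         (sym (∑-cong corners (λ j → ∑-cong corners (λ k → eG (upd-comm σ j k c≢c′))))))))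

  S-+ : ∀ cs F G → S cs (λ σ → F σ + G σ) ≡ S cs F + S cs G
  S-+ []       F G = refl
  S-+ (c ∷ cs) F G = trans (S-cong cs (λ σ → ∑-+ corners (λ k → F (upd σ c k)) (λ k → G (upd σ c k)))) (S-+ cs _ _)

  S-0 : ∀ cs → S cs (λ _ → 0ℤ) ≡ 0ℤ
  S-0 []       = refl
  S-0 (c ∷ cs) = S-0 cs

  S-zero : ∀ cs {F} → (∀ σ → F σ ≡ 0ℤ) → S cs F ≡ 0ℤ
  S-zero cs h = trans (S-cong cs h) (S-0 cs)

  S-*ˡ : ∀ cs a F → S cs (λ σ → a * F σ) ≡ a * S cs F
  S-*ˡ []       a F = refl
  S-*ˡ (c ∷ cs) a F = trans (S-cong cs (λ σ → ∑-*ˡ corners a (λ k → F (upd σ c k)))) (S-*ˡ cs a _)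

  S-∑ : ∀ {D : Set} cs (ds : List D) (F : Asg → D → ℤ) →
        S cs (λ σ → ∑ ds (F σ)) ≡ ∑ ds (λ d → S cs (λ σ → F σ d))
  S-∑ cs []       F = S-0 cs
  S-∑ cs (d ∷ ds) F = trans (S-+ cs (λ σ → F σ d) (λ σ → ∑ ds (F σ))) (cong (_+_ (S cs (λ σ → F σ d))) (S-∑ cs ds F))

  S-mono : ∀ cs {F G} → (∀ σ → F σ ℤ.≤ G σ) → S cs F ℤ.≤ S cs G
  S-mono []       h = h _
  S-mono (c ∷ cs) h = S-mono cs (λ σ → ∑-mono corners (λ k → h (upd σ c k)))

  S≢0 : ∀ cs F → S cs F ≢ 0ℤ → ∃[ σ ] F σ ≢ 0ℤ
  S≢0 []       F n = _ , n
  S≢0 (c ∷ cs) F n with S≢0 cs _ n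
  ... | σ , m with ∑≢0 corners _ m
  ...   | k , _ , q = upd σ c k , q

  -- The factor for `top` selects one of the four assignments that differ only at c, so that the
  -- outer sum effectively runs over assignments away from c.
  S-fibre : ∀ cs {c} F → c ∈ cs → Ext F →
            S cs F ≡ S cs (λ σ → ⟦ FinSet._≟_ cornerᶠ (σ c) top ⟧ * ∑ₖ (λ k → F (upd σ c k)))
  S-fibre cs {c} F i eF = S-local i eF
    (λ e → cong₂ _*_ (cong (λ k → ⟦ FinSet._≟_ cornerᶠ k top ⟧) (e c)) (∑-cong corners (λ k → eF (upd-cong c k e))))
    (λ σ → sym (trans (∑-cong corners (λ j → cong₂ _*_ (cong (λ k → ⟦ FinSet._≟_ cornerᶠ k top ⟧) (upd-here σ c j))
                                    (∑-cong corners (λ k → eF (upd-twice σ c j k)))))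
                      (fin _)))
    where
    fin : ∀ a → 1ℤ * a + (0ℤ * a + (0ℤ * a + (0ℤ * a + 0ℤ))) ≡ a
    fin = solve-∀

module _ (D : Diagram) where
  open Diagram D
  open Assignments crossingᶠ

  ∑-assignments : ∀ cs F → Ext F → ∑ (assignments D cs) F ≡ S cs F
  ∑-assignments []       F e = ℤ.+-identityʳ _
  ∑-assignments (c ∷ cs) F e =
    trans (∑-concatMap _ (assignments D cs) F)
   (trans (∑-cong (assignments D cs) (λ σ → trans (∑-map (λ k c′ → if does (FinSet._≟_ crossingᶠ c′ c) then k else σ c′) corners F) (∑-cong corners (λ k → e {τ = upd σ c k} (λ _ → refl)))))
          (∑-assignments cs _ (λ h → ∑-cong corners (λ k → e (upd-cong c k h)))))

-- Periodicity of iterates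

iter : {A : Set} → (A → A) → ℕ → A → A
iter f zero    x = x
iter f (suc n) x = iter f n (f x)

iter-suc : {A : Set} (f : A → A) → ∀ n x → iter f (suc n) x ≡ f (iter f n x)
iter-suc f zero    x = refl
iter-suc f (suc n) x = iter-suc f n (f x)

iter-+ : {A : Set} (f : A → A) → ∀ m n x → iter f (m ℕ.+ n) x ≡ iter f n (iter f m x)
iter-+ f zero    n x = refl
iter-+ f (suc m) n x = iter-+ f m n (f x)

module Iteration (A : FinSet) (f : FinSet.Carrier A → FinSet.Carrier A) where
  open FinSet A

  private N = size A

  position : Carrier → Fin.Fin N
  position x = Any.index (complete x)

  position-injective : ∀ {x y} → position x ≡ position y → x ≡ y
  position-injective {x} {y} e =
    trans (lookup-index (complete x)) (trans (cong (lookup elements) e) (sym (lookup-index (complete y))))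

  repeats : ∀ x → ∃₂ λ i j → i ℕ.< j × j ℕ.≤ N × iter f i x ≡ iter f j x
  repeats x with Fin.pigeonhole (ℕ.n<1+n N) (λ (i : Fin.Fin (suc N)) → position (iter f (Fin.toℕ i) x))
  ... | i , j , i<j , e = Fin.toℕ i , Fin.toℕ j , i<j , ℕ.≤-pred (Fin.toℕ<n j) , position-injective e

  shortcut : ∀ x m → N ℕ.< m → ∃[ m′ ] m′ ℕ.< m × iter f m′ x ≡ iter f m x
  shortcut x m N<m with repeats x
  ... | i , j , i<j , j≤N , e = i ℕ.+ (m ℕ.∸ j) ,
        subst (i ℕ.+ (m ℕ.∸ j) ℕ.<_) m≡ (ℕ.+-monoˡ-< (m ℕ.∸ j) i<j) ,
        trans (iter-+ f i (m ℕ.∸ j) x) (trans (cong (iter f (m ℕ.∸ j)) e)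
       (trans (sym (iter-+ f j (m ℕ.∸ j) x)) (cong (λ z → iter f z x) m≡)))
    where
    m≡ : j ℕ.+ (m ℕ.∸ j) ≡ m
    m≡ = ℕ.m+[n∸m]≡n (ℕ.≤-trans j≤N (ℕ.<⇒≤ N<m))

  module _ (R : Carrier → Set) (step : ∀ {y} → R y → R (f y)) where

    push : ∀ n {x} → R x → R (iter f n x)
    push zero    r = r
    push (suc n) r = push n (step r)

    -- By pigeonhole an iterate beyond the N-th equals an earlier one. A condition preserved by f
    -- that is reached at all therefore holds at step N.
    stabilises : ∀ x m → R (iter f m x) → R (iter f N x)
    stabilises x m = go m m ℕ.≤-refl
      where
      go : ∀ fuel m → m ℕ.≤ fuel → R (iter f m x) → R (iter f N x)
      go fuel m m≤ r with m ℕ.≤? N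
      ... | yes m≤N = subst R (trans (sym (iter-+ f m (N ℕ.∸ m) x)) (cong (λ z → iter f z x) (ℕ.m+[n∸m]≡n m≤N)))
                        (push (N ℕ.∸ m) r)
      go zero    m m≤ r | no m≰N = contradiction (ℕ.≤-trans m≤ z≤n) m≰N
      go (suc fuel) m m≤ r | no m≰N with shortcut x m (ℕ.≰⇒> m≰N)
      ... | m′ , m′<m , e = go fuel m′ (ℕ.≤-pred (ℕ.≤-trans m′<m m≤)) (subst R (sym e) r)

-- The four corners of a crossing

rot rot⁻ opp lf rt : Corner → Corner
rot top    = left
rot left   = bottom
rot bottom = right
rot right  = top
rot⁻ top    = right
rot⁻ left   = top
rot⁻ bottom = left
rot⁻ right  = bottom
opp top    = bottom
opp left   = right
opp bottom = top
opp right  = left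
-- The corners k and rot k are separated by a single strand end; lf k lies to its left.
lf top    = left
lf left   = left
lf bottom = bottom
lf right  = top
rt top    = top
rt left   = bottom
rt bottom = right
rt right  = right

-- The local form of the checkerboard colouring. Opposite corners share a shade, and the overstrand
-- decides which pair is shaded; alternation makes these choices fit together.
shade : Over → Corner → Bool
shade bl→tr top    = true
shade bl→tr bottom = true
shade bl→tr left   = false
shade bl→tr right  = false
shade br→tl top    = false
shade br→tl bottom = false
shade br→tl left   = true
shade br→tl right  = true

-- `exponent` counts half powers of t. `index` is the Alexander index near a crossing, normalised to
-- 0 at the top corner: it drops by one on crossing a strand from left to right.
exponent index : Over → Corner → ℤ
exponent o k = proj₂ (weight o k)
index _ top    = 0ℤ
index _ left   = 1ℤ
index _ bottom = 0ℤ
index _ right  = -1ℤ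

_≟ᶜ_ : DecidableEquality Corner
_≟ᶜ_ = FinSet._≟_ cornerᶠ

∑ₖ-around : ∀ s (f : Corner → ℤ) → ∑ₖ f ≡ (f s + f (opp s)) + (f (rot s) + f (rot⁻ s))
∑ₖ-around top f = lemma (f top) (f bottom) (f left) (f right)
  where
  lemma : ∀ a b c d → a + (b + (c + (d + 0ℤ))) ≡ (a + b) + (c + d)
  lemma = solve-∀
∑ₖ-around bottom f = lemma (f top) (f bottom) (f left) (f right)
  where
  lemma : ∀ a b c d → a + (b + (c + (d + 0ℤ))) ≡ (b + a) + (d + c)
  lemma = solve-∀
∑ₖ-around left f = lemma (f top) (f bottom) (f left) (f right)
  where
  lemma : ∀ a b c d → a + (b + (c + (d + 0ℤ))) ≡ (c + d) + (b + a)
  lemma = solve-∀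
∑ₖ-around right f = lemma (f top) (f bottom) (f left) (f right)
  where
  lemma : ∀ a b c d → a + (b + (c + (d + 0ℤ))) ≡ (d + c) + (a + b)
  lemma = solve-∀

data Around (s : Corner) : Corner → Set where
  itself : Around s s
  opposite : Around s (opp s)
  succeeding : Around s (rot s)
  preceding : Around s (rot⁻ s)

around : ∀ s k → Around s k
around top top = itself
around top bottom = opposite
around top left = succeeding
around top right = preceding
around bottom top = opposite
around bottom bottom = itself
around bottom left = preceding
around bottom right = succeeding
around left top = preceding
around left bottom = succeeding
around left left = itself
around left right = opposite
around right top = succeeding
around right bottom = preceding
around right left = opposite
around right right = itself

rot-opp : ∀ s → rot (opp s) ≡ rot⁻ s
rot-opp top    = refl
rot-opp left   = refl
rot-opp bottom = refl
rot-opp right  = refl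

rot⁻-opp : ∀ s → rot⁻ (opp s) ≡ rot s
rot⁻-opp top    = refl
rot⁻-opp left   = refl
rot⁻-opp bottom = refl
rot⁻-opp right  = refl

rot-rot : ∀ s → rot (rot s) ≡ opp s
rot-rot top    = refl
rot-rot left   = refl
rot-rot bottom = refl
rot-rot right  = refl

rot⁻-rot⁻ : ∀ s → rot⁻ (rot⁻ s) ≡ opp s
rot⁻-rot⁻ top    = refl
rot⁻-rot⁻ left   = refl
rot⁻-rot⁻ bottom = refl
rot⁻-rot⁻ right  = refl

rot-rot⁻ : ∀ s → rot (rot⁻ s) ≡ s
rot-rot⁻ top    = refl
rot-rot⁻ left   = refl
rot-rot⁻ bottom = refl
rot-rot⁻ right  = refl

rot⁻-rot : ∀ s → rot⁻ (rot s) ≡ s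
rot⁻-rot top    = refl
rot⁻-rot left   = refl
rot⁻-rot bottom = refl
rot⁻-rot right  = refl

opp-opp : ∀ s → opp (opp s) ≡ s
opp-opp top    = refl
opp-opp left   = refl
opp-opp bottom = refl
opp-opp right  = refl

opp-rot : ∀ s → opp (rot s) ≡ rot⁻ s
opp-rot top    = refl
opp-rot left   = refl
opp-rot bottom = refl
opp-rot right  = refl

shade-opp : ∀ o s → shade o (opp s) ≡ shade o s
shade-opp bl→tr top    = refl
shade-opp bl→tr left   = refl
shade-opp bl→tr bottom = refl
shade-opp bl→tr right  = refl
shade-opp br→tl top    = refl
shade-opp br→tl left   = refl
shade-opp br→tl bottom = refl
shade-opp br→tl right  = refl

-- The corners form two opposite pairs, and two adjacent corners contain one member of each. Hence R
-- holds at s or `opp s`, so at both, and then it passes between the two corners of the other pair.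
spread : ∀ (R : Corner → Set) s → (R s → R (opp s)) → (R (opp s) → R s) →
         (R s → R (rot s) → R (rot⁻ s)) → (R s → R (rot⁻ s) → R (rot s)) →
         ∀ i → R (lf i) → R (rt i) → ∀ k → R k
spread R s h₁ h₂ h₃ h₄ i a b k = all k (around s k) (two i (around s (lf i)) (around s (rt i)) refl refl a b)
  where
  Pair = R s × (R (rot s) ⊎ R (rot⁻ s))
  all : ∀ k → Around s k → Pair → R k
  all _ itself (x , y) = x
  all _ opposite (x , y) = h₁ x
  all _ succeeding (x , inj₁ y) = y
  all _ succeeding (x , inj₂ y) = h₄ x y
  all _ preceding (x , inj₁ y) = h₃ x y
  all _ preceding (x , inj₂ y) = y
  clash : ∀ i s → lf i ≡ s → (rt i ≡ s ⊎ rt i ≡ opp s) → ⊥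
  clash top    _ refl (inj₁ ())
  clash top    _ refl (inj₂ ())
  clash left   _ refl (inj₁ ())
  clash left   _ refl (inj₂ ())
  clash bottom _ refl (inj₁ ())
  clash bottom _ refl (inj₂ ())
  clash right  _ refl (inj₁ ())
  clash right  _ refl (inj₂ ())
  two : ∀ i {k l} → Around s k → Around s l → lf i ≡ k → rt i ≡ l → R k → R l → Pair
  two i itself itself e f a b = ⊥-elim (clash i _ e (inj₁ f))
  two i itself opposite e f a b = ⊥-elim (clash i _ e (inj₂ f))
  two i itself succeeding e f a b = a , inj₁ b
  two i itself preceding e f a b = a , inj₂ b
  two i opposite itself e f a b = ⊥-elim (clash i _ e (inj₂ (trans f (sym (opp-opp s)))))
  two i opposite opposite e f a b = ⊥-elim (clash i _ e (inj₁ f))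
  two i opposite succeeding e f a b = h₂ a , inj₁ b
  two i opposite preceding e f a b = h₂ a , inj₂ b
  two i succeeding itself e f a b = b , inj₁ a
  two i succeeding opposite e f a b = h₂ b , inj₁ a
  two i succeeding succeeding e f a b = ⊥-elim (clash i _ e (inj₁ f))
  two i succeeding preceding e f a b = ⊥-elim (clash i _ e (inj₂ (trans f (sym (opp-rot s)))))
  two i preceding itself e f a b = b , inj₂ a
  two i preceding opposite e f a b = h₂ b , inj₂ a
  two i preceding succeeding e f a b = ⊥-elim (clash i _ e (inj₂ (trans f (sym (trans (cong opp (sym (opp-rot s))) (opp-opp (rot s)))))))
  two i preceding preceding e f a b = ⊥-elim (clash i _ e (inj₁ f))

-- Pointers, potentials and the Alexander index

-- In connected, Θ is a property of segments, expressed by their left and right regions;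
-- the double negation costs nothing, as only decidable conclusions are drawn.
record Skeleton : Set₁ where
  field
    crossings regions : FinSet
    κ  : FinSet.Carrier crossings → Corner → FinSet.Carrier regions
    ov : FinSet.Carrier crossings → Over
    seg : ∀ (G : FinSet.Carrier regions → FinSet.Carrier regions → ℤ) →
          ∑ (FinSet.elements crossings) (λ c → G (κ c left) (κ c bottom) + G (κ c bottom) (κ c right))
        ≡ ∑ (FinSet.elements crossings) (λ c → G (κ c left) (κ c top) + G (κ c top) (κ c right))
    connected : ∀ (Θ : FinSet.Carrier regions → FinSet.Carrier regions → Set) →
                (∀ c i j → Θ (κ c (lf i)) (κ c (rt i)) → Θ (κ c (lf j)) (κ c (rt j))) →
                ∀ c i c′ j → Θ (κ c (lf i)) (κ c (rt i)) → ¬ ¬ Θ (κ c′ (lf j)) (κ c′ (rt j))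
    coloured : ∀ c k c′ k′ → κ c k ≡ κ c′ k′ → shade (ov c) k ≡ shade (ov c′) k′

module Skel (K : Skeleton) where
  open Skeleton K public
  open Assignments crossings public
  open Finite crossings public using () renaming (Carrier to X; elements to Xs; complete to X-complete; unique to X-unique; _≟_ to _≟ₓ_; ∑-δ to ∑-δₓ; δ to δₓ)
  open Finite regions public using () renaming (Carrier to Y; elements to Ys; complete to Y-complete; _≟_ to _≟ᵧ_; δ to δᵧ)

  -- A discrete Stokes formula. Around a crossing the sum collects the antisymmetric form G over the
  -- four strand ends, incoming ones with one sign and outgoing ones with the other, and the two
  -- ends of every segment cancel by `seg`.
  pairing : ∀ (q h : Y → ℤ) → ∑ Xs (λ c → ∑ₖ (λ k → q (κ c k) * (h (κ c (rot k)) - h (κ c (rot⁻ k))))) ≡ 0ℤ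
  pairing q h = trans (∑-cong Xs (λ c → lemma (q (κ c left)) (q (κ c bottom)) (q (κ c right)) (q (κ c top))
                         (h (κ c left)) (h (κ c bottom)) (h (κ c right)) (h (κ c top))))
               (trans (∑-- Xs (λ c → G (κ c left) (κ c bottom) + G (κ c bottom) (κ c right)) _)
                      (ℤ.i≡j⇒i-j≡0 (seg G)))
    where
    G : Y → Y → ℤ
    G x y = q x * h y - q y * h x
    lemma : ∀ l b r t l′ b′ r′ t′ →
      t * (l′ - r′) + (b * (r′ - l′) + (l * (b′ - t′) + (r * (t′ - b′) + 0ℤ))) ≡
      ((l * b′ - b * l′) + (b * r′ - r * b′)) - ((l * t′ - t * l′) + (t * r′ - r * t′))
    lemma = solve-∀

  -- Every segment is counted at both of its ends with the value of q on its left; the contributions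
  -- of the left corners cancel at each crossing.
  balance : ∀ (q : Y → ℤ) → ∑ Xs (λ c → q (κ c top) - q (κ c bottom)) ≡ 0ℤ
  balance q = trans (∑-cong Xs (λ c → lemma (q (κ c left)) (q (κ c bottom)) (q (κ c top))))
             (trans (∑-- Xs (λ c → G (κ c left) (κ c top) + G (κ c top) (κ c right)) _)
                    (ℤ.i≡j⇒i-j≡0 (sym (seg G))))
    where
    G : Y → Y → ℤ
    G x _ = q x
    lemma : ∀ l b t → t - b ≡ (l + t) - (l + b)
    lemma = solve-∀

  Mask : Set
  Mask = X → Bool

  full : Mask
  full _ = true

  _∖_ : Mask → X → Mask
  (a ∖ d) c = a c ∧ not (does (c ≟ₓ d))

  Points : Mask → Asg → Y → X → Set
  Points a σ r c = a c ≡ true × κ c (σ c) ≡ r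

  points? : ∀ a σ r c → Dec (Points a σ r c)
  points? a σ r c = (a c Bool.≟ true) ×-dec (κ c (σ c) ≟ᵧ r)

  uses : Mask → Asg → Y → ℤ
  uses a σ r = ∑ Xs (λ c → ⟦ points? a σ r c ⟧)

  target : (Y → Bool) → Y → ℤ
  target root r = if root r then 0ℤ else 1ℤ

  module Walk (a : Mask) (σ : Asg) where

    search : List X → Y → Y
    search []       r = r
    search (c ∷ cs) r = if does (points? a σ r c) then κ c (opp (σ c)) else search cs r

    -- One step of the walk: across the crossing that points to the region. A region that nothing
    -- points to stays in place, so walks come to rest at roots.
    par : Y → Y
    par = search Xs

    N : ℕ
    N = size regions

    -- As many steps as there are regions are enough to arrive at a root if one is ever reached, see
    -- `stable`.
    lead : Y → Y
    lead = iter par N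

  search-cong : ∀ {a b σ τ r} → (∀ c → Points a σ r c → Points b τ r c × σ c ≡ τ c) →
                (∀ c → Points b τ r c → Points a σ r c) →
                ∀ cs → Walk.search a σ cs r ≡ Walk.search b τ cs r
  search-cong f g []       = refl
  search-cong {a} {b} {σ} {τ} {r} f g (c ∷ cs) = go (points? a σ r c)
    where
    go : Dec (Points a σ r c) → Walk.search a σ (c ∷ cs) r ≡ Walk.search b τ (c ∷ cs) r
    go (yes p) = trans (if-yes (points? a σ r c) p)
                (trans (cong (κ c ∘ opp) (proj₂ (f c p))) (sym (if-yes (points? b τ r c) (proj₁ (f c p)))))
    go (no ¬p) = trans (if-no (points? a σ r c) ¬p)
                (trans (search-cong f g cs) (sym (if-no (points? b τ r c) (¬p ∘ g c))))

  Covers : Mask → (Y → Bool) → Asg → Set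
  Covers a root σ = ∀ r → uses a σ r ≡ target root r

  module Pointers (a : Mask) (σ : Asg) (root : Y → Bool) (covers : Covers a root σ) where

    open Walk a σ public

    search-hit : ∀ {cs c r} → c ∈ cs → Points a σ r c → (∀ {y} → y ∈ cs → Points a σ r y → y ≡ c) →
                 search cs r ≡ κ c (opp (σ c))
    search-hit {d ∷ cs} {c} {r} i p u = go (points? a σ r d) i
      where
      go : Dec (Points a σ r d) → c ∈ d ∷ cs → search (d ∷ cs) r ≡ κ c (opp (σ c))
      go (yes q) i = trans (if-yes (points? a σ r d) q) (cong (λ y → κ y (opp (σ y))) (u (here refl) q))
      go (no ¬q) (here refl) = contradiction p ¬q
      go (no ¬q) (there i) = trans (if-no (points? a σ r d) ¬q) (search-hit i p (u ∘ there))

    search-miss : ∀ {cs r} → (∀ {c} → c ∈ cs → ¬ Points a σ r c) → search cs r ≡ r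
    search-miss {[]} h = refl
    search-miss {c ∷ cs} {r} h = trans (if-no (points? a σ r c) (h (here refl))) (search-miss (h ∘ there))

    par-root : ∀ {r} → root r ≡ true → par r ≡ r
    par-root {r} e = search-miss (count-none (points? a σ r) Xs (trans (covers r) (cong (if_then 0ℤ else 1ℤ) e)))

    root-active : ∀ {c} → a c ≡ true → root (κ c (σ c)) ≡ false
    root-active {c} ac with root (κ c (σ c)) in e
    ... | false = refl
    ... | true  = contradiction (ac , refl)
        (count-none (points? a σ (κ c (σ c))) Xs (trans (covers _) (cong (if_then 0ℤ else 1ℤ) e)) (X-complete c))

    pointer : ∀ {r} → root r ≡ false → ∃[ c ] Points a σ r c × (∀ {y} → Points a σ r y → y ≡ c)
    pointer {r} e with count-one (points? a σ r) Xs (trans (covers r) (cong (if_then 0ℤ else 1ℤ) e))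
    ... | c , _ , p , u = c , p , λ q → u (X-complete _) q

    par-active : ∀ {c} → a c ≡ true → par (κ c (σ c)) ≡ κ c (opp (σ c))
    par-active {c} ac with pointer (root-active ac)
    ... | d , p , u = search-hit (X-complete c) (ac , refl) (λ _ q → trans (u q) (sym (u (ac , refl))))

    at : (X → ℤ) → Y → ℤ
    at F r = ∑ Xs (λ c → ⟦ points? a σ r c ⟧ * F c)

    at-active : ∀ F {c} → a c ≡ true → at F (κ c (σ c)) ≡ F c
    at-active F {c} ac with pointer (root-active ac)
    ... | d , p , u = ∑-single (points? a σ _) F (X-complete c) (ac , refl)
                        (λ _ q → trans (u q) (sym (u (ac , refl)))) X-unique

    Root : Y → Set
    Root r = root r ≡ true

    Rooted : Y → Set
    Rooted r = Root (lead r)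

    rooted? : ∀ r → Dec (Rooted r)
    rooted? r = root (lead r) Bool.≟ true

    root-step : ∀ {y} → Root y → Root (par y)
    root-step e = trans (cong root (par-root e)) e

    iter-root : ∀ n {y} → Root y → iter par n y ≡ y
    iter-root zero    e = refl
    iter-root (suc n) e = trans (cong (iter par n) (par-root e)) (iter-root n e)

    lead-root : ∀ {y} → Root y → lead y ≡ y
    lead-root = iter-root N

    root⇒rooted : ∀ {y} → Root y → Rooted y
    root⇒rooted e = trans (cong root (lead-root e)) e

    stable : ∀ m {r} → Root (iter par m r) → Rooted r
    stable m {r} = Iteration.stabilises regions par Root root-step r m

    lead-par : ∀ {r} → Rooted r → lead (par r) ≡ lead r
    lead-par {r} e = trans (iter-suc par N r) (par-root e)

    rooted-par : ∀ {r} → Rooted r → Rooted (par r)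
    rooted-par e = trans (cong root (lead-par e)) e

    rooted-par⁻ : ∀ {r} → Rooted (par r) → Rooted r
    rooted-par⁻ {r} e = stable (suc N) e

    -- The sum of the jumps J along the walk to the root, plus the value v there. It is set to zero
    -- on regions that never reach a root; `par` preserves this distinction, so no jump arises
    -- across their pointers.
    module Potential (J v : Y → ℤ) where

      sumTo : ℕ → Y → ℤ
      sumTo zero    r = v r
      sumTo (suc n) r = if root r then v r else J r + sumTo n (par r)

      sumTo-stable : ∀ n r → Root (iter par n r) → sumTo (suc n) r ≡ sumTo n r
      sumTo-stable zero    r e rewrite e = refl
      sumTo-stable (suc n) r e with root r
      ... | true  = refl
      ... | false = cong (_+_ (J r)) (sumTo-stable n (par r) e)

      pot : Y → ℤ
      pot r = if does (rooted? r) then sumTo N r else 0ℤ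

      pot-unrooted : ∀ {r} → ¬ Rooted r → pot r ≡ 0ℤ
      pot-unrooted {r} n rewrite dec-false (rooted? r) n = refl

      sumTo-root : ∀ n {r} → Root r → sumTo n r ≡ v r
      sumTo-root zero    e = refl
      sumTo-root (suc n) e rewrite e = refl

      pot-root : ∀ {r} → Root r → pot r ≡ v r
      pot-root {r} e rewrite dec-true (rooted? r) (root⇒rooted e) = sumTo-root N e

      pot-par : ∀ {r} → root r ≡ false → Rooted r → pot r ≡ J r + pot (par r)
      pot-par {r} e rd rewrite dec-true (rooted? r) rd | dec-true (rooted? (par r)) (rooted-par rd) =
        trans (sym (sumTo-stable N r rd)) (cong (if_then v r else (J r + sumTo N (par r))) e)

  -- Choosing q to be a potential of the differences turns the hypothesis into the
  -- vanishing of a sum of squares.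
  module _ (σ : Asg) (root : Y → Bool) (covers : Covers full root σ) where
    open Pointers full σ root covers

    energy : (D : X → Corner → ℤ) →
      (∀ q → ∑ Xs (λ c → ∑ₖ (λ k → q (κ c k) * (D c (rot k) - D c (rot⁻ k)))) ≡ 0ℤ) →
      (∀ c → D c (σ c) ≡ D c (opp (σ c))) →
      ∀ c → Rooted (κ c (σ c)) → D c (rot (σ c)) ≡ D c (rot⁻ (σ c))
    energy D orth level c rd = ℤ.i-j≡0⇒i≡j _ _ (square-zero (F c) (trans (sym (term-rooted c rd))
        (∑-nonneg-zero Xs nonneg (trans (sym (∑-cong Xs term)) (orth q)) (X-complete c))))
      where
      F : X → ℤ
      F c = D c (rot (σ c)) - D c (rot⁻ (σ c))
      open Potential (at F) (λ _ → 0ℤ) renaming (pot to q)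
      t : X → ℤ
      t c = (q (κ c (σ c)) - q (κ c (opp (σ c)))) * F c
      rearrange : ∀ a b c d x y z → z ≡ 0ℤ → (a * (x - y) + b * (y - x)) + (c * z + d * - z) ≡ (a - b) * (x - y)
      rearrange a b c d x y _ refl = lemma a b c d x y
        where
        lemma : ∀ a b c d x y → (a * (x - y) + b * (y - x)) + (c * 0ℤ + d * - 0ℤ) ≡ (a - b) * (x - y)
        lemma = solve-∀
      neg- : ∀ a b → a - b ≡ - (b - a)
      neg- = solve-∀
      -- The corners beside the pointer contribute nothing: their neighbours are σ c and its
      -- opposite, where D agrees by `level`. The other two combine to a difference of q times F.
      term : ∀ c → ∑ₖ (λ k → q (κ c k) * (D c (rot k) - D c (rot⁻ k))) ≡ t c
      term c = trans (∑ₖ-around s (λ k → q (κ c k) * (D c (rot k) - D c (rot⁻ k))))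
               (trans (cong₂ _+_ (cong (_+_ (q (κ c s) * (D c (rot s) - D c (rot⁻ s)))) (cong (λ z → q (κ c (opp s)) * z) (cong₂ (λ u v → D c u - D c v) (rot-opp s) (rot⁻-opp s))))
                     (cong₂ _+_ (cong (λ z → q (κ c (rot s)) * z) (cong₂ (λ u v → D c u - D c v) (rot-rot s) (rot⁻-rot s)))
                         (cong (λ z → q (κ c (rot⁻ s)) * z) (trans (cong₂ (λ u v → D c u - D c v) (rot-rot⁻ s) (rot⁻-rot⁻ s)) (neg- (D c s) (D c (opp s)))))))
                      (rearrange (q (κ c s)) (q (κ c (opp s))) (q (κ c (rot s))) (q (κ c (rot⁻ s))) (D c (rot s)) (D c (rot⁻ s))
                        (D c (opp s) - D c s) (ℤ.i≡j⇒i-j≡0 (sym (level c)))))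
        where s = σ c
      term-rooted : ∀ c → Rooted (κ c (σ c)) → t c ≡ F c * F c
      term-rooted c rd = cong (_* F c) (trans (cong₂ _-_
          (trans (pot-par (root-active refl) rd) (cong₂ _+_ (at-active F refl) (cong q (par-active refl)))) refl)
          (lemma (F c) _))
        where
        lemma : ∀ a b → (a + b) - b ≡ a
        lemma = solve-∀
      nonneg : ∀ c → 0ℤ ℤ.≤ t c
      nonneg c = go (rooted? (κ c (σ c)))
        where
        go : Dec (Rooted (κ c (σ c))) → 0ℤ ℤ.≤ t c
        go (yes rd) = subst (0ℤ ℤ.≤_) (sym (term-rooted c rd)) (square-nonneg (F c))
        go (no ¬rd) = subst (0ℤ ℤ.≤_) (sym (cong (_* F c) (cong₂ _-_ (pot-unrooted ¬rd)
            (pot-unrooted (λ r → ¬rd (rooted-par⁻ (trans (cong (root ∘ lead) (par-active refl)) r))))))) (ℤ.+≤+ z≤n)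

lf-rt-index : ∀ o i → index o (lf i) - index o (rt i) ≡ 1ℤ
lf-rt-index o top    = refl
lf-rt-index o left   = refl
lf-rt-index o bottom = refl
lf-rt-index o right  = refl

shade-lf-rt : ∀ o i → shade o (lf i) ≢ shade o (rt i)
shade-lf-rt bl→tr top    ()
shade-lf-rt bl→tr left   ()
shade-lf-rt bl→tr bottom ()
shade-lf-rt bl→tr right  ()
shade-lf-rt br→tl top    ()
shade-lf-rt br→tl left   ()
shade-lf-rt br→tl bottom ()
shade-lf-rt br→tl right  ()

corner-on : ∀ (R : Corner → Set) → (∀ i → R (lf i) × R (rt i)) → ∀ k → R k
corner-on R h top    = proj₂ (h top)
corner-on R h left   = proj₁ (h left)
corner-on R h bottom = proj₁ (h bottom)
corner-on R h right  = proj₂ (h right)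

module States (K : Skeleton) where
  open Skel K public

  base : Y → Y → Y → Bool
  base x y r = does (r ≟ᵧ x) ∨ does (r ≟ᵧ y)

  State : Y → Y → Asg → Set
  State x y σ = ∀ r → uses full σ r ≡ target (base x y) r

  base-left : ∀ x y → base x y x ≡ true
  base-left x y = cong (_∨ does (x ≟ᵧ y)) (dec-true (x ≟ᵧ x) refl)

  base-right : ∀ x y → base x y y ≡ true
  base-right x y = trans (cong (does (y ≟ᵧ x) ∨_) (dec-true (y ≟ᵧ y) refl)) (Bool.∨-zeroʳ _)

  base-cases : ∀ x y r → base x y r ≡ true → r ≡ x ⊎ r ≡ y
  base-cases x y r e with r ≟ᵧ x
  ... | yes p = inj₁ p
  ... | no _ with r ≟ᵧ y
  ...   | yes q = inj₂ q

  base-neither : ∀ x y r → r ≢ x → r ≢ y → base x y r ≡ false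
  base-neither x y r n m = cong₂ _∨_ (dec-false (r ≟ᵧ x) n) (dec-false (r ≟ᵧ y) m)

  -- A state is a pair of spanning trees: the regions whose pointers never reach the
  -- base would otherwise be cut off from it.
  module Acyclic (c₀ : X) (k₀ : Corner) (σ : Asg) (st : State (κ c₀ (lf k₀)) (κ c₀ (rt k₀)) σ) where

    private
      x₀ = κ c₀ (lf k₀)
      y₀ = κ c₀ (rt k₀)

    open Pointers full σ (base x₀ y₀) st public

    private
      n : Y → ℤ
      n r = ⟦ rooted? r ⟧

      rooted-opp : ∀ c → Rooted (κ c (σ c)) → Rooted (κ c (opp (σ c)))
      rooted-opp c e = subst Rooted (par-active refl) (rooted-par e)

      rooted-opp⁻ : ∀ c → Rooted (κ c (opp (σ c))) → Rooted (κ c (σ c))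
      rooted-opp⁻ c e = rooted-par⁻ (subst Rooted (sym (par-active refl)) e)

      level : ∀ c → n (κ c (σ c)) ≡ n (κ c (opp (σ c)))
      level c = ⟦⟧-cong (rooted? _) (rooted? _) (rooted-opp c) (rooted-opp⁻ c)

      -- With the indicator of rootedness as D, the orthogonality required by `energy` is `pairing`
      -- itself, and level holds because `par` leads from σ c to its opposite corner.
      sides-equal : ∀ c → Rooted (κ c (σ c)) → n (κ c (rot (σ c))) ≡ n (κ c (rot⁻ (σ c)))
      sides-equal = energy σ (base x₀ y₀) st (λ c k → n (κ c k)) (λ q → pairing q n) level

      closure : ∀ c i → Rooted (κ c (lf i)) × Rooted (κ c (rt i)) → ∀ k → Rooted (κ c k)
      closure c i (a , b) = spread (λ k → Rooted (κ c k)) (σ c) (rooted-opp c) (rooted-opp⁻ c)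
        (λ r e → ⟦⟧-1 (rooted? _) (trans (sym (sides-equal c r)) (⟦⟧-yes (rooted? _) e)))
        (λ r e → ⟦⟧-1 (rooted? _) (trans (sides-equal c r) (⟦⟧-yes (rooted? _) e)))
        i a b

    corner-rooted : ∀ c k → Rooted (κ c k)
    corner-rooted c = corner-on (λ k → Rooted (κ c k)) (λ i →
      decidable-stable (rooted? _ ×-dec rooted? _)
        (connected (λ x y → Rooted x × Rooted y)
          (λ c i j e → closure c i e (lf j) , closure c i e (rt j)) c₀ k₀ c i
          (root⇒rooted (base-left x₀ y₀) , root⇒rooted (base-right x₀ y₀))))

    all-rooted : ∀ r → Rooted r
    all-rooted r with base x₀ y₀ r in e
    ... | true  = root⇒rooted e
    ... | false with pointer e
    ...   | c , (_ , refl) , _ = corner-rooted c (σ c)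

    private
      ix : X → Corner → ℤ
      ix c k = index (ov c) k
      v : Y → ℤ
      v r = if does (r ≟ᵧ x₀) then ix c₀ (lf k₀) else ix c₀ (rt k₀)
      -- The jumps are chosen so that p changes across each pointer as `index` does; then the
      -- difference D of p and `index` is level.
      open Potential (at (λ c → ix c (σ c) - ix c (opp (σ c)))) v renaming (pot to p)
      D : X → Corner → ℤ
      D c k = p (κ c k) - ix c k

      levelₚ : ∀ c → D c (σ c) ≡ D c (opp (σ c))
      levelₚ c = trans (cong (_- ix c (σ c)) (trans (pot-par (root-active refl) (all-rooted _))
                          (cong₂ _+_ (at-active _ refl) (cong p (par-active refl)))))
                       (lemma (ix c (σ c)) _ _)
        where
        lemma : ∀ a b d → ((a - b) + d) - a ≡ d - b
        lemma = solve-∀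

      -- Subtracting `index` changes the pairing by twice the sum in `balance`; the 2 is the
      -- difference between the indices of left and right.
      orth : ∀ q → ∑ Xs (λ c → ∑ₖ (λ k → q (κ c k) * (D c (rot k) - D c (rot⁻ k)))) ≡ 0ℤ
      orth q = trans (∑-cong Xs (λ c → lemma (q (κ c top)) (q (κ c bottom)) (q (κ c left)) (q (κ c right))
                                       (p (κ c top)) (p (κ c bottom)) (p (κ c left)) (p (κ c right))))
              (trans (∑-- Xs (λ c → ∑ₖ (λ k → q (κ c k) * (p (κ c (rot k)) - p (κ c (rot⁻ k))))) _)
              (trans (cong₂ _-_ (pairing q p) (trans (∑-*ˡ Xs (+ 2) (λ c → q (κ c top) - q (κ c bottom))) (cong (+ 2 *_) (balance q)))) refl))
        where
        lemma : ∀ t b l r pt pb pl pr →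
          t * ((pl - 1ℤ) - (pr - -1ℤ)) + (b * ((pr - -1ℤ) - (pl - 1ℤ)) +
            (l * ((pb - 0ℤ) - (pt - 0ℤ)) + (r * ((pt - 0ℤ) - (pb - 0ℤ)) + 0ℤ)))
          ≡ (t * (pl - pr) + (b * (pr - pl) + (l * (pb - pt) + (r * (pt - pb) + 0ℤ)))) - + 2 * (t - b)
        lemma = solve-∀

      sides-equalₚ : ∀ c → D c (rot (σ c)) ≡ D c (rot⁻ (σ c))
      sides-equalₚ c = energy σ (base x₀ y₀) st D orth levelₚ c (all-rooted _)

      Θ : Y → Y → Set
      Θ x y = p x - p y ≡ 1ℤ

      to-D : ∀ c i → Θ (κ c (lf i)) (κ c (rt i)) → D c (rt i) ≡ D c (lf i)
      to-D c i e = trans (lemma₁ (p (κ c (rt i))) (ix c (lf i)) (ix c (rt i)) (lf-rt-index (ov c) i))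
                         (lemma₂ (p (κ c (lf i))) (p (κ c (rt i))) _ e)
        where
        lemma₁ : ∀ y a b → a - b ≡ 1ℤ → y - b ≡ (y + 1ℤ) - a
        lemma₁ y a b e = trans (alg y a b) (cong (λ z → (y + z) - a) e)
          where
          alg : ∀ y a b → y - b ≡ (y + (a - b)) - a
          alg = solve-∀
        lemma₂ : ∀ x y a → x - y ≡ 1ℤ → (y + 1ℤ) - a ≡ x - a
        lemma₂ x y a e = trans (cong (λ z → (y + z) - a) (sym e)) (alg x y a)
          where
          alg : ∀ x y a → (y + (x - y)) - a ≡ x - a
          alg = solve-∀

      from-D : ∀ c j → D c (rt j) ≡ D c (lf j) → Θ (κ c (lf j)) (κ c (rt j))
      from-D c j e = trans (alg (p (κ c (lf j))) (p (κ c (rt j))) (ix c (lf j)) (ix c (rt j)))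
                           (trans (cong (λ z → (D c (lf j) - z) + _) e)
                           (trans (cong₂ _+_ (ℤ.+-inverseʳ (D c (lf j))) (lf-rt-index (ov c) j)) refl))
        where
        alg : ∀ x y a b → x - y ≡ ((x - a) - (y - b)) + (a - b)
        alg = solve-∀

      closureₚ : ∀ c i j → Θ (κ c (lf i)) (κ c (rt i)) → Θ (κ c (lf j)) (κ c (rt j))
      closureₚ c i j e = from-D c j (trans (eq (rt j)) (sym (eq (lf j))))
        where
        eq : ∀ k → D c k ≡ D c (lf i)
        eq = spread (λ k → D c k ≡ D c (lf i)) (σ c)
               (trans (sym (levelₚ c))) (trans (levelₚ c))
               (λ _ → trans (sym (sides-equalₚ c))) (λ _ → trans (sides-equalₚ c)) i refl (to-D c i e)

      x₀≢y₀ : x₀ ≢ y₀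
      x₀≢y₀ e = shade-lf-rt (ov c₀) k₀ (coloured _ _ _ _ e)

      p-x₀ : p x₀ ≡ ix c₀ (lf k₀)
      p-x₀ = trans (pot-root (base-left x₀ y₀)) (if-yes (x₀ ≟ᵧ x₀) refl)

      p-y₀ : p y₀ ≡ ix c₀ (rt k₀)
      p-y₀ = trans (pot-root (base-right x₀ y₀)) (if-no (y₀ ≟ᵧ x₀) (x₀≢y₀ ∘ sym))

    Indexing : (Y → ℤ) → Set
    Indexing p = (∀ c i → p (κ c (lf i)) - p (κ c (rt i)) ≡ 1ℤ) × p x₀ ≡ index (ov c₀) (lf k₀)

    -- Topologically this is an intersection number of arcs with the oriented link. Here it is
    -- integrated along the pointer trees of a state, and `energy` shows that the result is right
    -- across the remaining segments as well.
    alexander-index : ∃ Indexing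
    alexander-index = p , (λ c i → decidable-stable (_ ℤ.≟ 1ℤ)
        (connected Θ closureₚ c₀ k₀ c i (trans (cong₂ _-_ p-x₀ p-y₀) (lf-rt-index (ov c₀) k₀)))) , p-x₀

-- Independence of the base segment

data Sense : Set where
  rising falling : Sense

slope : Sense → ℤ
slope rising  = 1ℤ
slope falling = -1ℤ

-- The signs with which the corners of the distinguished crossing enter the double count.
sign : Sense → Over → Corner → ℤ
sign rising  bl→tr top    = 1ℤ
sign rising  bl→tr bottom = -1ℤ
sign rising  bl→tr left   = 1ℤ
sign rising  bl→tr right  = -1ℤ
sign rising  br→tl top    = -1ℤ
sign rising  br→tl bottom = 1ℤ
sign rising  br→tl left   = 1ℤ
sign rising  br→tl right  = -1ℤ
sign falling bl→tr top    = -1ℤ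
sign falling bl→tr bottom = 1ℤ
sign falling bl→tr left   = 1ℤ
sign falling bl→tr right  = -1ℤ
sign falling br→tl top    = -1ℤ
sign falling br→tl bottom = 1ℤ
sign falling br→tl left   = -1ℤ
sign falling br→tl right  = 1ℤ

sign-opp : ∀ m o s → sign m o (opp s) ≡ - sign m o s
sign-opp rising  bl→tr top    = refl
sign-opp rising  bl→tr bottom = refl
sign-opp rising  bl→tr left   = refl
sign-opp rising  bl→tr right  = refl
sign-opp rising  br→tl top    = refl
sign-opp rising  br→tl bottom = refl
sign-opp rising  br→tl left   = refl
sign-opp rising  br→tl right  = refl
sign-opp falling bl→tr top    = refl
sign-opp falling bl→tr bottom = refl
sign-opp falling bl→tr left   = refl
sign-opp falling bl→tr right  = refl
sign-opp falling br→tl top    = refl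
sign-opp falling br→tl bottom = refl
sign-opp falling br→tl left   = refl
sign-opp falling br→tl right  = refl

-- What the pointer k of a marked crossing adds to the grade. The four corners split into two pairs
-- of adjacent corners with equal gain, and the two senses give the two different splittings.
gain : Sense → Over → Corner → ℤ
gain m o k = exponent o k + slope m * index o k

-- Two adjacent corners of equal gain go under ν to adjacent corners of the distinguished crossing
-- with opposite signs. The shades guarantee that the splitting by gain matches the one by sign.
local-cancellation : ∀ m o₀ o (ν : Corner → Corner) → (∀ k → ν (rot k) ≡ rot⁻ (ν k)) →
                     shade o top ≡ shade o₀ (ν top) → (I : ℤ → ℤ) →
                     ∑ₖ (λ k → sign m o₀ (ν k) * I (gain m o k)) ≡ 0ℤ
local-cancellation m o₀ o ν h e I =
  trans (cong₂ (λ b lr → sign m o₀ (ν top) * I (gain m o top) + (sign m o₀ b * I (gain m o bottom)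
                + (sign m o₀ (proj₁ lr) * I (gain m o left) + (sign m o₀ (proj₂ lr) * I (gain m o right) + 0ℤ))))
          (trans (h left) (cong rot⁻ (h top)))
          (cong₂ _,_ (h top) (trans (h bottom) (cong rot⁻ (trans (h left) (cong rot⁻ (h top)))))))
        (cancel m o₀ o (ν top) e I)
  where
  sum⁺₁ : ∀ a b → 1ℤ * a + (-1ℤ * b + (-1ℤ * a + (1ℤ * b + 0ℤ))) ≡ 0ℤ
  sum⁺₁ = solve-∀
  sum⁻₁ : ∀ a b → -1ℤ * a + (1ℤ * b + (1ℤ * a + (-1ℤ * b + 0ℤ))) ≡ 0ℤ
  sum⁻₁ = solve-∀
  sum⁺₂ : ∀ a b → 1ℤ * a + (-1ℤ * b + (1ℤ * b + (-1ℤ * a + 0ℤ))) ≡ 0ℤ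
  sum⁺₂ = solve-∀
  sum⁻₂ : ∀ a b → -1ℤ * a + (1ℤ * b + (-1ℤ * b + (1ℤ * a + 0ℤ))) ≡ 0ℤ
  sum⁻₂ = solve-∀
  cancel : ∀ m o₀ o w → shade o top ≡ shade o₀ w → (I : ℤ → ℤ) →
    sign m o₀ w * I (gain m o top) + (sign m o₀ (rot⁻ (rot⁻ w)) * I (gain m o bottom)
      + (sign m o₀ (rot⁻ w) * I (gain m o left) + (sign m o₀ (rot⁻ (rot⁻ (rot⁻ w))) * I (gain m o right) + 0ℤ))) ≡ 0ℤ
  cancel rising bl→tr bl→tr top _ I = sum⁺₁ (I (+ 1)) (I (-1ℤ))
  cancel rising bl→tr bl→tr bottom _ I = sum⁻₁ (I (+ 1)) (I (-1ℤ))
  cancel rising bl→tr bl→tr left () I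
  cancel rising bl→tr bl→tr right () I
  cancel rising bl→tr br→tl top () I
  cancel rising bl→tr br→tl bottom () I
  cancel rising bl→tr br→tl left _ I = sum⁺₂ (I (-1ℤ)) (I (+ 1))
  cancel rising bl→tr br→tl right _ I = sum⁻₂ (I (-1ℤ)) (I (+ 1))
  cancel rising br→tl bl→tr top () I
  cancel rising br→tl bl→tr bottom () I
  cancel rising br→tl bl→tr left _ I = sum⁺₁ (I (+ 1)) (I (-1ℤ))
  cancel rising br→tl bl→tr right _ I = sum⁻₁ (I (+ 1)) (I (-1ℤ))
  cancel rising br→tl br→tl top _ I = sum⁻₂ (I (-1ℤ)) (I (+ 1))
  cancel rising br→tl br→tl bottom _ I = sum⁺₂ (I (-1ℤ)) (I (+ 1))
  cancel rising br→tl br→tl left () I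
  cancel rising br→tl br→tl right () I
  cancel falling bl→tr bl→tr top _ I = sum⁻₂ (I (+ 1)) (I (-1ℤ))
  cancel falling bl→tr bl→tr bottom _ I = sum⁺₂ (I (+ 1)) (I (-1ℤ))
  cancel falling bl→tr bl→tr left () I
  cancel falling bl→tr bl→tr right () I
  cancel falling bl→tr br→tl top () I
  cancel falling bl→tr br→tl bottom () I
  cancel falling bl→tr br→tl left _ I = sum⁺₁ (I (-1ℤ)) (I (+ 1))
  cancel falling bl→tr br→tl right _ I = sum⁻₁ (I (-1ℤ)) (I (+ 1))
  cancel falling br→tl bl→tr top () I
  cancel falling br→tl bl→tr bottom () I
  cancel falling br→tl bl→tr left _ I = sum⁻₂ (I (+ 1)) (I (-1ℤ))
  cancel falling br→tl bl→tr right _ I = sum⁺₂ (I (+ 1)) (I (-1ℤ))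
  cancel falling br→tl br→tl top _ I = sum⁻₁ (I (-1ℤ)) (I (+ 1))
  cancel falling br→tl br→tl bottom _ I = sum⁺₁ (I (-1ℤ)) (I (+ 1))
  cancel falling br→tl br→tl left () I
  cancel falling br→tl br→tl right () I

δᶜ : Corner → Corner → ℤ
δᶜ j k = ⟦ j ≟ᶜ k ⟧

-- Read the labels once around a crossing: the steps from s to s′ are counted against those from s′
-- to s.
winding : (Corner → Corner) → Corner → Corner → ℤ
winding ν s s′ = ∑ₖ (λ k → δᶜ (ν k) s * (δᶜ (ν (rot k)) s′ - δᶜ (ν (rot⁻ k)) s′))

-- Every step from s to `rot s` around the distinguished crossing has to be balanced by a reverse
-- step among the values of ν. An evaluation over all 256 maps shows that this forces ν to reverse
-- the cyclic order.
reversed : ∀ (ν : Corner → Corner) → (∀ s s′ → winding ν s s′ + winding id s s′ ≡ 0ℤ) →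
           ∀ k → ν (rot k) ≡ rot⁻ (ν k)
reversed ν h = conclude (checked (ν top) (ν bottom) (ν left) (ν right) hyp)
  where
  pick : Corner → Corner → Corner → Corner → Corner → Corner
  pick a b c d top    = a
  pick a b c d bottom = b
  pick a b c d left   = c
  pick a b c d right  = d
  Hyp Con : Corner → Corner → Corner → Corner → Set
  Hyp a b c d = All (λ s → winding (pick a b c d) s (rot s) + winding id s (rot s) ≡ 0ℤ) corners
  Con a b c d = c ≡ rot⁻ a × b ≡ rot⁻ c × d ≡ rot⁻ b × a ≡ rot⁻ d
  hyp : Hyp (ν top) (ν bottom) (ν left) (ν right)
  hyp = h top left ∷ h bottom right ∷ h left bottom ∷ h right top ∷ []
  all-corners : ∀ {P : Corner → Set} → All P corners → ∀ k → P k
  all-corners ps k = All.lookup ps (FinSet.complete cornerᶠ k)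
  test? : ∀ a b c d → Dec (Hyp a b c d → Con a b c d)
  test? a b c d = all? (λ s → _ ℤ.≟ 0ℤ) corners →-dec ((c ≟ᶜ _) ×-dec (b ≟ᶜ _) ×-dec (d ≟ᶜ _) ×-dec (a ≟ᶜ _))
  checked : ∀ a b c d → Hyp a b c d → Con a b c d
  checked a b c d = all-corners (all-corners (all-corners (all-corners
    (toWitness {a? = all? (λ a → all? (λ b → all? (λ c → all? (λ d → test? a b c d) corners) corners) corners) corners} tt)
    a) b) c) d
  conclude : Con (ν top) (ν bottom) (ν left) (ν right) → ∀ k → ν (rot k) ≡ rot⁻ (ν k)
  conclude (e , _ , _ , _) top    = e
  conclude (_ , e , _ , _) left   = e
  conclude (_ , _ , e , _) bottom = e
  conclude (_ , _ , _ , e) right  = e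

module Kauffman (K : Skeleton) where
  open States K public

  𝟙 : Bool → ℤ
  𝟙 b = if b then 1ℤ else 0ℤ

  ex : Mask → Asg → ℤ
  ex a σ = ∑ Xs (λ c → 𝟙 (a c) * exponent (ov c) (σ c))

  remove-other : ∀ (a : Mask) {c d} → c ≢ d → (a ∖ d) c ≡ a c
  remove-other a {c} {d} n = trans (cong (λ b → a c ∧ not b) (dec-false (c ≟ₓ d) n)) (Bool.∧-identityʳ (a c))

  remove-self : ∀ (a : Mask) d → (a ∖ d) d ≡ false
  remove-self a d = trans (cong (λ b → a d ∧ not b) (dec-true (d ≟ₓ d) refl)) (Bool.∧-zeroʳ (a d))

  removed-active : ∀ (a : Mask) {c d} → (a ∖ d) c ≡ true → a c ≡ true × c ≢ d
  removed-active a {c} {d} e with a c | c ≟ₓ d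
  ... | true | no n = refl , n

  private
    one-term : ∀ (a : Mask) {d} → a d ≡ true → (f : Bool → X → ℤ) → (∀ c → f false c ≡ 0ℤ) →
               ∑ Xs (λ c → f (a c) c) ≡ ∑ Xs (λ c → f ((a ∖ d) c) c) + f true d
    one-term a {d} ad f f0 =
      trans (∑-cong Xs (λ c → go c (c ≟ₓ d)))
     (trans (∑-+ Xs (λ c → f ((a ∖ d) c) c) (λ c → δₓ c d * f true c))
            (cong (_+_ (∑ Xs (λ c → f ((a ∖ d) c) c))) (∑-δₓ d (f true))))
      where
      go : ∀ c → Dec (c ≡ d) → f (a c) c ≡ f ((a ∖ d) c) c + δₓ c d * f true c
      go c (yes refl) = trans (cong (λ b → f b c) ad) (sym (trans (cong₂ _+_ (trans (cong (λ b → f b c) (remove-self a c)) (f0 c))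
                          (trans (cong (_* f true c) (⟦⟧-yes (c ≟ₓ c) refl)) (ℤ.*-identityˡ (f true c)))) (ℤ.+-identityˡ _)))
      go c (no n) = sym (trans (cong₂ _+_ (cong (λ b → f b c) (remove-other a n)) (cong (_* f true c) (⟦⟧-no (c ≟ₓ d) n))) (ℤ.+-identityʳ _))

  uses-split : ∀ a {d} → a d ≡ true → ∀ σ r → uses a σ r ≡ uses (a ∖ d) σ r + δᵧ (κ d (σ d)) r
  uses-split a ad σ r = one-term a ad (λ b c → ⟦ (b Bool.≟ true) ×-dec (κ c (σ c) ≟ᵧ r) ⟧) (λ _ → refl)

  ex-split : ∀ a {d} → a d ≡ true → ∀ σ → ex a σ ≡ ex (a ∖ d) σ + exponent (ov d) (σ d)
  ex-split a {d} ad σ = trans (one-term a ad (λ b c → 𝟙 b * exponent (ov c) (σ c)) (λ _ → refl))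
                          (cong (_+_ (ex (a ∖ d) σ)) (ℤ.*-identityˡ _))

  Agree : Mask → Asg → Asg → Set
  Agree a σ τ = ∀ c → a c ≡ true → σ c ≡ τ c

  agree-upd : ∀ (a : Mask) {d} → a d ≡ false → ∀ σ k → Agree a (upd σ d k) σ
  agree-upd a {d} ad σ k c ac = upd-there σ k (λ { refl → case trans (sym ac) ad of λ () })

  agree-sym : ∀ {a σ τ} → Agree a σ τ → Agree a τ σ
  agree-sym h c ac = sym (h c ac)

  points-agree : ∀ {a σ τ r} → Agree a σ τ → ∀ c → Points a σ r c → Points a τ r c
  points-agree h c (ac , e) = ac , trans (cong (κ c) (sym (h c ac))) e

  uses-agree : ∀ {a σ τ} → Agree a σ τ → ∀ r → uses a σ r ≡ uses a τ r
  uses-agree {a} {σ} {τ} h r = ∑-cong Xs (λ c → ⟦⟧-cong (points? a σ r c) (points? a τ r c)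
                         (points-agree h c) (points-agree (agree-sym h) c))

  ex-agree : ∀ {a σ τ} → Agree a σ τ → ex a σ ≡ ex a τ
  ex-agree {a} {σ} {τ} h = ∑-cong Xs (λ c → go c (a c) refl)
    where
    go : ∀ c b → a c ≡ b → 𝟙 b * exponent (ov c) (σ c) ≡ 𝟙 b * exponent (ov c) (τ c)
    go c true  e = cong (λ k → 1ℤ * exponent (ov c) k) (h c e)
    go c false e = refl

  lead-agree : ∀ {a σ τ} → Agree a σ τ → ∀ r → Walk.lead a σ r ≡ Walk.lead a τ r
  lead-agree {a} {σ} {τ} h = go (size regions)
    where
    go : ∀ n r → iter (Walk.par a σ) n r ≡ iter (Walk.par a τ) n r
    go zero    r = refl
    go (suc n) r = trans (go n (Walk.par a σ r)) (cong (iter (Walk.par a τ) n)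
       (search-cong (λ c p → points-agree h c p , h c (proj₁ p)) (points-agree (agree-sym h)) Xs))

  ∀Y? : {P : Y → Set} → (∀ r → Dec (P r)) → Dec (∀ r → P r)
  ∀Y? P? = map′ (λ ps r → All.lookup ps (Y-complete r)) (λ h → All.tabulate (λ {r} _ → h r)) (all? P? Ys)

  covers? : ∀ a root σ → Dec (Covers a root σ)
  covers? a root σ = ∀Y? (λ r → uses a σ r ℤ.≟ target root r)

  state? : ∀ x y σ → Dec (State x y σ)
  state? x y = covers? full (base x y)

  agree-ext : ∀ {a σ τ} → σ ≗ₐ τ → Agree a σ τ
  agree-ext h c _ = h c

  covers-agree : ∀ {a root σ τ} → Agree a σ τ → Covers a root σ → Covers a root τ
  covers-agree h cv r = trans (sym (uses-agree h r)) (cv r)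

  #states : Y → Y → ℤ → ℤ
  #states x y n = S Xs (λ σ → ⟦ state? x y σ ⟧ * ⟦ ex full σ ℤ.≟ n ⟧)

  p-corner : ∀ (p : Y → ℤ) → (∀ c i → p (κ c (lf i)) - p (κ c (rt i)) ≡ 1ℤ) → ∀ c k → p (κ c k) ≡ p (κ c top) + index (ov c) k
  p-corner p h c top    = sym (ℤ.+-identityʳ _)
  p-corner p h c left   = lemma (p (κ c left)) (p (κ c top)) (h c top)
    where
    lemma : ∀ a b → a - b ≡ 1ℤ → a ≡ b + 1ℤ
    lemma a b e = trans (alg a b) (cong (_+_ b) e)
      where
      alg : ∀ a b → a ≡ b + (a - b)
      alg = solve-∀
  p-corner p h c bottom = lemma (p (κ c left)) (p (κ c top)) (p (κ c bottom)) (trans (h c left) (sym (h c top)))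
    where
    lemma : ∀ l t b → l - b ≡ l - t → b ≡ t + 0ℤ
    lemma l t b e = trans (alg l b) (trans (cong (_-_ l) e) (alg′ l t))
      where
      alg : ∀ l b → b ≡ l - (l - b)
      alg = solve-∀
      alg′ : ∀ l t → l - (l - t) ≡ t + 0ℤ
      alg′ = solve-∀
  p-corner p h c right  = lemma (p (κ c top)) (p (κ c right)) (h c right)
    where
    lemma : ∀ a b → a - b ≡ 1ℤ → b ≡ a + -1ℤ
    lemma a b e = trans (alg a b) (cong (λ z → a + - z) e)
      where
      alg : ∀ a b → b ≡ a + - (a - b)
      alg = solve-∀

  uses-upd : ∀ σ c k r → uses full (upd σ c k) r ≡ uses (full ∖ c) σ r + δᵧ (κ c k) r
  uses-upd σ c k r = trans (uses-split full refl (upd σ c k) r)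
    (cong₂ _+_ (uses-agree (agree-upd (full ∖ c) (remove-self full c) σ k) r) (cong (λ z → δᵧ (κ c z) r) (upd-here σ c k)))

  ex-upd : ∀ σ c k → ex full (upd σ c k) ≡ ex (full ∖ c) σ + exponent (ov c) k
  ex-upd σ c k = trans (ex-split full refl (upd σ c k))
    (cong₂ _+_ (ex-agree {full ∖ c} (agree-upd (full ∖ c) (remove-self full c) σ k)) (cong (exponent (ov c)) (upd-here σ c k)))

  state-avoids : ∀ {x y σ c k} → σ c ≡ k → base x y (κ c k) ≡ true → ¬ State x y σ
  state-avoids {x} {y} {σ} {c} refl e st =
    count-none (points? full σ (κ c (σ c))) Xs (trans (st _) (cong (if_then 0ℤ else 1ℤ) e)) (X-complete c) (refl , refl)

  module Star (c₀ : X) (p : Y → ℤ) (p-lf-rt : ∀ c i → p (κ c (lf i)) - p (κ c (rt i)) ≡ 1ℤ)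
              (p-index : ∀ k → p (κ c₀ k) ≡ index (ov c₀) k)
              (distinct : ∀ j k → κ c₀ j ≡ κ c₀ k → j ≡ k) where

    Star : Y → Set
    Star r = ∃[ k ] r ≡ κ c₀ k

    star? : ∀ r → Dec (Star r)
    star? r = map′ (λ i → _ , proj₂ (proj₂ (find i))) (λ (k , e) → lose (FinSet.complete cornerᶠ k) e) (any? (λ k → r ≟ᵧ κ c₀ k) corners)

    star : Y → Bool
    star r = does (star? r)

    star-κ : ∀ k → star (κ c₀ k) ≡ true
    star-κ k = dec-true (star? _) (k , refl)

    star-elim : ∀ {r} → star r ≡ true → Star r
    star-elim {r} = does-true (star? r)

    -- Inverse to `κ c₀` on the four regions at c₀; any other region receives the default `right`.
    labelOf : Y → Corner
    labelOf y = if does (y ≟ᵧ κ c₀ top) then top else (if does (y ≟ᵧ κ c₀ bottom) then bottom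
                else (if does (y ≟ᵧ κ c₀ left) then left else right))

    labelOf-κ : ∀ k → labelOf (κ c₀ k) ≡ k
    labelOf-κ top = if-yes (_ ≟ᵧ κ c₀ top) refl
    labelOf-κ bottom = trans (if-no (_ ≟ᵧ κ c₀ top) (λ e → case distinct _ _ e of λ ()))
                             (if-yes (_ ≟ᵧ κ c₀ bottom) refl)
    labelOf-κ left = trans (if-no (_ ≟ᵧ κ c₀ top) (λ e → case distinct _ _ e of λ ()))
                    (trans (if-no (_ ≟ᵧ κ c₀ bottom) (λ e → case distinct _ _ e of λ ()))
                           (if-yes (_ ≟ᵧ κ c₀ left) refl))
    labelOf-κ right = trans (if-no (_ ≟ᵧ κ c₀ top) (λ e → case distinct _ _ e of λ ()))
                     (trans (if-no (_ ≟ᵧ κ c₀ bottom) (λ e → case distinct _ _ e of λ ()))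
                            (if-no (_ ≟ᵧ κ c₀ left) (λ e → case distinct _ _ e of λ ())))

    κ-labelOf : ∀ {r} → star r ≡ true → κ c₀ (labelOf r) ≡ r
    κ-labelOf e with star-elim e
    ... | k , refl = cong (κ c₀) (labelOf-κ k)

    a₀ : Mask
    a₀ = full ∖ c₀

    a₁ : X → Mask
    a₁ d = a₀ ∖ d

    a₀-active : ∀ {d} → d ≢ c₀ → a₀ d ≡ true
    a₀-active n = remove-other full n

    a₁-active : ∀ {c d} → c ≢ c₀ → c ≢ d → a₁ d c ≡ true
    a₁-active n m = trans (remove-other a₀ m) (a₀-active n)

    -- The pointers other than those of c₀ and d form a forest whose trees are rooted at the four
    -- regions around c₀.
    Good : Asg → X → Set
    Good σ d = d ≢ c₀ × Covers (a₁ d) star σ × (∀ r → star (Walk.lead (a₁ d) σ r) ≡ true)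

    good? : ∀ σ d → Dec (Good σ d)
    good? σ d = ¬? (d ≟ₓ c₀) ×-dec (covers? (a₁ d) star σ ×-dec ∀Y? (λ r → star (Walk.lead (a₁ d) σ r) Bool.≟ true))

    good-agree : ∀ {σ τ d} → Agree (a₁ d) σ τ → Good σ d → Good τ d
    good-agree h (n , cv , rd) = n , covers-agree h cv , λ r → trans (cong star (sym (lead-agree h r))) (rd r)

    label : Asg → X → Corner → Corner
    label σ d k = labelOf (Walk.lead (a₁ d) σ (κ d k))

    module Free (σ : Asg) (d : X) (good : Good σ d) where
      private
        d≢c₀ = proj₁ good
        cv   = proj₁ (proj₂ good)
        rd   = proj₂ (proj₂ good)
      open Pointers (a₁ d) σ star cv public

      ν : Corner → Corner
      ν = label σ d

      κ-ν : ∀ k → κ c₀ (ν k) ≡ lead (κ d k)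
      κ-ν k = κ-labelOf (rd (κ d k))

      lead-opp : ∀ c → a₁ d c ≡ true → lead (κ c (opp (σ c))) ≡ lead (κ c (σ c))
      lead-opp c ac = trans (cong lead (sym (par-active ac))) (lead-par (rd _))

      private
        ind : Corner → Y → ℤ
        ind s r = ⟦ lead r ≟ᵧ κ c₀ s ⟧

        ind-d : ∀ s k → ind s (κ d k) ≡ δᶜ (ν k) s
        ind-d s k = ⟦⟧-cong (_ ≟ᵧ _) (_ ≟ᶜ _) (λ e → distinct _ _ (trans (κ-ν k) e))
                              (λ e → trans (sym (κ-ν k)) (cong (κ c₀) e))

        ind-c₀ : ∀ s k → ind s (κ c₀ k) ≡ δᶜ k s
        ind-c₀ s k = ⟦⟧-cong (_ ≟ᵧ _) (_ ≟ᶜ _) (λ e → distinct _ _ (trans (sym (lead-root (star-κ k))) e))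
                               (λ e → trans (lead-root (star-κ k)) (cong (κ c₀) e))

        module _ (s s′ : Corner) where
          Tm : X → ℤ
          Tm c = ∑ₖ (λ k → ind s (κ c k) * (ind s′ (κ c (rot k)) - ind s′ (κ c (rot⁻ k))))

          -- An active pointer puts two opposite corners into the same tree, so the terms cancel in
          -- pairs. In `pairing` for the indicators of two trees only d and c₀ survive.
          Tm-active : ∀ c → a₁ d c ≡ true → Tm c ≡ 0ℤ
          Tm-active c ac = trans (∑ₖ-around (σ c) (λ k → ind s (κ c k) * (ind s′ (κ c (rot k)) - ind s′ (κ c (rot⁻ k)))))
            (lemma (f s (σ c)) (f s (opp (σ c))) (f s (rot (σ c))) (f s (rot⁻ (σ c)))
               (cong (λ r → ⟦ r ≟ᵧ κ c₀ s ⟧) (lead-opp c ac))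
               (cong (f s′) (rot-opp (σ c))) (cong (f s′) (rot⁻-opp (σ c)))
               (trans (cong (f s′) (rot-rot (σ c))) (trans (cong (λ r → ⟦ r ≟ᵧ κ c₀ s′ ⟧) (lead-opp c ac)) (sym (cong (f s′) (rot⁻-rot (σ c))))))
               (trans (cong (f s′) (rot-rot⁻ (σ c))) (trans (sym (cong (λ r → ⟦ r ≟ᵧ κ c₀ s′ ⟧) (lead-opp c ac))) (sym (cong (f s′) (rot⁻-rot⁻ (σ c)))))))
            where
            f : Corner → Corner → ℤ
            f s k = ind s (κ c k)
            lemma : ∀ a b x y {u v u′ v′ w w′ z z′} → b ≡ a → u′ ≡ v → v′ ≡ u → w ≡ w′ → z ≡ z′ →
                    (a * (u - v) + b * (u′ - v′)) + (x * (w - w′) + y * (z - z′)) ≡ 0ℤ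
            lemma a _ x y {u} {v} {w = w} {z = z} refl refl refl refl refl = alg a x y u v w z
              where
              alg : ∀ a x y u v w z → (a * (u - v) + a * (v - u)) + (x * (w - w) + y * (z - z)) ≡ 0ℤ
              alg = solve-∀

          Tm-split : ∀ c → Tm c ≡ δₓ c d * Tm c + δₓ c c₀ * Tm c
          Tm-split c = go (c ≟ₓ d) (c ≟ₓ c₀)
            where
            go : Dec (c ≡ d) → Dec (c ≡ c₀) → Tm c ≡ δₓ c d * Tm c + δₓ c c₀ * Tm c
            go (yes refl) (yes e) = contradiction e d≢c₀
            go (yes e) (no n) = sym (trans (cong₂ (λ u v → u * Tm c + v * Tm c) (⟦⟧-yes (c ≟ₓ d) e) (⟦⟧-no (c ≟ₓ c₀) n)) (alg (Tm c)))
              where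
              alg : ∀ t → 1ℤ * t + 0ℤ * t ≡ t
              alg = solve-∀
            go (no n) (yes e) = sym (trans (cong₂ (λ u v → u * Tm c + v * Tm c) (⟦⟧-no (c ≟ₓ d) n) (⟦⟧-yes (c ≟ₓ c₀) e)) (alg (Tm c)))
              where
              alg : ∀ t → 0ℤ * t + 1ℤ * t ≡ t
              alg = solve-∀
            go (no n) (no m) = trans t0 (sym (cong₂ (λ u v → u * Tm c + v * Tm c) (⟦⟧-no (c ≟ₓ d) n) (⟦⟧-no (c ≟ₓ c₀) m)))
              where
              t0 : Tm c ≡ 0ℤ
              t0 = Tm-active c (a₁-active m n)

          balanced : winding ν s s′ + winding id s s′ ≡ 0ℤ
          balanced = trans (cong₂ _+_ (sym (wind d ν ind-d)) (sym (wind c₀ id ind-c₀)))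
                    (trans (cong₂ _+_ (sym (∑-δₓ d Tm)) (sym (∑-δₓ c₀ Tm)))
                    (trans (sym (∑-+ Xs (λ c → δₓ c d * Tm c) (λ c → δₓ c c₀ * Tm c)))
                    (trans (sym (∑-cong Xs Tm-split)) (pairing (ind s) (ind s′)))))
            where
            wind : ∀ c (f : Corner → Corner) → (∀ s k → ind s (κ c k) ≡ δᶜ (f k) s) → Tm c ≡ winding f s s′
            wind c f h = ∑-cong corners (λ k → cong₂ _*_ (h s k) (cong₂ _-_ (h s′ (rot k)) (h s′ (rot⁻ k))))

      -- Geometrically, four disjoint trees joining the corners of d to those of c₀ on the sphere
      -- leave the two crossings in opposite cyclic orders.
      ν-reversed : ∀ k → ν (rot k) ≡ rot⁻ (ν k)
      ν-reversed = reversed ν balanced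

      ν-opp : ∀ k → ν (opp k) ≡ opp (ν k)
      ν-opp k = trans (cong ν (sym (rot-rot k))) (trans (ν-reversed (rot k)) (trans (cong rot⁻ (ν-reversed k)) (rot⁻-rot⁻ (ν k))))

      private
        shade-lead : ∀ n c k c′ k′ → star (iter par n (κ c k)) ≡ true → κ c′ k′ ≡ iter par n (κ c k) →
                     shade (ov c) k ≡ shade (ov c′) k′
        shade-lead zero    c k c′ k′ _ e = coloured c k c′ k′ (sym e)
        shade-lead (suc n) c k c′ k′ r e with star (κ c k) in eq
        ... | true  = coloured c k c′ k′ (sym (trans e (trans (cong (iter par n) (par-root eq)) (iter-root n eq))))
        ... | false with pointer eq
        ...   | b , (ab , f) , _ = trans (trans (coloured c k b (σ b) (sym f)) (sym (shade-opp (ov b) (σ b))))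
                (shade-lead n b (opp (σ b)) c′ k′ (subst (λ z → star (iter par n z) ≡ true) pe r)
                    (trans e (cong (iter par n) pe)))
          where
          pe : par (κ c k) ≡ κ b (opp (σ b))
          pe = trans (cong par (sym f)) (par-active ab)

      -- Each step of a walk goes from a corner to the opposite corner of the same crossing, which
      -- has the same shade.
      ν-shade : ∀ k → shade (ov d) k ≡ shade (ov c₀) (ν k)
      ν-shade k = shade-lead N d k c₀ (ν k) (rd (κ d k)) (κ-ν k)

    -- Two crossings point to the same region. Marking d₂ in place of d₁ makes that region continue
    -- across d₁, into the tree at the opposite corner of c₀ by `ν-opp`. So the forest persists,
    -- while the sign of the mark changes.
    module Swap (σ : Asg) (d₁ d₂ : X) (d₁≢d₂ : d₁ ≢ d₂) (good₁ : Good σ d₁) (d₂≢c₀ : d₂ ≢ c₀)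
                (same-region : κ d₁ (σ d₁) ≡ κ d₂ (σ d₂)) where
      private
        module F = Free σ d₁ good₁
        d₁≢c₀ = proj₁ good₁
        rd₁   = proj₂ (proj₂ good₁)
        r₁ = κ d₁ (σ d₁)
        y  = κ d₁ (opp (σ d₁))

        cv₂ : Covers (a₁ d₂) star σ
        cv₂ r = ℤ+.∙-cancelʳ (δᵧ r₁ r) _ _
          (trans (cong (λ z → uses (a₁ d₂) σ r + δᵧ z r) same-region)
          (trans (sym (uses-split a₀ (a₀-active d₂≢c₀) σ r))
          (trans (uses-split a₀ (a₀-active d₁≢c₀) σ r) (cong (_+ δᵧ r₁ r) (proj₁ (proj₂ good₁) r)))))

        module G = Pointers (a₁ d₂) σ star cv₂

        par-other : ∀ {t} → t ≢ r₁ → G.par t ≡ F.par t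
        par-other {t} n = search-cong
          (λ c (ac , e) → (a₁-active (a₁⇒c₀ ac) (λ { refl → n (sym e) }) , e) , refl)
          (λ c (ac , e) → a₁-active (a₁⇒c₀ ac) (λ { refl → n (trans (sym e) (sym same-region)) }) , e) Xs
          where
          a₁⇒c₀ : ∀ {c d} → a₁ d c ≡ true → c ≢ c₀
          a₁⇒c₀ ac = proj₂ (removed-active full (proj₁ (removed-active a₀ ac)))

        par-r₁ : G.par r₁ ≡ y
        par-r₁ = G.par-active (a₁-active d₁≢c₀ d₁≢d₂)

        far-apart : F.lead y ≢ F.lead r₁
        far-apart e = opp-≢ (F.ν (σ d₁)) (trans (sym (F.ν-opp (σ d₁)))
                        (distinct _ _ (trans (F.κ-ν _) (trans e (sym (F.κ-ν _))))))
          where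
          opp-≢ : ∀ k → opp k ≢ k
          opp-≢ top ()
          opp-≢ left ()
          opp-≢ bottom ()
          opp-≢ right ()

        -- Only the step from r₁ has changed, and a walk whose root is not that of r₁ never visits
        -- r₁.
        far : ∀ n t → F.lead t ≢ F.lead r₁ → iter G.par n t ≡ iter F.par n t
        far zero    t h = refl
        far (suc n) t h = trans (cong (iter G.par n) (par-other (λ { refl → h refl })))
                                (far n (F.par t) (λ e → h (trans (sym (F.lead-par (rd₁ t))) e)))

        lead-y : G.lead y ≡ F.lead y
        lead-y = far (size regions) y far-apart

        rooted₂ : ∀ n t → star (iter F.par n t) ≡ true → G.Rooted t
        rooted₂ zero    t e = G.root⇒rooted e
        rooted₂ (suc n) t e with t ≟ᵧ r₁
        ... | yes refl = G.rooted-par⁻ (trans (cong (star ∘ G.lead) par-r₁) (trans (cong star lead-y) (rd₁ y)))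
        ... | no ne = G.rooted-par⁻ (subst G.Rooted (sym (par-other ne)) (rooted₂ n (F.par t) e))

      good₂ : Good σ d₂
      good₂ = d₂≢c₀ , cv₂ , λ r → rooted₂ (size regions) r (rd₁ r)

      label₂ : label σ d₂ (σ d₂) ≡ opp (label σ d₁ (σ d₁))
      label₂ = trans (cong (labelOf ∘ G.lead) (sym same-region))
              (trans (cong labelOf (sym (G.lead-par (proj₂ (proj₂ good₂) r₁))))
              (trans (cong (labelOf ∘ G.lead) par-r₁) (trans (cong labelOf lead-y) (F.ν-opp (σ d₁)))))

    Doubles : Y → Asg → Set
    Doubles r₁ σ = ∀ r → uses a₀ σ r ≡ target star r + δᵧ r₁ r

    End : Corner → Asg → Set
    End s = Doubles (κ c₀ s)

    doubles? : ∀ r₁ σ → Dec (Doubles r₁ σ)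
    doubles? r₁ σ = ∀Y? (λ r → uses a₀ σ r ℤ.≟ target star r + δᵧ r₁ r)

    end? : ∀ s σ → Dec (End s σ)
    end? s = doubles? (κ c₀ s)

    doubles-unique : ∀ {r₁ r₂ σ} → Doubles r₁ σ → Doubles r₂ σ → r₁ ≡ r₂
    doubles-unique {r₁} {r₂} h g = sym (⟦⟧-1 (r₂ ≟ᵧ r₁)
      (trans (ℤ+.∙-cancelˡ (target star r₁) _ _ (trans (sym (g r₁)) (h r₁))) (⟦⟧-yes (r₁ ≟ᵧ r₁) refl)))

    good-doubles : ∀ {σ d} → Good σ d → Doubles (κ d (σ d)) σ
    good-doubles {σ} {d} (n , cv , _) r = trans (uses-split a₀ (a₀-active n) σ r) (cong (_+ δᵧ (κ d (σ d)) r) (cv r))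

    lf-rt-rot : ∀ i → (lf i ≡ i × rt i ≡ rot i) ⊎ (lf i ≡ rot i × rt i ≡ i)
    lf-rt-rot top    = inj₂ (refl , refl)
    lf-rt-rot left   = inj₁ (refl , refl)
    lf-rt-rot bottom = inj₁ (refl , refl)
    lf-rt-rot right  = inj₂ (refl , refl)

    pairOf : Corner → Y → Bool
    pairOf i = base (κ c₀ (lf i)) (κ c₀ (rt i))

    pair-true : ∀ i {k} → k ≡ i ⊎ k ≡ rot i → pairOf i (κ c₀ k) ≡ true
    pair-true i {k} h with lf-rt-rot i | h
    ... | inj₁ (a , b) | inj₁ refl = trans (cong (λ z → pairOf i (κ c₀ z)) (sym a)) (base-left _ _)
    ... | inj₁ (a , b) | inj₂ refl = trans (cong (λ z → pairOf i (κ c₀ z)) (sym b)) (base-right _ _)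
    ... | inj₂ (a , b) | inj₁ refl = trans (cong (λ z → pairOf i (κ c₀ z)) (sym b)) (base-right _ _)
    ... | inj₂ (a , b) | inj₂ refl = trans (cong (λ z → pairOf i (κ c₀ z)) (sym a)) (base-left _ _)

    pair-false : ∀ i {r} → r ≢ κ c₀ i → r ≢ κ c₀ (rot i) → pairOf i r ≡ false
    pair-false i {r} n m with lf-rt-rot i
    ... | inj₁ (a , b) = base-neither _ _ r (subst (λ z → r ≢ κ c₀ z) (sym a) n) (subst (λ z → r ≢ κ c₀ z) (sym b) m)
    ... | inj₂ (a , b) = base-neither _ _ r (subst (λ z → r ≢ κ c₀ z) (sym a) m) (subst (λ z → r ≢ κ c₀ z) (sym b) n)

    around-distinct : ∀ i → opp i ≢ i × opp i ≢ rot i × rot⁻ i ≢ i × rot⁻ i ≢ rot i × opp i ≢ rot⁻ i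
    around-distinct top    = (λ ()) , (λ ()) , (λ ()) , (λ ()) , (λ ())
    around-distinct left   = (λ ()) , (λ ()) , (λ ()) , (λ ()) , (λ ())
    around-distinct bottom = (λ ()) , (λ ()) , (λ ()) , (λ ()) , (λ ())
    around-distinct right  = (λ ()) , (λ ()) , (λ ()) , (λ ()) , (λ ())

    private
      tgt : Bool → ℤ
      tgt b = if b then 0ℤ else 1ℤ

    pair-target : ∀ i r → target (pairOf i) r ≡ (target star r + δᵧ (κ c₀ (opp i)) r) + δᵧ (κ c₀ (rot⁻ i)) r
    pair-target i r with around-distinct i
    ... | n₁ , n₂ , n₃ , n₄ , n₅ = go (star? r)
      where
      outside : ¬ Star r → ∀ k → κ c₀ k ≢ r
      outside n k e = n (k , sym e)
      neq : ∀ {j k} → j ≢ k → κ c₀ j ≢ κ c₀ k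
      neq n e = n (distinct _ _ e)
      value : ∀ {b s x y r} → pairOf i r ≡ b → star r ≡ s → δᵧ (κ c₀ (opp i)) r ≡ x → δᵧ (κ c₀ (rot⁻ i)) r ≡ y →
              tgt b ≡ (tgt s + x) + y →
              target (pairOf i) r ≡ (target star r + δᵧ (κ c₀ (opp i)) r) + δᵧ (κ c₀ (rot⁻ i)) r
      value e f g h q = trans (cong tgt e) (trans q (sym (cong₂ _+_ (cong₂ _+_ (cong tgt f) g) h)))
      at-corner : ∀ {k} → Around i k →
        target (pairOf i) (κ c₀ k) ≡ (target star (κ c₀ k) + δᵧ (κ c₀ (opp i)) (κ c₀ k)) + δᵧ (κ c₀ (rot⁻ i)) (κ c₀ k)
      at-corner itself = value (pair-true i (inj₁ refl)) (star-κ _) (⟦⟧-no (_ ≟ᵧ _) (neq n₁)) (⟦⟧-no (_ ≟ᵧ _) (neq n₃)) refl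
      at-corner succeeding = value (pair-true i (inj₂ refl)) (star-κ _) (⟦⟧-no (_ ≟ᵧ _) (neq n₂)) (⟦⟧-no (_ ≟ᵧ _) (neq n₄)) refl
      at-corner opposite = value (pair-false i (neq n₁) (neq n₂)) (star-κ _) (⟦⟧-yes (_ ≟ᵧ _) refl) (⟦⟧-no (_ ≟ᵧ _) (neq (n₅ ∘ sym))) refl
      at-corner preceding = value (pair-false i (neq n₃) (neq n₄)) (star-κ _) (⟦⟧-no (_ ≟ᵧ _) (neq n₅)) (⟦⟧-yes (_ ≟ᵧ _) refl) refl
      go : Dec (Star r) → target (pairOf i) r ≡ (target star r + δᵧ (κ c₀ (opp i)) r) + δᵧ (κ c₀ (rot⁻ i)) r
      go (no n) = value (pair-false i (outside n i ∘ sym) (outside n (rot i) ∘ sym)) (dec-false (star? r) n)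
                    (⟦⟧-no (_ ≟ᵧ _) (outside n _)) (⟦⟧-no (_ ≟ᵧ _) (outside n _)) refl
      go (yes (k , refl)) = at-corner (around i k)

    -- An end becomes a state, hence acyclic, once the distinguished crossing is pointed suitably.
    end-good : ∀ {s σ d} → End s σ → d ≢ c₀ → κ d (σ d) ≡ κ c₀ s → Good σ d
    end-good {s} {σ} {d} end d≢c₀ e = d≢c₀ , cv , λ r → near A.N r (A.all-rooted r)
      where
      σ⁺ = upd σ c₀ (rot s)
      cv : Covers (a₁ d) star σ
      cv r = ℤ+.∙-cancelʳ (δᵧ (κ c₀ s) r) _ _ (trans (cong (λ z → uses (a₁ d) σ r + δᵧ z r) (sym e))
               (trans (sym (uses-split a₀ (a₀-active d≢c₀) σ r)) (end r)))
      st : State (κ c₀ (lf (opp s))) (κ c₀ (rt (opp s))) σ⁺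
      st r = trans (uses-upd σ c₀ (rot s) r) (trans (cong (_+ δᵧ (κ c₀ (rot s)) r) (end r))
             (trans (cong₂ (λ j k → (target star r + δᵧ (κ c₀ j) r) + δᵧ (κ c₀ k) r) (sym (opp-opp s)) (sym (rot⁻-opp s)))
                    (sym (pair-target (opp s) r))))
      module A = Acyclic c₀ (opp s) σ⁺ st
      module P = Pointers (a₁ d) σ star cv
      par-same : ∀ {t} → ¬ Star t → P.par t ≡ A.par t
      par-same {t} n = search-cong
        (λ c (ac , q) → (refl , trans (cong (κ c) (upd-there σ (rot s) (c≢ ac))) q) , sym (upd-there σ (rot s) (c≢ ac)))
        (λ c (_ , q) → let c≢c₀ = λ { refl → n (_ , sym q) } ; q′ = trans (cong (κ c) (sym (upd-there σ (rot s) c≢c₀))) q in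
              a₁-active c≢c₀ (λ { refl → n (s , trans (sym q′) e) }) , q′) Xs
        where
        c≢ : ∀ {c} → a₁ d c ≡ true → c ≢ c₀
        c≢ ac = proj₂ (removed-active full (proj₁ (removed-active a₀ ac)))
      near : ∀ n t → pairOf (opp s) (iter A.par n t) ≡ true → P.Rooted t
      near zero t h with base-cases _ _ t h
      ... | inj₁ refl = P.root⇒rooted (star-κ _)
      ... | inj₂ refl = P.root⇒rooted (star-κ _)
      near (suc n) t h with star? t
      ... | yes (k , refl) = P.root⇒rooted (star-κ k)
      ... | no ¬s = P.rooted-par⁻ (subst P.Rooted (sym (par-same ¬s)) (near n (A.par t) h))

    -- Pairs of an assignment and a marked crossing are summed in two ways. Moving the pointer of
    -- the mark gives zero (`corner-sum`); moving the mark leaves the ends (`mark-sum`). This yields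
    -- one linear relation for every sense and grade.
    module DoubleCount (m : Sense) (E : ℤ) where

      -- The shift by the Alexander index is what makes adjacent corners of the mark agree in pairs.
      -- It depends on the region pointed to only, so two marks at one region have the same grade.
      grade : Asg → X → ℤ
      grade σ d = ex a₀ σ + slope m * p (κ d (σ d))

      φ : Asg → X → ℤ
      φ σ d = ⟦ good? σ d ⟧ * (sign m (ov c₀) (label σ d (σ d)) * ⟦ grade σ d ℤ.≟ E ⟧)

      -- Assignments carry a pointer at c₀ as well, which the forest does not see; fixing it at
      -- `top` counts every configuration once.
      τ : Asg → ℤ
      τ σ = ⟦ σ c₀ ≟ᶜ top ⟧

      φ-bad : ∀ {σ d} → ¬ Good σ d → φ σ d ≡ 0ℤ
      φ-bad {σ} {d} n = cong (_* (sign m (ov c₀) (label σ d (σ d)) * ⟦ grade σ d ℤ.≟ E ⟧)) (⟦⟧-no (good? σ d) n)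

      φ-good : ∀ {σ d} → Good σ d → φ σ d ≡ sign m (ov c₀) (label σ d (σ d)) * ⟦ grade σ d ℤ.≟ E ⟧
      φ-good {σ} {d} g = trans (cong (_* (sign m (ov c₀) (label σ d (σ d)) * ⟦ grade σ d ℤ.≟ E ⟧)) (⟦⟧-yes (good? σ d) g)) (ℤ.*-identityˡ _)

      φ-ext : ∀ d → Ext (λ σ → τ σ * φ σ d)
      φ-ext d {σ} {σ′} h = cong₂ _*_ (cong (λ k → ⟦ k ≟ᶜ top ⟧) (h c₀))
        (cong₂ _*_ (⟦⟧-cong (good? σ d) (good? σ′ d) (good-agree (agree-ext {a₁ d} h)) (good-agree (agree-ext {a₁ d} (sym ∘ h))))
          (cong₂ (λ k z → sign m (ov c₀) k * ⟦ z ℤ.≟ E ⟧)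
            (cong labelOf (trans (lead-agree (agree-ext {a₁ d} h) (κ d (σ d))) (cong (λ k → Walk.lead (a₁ d) σ′ (κ d k)) (h d))))
            (cong₂ _+_ (ex-agree {a₀} (agree-ext h)) (cong (λ k → slope m * p (κ d k)) (h d)))))

      -- The forest and its labels do not depend on the pointer of the mark d, so its four positions
      -- can be summed with everything else fixed.
      corner-sum : ∀ d → S Xs (λ σ → τ σ * φ σ d) ≡ 0ℤ
      corner-sum d = go (d ≟ₓ c₀)
        where
        go : Dec (d ≡ c₀) → S Xs (λ σ → τ σ * φ σ d) ≡ 0ℤ
        go (yes e) = S-zero Xs (λ σ → trans (cong (τ σ *_) (φ-bad (λ g → proj₁ g e))) (ℤ.*-zeroʳ (τ σ)))
        go (no d≢c₀) = trans (S-local (X-complete d) (φ-ext d) (λ _ → refl) local) (S-0 Xs)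
          where
          inactive : a₁ d d ≡ false
          inactive = remove-self a₀ d
          local : ∀ σ → ∑ₖ (λ k → τ (upd σ d k) * φ (upd σ d k) d) ≡ 0ℤ
          local σ = split (good? σ d)
            where
            split : Dec (Good σ d) → ∑ₖ (λ k → τ (upd σ d k) * φ (upd σ d k) d) ≡ 0ℤ
            split (no n) = ∑-zero corners (λ k → trans (cong (τ (upd σ d k) *_)
                (φ-bad (λ g → n (good-agree (agree-upd (a₁ d) inactive σ k) g)))) (ℤ.*-zeroʳ (τ (upd σ d k))))
            split (yes g) = trans (∑-cong corners term)
                 (trans (∑-*ˡ corners (τ σ) (λ k → sign m (ov c₀) (F.ν k) * I (gain m (ov d) k)))
                 (trans (cong (τ σ *_) (local-cancellation m (ov c₀) (ov d) F.ν F.ν-reversed (F.ν-shade top) I)) (ℤ.*-zeroʳ (τ σ))))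
              where
              module F = Free σ d g
              Z : ℤ
              Z = ex (a₁ d) σ + slope m * p (κ d top)
              I : ℤ → ℤ
              I z = ⟦ Z + z ℤ.≟ E ⟧
              alg : ∀ x e s q i → (x + e) + s * (q + i) ≡ (x + s * q) + (e + s * i)
              alg = solve-∀
              grade-upd : ∀ k → grade (upd σ d k) d ≡ Z + gain m (ov d) k
              grade-upd k = trans (cong₂ _+_
                  (trans (ex-split a₀ (a₀-active d≢c₀) (upd σ d k))
                         (cong₂ _+_ (ex-agree {a₁ d} (agree-upd (a₁ d) inactive σ k)) (cong (exponent (ov d)) (upd-here σ d k))))
                  (cong (slope m *_) (trans (cong (p ∘ κ d) (upd-here σ d k)) (p-corner p p-lf-rt d k))))
                (alg (ex (a₁ d) σ) (exponent (ov d) k) (slope m) (p (κ d top)) (index (ov d) k))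
              term : ∀ k → τ (upd σ d k) * φ (upd σ d k) d ≡ τ σ * (sign m (ov c₀) (F.ν k) * I (gain m (ov d) k))
              term k = cong₂ _*_ (cong (λ j → ⟦ j ≟ᶜ top ⟧) (upd-there σ k (d≢c₀ ∘ sym)))
                (trans (φ-good (good-agree (agree-sym (agree-upd (a₁ d) inactive σ k)) g))
                  (cong₂ (λ j z → sign m (ov c₀) j * ⟦ z ℤ.≟ E ⟧)
                    (cong labelOf (trans (lead-agree (agree-upd (a₁ d) inactive σ k) _) (cong (F.lead ∘ κ d) (upd-here σ d k))))
                    (grade-upd k)))

      endTerm : Asg → Corner → ℤ
      endTerm σ s = sign m (ov c₀) s * (⟦ end? s σ ⟧ * ⟦ ex a₀ σ + slope m * p (κ c₀ s) ℤ.≟ E ⟧)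

      not-end : ∀ {σ s} → ¬ End s σ → endTerm σ s ≡ 0ℤ
      not-end {σ} {s} n = trans (cong (λ z → sign m (ov c₀) s * (z * ⟦ ex a₀ σ + slope m * p (κ c₀ s) ℤ.≟ E ⟧)) (⟦⟧-no (end? s σ) n)) (ℤ.*-zeroʳ (sign m (ov c₀) s))

      -- A good mark means that exactly one region r₁ is used once too often. Away from c₀ this
      -- region has two pointers, whose marks cancel by `Swap`. At c₀ it has a single one, which is
      -- the only possible mark and is good by `end-good`.
      mark-sum : ∀ σ → ∑ Xs (φ σ) ≡ ∑ₖ (endTerm σ)
      mark-sum σ = go (any? (λ r → doubles? r σ) Ys)
        where
        go : Dec (Any.Any (λ r → Doubles r σ) Ys) → ∑ Xs (φ σ) ≡ ∑ₖ (endTerm σ)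
        go (no n) = trans (∑-zero Xs (λ d → φ-bad (λ g → n (lose (Y-complete _) (good-doubles g)))))
                     (sym (∑-zero corners {endTerm σ} (λ s → not-end (λ e → n (lose (Y-complete _) e)))))
        go (yes i) with find i
        ... | r₁ , _ , dbl = fork (star? r₁)
          where
          pointed : ∀ d → φ σ d ≡ ⟦ points? a₀ σ r₁ d ⟧ * φ σ d
          pointed d = split (good? σ d)
            where
            split : Dec (Good σ d) → φ σ d ≡ ⟦ points? a₀ σ r₁ d ⟧ * φ σ d
            split (yes g) = sym (trans (cong (_* φ σ d) (⟦⟧-yes (points? a₀ σ r₁ d)
                (a₀-active (proj₁ g) , doubles-unique (good-doubles g) dbl))) (ℤ.*-identityˡ (φ σ d)))
            split (no n) = trans (φ-bad n) (sym (trans (cong (⟦ points? a₀ σ r₁ d ⟧ *_) (φ-bad n)) (ℤ.*-zeroʳ ⟦ points? a₀ σ r₁ d ⟧)))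
          a₀⇒≢ : ∀ {d} → a₀ d ≡ true → d ≢ c₀
          a₀⇒≢ ac = proj₂ (removed-active full ac)
          total : star r₁ ≡ true ⊎ star r₁ ≡ false → uses a₀ σ r₁ ≡ tgt (star r₁) + 1ℤ
          total _ = trans (dbl r₁) (cong (_+_ (tgt (star r₁))) (⟦⟧-yes (r₁ ≟ᵧ r₁) refl))
          fork : Dec (Star r₁) → ∑ Xs (φ σ) ≡ ∑ₖ (endTerm σ)
          fork (yes (s , refl)) with count-one (points? a₀ σ r₁) Xs
                  (trans (total (inj₁ (star-κ s))) (cong (λ b → tgt b + 1ℤ) (star-κ s)))
          ... | d , i , (ad , q) , u =
            trans (∑-cong Xs pointed) (trans (∑-single (points? a₀ σ r₁) (φ σ) i (ad , q) u X-unique)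
           (trans (φ-good g) (trans (cong₂ (λ k r → sign m (ov c₀) k * ⟦ ex a₀ σ + slope m * p r ℤ.≟ E ⟧) lab q)
           (sym (trans (∑-cong corners spot) (trans (∑-single (_≟ᶜ s) (endTerm σ) (FinSet.complete cornerᶠ s) refl (λ _ e → e) (FinSet.unique cornerᶠ))
             (cong (sign m (ov c₀) s *_) (trans (cong (_* ⟦ ex a₀ σ + slope m * p (κ c₀ s) ℤ.≟ E ⟧) (⟦⟧-yes (end? s σ) dbl)) (ℤ.*-identityˡ _)))))))))
            where
            g : Good σ d
            g = end-good dbl (a₀⇒≢ ad) q
            lab : label σ d (σ d) ≡ s
            lab = trans (cong labelOf (trans (cong (Walk.lead (a₁ d) σ) q) (Free.lead-root σ d g (star-κ s)))) (labelOf-κ s)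
            spot : ∀ k → endTerm σ k ≡ ⟦ k ≟ᶜ s ⟧ * endTerm σ k
            spot k = split (k ≟ᶜ s)
              where
              split : Dec (k ≡ s) → endTerm σ k ≡ ⟦ k ≟ᶜ s ⟧ * endTerm σ k
              split (yes e) = sym (trans (cong (_* endTerm σ k) (⟦⟧-yes (k ≟ᶜ s) e)) (ℤ.*-identityˡ (endTerm σ k)))
              split (no n) = trans (not-end (λ e → n (distinct _ _ (doubles-unique e dbl)))) (sym (cong (_* endTerm σ k) (⟦⟧-no (k ≟ᶜ s) n)))
          fork (no ¬s) with ∑-two (points? a₀ σ r₁) (φ σ) X-unique
                  (trans (total (inj₂ (dec-false (star? r₁) ¬s))) (cong (λ b → tgt b + 1ℤ) (dec-false (star? r₁) ¬s)))
          ... | d₁ , d₂ , _ , _ , ne , (ad₁ , q₁) , (ad₂ , q₂) , _ , e =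
            trans (∑-cong Xs pointed) (trans e (trans (cancel (good? σ d₁) (good? σ d₂))
              (sym (∑-zero corners {endTerm σ} (λ s → not-end (λ en → ¬s (s , doubles-unique dbl en)))))))
            where
            opposite-terms : ∀ k j z → j ≡ opp k → sign m (ov c₀) k * z + sign m (ov c₀) j * z ≡ 0ℤ
            opposite-terms k _ z refl = trans (cong (λ w → sign m (ov c₀) k * z + w * z) (sign-opp m (ov c₀) k)) (alg (sign m (ov c₀) k) z)
              where
              alg : ∀ a z → a * z + - a * z ≡ 0ℤ
              alg = solve-∀
            cancel : Dec (Good σ d₁) → Dec (Good σ d₂) → φ σ d₁ + φ σ d₂ ≡ 0ℤ
            cancel (yes g) _ = trans (cong₂ _+_ (φ-good g) (φ-good W.good₂))
                (trans (cong (λ r → sign m (ov c₀) (label σ d₁ (σ d₁)) * ⟦ grade σ d₁ ℤ.≟ E ⟧ + sign m (ov c₀) (label σ d₂ (σ d₂))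
                                * ⟦ ex a₀ σ + slope m * p r ℤ.≟ E ⟧) (trans q₂ (sym q₁)))
                (opposite-terms (label σ d₁ (σ d₁)) (label σ d₂ (σ d₂)) ⟦ grade σ d₁ ℤ.≟ E ⟧ W.label₂))
              where module W = Swap σ d₁ d₂ ne g (a₀⇒≢ ad₂) (trans q₁ (sym q₂))
            cancel (no n) (yes g) = contradiction (Swap.good₂ σ d₂ d₁ (ne ∘ sym) g (a₀⇒≢ ad₁) (trans q₂ (sym q₁))) n
            cancel (no n) (no n′) = cong₂ _+_ (φ-bad n) (φ-bad n′)

-- G changes sign under a shift by two, so its vanishing at large arguments propagates downwards.
-- The induction is on the distance to V.
telescope-zero : ∀ (G : ℤ → ℤ) (V : ℤ) → (∀ E → G (E - 1ℤ) + G (E + 1ℤ) ≡ 0ℤ) → (∀ x → V ℤ.< x → G x ≡ 0ℤ) → ∀ x → G x ≡ 0ℤ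
telescope-zero G V step big x = go ℤ.∣ V - x ∣ x (above V x)
  where
  above : ∀ V x → V ℤ.< (x + 1ℤ) + + ℤ.∣ V - x ∣
  above V x = subst (ℤ._< (x + 1ℤ) + + ℤ.∣ V - x ∣) (alg x (V - x) V (alg′ V x))
    (ℤ.+-mono-<-≤ (subst (ℤ._< x + 1ℤ) (ℤ.+-identityʳ x) (ℤ.+-monoʳ-< x (ℤ.+<+ (s≤s z≤n)))) (i≤∣i∣ (V - x)))
    where
    alg : ∀ x d V → V ≡ x + d → x + d ≡ V
    alg x d V e = sym e
    alg′ : ∀ V x → V ≡ x + (V - x)
    alg′ = solve-∀
    i≤∣i∣ : ∀ i → i ℤ.≤ + ℤ.∣ i ∣
    i≤∣i∣ (+ n)      = ℤ.≤-refl
    i≤∣i∣ ℤ.-[1+ n ] = ℤ.-≤+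
  go : ∀ m x → V ℤ.< (x + 1ℤ) + + m → G x ≡ 0ℤ
  go zero x h = trans (sym (trans (cong (_+ G x) g0) (ℤ.+-identityˡ (G x))))
                 (trans (ℤ.+-comm (G ((x + 1ℤ) + 1ℤ)) (G x)) (subst (λ z → G z + G ((x + 1ℤ) + 1ℤ) ≡ 0ℤ) (alg x) (step (x + 1ℤ))))
    where
    alg : ∀ x → (x + 1ℤ) - 1ℤ ≡ x
    alg = solve-∀
    g0 : G ((x + 1ℤ) + 1ℤ) ≡ 0ℤ
    g0 = big _ (ℤ.<-trans (subst (V ℤ.<_) (ℤ.+-identityʳ (x + 1ℤ)) h)
                 (subst (ℤ._< (x + 1ℤ) + 1ℤ) (ℤ.+-identityʳ (x + 1ℤ)) (ℤ.+-monoʳ-< (x + 1ℤ) (ℤ.+<+ (s≤s z≤n)))))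
  go (suc m) x h = trans (sym (trans (cong (_+_ (G x)) g0) (ℤ.+-identityʳ (G x))))
                     (subst (λ z → G z + G ((x + 1ℤ) + 1ℤ) ≡ 0ℤ) (alg x) (step (x + 1ℤ)))
    where
    alg : ∀ x → (x + 1ℤ) - 1ℤ ≡ x
    alg = solve-∀
    alg″ : ∀ x m → (x + 1ℤ) + (1ℤ + m) ≡ (((x + 1ℤ)) + 1ℤ) + m
    alg″ = solve-∀
    g0 : G ((x + 1ℤ) + 1ℤ) ≡ 0ℤ
    g0 = go m ((x + 1ℤ) + 1ℤ) (ℤ.<-≤-trans (subst (V ℤ.<_) (alg″ x (+ m)) h)
           (ℤ.+-monoˡ-≤ (+ m) (subst (ℤ._≤ ((x + 1ℤ) + 1ℤ) + 1ℤ) (ℤ.+-identityʳ ((x + 1ℤ) + 1ℤ)) (ℤ.+-monoʳ-≤ ((x + 1ℤ) + 1ℤ) (ℤ.+≤+ (z≤n {1}))))))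

module Independence (K : Skeleton) where
  open Kauffman K public

  ex-left-right : ∀ o → exponent o left ≡ exponent o right
  ex-left-right bl→tr = refl
  ex-left-right br→tl = refl

  exponent≤1 : ∀ o k → exponent o k ℤ.≤ 1ℤ
  exponent≤1 bl→tr top    = ℤ.≤-refl
  exponent≤1 bl→tr bottom = ℤ.-≤+
  exponent≤1 bl→tr left   = ℤ.+≤+ z≤n
  exponent≤1 bl→tr right  = ℤ.+≤+ z≤n
  exponent≤1 br→tl top    = ℤ.-≤+
  exponent≤1 br→tl bottom = ℤ.≤-refl
  exponent≤1 br→tl left   = ℤ.+≤+ z≤n
  exponent≤1 br→tl right  = ℤ.+≤+ z≤n

  ex-bound : ∀ a σ → ex a σ ℤ.≤ + length Xs
  ex-bound a σ = subst (ex a σ ℤ.≤_) (∑-length Xs) (∑-mono Xs (λ c → go (a c) c))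
    where
    go : ∀ b c → 𝟙 b * exponent (ov c) (σ c) ℤ.≤ 1ℤ
    go true  c = subst (ℤ._≤ 1ℤ) (sym (ℤ.*-identityˡ _)) (exponent≤1 (ov c) (σ c))
    go false c = ℤ.+≤+ z≤n

  module AtCrossing (c₀ : X) (p : Y → ℤ) (p-lf-rt : ∀ c i → p (κ c (lf i)) - p (κ c (rt i)) ≡ 1ℤ)
                    (p-index : ∀ k → p (κ c₀ k) ≡ index (ov c₀) k)
                    (distinct : ∀ j k → κ c₀ j ≡ κ c₀ k → j ≡ k) where
    open Star c₀ p p-lf-rt p-index distinct

    τ : Asg → ℤ
    τ σ = ⟦ σ c₀ ≟ᶜ top ⟧

    #ends : Corner → ℤ → ℤ
    #ends s e = S Xs (λ σ → τ σ * (⟦ end? s σ ⟧ * ⟦ ex a₀ σ ℤ.≟ e ⟧))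

    ends-big : ∀ s e → + length Xs ℤ.< e → #ends s e ≡ 0ℤ
    ends-big s e h = S-zero Xs (λ σ → trans (cong (λ z → τ σ * (⟦ end? s σ ⟧ * z))
        (⟦⟧-no (ex a₀ σ ℤ.≟ e) (λ { refl → ℤ.<-irrefl refl (ℤ.<-≤-trans h (ex-bound a₀ σ)) })))
        (trans (cong (τ σ *_) (ℤ.*-zeroʳ ⟦ end? s σ ⟧)) (ℤ.*-zeroʳ (τ σ))))

    relation : ∀ m E → ∑ₖ (λ s → sign m (ov c₀) s * #ends s (E - slope m * index (ov c₀) s)) ≡ 0ℤ
    relation m E = trans (∑-cong corners (λ s → sym (S-*ˡ Xs (sign m (ov c₀) s) (summand s))))
                  (trans (sym (S-∑ Xs corners (λ σ s → sign m (ov c₀) s * summand s σ)))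
                  (trans (S-cong Xs (λ σ → trans (∑-cong corners (exchange σ)) (∑-*ˡ corners (τ σ) (C.endTerm σ))))
                  (trans (sym (S-cong Xs (λ σ → trans (∑-*ˡ Xs (τ σ) (C.φ σ)) (cong (τ σ *_) (C.mark-sum σ)))))
                  (trans (S-∑ Xs Xs (λ σ d → τ σ * C.φ σ d)) (∑-zero Xs C.corner-sum)))))
      where
      module C = DoubleCount m E
      summand : Corner → Asg → ℤ
      summand s σ = τ σ * (⟦ end? s σ ⟧ * ⟦ ex a₀ σ ℤ.≟ E - slope m * index (ov c₀) s ⟧)
      alg : ∀ a b c d → a * (b * (c * d)) ≡ b * (a * (c * d))
      alg = solve-∀
      shift : ∀ x y → x ≡ E - y → x + y ≡ E
      shift x y e = trans (cong (_+ y) e) (alg′ E y)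
        where
        alg′ : ∀ E y → (E - y) + y ≡ E
        alg′ = solve-∀
      shift⁻ : ∀ x y → x + y ≡ E → x ≡ E - y
      shift⁻ x y e = trans (alg′ x y) (cong (_- y) e)
        where
        alg′ : ∀ x y → x ≡ (x + y) - y
        alg′ = solve-∀
      exchange : ∀ σ s → sign m (ov c₀) s * summand s σ ≡ τ σ * C.endTerm σ s
      exchange σ s = trans (alg (sign m (ov c₀) s) (τ σ) ⟦ end? s σ ⟧ ⟦ ex a₀ σ ℤ.≟ E - slope m * index (ov c₀) s ⟧)
        (cong (λ z → τ σ * (sign m (ov c₀) s * (⟦ end? s σ ⟧ * z)))
          (trans (⟦⟧-cong (_ ℤ.≟ _) (_ ℤ.≟ _) (shift (ex a₀ σ) (slope m * index (ov c₀) s)) (shift⁻ (ex a₀ σ) (slope m * index (ov c₀) s)))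
                 (cong (λ z → ⟦ ex a₀ σ + slope m * z ℤ.≟ E ⟧) (sym (p-index s)))))

    -- In a state the crossing c₀ points to one of the two corners outside the base. Deleting this
    -- pointer leaves an end at the other one, which accounts for the interchange of `opp i` and
    -- `rot⁻ i`.
    states-ends : ∀ i n → #states (κ c₀ (lf i)) (κ c₀ (rt i)) n ≡
      #ends (rot⁻ i) (n - exponent (ov c₀) (opp i)) + #ends (opp i) (n - exponent (ov c₀) (rot⁻ i))
    states-ends i n = trans (S-fibre Xs F (X-complete c₀) F-ext)
                     (trans (S-cong Xs fibre)
                            (S-+ Xs (λ σ → τ σ * G (rot⁻ i) (opp i) σ) (λ σ → τ σ * G (opp i) (rot⁻ i) σ)))
      where
      x = κ c₀ (lf i)
      y = κ c₀ (rt i)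
      F : Asg → ℤ
      F σ = ⟦ state? x y σ ⟧ * ⟦ ex full σ ℤ.≟ n ⟧
      F-ext : Ext F
      F-ext {σ} {σ′} h = cong₂ _*_ (⟦⟧-cong (state? x y σ) (state? x y σ′) (covers-agree {full} (agree-ext h)) (covers-agree {full} (agree-ext (sym ∘ h))))
                            (cong (λ z → ⟦ z ℤ.≟ n ⟧) (ex-agree {full} (agree-ext h)))
      G : Corner → Corner → Asg → ℤ
      G s k σ = ⟦ end? s σ ⟧ * ⟦ ex a₀ σ ℤ.≟ n - exponent (ov c₀) k ⟧
      exs : ∀ σ k → ⟦ ex full (upd σ c₀ k) ℤ.≟ n ⟧ ≡ ⟦ ex a₀ σ ℤ.≟ n - exponent (ov c₀) k ⟧
      exs σ k = ⟦⟧-cong (_ ℤ.≟ _) (_ ℤ.≟ _)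
        (λ e → trans (alg (ex a₀ σ) (exponent (ov c₀) k)) (cong (_- exponent (ov c₀) k) (trans (sym (ex-upd σ c₀ k)) e)))
        (λ e → trans (ex-upd σ c₀ k) (trans (cong (_+ exponent (ov c₀) k) e) (alg′ n (exponent (ov c₀) k))))
        where
        alg : ∀ x y → x ≡ (x + y) - y
        alg = solve-∀
        alg′ : ∀ x y → (x - y) + y ≡ x
        alg′ = solve-∀
      hit : ∀ σ s k → (∀ r → target (pairOf i) r ≡ (target star r + δᵧ (κ c₀ s) r) + δᵧ (κ c₀ k) r) → F (upd σ c₀ k) ≡ G s k σ
      hit σ s k t = cong₂ _*_ (⟦⟧-cong (state? x y (upd σ c₀ k)) (end? s σ)
          (λ st r → ℤ+.∙-cancelʳ (δᵧ (κ c₀ k) r) _ _ (trans (sym (uses-upd σ c₀ k r)) (trans (st r) (t r))))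
          (λ en r → trans (uses-upd σ c₀ k r) (trans (cong (_+ δᵧ (κ c₀ k) r) (en r)) (sym (t r)))))
        (exs σ k)
      miss : ∀ σ k → pairOf i (κ c₀ k) ≡ true → F (upd σ c₀ k) ≡ 0ℤ
      miss σ k e = cong (_* ⟦ ex full (upd σ c₀ k) ℤ.≟ n ⟧) (⟦⟧-no (state? x y (upd σ c₀ k)) (state-avoids (upd-here σ c₀ k) e))
      comm : ∀ r → target (pairOf i) r ≡ (target star r + δᵧ (κ c₀ (rot⁻ i)) r) + δᵧ (κ c₀ (opp i)) r
      comm r = trans (pair-target i r) (alg (target star r) _ _)
        where
        alg : ∀ a b c → (a + b) + c ≡ (a + c) + b
        alg = solve-∀
      fibre : ∀ σ → ⟦ FinSet._≟_ cornerᶠ (σ c₀) top ⟧ * ∑ₖ (λ k → F (upd σ c₀ k)) ≡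
                    τ σ * G (rot⁻ i) (opp i) σ + τ σ * G (opp i) (rot⁻ i) σ
      fibre σ = trans (cong (τ σ *_) (trans (∑ₖ-around i (λ k → F (upd σ c₀ k)))
        (cong₂ _+_ (cong₂ _+_ (miss σ i (pair-true i (inj₁ refl))) (hit σ (rot⁻ i) (opp i) comm))
                   (cong₂ _+_ (miss σ (rot i) (pair-true i (inj₂ refl))) (hit σ (opp i) (rot⁻ i) (pair-target i))))))
        (alg (τ σ) (G (rot⁻ i) (opp i) σ) (G (opp i) (rot⁻ i) σ))
        where
        alg : ∀ t a b → t * ((0ℤ + a) + (0ℤ + b)) ≡ t * a + t * b
        alg = solve-∀

    private
      U V L R : ℤ → ℤ
      U = #ends top
      V = #ends bottom
      L = #ends left
      R = #ends right

      s0 : ∀ E → E - 1ℤ * 0ℤ ≡ E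
      s0 = solve-∀
      s0′ : ∀ E → E - -1ℤ * 0ℤ ≡ E
      s0′ = solve-∀
      s1 : ∀ E → E - -1ℤ * 1ℤ ≡ E + 1ℤ
      s1 = solve-∀
      s2 : ∀ E → E - 1ℤ * -1ℤ ≡ E + 1ℤ
      s2 = solve-∀
      s3 : ∀ E → E - -1ℤ * -1ℤ ≡ E - 1ℤ
      s3 = solve-∀
      s4 : ∀ E → E - 1ℤ * 1ℤ ≡ E - 1ℤ
      s4 = solve-∀

      Rise Fall : Over → Set
      Rise o = ∀ E → sign rising o top * U E + (sign rising o bottom * V E + (1ℤ * L (E - 1ℤ) + (-1ℤ * R (E + 1ℤ) + 0ℤ))) ≡ 0ℤ
      Fall o = ∀ E → sign falling o top * U E + (sign falling o bottom * V E + (sign falling o left * L (E + 1ℤ) + (sign falling o right * R (E - 1ℤ) + 0ℤ))) ≡ 0ℤ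

      sign-rl : ∀ o → sign rising o left ≡ 1ℤ × sign rising o right ≡ -1ℤ
      sign-rl bl→tr = refl , refl
      sign-rl br→tl = refl , refl

      rise : Rise (ov c₀)
      rise E = trans (sym (cong₂ _+_ (cong (λ e → sign rising (ov c₀) top * U e) (s0 E))
                (cong₂ _+_ (cong (λ e → sign rising (ov c₀) bottom * V e) (s0 E))
                (cong₂ _+_ (cong₂ (λ u e → u * L e) (proj₁ (sign-rl (ov c₀))) (s4 E))
                (cong (_+ 0ℤ) (cong₂ (λ u e → u * R e) (proj₂ (sign-rl (ov c₀))) (s2 E))))))) (relation rising E)
      fall : Fall (ov c₀)
      fall E = trans (sym (cong₂ _+_ (cong (λ e → sign falling (ov c₀) top * U e) (s0′ E))
                (cong₂ _+_ (cong (λ e → sign falling (ov c₀) bottom * V e) (s0′ E))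
                (cong₂ _+_ (cong (λ e → sign falling (ov c₀) left * L e) (s1 E))
                (cong (_+ 0ℤ) (cong (λ e → sign falling (ov c₀) right * R e) (s3 E))))))) (relation falling E)

      -- The ends at top and bottom are eliminated between the relations for the two senses.
      diff : ∀ o → Rise o → Fall o → ∀ E → (L (E - 1ℤ) - R (E - 1ℤ)) + (L (E + 1ℤ) - R (E + 1ℤ)) ≡ 0ℤ
      diff bl→tr r f E = trans (alg (U E) (V E) (L (E - 1ℤ)) (R (E - 1ℤ)) (L (E + 1ℤ)) (R (E + 1ℤ))) (cong₂ _+_ (r E) (f E))
        where
        alg : ∀ U V L₁ R₁ L₂ R₂ → (L₁ - R₁) + (L₂ - R₂) ≡
          (1ℤ * U + (-1ℤ * V + (1ℤ * L₁ + (-1ℤ * R₂ + 0ℤ)))) + (-1ℤ * U + (1ℤ * V + (1ℤ * L₂ + (-1ℤ * R₁ + 0ℤ))))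
        alg = solve-∀
      diff br→tl r f E = trans (alg (U E) (V E) (L (E - 1ℤ)) (R (E - 1ℤ)) (L (E + 1ℤ)) (R (E + 1ℤ))) (cong₂ _-_ (r E) (f E))
        where
        alg : ∀ U V L₁ R₁ L₂ R₂ → (L₁ - R₁) + (L₂ - R₂) ≡
          (-1ℤ * U + (1ℤ * V + (1ℤ * L₁ + (-1ℤ * R₂ + 0ℤ)))) - (-1ℤ * U + (1ℤ * V + (-1ℤ * L₂ + (1ℤ * R₁ + 0ℤ))))
        alg = solve-∀

      L≡R : ∀ e → L e ≡ R e
      L≡R e = ℤ.i-j≡0⇒i≡j (L e) (R e) (telescope-zero (λ z → L z - R z) (+ length Xs) (diff (ov c₀) rise fall)
          (λ z h → cong₂ _-_ (ends-big left z h) (ends-big right z h)) e)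

      n0 : ∀ n → n - 0ℤ ≡ n
      n0 = solve-∀

      left≡top : ∀ o → Rise o → ∀ n → U (n - exponent o right) + R (n - exponent o top) ≡ R (n - exponent o bottom) + V (n - exponent o right)
      left≡top bl→tr r n = trans (cong₂ (λ u v → U u + v) (n0 n) (sym (L≡R (n - 1ℤ))))
          (trans (alg (U n) (V n) (L (n - 1ℤ)) (R (n + 1ℤ))) (trans (cong (_+ (R (n + 1ℤ) + V n)) (r n))
          (trans (ℤ.+-identityˡ _) (cong (λ u → R (n + 1ℤ) + V u) (sym (n0 n))))))
        where
        alg : ∀ U V L R → U + L ≡ (1ℤ * U + (-1ℤ * V + (1ℤ * L + (-1ℤ * R + 0ℤ)))) + (R + V)
        alg = solve-∀
      left≡top br→tl r n = trans (cong (λ u → U u + R (n + 1ℤ)) (n0 n))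
          (trans (alg (U n) (V n) (L (n - 1ℤ)) (R (n + 1ℤ))) (trans (cong (λ z → (L (n - 1ℤ) + V n) - z) (r n))
          (trans (ℤ.+-identityʳ _) (cong₂ (λ u v → u + V v) (L≡R (n - 1ℤ)) (sym (n0 n))))))
        where
        alg : ∀ U V L R → U + R ≡ (L + V) - (-1ℤ * U + (1ℤ * V + (1ℤ * L + (-1ℤ * R + 0ℤ))))
        alg = solve-∀

    states-top : ∀ i n → #states (κ c₀ (lf i)) (κ c₀ (rt i)) n ≡ #states (κ c₀ left) (κ c₀ top) n
    states-top top    n = refl
    states-top left   n = trans (states-ends left n) (trans (left≡top (ov c₀) rise n) (sym (states-ends top n)))
    states-top bottom n = trans (states-ends bottom n) (trans
       (trans (ℤ.+-comm (L (n - exponent (ov c₀) top)) _) (cong₂ _+_ (cong (λ e → U (n - e)) (ex-left-right (ov c₀))) (L≡R _)))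
       (trans (left≡top (ov c₀) rise n) (sym (states-ends top n))))
    states-top right  n = trans (states-ends right n) (trans
       (trans (ℤ.+-comm (V (n - exponent (ov c₀) left)) _) (cong₂ _+_ (L≡R _) (cong (λ e → V (n - e)) (ex-left-right (ov c₀)))))
       (sym (states-ends top n)))

  nonzero-state : ∀ {x y n} → #states x y n ≢ 0ℤ → ∃[ σ ] State x y σ
  nonzero-state {x} {y} {n} h =
    let σ , e = S≢0 Xs (λ σ → ⟦ state? x y σ ⟧ * ⟦ ex full σ ℤ.≟ n ⟧) h
    in σ , decidable-stable (state? x y σ) (λ ¬st → e (cong (_* ⟦ ex full σ ℤ.≟ n ⟧) (⟦⟧-no (state? x y σ) ¬st)))

  base-target : ∀ {x y} → x ≢ y → ∀ r → target (base x y) r + (δᵧ x r + δᵧ y r) ≡ 1ℤ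
  base-target {x} {y} n r = go (x ≟ᵧ r) (y ≟ᵧ r)
    where
    value : ∀ {b u v} → base x y r ≡ b → δᵧ x r ≡ u → δᵧ y r ≡ v → (if b then 0ℤ else 1ℤ) + (u + v) ≡ 1ℤ →
            target (base x y) r + (δᵧ x r + δᵧ y r) ≡ 1ℤ
    value e f g q = trans (cong₂ _+_ (cong (if_then 0ℤ else 1ℤ) e) (cong₂ _+_ f g)) q
    go : Dec (x ≡ r) → Dec (y ≡ r) → target (base x y) r + (δᵧ x r + δᵧ y r) ≡ 1ℤ
    go (yes e) (yes f) = contradiction (trans e (sym f)) n
    go (yes e) (no f) = value (subst (λ z → base x y z ≡ true) e (base-left x y)) (⟦⟧-yes (x ≟ᵧ r) e) (⟦⟧-no (y ≟ᵧ r) f) refl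
    go (no e) (yes f) = value (subst (λ z → base x y z ≡ true) f (base-right x y)) (⟦⟧-no (x ≟ᵧ r) e) (⟦⟧-yes (y ≟ᵧ r) f) refl
    go (no e) (no f) = value (base-neither x y r (e ∘ sym) (f ∘ sym)) (⟦⟧-no (x ≟ᵧ r) e) (⟦⟧-no (y ≟ᵧ r) f) refl

  -- Both bases force the pointer of c₀ to the remaining one of its left and right corners.
  states-degenerate : ∀ c₀ → κ c₀ top ≡ κ c₀ bottom → κ c₀ left ≢ κ c₀ top → κ c₀ top ≢ κ c₀ right → ∀ n →
                      #states (κ c₀ top) (κ c₀ right) n ≡ #states (κ c₀ left) (κ c₀ top) n
  states-degenerate c₀ t≡b l≢t t≢r n = sym (S-local (X-complete c₀) (ext l t) (ext t r) local)
    where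
    l = κ c₀ left
    t = κ c₀ top
    r = κ c₀ right
    F : Y → Y → Asg → ℤ
    F x y σ = ⟦ state? x y σ ⟧ * ⟦ ex full σ ℤ.≟ n ⟧
    ext : ∀ x y → Ext (F x y)
    ext x y {σ} {σ′} h = cong₂ _*_ (⟦⟧-cong (state? x y σ) (state? x y σ′) (covers-agree {full} (agree-ext h)) (covers-agree {full} (agree-ext (sym ∘ h))))
                            (cong (λ z → ⟦ z ℤ.≟ n ⟧) (ex-agree {full} (agree-ext h)))
    zero-at : ∀ x y σ k → base x y (κ c₀ k) ≡ true → F x y (upd σ c₀ k) ≡ 0ℤ
    zero-at x y σ k e = cong (_* ⟦ ex full (upd σ c₀ k) ℤ.≟ n ⟧) (⟦⟧-no (state? x y (upd σ c₀ k)) (state-avoids (upd-here σ c₀ k) e))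
    balance-targets : ∀ z → target (base l t) z + δᵧ l z ≡ target (base t r) z + δᵧ r z
    balance-targets z = ℤ+.∙-cancelʳ (δᵧ t z) _ _ (trans (alg (target (base l t) z) (δᵧ l z) (δᵧ t z))
       (trans (base-target l≢t z) (trans (sym (base-target t≢r z)) (alg′ (target (base t r) z) (δᵧ t z) (δᵧ r z)))))
      where
      alg : ∀ a b c → (a + b) + c ≡ a + (b + c)
      alg = solve-∀
      alg′ : ∀ a b c → a + (b + c) ≡ (a + c) + b
      alg′ = solve-∀
    move : ∀ u a b c d → u + b ≡ a → a + d ≡ c + b → u + d ≡ c
    move u a b c d refl e = ℤ+.∙-cancelʳ b _ _ (trans (alg u d b) e)
      where
      alg : ∀ u d b → (u + d) + b ≡ (u + b) + d
      alg = solve-∀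
    key : ∀ σ → F l t (upd σ c₀ right) ≡ F t r (upd σ c₀ left)
    key σ = cong₂ _*_ (⟦⟧-cong (state? l t (upd σ c₀ right)) (state? t r (upd σ c₀ left))
        (λ st z → trans (uses-upd σ c₀ left z) (move (uses (full ∖ c₀) σ z) _ (δᵧ r z) _ (δᵧ l z)
                    (trans (sym (uses-upd σ c₀ right z)) (st z)) (balance-targets z)))
        (λ st z → trans (uses-upd σ c₀ right z) (move (uses (full ∖ c₀) σ z) _ (δᵧ l z) _ (δᵧ r z)
                    (trans (sym (uses-upd σ c₀ left z)) (st z)) (sym (balance-targets z)))))
      (cong (λ z → ⟦ z ℤ.≟ n ⟧) (trans (ex-upd σ c₀ right)
        (trans (cong (_+_ (ex (full ∖ c₀) σ)) (sym (ex-left-right (ov c₀)))) (sym (ex-upd σ c₀ left)))))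
    local : ∀ σ → ∑ₖ (λ k → F l t (upd σ c₀ k)) ≡ ∑ₖ (λ k → F t r (upd σ c₀ k))
    local σ = trans (cong₂ _+_ (zero-at l t σ top (base-right l t))
                    (cong₂ _+_ (zero-at l t σ bottom (trans (cong (base l t) (sym t≡b)) (base-right l t)))
                    (cong₂ _+_ (zero-at l t σ left (base-left l t)) (cong (_+ 0ℤ) (key σ)))))
             (trans (alg (F t r (upd σ c₀ left)))
             (sym (cong₂ _+_ (zero-at t r σ top (base-left t r))
                    (cong₂ _+_ (zero-at t r σ bottom (trans (cong (base t r) (sym t≡b)) (base-left t r)))
                    (cong (_+_ (F t r (upd σ c₀ left))) (cong (_+ 0ℤ) (zero-at t r σ right (base-right t r))))))))
      where
      alg : ∀ a → 0ℤ + (0ℤ + (0ℤ + (a + 0ℤ))) ≡ 0ℤ + (0ℤ + (a + (0ℤ + 0ℤ)))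
      alg = solve-∀

  index-injective : ∀ o j k → index o j ≡ index o k → j ≡ k ⊎ (j ≡ top × k ≡ bottom) ⊎ (j ≡ bottom × k ≡ top)
  index-injective o top    top    e = inj₁ refl
  index-injective o top    bottom e = inj₂ (inj₁ (refl , refl))
  index-injective o bottom top    e = inj₂ (inj₂ (refl , refl))
  index-injective o bottom bottom e = inj₁ refl
  index-injective o left   left   e = inj₁ refl
  index-injective o right  right  e = inj₁ refl
  index-injective o top    left   ()
  index-injective o top    right  ()
  index-injective o bottom left   ()
  index-injective o bottom right  ()
  index-injective o left   top    ()
  index-injective o left   bottom ()
  index-injective o left   right  ()
  index-injective o right  top    ()
  index-injective o right  bottom ()
  index-injective o right  left   ()

  -- One state suffices to define the Alexander index, which separates the regions at left, top and
  -- right. Only top and bottom may coincide, at a nugatory crossing, and then the pointer of c₀ is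
  -- forced.
  states-with-state : ∀ c₀ k₀ σ → State (κ c₀ (lf k₀)) (κ c₀ (rt k₀)) σ →
    ∀ i n → #states (κ c₀ (lf i)) (κ c₀ (rt i)) n ≡ #states (κ c₀ left) (κ c₀ top) n
  states-with-state c₀ k₀ σ st i n = go (κ c₀ top ≟ᵧ κ c₀ bottom)
    where
    indexing = Acyclic.alexander-index c₀ k₀ σ st
    p = proj₁ indexing
    diffs = proj₁ (proj₂ indexing)
    norm = proj₂ (proj₂ indexing)
    p-top : p (κ c₀ top) ≡ 0ℤ
    p-top = ℤ+.∙-cancelʳ (index (ov c₀) (lf k₀)) (p (κ c₀ top)) 0ℤ
      (trans (sym (p-corner p diffs c₀ (lf k₀))) (trans norm (sym (ℤ.+-identityˡ (index (ov c₀) (lf k₀))))))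
    p-index : ∀ k → p (κ c₀ k) ≡ index (ov c₀) k
    p-index k = trans (p-corner p diffs c₀ k) (trans (cong (_+ index (ov c₀) k) p-top) (ℤ.+-identityˡ (index (ov c₀) k)))
    index-eq : ∀ {j k} → κ c₀ j ≡ κ c₀ k → index (ov c₀) j ≡ index (ov c₀) k
    index-eq {j} {k} e = trans (sym (p-index j)) (trans (cong p e) (p-index k))
    go : Dec (κ c₀ top ≡ κ c₀ bottom) → #states (κ c₀ (lf i)) (κ c₀ (rt i)) n ≡ #states (κ c₀ left) (κ c₀ top) n
    go (no t≢b) = AtCrossing.states-top c₀ p diffs p-index distinct i n
      where
      distinct : ∀ j k → κ c₀ j ≡ κ c₀ k → j ≡ k
      distinct j k e = same-corner (index-injective (ov c₀) j k (index-eq e)) e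
        where
        same-corner : ∀ {j k} → j ≡ k ⊎ (j ≡ top × k ≡ bottom) ⊎ (j ≡ bottom × k ≡ top) → κ c₀ j ≡ κ c₀ k → j ≡ k
        same-corner (inj₁ f) _ = f
        same-corner (inj₂ (inj₁ (refl , refl))) e = contradiction e t≢b
        same-corner (inj₂ (inj₂ (refl , refl))) e = contradiction (sym e) t≢b
    go (yes t≡b) = cases i
      where
      deg : #states (κ c₀ top) (κ c₀ right) n ≡ #states (κ c₀ left) (κ c₀ top) n
      deg = states-degenerate c₀ t≡b l≢t t≢r n
        where
        1≢0 : 1ℤ ≢ 0ℤ
        1≢0 ()
        0≢-1 : 0ℤ ≢ -1ℤ
        0≢-1 ()
        l≢t : κ c₀ left ≢ κ c₀ top
        l≢t e = 1≢0 (index-eq {left} {top} e)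
        t≢r : κ c₀ top ≢ κ c₀ right
        t≢r e = 0≢-1 (index-eq {top} {right} e)
      cases : ∀ i → #states (κ c₀ (lf i)) (κ c₀ (rt i)) n ≡ #states (κ c₀ left) (κ c₀ top) n
      cases top    = refl
      cases left   = cong (λ z → #states (κ c₀ left) z n) (sym t≡b)
      cases bottom = trans (cong (λ z → #states z (κ c₀ right) n) (sym t≡b)) deg
      cases right  = deg

  -- If the counts differed, one of them would be nonzero and so supply the state needed for
  -- `states-with-state`.
  states-at-crossing : ∀ c₀ i j n → #states (κ c₀ (lf i)) (κ c₀ (rt i)) n ≡ #states (κ c₀ (lf j)) (κ c₀ (rt j)) n
  states-at-crossing c₀ i j n = decidable-stable (a ℤ.≟ b) (λ ne → ne (go ne (#states (κ c₀ (lf i)) (κ c₀ (rt i)) n ℤ.≟ 0ℤ)))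
    where
    a = #states (κ c₀ (lf i)) (κ c₀ (rt i)) n
    b = #states (κ c₀ (lf j)) (κ c₀ (rt j)) n
    from : ∀ k → #states (κ c₀ (lf k)) (κ c₀ (rt k)) n ≢ 0ℤ → a ≡ b
    from k h = let σ , st = nonzero-state h in trans (states-with-state c₀ k σ st i n) (sym (states-with-state c₀ k σ st j n))
    go : a ≢ b → Dec (a ≡ 0ℤ) → a ≡ b
    go ne (no h) = from i h
    go ne (yes h) = from j (λ h′ → ne (trans h (sym h′)))

  -- A segment has the same pair of regions at both ends, so equality at each crossing spreads over
  -- the connected projection.
  states-invariant : ∀ c i c′ j n → #states (κ c (lf i)) (κ c (rt i)) n ≡ #states (κ c′ (lf j)) (κ c′ (rt j)) n
  states-invariant c i c′ j n = sym (decidable-stable (#states (κ c′ (lf j)) (κ c′ (rt j)) n ℤ.≟ #states (κ c (lf i)) (κ c (rt i)) n)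
    (connected (λ x y → #states x y n ≡ #states (κ c (lf i)) (κ c (rt i)) n)
      (λ d k l e → trans (states-at-crossing d l k n) e) c i c′ j refl))

-- Coefficients as numbers of states

record Coherent (D : Diagram) : Set₁ where
  open Diagram D
  field
    seg : ∀ (G : Region → Region → ℤ) →
          ∑ (FinSet.elements crossingᶠ) (λ c → G (corner c left) (corner c bottom) + G (corner c bottom) (corner c right))
        ≡ ∑ (FinSet.elements crossingᶠ) (λ c → G (corner c left) (corner c top) + G (corner c top) (corner c right))
    connected : ∀ (Θ : Region → Region → Set) →
                (∀ c i j → Θ (corner c (lf i)) (corner c (rt i)) → Θ (corner c (lf j)) (corner c (rt j))) →
                ∀ c i c′ j → Θ (corner c (lf i)) (corner c (rt i)) → ¬ ¬ Θ (corner c′ (lf j)) (corner c′ (rt j))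
    coloured : ∀ c k c′ k′ → corner c k ≡ corner c′ k′ → shade (over c) k ≡ shade (over c′) k′

skeleton : (D : Diagram) → Coherent D → Skeleton
skeleton D co = record
  { crossings = crossingᶠ ; regions = regionᶠ ; κ = corner ; ov = over
  ; seg = seg ; connected = connected ; coloured = coloured }
  where
  open Diagram D
  open Coherent co

coeff-∑ : ∀ p n → coeff p n ≡ ∑ p (λ t → ⟦ proj₂ t ℤ.≟ n ⟧ * proj₁ t)
coeff-∑ []            n = refl
coeff-∑ ((a , m) ∷ p) n = cong₂ _+_ (go (m ℤ.≟ n)) (coeff-∑ p n)
  where
  go : (d : Dec (m ≡ n)) → (if does d then a else 0ℤ) ≡ ⟦ d ⟧ * a
  go (yes _) = sym (ℤ.*-identityˡ a)
  go (no _)  = refl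

coeff-∣∣ : ∀ p n → coeff ∣ p ∣ n ≡ + ℤ.∣ coeff p n ∣
coeff-∣∣ p n = trans (coeff-∑ ∣ p ∣ n) (trans (∑-map (λ m → + ℤ.∣ coeff p m ∣ , m) exps (λ t → ⟦ proj₂ t ℤ.≟ n ⟧ * proj₁ t)) (go (n ∈? exps)))
  where
  open import Data.List.Membership.DecPropositional ℤ._≟_ using (_∈?_)
  exps = deduplicate ℤ._≟_ (map proj₂ p)
  v : ℤ → ℤ
  v m = + ℤ.∣ coeff p m ∣
  go : Dec (n ∈ exps) → ∑ exps (λ m → ⟦ m ℤ.≟ n ⟧ * v m) ≡ v n
  go (yes i) = ∑-single (ℤ._≟ n) v i refl (λ _ e → e) (deduplicate-! ℤ._≟_ (map proj₂ p))
  go (no n∉) = trans (∑-none (ℤ._≟ n) v (All.tabulate (λ {m} i e → n∉ (subst (_∈ exps) e i))))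
    (cong (+_ ∘ ℤ.∣_∣) (sym (trans (coeff-∑ p n) (∑-none (λ t → proj₂ t ℤ.≟ n) proj₁
      (All.tabulate (λ {t} i e → n∉ (Mem.∈-deduplicate⁺ ℤ._≟_ (subst (_∈ map proj₂ p) e (Mem.∈-map⁺ proj₂ i)))))))))

altern : ℤ → ℤ
altern z = -1ℤ ℤ.^ ℤ.∣ z ∣

altern-suc : ∀ z → altern (1ℤ + z) ≡ -1ℤ * altern z
altern-suc (+ n)            = refl
altern-suc ℤ.-[1+ zero ]    = refl
altern-suc ℤ.-[1+ (suc n) ] = sym (alg (-1ℤ ℤ.^ suc n))
  where
  alg : ∀ x → -1ℤ * (-1ℤ * x) ≡ x
  alg = solve-∀

altern-pred : ∀ z → altern (-1ℤ + z) ≡ -1ℤ * altern z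
altern-pred z = trans (alg (altern (-1ℤ + z))) (cong (-1ℤ *_) (trans (sym (altern-suc (-1ℤ + z))) (cong altern (alg′ z))))
  where
  alg : ∀ x → x ≡ -1ℤ * (-1ℤ * x)
  alg = solve-∀
  alg′ : ∀ z → 1ℤ + (-1ℤ + z) ≡ z
  alg′ = solve-∀

altern-unit : ∀ z → ℤ.∣ altern z ∣ ≡ 1
altern-unit z = go ℤ.∣ z ∣
  where
  go : ∀ n → ℤ.∣ -1ℤ ℤ.^ n ∣ ≡ 1
  go zero    = refl
  go (suc n) = trans (ℤ.abs-* -1ℤ (-1ℤ ℤ.^ n)) (trans (ℕ.*-identityˡ _) (go n))

-- Half of what the exponent of a corner exceeds the value read off its shade by.
twist : Over → Corner → ℤ
twist bl→tr bottom = -1ℤ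
twist br→tl bottom = 1ℤ
twist _     _      = 0ℤ

offset : Over → ℤ
offset bl→tr = 0ℤ
offset br→tl = 1ℤ

exponent-twist : ∀ o k → exponent o k ≡ ((if shade o k then 1ℤ else 0ℤ) - offset o) + + 2 * twist o k
exponent-twist bl→tr top    = refl
exponent-twist bl→tr bottom = refl
exponent-twist bl→tr left   = refl
exponent-twist bl→tr right  = refl
exponent-twist br→tl top    = refl
exponent-twist br→tl bottom = refl
exponent-twist br→tl left   = refl
exponent-twist br→tl right  = refl

altern-twist : ∀ o k z → proj₁ (weight o k) * altern z ≡ altern (twist o k + z)
altern-twist bl→tr bottom z = sym (altern-pred z)
altern-twist br→tl bottom z = sym (altern-suc z)
altern-twist bl→tr top    z = trans (ℤ.*-identityˡ (altern z)) (cong altern (sym (ℤ.+-identityˡ z)))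
altern-twist bl→tr left   z = trans (ℤ.*-identityˡ (altern z)) (cong altern (sym (ℤ.+-identityˡ z)))
altern-twist bl→tr right  z = trans (ℤ.*-identityˡ (altern z)) (cong altern (sym (ℤ.+-identityˡ z)))
altern-twist br→tl top    z = trans (ℤ.*-identityˡ (altern z)) (cong altern (sym (ℤ.+-identityˡ z)))
altern-twist br→tl left   z = trans (ℤ.*-identityˡ (altern z)) (cong altern (sym (ℤ.+-identityˡ z)))
altern-twist br→tl right  z = trans (ℤ.*-identityˡ (altern z)) (cong altern (sym (ℤ.+-identityˡ z)))

module Coefficients (D : Diagram) (co : Coherent D) where
  open Diagram D using (leftOf; rightOf; Segment; adjacent?; Adjacent; regionᶠ; crossingᶠ)
  open Independence (skeleton D co) public

  -- A region is coloured if one of its corners is shaded; by `coloured` all of its corners then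
  -- are. Regions touching no crossing get `false`.
  colour : Y → Bool
  colour r = does (any? (λ c → any? (λ k → (κ c k ≟ᵧ r) ×-dec (shade (ov c) k Bool.≟ true)) corners) Xs)

  colour-κ : ∀ c k → colour (κ c k) ≡ shade (ov c) k
  colour-κ c k = go (shade (ov c) k) refl
    where
    d? = any? (λ c′ → any? (λ k′ → (κ c′ k′ ≟ᵧ κ c k) ×-dec (shade (ov c′) k′ Bool.≟ true)) corners) Xs
    go : ∀ b → shade (ov c) k ≡ b → does d? ≡ b
    go true  e = dec-true d? (lose (X-complete c) (lose (FinSet.complete cornerᶠ k) (refl , e)))
    go false e = dec-false d? (λ i → let c′ , _ , j = find i ; k′ , _ , (f , g) = find j in
                   true≢false (trans (sym g) (trans (coloured c′ k′ c k f) e)))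
      where
      true≢false : true ≢ false
      true≢false ()

  ∑-regions : ∀ (f : Y → ℤ) σ → ∑ Xs (λ c → f (κ c (σ c))) ≡ ∑ Ys (λ r → uses full σ r * f r)
  ∑-regions f σ =
    trans (∑-cong Xs (λ c → sym (Finite.∑-δ regions (κ c (σ c)) f)))
   (trans (∑-swap Xs Ys (λ c r → δᵧ r (κ c (σ c)) * f r))
          (∑-cong Ys (λ r → trans (∑-*ʳ Xs (f r) (λ c → δᵧ r (κ c (σ c))))
                                  (cong (_* f r) (∑-cong Xs (λ c → Finite.δ-sym regions r (κ c (σ c))))))))

  shades : Asg → ℤ
  shades σ = ∑ Xs (λ c → 𝟙 (shade (ov c) (σ c)))

  -- A state uses every present region exactly once, so it has as many shaded pointers as there are
  -- coloured present regions.
  shades-state : ∀ {x y σ τ} → State x y σ → State x y τ → shades σ ≡ shades τ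
  shades-state {x} {y} {σ} {τ} st st′ = trans (via σ st) (sym (via τ st′))
    where
    via : ∀ σ → State x y σ → shades σ ≡ ∑ Ys (λ r → target (base x y) r * 𝟙 (colour r))
    via σ st = trans (∑-cong Xs (λ c → cong 𝟙 (sym (colour-κ c (σ c)))))
              (trans (∑-regions (𝟙 ∘ colour) σ) (∑-cong Ys (λ r → cong (_* 𝟙 (colour r)) (st r))))

  twists : Asg → ℤ
  twists σ = ∑ Xs (λ c → twist (ov c) (σ c))

  ex-twists : ∀ σ → ex full σ ≡ (shades σ - ∑ Xs (λ c → offset (ov c))) + + 2 * twists σ
  ex-twists σ = trans (∑-cong Xs (λ c → trans (ℤ.*-identityˡ (exponent (ov c) (σ c))) (exponent-twist (ov c) (σ c))))
    (trans (∑-+ Xs (λ c → 𝟙 (shade (ov c) (σ c)) - offset (ov c)) (λ c → + 2 * twist (ov c) (σ c)))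
    (cong₂ _+_ (∑-- Xs (λ c → 𝟙 (shade (ov c) (σ c))) (λ c → offset (ov c))) (∑-*ˡ Xs (+ 2) (λ c → twist (ov c) (σ c)))))

  -- The exponent is a constant of the base plus twice the number of twists, and the parity of the
  -- latter is the sign of the weight.
  twists-state : ∀ {x y σ τ} → State x y σ → State x y τ → ex full σ ≡ ex full τ → twists σ ≡ twists τ
  twists-state {x} {y} {σ} {τ} st st′ e = ℤ.*-cancelˡ-≡ (+ 2) _ _ (ℤ+.∙-cancelˡ (shades σ - O) _ _
      (trans (sym (ex-twists σ)) (trans e (trans (ex-twists τ) (cong (λ z → (z - O) + + 2 * twists τ) (sym (shades-state {x} {y} st st′)))))))
    where O = ∑ Xs (λ c → offset (ov c))

  stateWeight-split : ∀ cs (σ : Asg) →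
    foldr (λ c w → weight (ov c) (σ c) · w) (1ℤ , 0ℤ) cs ≡ (altern (∑ cs (λ c → twist (ov c) (σ c))) , ∑ cs (λ c → 1ℤ * exponent (ov c) (σ c)))
  stateWeight-split []       σ = refl
  stateWeight-split (c ∷ cs) σ = trans (cong (weight (ov c) (σ c) ·_) (stateWeight-split cs σ))
    (cong₂ _,_ (altern-twist (ov c) (σ c) (∑ cs (λ c → twist (ov c) (σ c))))
       (cong (_+ ∑ cs (λ c → 1ℤ * exponent (ov c) (σ c))) (sym (ℤ.*-identityˡ (exponent (ov c) (σ c))))))

  module _ (i : Segment) where
    private
      x = leftOf i
      y = rightOf i

      uses-usesOf : ∀ σ r → + usesOf D σ r ≡ uses full σ r
      uses-usesOf σ r = ∑-count (λ c → κ c (σ c) ≟ᵧ r) Xs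

      isState⇒state : ∀ {σ} → IsState D i σ → State x y σ
      isState⇒state {σ} (av , once) r = go (adjacent? i r)
        where
        go : Dec (Adjacent i r) → uses full σ r ≡ target (base x y) r
        go (yes a) = trans (∑-zero Xs (λ c → ⟦⟧-no (points? full σ r c)
            (λ (_ , e) → All.lookup av (X-complete c) (subst (Adjacent i) (sym e) a))))
          (sym (cong (if_then 0ℤ else 1ℤ) (in-base a)))
          where
          in-base : Adjacent i r → base x y r ≡ true
          in-base (inj₁ refl) = base-left x y
          in-base (inj₂ refl) = base-right x y
        go (no n) = trans (sym (uses-usesOf σ r)) (trans (cong +_ (All.lookup once (Y-complete r) n))
          (sym (cong (if_then 0ℤ else 1ℤ) (base-neither x y r (n ∘ inj₁) (n ∘ inj₂)))))

      state⇒isState : ∀ {σ} → State x y σ → IsState D i σ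
      state⇒isState {σ} st = All.tabulate (λ {c} _ → avoids c) , All.tabulate (λ {r} _ → once r)
        where
        avoids : ∀ c → ¬ Adjacent i (κ c (σ c))
        avoids c (inj₁ e) = state-avoids {k = σ c} refl (trans (cong (base x y) e) (base-left x y)) st
        avoids c (inj₂ e) = state-avoids {k = σ c} refl (trans (cong (base x y) e) (base-right x y)) st
        once : ∀ r → ¬ Adjacent i r → usesOf D σ r ≡ 1
        once r n = ℤ.+-injective (trans (uses-usesOf σ r) (trans (st r)
          (cong (if_then 0ℤ else 1ℤ) (base-neither x y r (n ∘ inj₁) (n ∘ inj₂)))))

      As = assignments D Xs

      count : ℤ → Asg → ℤ
      count n σ = ⟦ isState? D i σ ⟧ * ⟦ ex full σ ℤ.≟ n ⟧

      count-state : ∀ n σ → count n σ ≡ ⟦ state? x y σ ⟧ * ⟦ ex full σ ℤ.≟ n ⟧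
      count-state n σ = cong (_* ⟦ ex full σ ℤ.≟ n ⟧) (⟦⟧-cong (isState? D i σ) (state? x y σ) isState⇒state state⇒isState)

      total : ∀ n → ∑ As (count n) ≡ #states x y n
      total n = trans (∑-cong As (count-state n)) (∑-assignments D Xs (λ σ → ⟦ state? x y σ ⟧ * ⟦ ex full σ ℤ.≟ n ⟧)
        (λ {σ} {σ′} h → cong₂ _*_ (⟦⟧-cong (state? x y σ) (state? x y σ′) (covers-agree {full} (agree-ext h)) (covers-agree {full} (agree-ext (sym ∘ h))))
                            (cong (λ z → ⟦ z ℤ.≟ n ⟧) (ex-agree {full} (agree-ext h)))))

      coeff-Δ̃ : ∀ n → coeff (Δ̃ D i) n ≡ ∑ As (λ σ → count n σ * altern (twists σ))
      coeff-Δ̃ n = trans (coeff-∑ (Δ̃ D i) n)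
        (trans (∑-map (stateWeight D) (filter (isState? D i) As) (λ t → ⟦ proj₂ t ℤ.≟ n ⟧ * proj₁ t))
        (trans (∑-filter (isState? D i) As (λ σ → ⟦ proj₂ (stateWeight D σ) ℤ.≟ n ⟧ * proj₁ (stateWeight D σ)))
        (∑-cong As (λ σ → trans (cong (λ t → ⟦ isState? D i σ ⟧ * (⟦ proj₂ t ℤ.≟ n ⟧ * proj₁ t)) (stateWeight-split Xs σ))
                                (sym (ℤ.*-assoc ⟦ isState? D i σ ⟧ ⟦ ex full σ ℤ.≟ n ⟧ (altern (twists σ))))))))

      nonneg-count : ∀ n σ → 0ℤ ℤ.≤ count n σ
      nonneg-count n σ = subst (0ℤ ℤ.≤_) (⟦⟧-× (isState? D i σ) (ex full σ ℤ.≟ n)) (⟦⟧-nonneg (isState? D i σ ×-dec (ex full σ ℤ.≟ n)))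

      counted : ∀ n σ → count n σ ≢ 0ℤ → State x y σ × ex full σ ≡ n
      counted n σ h = decidable-stable (state? x y σ) (λ ¬st → h (trans (count-state n σ) (cong (_* ⟦ ex full σ ℤ.≟ n ⟧) (⟦⟧-no (state? x y σ) ¬st)))) ,
        decidable-stable (ex full σ ℤ.≟ n) (λ ¬e → h (trans (cong (⟦ isState? D i σ ⟧ *_) (⟦⟧-no (ex full σ ℤ.≟ n) ¬e)) (ℤ.*-zeroʳ ⟦ isState? D i σ ⟧)))

    coeff-∣Δ̃∣ : ∀ n → coeff ∣ Δ̃ D i ∣ n ≡ #states x y n
    coeff-∣Δ̃∣ n = trans (coeff-∣∣ (Δ̃ D i) n) (trans (cong (+_ ∘ ℤ.∣_∣) (coeff-Δ̃ n)) (trans (go (∑ As (count n) ℤ.≟ 0ℤ)) (total n)))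
      where
      go : Dec (∑ As (count n) ≡ 0ℤ) → + ℤ.∣ ∑ As (λ σ → count n σ * altern (twists σ)) ∣ ≡ ∑ As (count n)
      go (yes e) = trans (cong (+_ ∘ ℤ.∣_∣) (zero-sum As (λ j → ∑-nonneg-zero As (nonneg-count n) e j))) (sym e)
        where
        zero-sum : ∀ xs → (∀ {σ} → σ ∈ xs → count n σ ≡ 0ℤ) → ∑ xs (λ σ → count n σ * altern (twists σ)) ≡ 0ℤ
        zero-sum []       h = refl
        zero-sum (σ ∷ xs) h = cong₂ _+_ (cong (_* altern (twists σ)) (h (here refl))) (zero-sum xs (h ∘ there))
      go (no ne) = trans (cong (+_ ∘ ℤ.∣_∣) (trans (∑-cong As same-sign) (∑-*ʳ As (altern (twists σ₀)) (count n))))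
        (trans (cong +_ (trans (ℤ.abs-* (∑ As (count n)) (altern (twists σ₀))) (trans (cong (ℤ.∣ ∑ As (count n) ∣ ℕ.*_) (altern-unit (twists σ₀))) (ℕ.*-identityʳ _))))
               (ℤ.0≤i⇒+∣i∣≡i (∑-nonneg As (nonneg-count n))))
        where
        found = ∑≢0 As (count n) ne
        σ₀ = proj₁ found
        st₀ = counted n σ₀ (proj₂ (proj₂ found))
        same-sign : ∀ σ → count n σ * altern (twists σ) ≡ count n σ * altern (twists σ₀)
        same-sign σ = split (count n σ ℤ.≟ 0ℤ)
          where
          split : Dec (count n σ ≡ 0ℤ) → count n σ * altern (twists σ) ≡ count n σ * altern (twists σ₀)
          split (yes e) = trans (cong (_* altern (twists σ)) e) (sym (cong (_* altern (twists σ₀)) e))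
          split (no h) = let st , e = counted n σ h in
            cong (λ z → count n σ * altern z) (twists-state {x} {y} st (proj₁ st₀) (trans e (sym (proj₂ st₀))))

-- Duplicate-free lists, sums modulo 2 and orbits

unique-⊆-length : ∀ {xs ys : List A} → Unique xs → (∀ {x} → x ∈ xs → x ∈ ys) → length xs ℕ.≤ length ys
unique-⊆-length {xs = []}     _        h = z≤n
unique-⊆-length {xs = x ∷ xs} (x∉ ∷ u) h with Mem.∈-∃++ (h (here refl))
... | as , bs , refl = subst (suc (length xs) ℕ.≤_) (sym len) (s≤s (unique-⊆-length u drop))
  where
  len : length (as ++ x ∷ bs) ≡ suc (length (as ++ bs))
  len = trans (List.length-++ as) (trans (ℕ.+-suc (length as) (length bs)) (cong suc (sym (List.length-++ as))))
  drop : ∀ {y} → y ∈ xs → y ∈ as ++ bs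
  drop {y} i with Mem.∈-++⁻ as (h (there i))
  ... | inj₁ j         = Mem.∈-++⁺ˡ j
  ... | inj₂ (here e)  = contradiction (sym e) (All.lookup x∉ i)
  ... | inj₂ (there j) = Mem.∈-++⁺ʳ as j

module _ (_≟_ : DecidableEquality A) where
  open import Data.List.Membership.DecPropositional _≟_ using (_∈?_)

  private
    split-unique : ∀ (as : List A) {y bs} → Unique (as ++ y ∷ bs) →
                   Unique (as ++ bs) × (∀ {z} → z ∈ as ++ bs → z ∈ as ++ y ∷ bs × z ≢ y)
    split-unique []       (y∉ ∷ u) = u , λ i → there i , λ { refl → All.lookup y∉ i refl }
    split-unique (a ∷ as) (a∉ ∷ u) with split-unique as u
    ... | u′ , h = All.tabulate (λ i e → All.lookup a∉ (proj₁ (h i)) e) ∷ u′ , λ where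
          (here refl) → here refl , λ e → All.lookup a∉ (Mem.∈-++⁺ʳ as (here refl)) e
          (there i)   → there (proj₁ (h i)) , proj₂ (h i)

  covered-⊆ : ∀ {xs ys : List A} → Unique xs → (∀ {x} → x ∈ xs → x ∈ ys) → length ys ℕ.≤ length xs →
              ∀ {y} → y ∈ ys → y ∈ xs
  covered-⊆ {xs} {ys} u h l {y} i with y ∈? xs
  ... | yes j = j
  ... | no y∉ = contradiction (ℕ.≤-trans (unique-⊆-length (All.tabulate (λ j e → y∉ (subst (_∈ xs) (sym e) j)) ∷ u)
                 (λ { (here refl) → i ; (there j) → h j })) l) (ℕ.<-irrefl refl)

  -- A list no longer than the duplicate-free list it covers can have no repetition. This is how
  -- equality in an estimate of region numbers is turned into injectivity.
  covered-unique : ∀ {xs ys : List A} → Unique xs → (∀ {x} → x ∈ xs → x ∈ ys) → length ys ℕ.≤ length xs → Unique ys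
  covered-unique {ys = []}          _ _ _ = []
  covered-unique {xs} {ys = y ∷ ys} u h l with Mem.∈-∃++ (covered-⊆ u h l (here refl))
  ... | as , bs , refl = All.tabulate (λ {z} i e → y∉ (subst (_∈ ys) (sym e) i)) ∷
        covered-unique (proj₁ (split-unique as u)) rest
          (ℕ.≤-pred (subst (suc (length ys) ℕ.≤_) len l))
    where
    len : length (as ++ y ∷ bs) ≡ suc (length (as ++ bs))
    len = trans (List.length-++ as) (trans (ℕ.+-suc (length as) (length bs)) (cong suc (sym (List.length-++ as))))
    y∉ : ¬ y ∈ ys
    y∉ i = ℕ.<-irrefl refl (ℕ.≤-trans l (unique-⊆-length u (λ j → case h j of λ { (here refl) → i ; (there k) → k })))
    rest : ∀ {x} → x ∈ as ++ bs → x ∈ ys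
    rest i with proj₂ (split-unique as u) i
    ... | j , ne with h j
    ...   | here e  = contradiction e ne
    ...   | there k = k

unique-++ˡ : ∀ (xs : List A) {ys} → Unique (xs ++ ys) → Unique xs
unique-++ˡ []       _        = []
unique-++ˡ (x ∷ xs) (x∉ ∷ u) = All.tabulate (λ i → All.lookup x∉ (Mem.∈-++⁺ˡ i)) ∷ unique-++ˡ xs u

unique-++ʳ : ∀ (xs : List A) {ys} → Unique (xs ++ ys) → Unique ys
unique-++ʳ []       u       = u
unique-++ʳ (x ∷ xs) (_ ∷ u) = unique-++ʳ xs u

unique-++-disjoint : ∀ (xs : List A) {ys} → Unique (xs ++ ys) → ∀ {x y} → x ∈ xs → y ∈ ys → x ≢ y
unique-++-disjoint (x ∷ xs) (x∉ ∷ u) (here refl) j = All.lookup x∉ (Mem.∈-++⁺ʳ xs j)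
unique-++-disjoint (x ∷ xs) (x∉ ∷ u) (there i)   j = unique-++-disjoint xs u i j

unique-map-injective : ∀ (f : A → B) {xs} → Unique (map f xs) → ∀ {x y} → x ∈ xs → y ∈ xs → f x ≡ f y → x ≡ y
unique-map-injective f (x∉ ∷ u) (here refl) (here refl) e = refl
unique-map-injective f (x∉ ∷ u) (here refl) (there j)   e = contradiction e (All.lookup x∉ (Mem.∈-map⁺ f j))
unique-map-injective f (x∉ ∷ u) (there i)   (here refl) e = contradiction (sym e) (All.lookup x∉ (Mem.∈-map⁺ f i))
unique-map-injective f (x∉ ∷ u) (there i)   (there j)   e = unique-map-injective f u i j e

lookup-injective : ∀ {xs : List A} → Unique xs → ∀ i j → lookup xs i ≡ lookup xs j → i ≡ j
lookup-injective (x∉ ∷ u) Fin.zero    Fin.zero    e = refl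
lookup-injective (x∉ ∷ u) Fin.zero    (Fin.suc j) e = contradiction e (All.lookup x∉ (Mem.∈-lookup j))
lookup-injective (x∉ ∷ u) (Fin.suc i) Fin.zero    e = contradiction (sym e) (All.lookup x∉ (Mem.∈-lookup i))
lookup-injective (x∉ ∷ u) (Fin.suc i) (Fin.suc j) e = cong Fin.suc (lookup-injective u i j e)

funToFin-cong : ∀ {m n} {f g : Fin.Fin m → Fin.Fin n} → (∀ i → f i ≡ g i) → Fin.funToFin f ≡ Fin.funToFin g
funToFin-cong {zero}  h = refl
funToFin-cong {suc m} h = cong₂ Fin.combine (h Fin.zero) (funToFin-cong (h ∘ Fin.suc))

module _ (A : FinSet) where
  open FinSet A

  private
    bit : Fin.Fin 2 → Bool
    bit Fin.zero = false
    bit (Fin.suc _) = true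
    unbit : Bool → Fin.Fin 2
    unbit false = Fin.zero
    unbit true  = Fin.suc Fin.zero
    fn : Fin.Fin (2 ℕ.^ size A) → Carrier → Bool
    fn i a = bit (Fin.finToFun {2} {size A} i (Any.index (complete a)))
    code : (φs : List ((Carrier → Bool) → Bool)) → Fin.Fin (2 ℕ.^ size A) → Fin.Fin (2 ℕ.^ length φs)
    code φs i = Fin.funToFin (λ q → unbit (lookup φs q (fn i)))

  -- There are fewer patterns of values than vectors. For linear functionals the difference of u and
  -- v is a nonzero element of the common kernel.
  bool-pigeonhole : (φs : List ((Carrier → Bool) → Bool)) → length φs ℕ.< size A →
    ∃₂ λ u v → (∀ {φ} → φ ∈ φs → φ u ≡ φ v) × ¬ (∀ a → u a ≡ v a)
  bool-pigeonhole φs m<k with Fin.pigeonhole (ℕ.^-monoʳ-< 2 (s≤s (s≤s z≤n)) m<k) (code φs)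
  ... | i , j , i<j , e = fn i , fn j , agree , differ
    where
    unbit-injective : ∀ x y → unbit x ≡ unbit y → x ≡ y
    unbit-injective true  true  _ = refl
    unbit-injective false false _ = refl
    bit-injective : ∀ x y → bit x ≡ bit y → x ≡ y
    bit-injective Fin.zero            Fin.zero            _ = refl
    bit-injective (Fin.suc Fin.zero) (Fin.suc Fin.zero) _ = refl
    agree : ∀ {φ} → φ ∈ φs → φ (fn i) ≡ φ (fn j)
    agree {φ} m = unbit-injective _ _ (subst (λ ψ → unbit (ψ (fn i)) ≡ unbit (ψ (fn j))) (sym (lookup-index m))
      (trans (sym (Fin.finToFun-funToFin (λ q → unbit (lookup φs q (fn i))) (Any.index m)))
      (trans (cong (λ z → Fin.finToFun {2} {length φs} z (Any.index m)) e)
             (Fin.finToFun-funToFin (λ q → unbit (lookup φs q (fn j))) (Any.index m)))))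
    differ : ¬ (∀ a → fn i a ≡ fn j a)
    differ h = Fin.<-irrefl i≡j i<j
      where
      at-position : ∀ q → Any.index (complete (lookup elements q)) ≡ q
      at-position q = lookup-injective unique _ q (sym (lookup-index (complete (lookup elements q))))
      i≡j : i ≡ j
      i≡j = trans (sym (Fin.funToFin-finToFin {size A} {2} i)) (trans (funToFin-cong (λ q →
        subst (λ z → Fin.finToFun {2} {size A} i z ≡ Fin.finToFun {2} {size A} j z) (at-position q)
          (bit-injective _ _ (h (lookup elements q))))) (Fin.funToFin-finToFin {size A} {2} j))

does-cong : ∀ {P Q : Set} (d : Dec P) (e : Dec Q) → (P → Q) → (Q → P) → does d ≡ does e
does-cong (yes p) e f g = sym (dec-true e (f p))
does-cong (no ¬p) e f g = sym (dec-false e (¬p ∘ g))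

xor-cancel : ∀ a b → a xor b ≡ false → a ≡ b
xor-cancel true  true  _ = refl
xor-cancel false false _ = refl

xor-zero : ∀ {a b} → a ≡ b → a xor b ≡ false
xor-zero {a} refl = Bool.xor-same a

xor-move : ∀ a b a′ b′ → a xor b ≡ a′ xor b′ → a xor a′ ≡ b xor b′
xor-move a b a′ b′ e = xor-cancel _ _ (trans (Xor.interchange a a′ b b′) (xor-zero e))

⊕ : List A → (A → Bool) → Bool
⊕ xs f = foldr (λ x s → f x xor s) false xs

⊕-cong : ∀ (xs : List A) {f g : A → Bool} → (∀ x → f x ≡ g x) → ⊕ xs f ≡ ⊕ xs g
⊕-cong []       h = refl
⊕-cong (x ∷ xs) h = cong₂ _xor_ (h x) (⊕-cong xs h)

⊕-false : ∀ (xs : List A) {f : A → Bool} → (∀ x → f x ≡ false) → ⊕ xs f ≡ false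
⊕-false []       h = refl
⊕-false (x ∷ xs) h = cong₂ _xor_ (h x) (⊕-false xs h)

⊕-xor : ∀ (xs : List A) (f g : A → Bool) → ⊕ xs (λ x → f x xor g x) ≡ ⊕ xs f xor ⊕ xs g
⊕-xor []       f g = refl
⊕-xor (x ∷ xs) f g = trans (cong ((f x xor g x) xor_) (⊕-xor xs f g)) (Xor.interchange (f x) (g x) (⊕ xs f) (⊕ xs g))

⊕-single : ∀ {xs : List A} {x} (f : A → Bool) → x ∈ xs → Unique xs → (∀ {y} → y ≢ x → f y ≡ false) → ⊕ xs f ≡ f x
⊕-single {xs = x ∷ xs} f (here refl) (x∉ ∷ u) h =
  trans (cong (f x xor_) (none xs (λ i → h (λ e → All.lookup x∉ i (sym e))))) (Bool.xor-identityʳ (f x))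
  where
  none : ∀ ys → (∀ {y} → y ∈ ys → f y ≡ false) → ⊕ ys f ≡ false
  none []       h = refl
  none (y ∷ ys) h = cong₂ _xor_ (h (here refl)) (none ys (h ∘ there))
⊕-single {xs = y ∷ xs} f (there i) (y∉ ∷ u) h =
  trans (cong (_xor ⊕ xs f) (h (All.lookup y∉ i))) (⊕-single f i u h)

module Reaching (A : FinSet) (f : FinSet.Carrier A → FinSet.Carrier A) where
  open FinSet A

  Reach : Carrier → Carrier → Set
  Reach x y = ∃[ m ] iter f m x ≡ y

  reach? : ∀ x y → Dec (Any.Any (y ≡_) (iterate f x (size A)))
  reach? x y = any? (y ≟_) (iterate f x (size A))

  -- The very list whose length `#orbits` takes, so that for `boundaryStep` Euler's formula speaks
  -- of it.
  representatives : List Carrier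
  representatives = deduplicate reach? elements

  ∈-iterate : ∀ {y} x n → Any.Any (y ≡_) (iterate f x n) → Reach x y
  ∈-iterate x (suc n) (here e)  = 0 , sym e
  ∈-iterate x (suc n) (there i) with ∈-iterate (f x) n i
  ... | m , e = suc m , e

  reach-trans : ∀ {x y z} → Reach x y → Reach y z → Reach x z
  reach-trans {x} (m , refl) (n , refl) = m ℕ.+ n , iter-+ f m n x

  represented : ∀ y → ∃[ x ] x ∈ representatives × Reach x y
  represented y = go elements (complete y)
    where
    go : ∀ xs → y ∈ xs → ∃[ x ] x ∈ deduplicate reach? xs × Reach x y
    go (x ∷ xs) (here refl) = x , here refl , 0 , refl
    go (x ∷ xs) (there i) with go xs i
    ... | w , j , r with reach? x w
    ...   | yes k = x , here refl , reach-trans (∈-iterate x (size A) k) r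
    ...   | no ¬k = w , there (Mem.∈-filter⁺ (¬? ∘ reach? x) j ¬k) , r

  invariant : ∀ {B : Set} (F : Carrier → B) → (∀ x → F (f x) ≡ F x) → ∀ {x y} → Reach x y → F x ≡ F y
  invariant F h (zero , refl)  = refl
  invariant F h (suc m , refl) = trans (sym (h _)) (invariant F h (m , refl))

-- The sphere and its first cohomology

module Sphere (D : Diagram) (sphere : OnSphere D) where
  open Diagram D public
  open OnSphere sphere public
  open Finite crossingᶠ public using () renaming (elements to Cs; complete to C-complete; _≟_ to _≟ₓ_; unique to C-unique)
  open Finite regionᶠ public using () renaming (elements to Rs; complete to R-complete; unique to R-unique; δ to δᵣ)
  open Finite endᶠ public using () renaming (elements to Es; complete to E-complete; unique to E-unique; _≟_ to _≟ᴱ_)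
  open Finite circleᶠ public using () renaming (elements to Os; complete to O-complete)

  src tgt : End → Crossing
  src e = proj₁ e
  tgt e = proj₁ (next e)

  lo ro : End → Region
  lo e = leftOf (inj₁ e)
  ro e = rightOf (inj₁ e)

  in-left : ∀ e → lo (prev e) ≡ regionAt (leftOfIn e)
  in-left e = trans (sym (left-ok (prev e))) (cong (regionAt ∘ leftOfIn) (next-prev e))

  in-right : ∀ e → ro (prev e) ≡ regionAt (rightOfIn e)
  in-right e = trans (sym (right-ok (prev e))) (cong (regionAt ∘ rightOfIn) (next-prev e))

  ∑-ends : ∀ F → ∑ Es F ≡ ∑ Cs (λ c → F (c , left) + F (c , right))
  ∑-ends F = trans (∑-cartesianProduct Cs sides F) (∑-cong Cs (λ c → cong (_+_ (F (c , left))) (ℤ.+-identityʳ (F (c , right)))))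

  reindex-next : ∀ F → ∑ Es (F ∘ next) ≡ ∑ Es F
  reindex-next = Finite.reindex endᶠ next prev next-prev prev-next

  -- A segment is seen at its start from an outgoing end and at its arrival from an incoming end;
  -- `next` matches the two.
  ∑-segments : ∀ (G : Region → Region → ℤ) →
    ∑ Cs (λ c → G (corner c left) (corner c bottom) + G (corner c bottom) (corner c right)) ≡
    ∑ Cs (λ c → G (corner c left) (corner c top) + G (corner c top) (corner c right))
  ∑-segments G = trans (sym (∑-ends F)) (trans (sym (reindex-next F))
    (trans (∑-cong Es (λ e → cong₂ G (left-ok e) (right-ok e))) (∑-ends (λ e → G (lo e) (ro e)))))
    where
    F : End → ℤ
    F e = G (regionAt (leftOfIn e)) (regionAt (rightOfIn e))

  -- Walking around the region r, the values of q add up to zero changes.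
  ∑-jumps : ∀ (q : Crossing → ℤ) r → ∑ Es (λ e → (δᵣ (lo e) r - δᵣ (ro e) r) * (q (tgt e) - q (src e))) ≡ 0ℤ
  ∑-jumps q r = trans (∑-cong Es (λ e → alg (δᵣ (lo e) r - δᵣ (ro e) r) (q (tgt e)) (q (src e))))
    (trans (∑-- Es (λ e → (δᵣ (lo e) r - δᵣ (ro e) r) * q (tgt e)) (λ e → (δᵣ (lo e) r - δᵣ (ro e) r) * q (src e)))
    (ℤ.i≡j⇒i-j≡0 (trans (∑-cong Es (λ e → cong₂ (λ x y → (δᵣ x r - δᵣ y r) * q (tgt e)) (sym (left-ok e)) (sym (right-ok e))))
      (trans (reindex-next F) (trans (∑-ends F) (trans (∑-cong Cs (λ c → alg′ (δᵣ (corner c left) r) (δᵣ (corner c bottom) r) (δᵣ (corner c right) r) (δᵣ (corner c top) r) (q c)))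
        (sym (∑-ends (λ e → (δᵣ (lo e) r - δᵣ (ro e) r) * q (src e))))))))))
    where
    F : End → ℤ
    F e = (δᵣ (regionAt (leftOfIn e)) r - δᵣ (regionAt (rightOfIn e)) r) * q (src e)
    alg : ∀ a x y → a * (x - y) ≡ a * x - a * y
    alg = solve-∀
    alg′ : ∀ l b r t q → (l - b) * q + (b - r) * q ≡ (l - t) * q + (t - r) * q
    alg′ = solve-∀

  joined-induction : ∀ {P : Segment → Set} (R : Region → Set) →
    (∀ s → P s → (R (leftOf s) → R (rightOf s)) × (R (rightOf s) → R (leftOf s))) →
    ∀ {r r′} → Joined P r r′ → R r → R r′
  joined-induction R h ε x = x
  joined-induction R h (fwd (s , p , refl , refl) ◅ j) x = joined-induction R h j (proj₁ (h s p) x)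
  joined-induction R h (bwd (s , p , refl , refl) ◅ j) x = joined-induction R h j (proj₂ (h s p) x)

  region-step : ∀ q → regionAt (boundaryStep q) ≡ regionAt q
  region-step (c , left)   = left-ok (c , left)
  region-step (c , top)    = left-ok (c , right)
  region-step (c , right)  = trans (out (prev (c , right))) (in-right (c , right))
    where
    out : ∀ e → regionAt (rightOfOut e) ≡ ro e
    out (_ , left)  = refl
    out (_ , right) = refl
  region-step (c , bottom) = trans (out (prev (c , left))) (in-right (c , left))
    where
    out : ∀ e → regionAt (rightOfOut e) ≡ ro e
    out (_ , left)  = refl
    out (_ , right) = refl

  crossing-step : ∀ {A : Set} (F : Crossing → A) → (∀ e → F (tgt e) ≡ F (src e)) →
                  ∀ q → F (proj₁ (boundaryStep q)) ≡ F (proj₁ q)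
  crossing-step F h (c , left)   = trans (cong F (in-crossing (next (c , left)))) (h (c , left))
    where
    in-crossing : ∀ e → proj₁ (leftOfIn e) ≡ proj₁ e
    in-crossing (_ , left)  = refl
    in-crossing (_ , right) = refl
  crossing-step F h (c , top)    = trans (cong F (in-crossing (next (c , right)))) (h (c , right))
    where
    in-crossing : ∀ e → proj₁ (leftOfIn e) ≡ proj₁ e
    in-crossing (_ , left)  = refl
    in-crossing (_ , right) = refl
  crossing-step F h (c , right)  = trans (cong F (out-crossing (prev (c , right)))) (trans (sym (h _)) (cong (F ∘ proj₁) (next-prev (c , right))))
    where
    out-crossing : ∀ e → proj₁ (rightOfOut e) ≡ proj₁ e
    out-crossing (_ , left)  = refl
    out-crossing (_ , right) = refl
  crossing-step F h (c , bottom) = trans (cong F (out-crossing (prev (c , left)))) (trans (sym (h _)) (cong (F ∘ proj₁) (next-prev (c , left))))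
    where
    out-crossing : ∀ e → proj₁ (rightOfOut e) ≡ proj₁ e
    out-crossing (_ , left)  = refl
    out-crossing (_ , right) = refl

  open Reaching (crossingᶠ ×ᶠ cornerᶠ) boundaryStep public

  -- The boundary modulo 2 of a chain of segments. As a segment is named by the end it leaves, the
  -- incoming ones appear through `prev`.
  ∂ : (End → Bool) → Crossing → Bool
  ∂ f b = (f (prev (b , left)) xor f (prev (b , right))) xor (f (b , left) xor f (b , right))

  ∂-cong : ∀ {f g} → (∀ e → f e ≡ g e) → ∀ b → ∂ f b ≡ ∂ g b
  ∂-cong h b = cong₂ _xor_ (cong₂ _xor_ (h _) (h _)) (cong₂ _xor_ (h _) (h _))

  ∂-xor : ∀ f g b → ∂ (λ e → f e xor g e) b ≡ ∂ f b xor ∂ g b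
  ∂-xor f g b = trans (cong₂ _xor_ (Xor.interchange (f (prev (b , left))) _ _ _) (Xor.interchange (f (b , left)) _ _ _))
                      (Xor.interchange (f (prev (b , left)) xor f (prev (b , right))) _ _ _)

  ∂-⊕ : ∀ {A : Set} (xs : List A) (f : A → End → Bool) b → ∂ (λ e → ⊕ xs (λ x → f x e)) b ≡ ⊕ xs (λ x → ∂ (f x) b)
  ∂-⊕ []       f b = refl
  ∂-⊕ (x ∷ xs) f b = trans (∂-xor (f x) (λ e → ⊕ xs (λ y → f y e)) b) (cong (∂ (f x) b xor_) (∂-⊕ xs f b))

  ∂-∧ : ∀ a f b → ∂ (λ e → a ∧ f e) b ≡ a ∧ ∂ f b
  ∂-∧ true  f b = refl
  ∂-∧ false f b = refl

  tri : ∀ a b c → (a xor b) xor (b xor c) ≡ a xor c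
  tri true  true  c = refl
  tri true  false c = refl
  tri false true  c = Bool.not-involutive c
  tri false false c = refl

  -- Going around a crossing, each of the four corners is met by two of the four strand ends.
  ∂-coboundary : ∀ (p : Region → Bool) b → ∂ (λ e → p (lo e) xor p (ro e)) b ≡ false
  ∂-coboundary p b = trans (cong₂ _xor_
      (trans (cong₂ _xor_ (cong₂ (λ x y → p x xor p y) (in-left (b , left)) (in-right (b , left)))
                          (cong₂ (λ x y → p x xor p y) (in-left (b , right)) (in-right (b , right))))
             (tri (p (corner b left)) (p (corner b bottom)) (p (corner b right))))
      (tri (p (corner b left)) (p (corner b top)) (p (corner b right))))
    (Bool.xor-same (p (corner b left) xor p (corner b right)))

  -- Invariance under `next` makes z a union of Seifert circles, and these are cycles: each incoming
  -- end at a crossing is matched with the outgoing end on the same side.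
  ∂-strand : ∀ z → (∀ e → z (next e) ≡ z e) → ∀ b → ∂ z b ≡ false
  ∂-strand z h b = trans (cong (_xor (z (b , left) xor z (b , right))) (cong₂ _xor_ (back (b , left)) (back (b , right))))
                         (Bool.xor-same (z (b , left) xor z (b , right)))
    where
    back : ∀ e → z (prev e) ≡ z e
    back e = trans (sym (h (prev e))) (cong z (next-prev e))

  single : End → End → Bool
  single e x = does (x ≟ᴱ e)

  ∂-single : ∀ e b → ∂ (single e) b ≡ does (b ≟ₓ tgt e) xor does (b ≟ₓ src e)
  ∂-single e b = cong₂ _xor_
    (trans (cong₂ _xor_ (flip left) (flip right)) (one (next e)))
    (one e)
    where
    one : ∀ (x : End) → does ((b , left) ≟ᴱ x) xor does ((b , right) ≟ᴱ x) ≡ does (b ≟ₓ proj₁ x)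
    one (c , left)  = trans (cong₂ _xor_ (does-cong ((b , left) ≟ᴱ (c , left)) (b ≟ₓ c) (λ { refl → refl }) (λ { refl → refl }))
                                         (dec-false ((b , right) ≟ᴱ (c , left)) (λ ()))) (Bool.xor-identityʳ _)
    one (c , right) = cong₂ _xor_ (dec-false ((b , left) ≟ᴱ (c , right)) (λ ()))
                                  (does-cong ((b , right) ≟ᴱ (c , right)) (b ≟ₓ c) (λ { refl → refl }) (λ { refl → refl }))
    flip : ∀ s → does (prev (b , s) ≟ᴱ e) ≡ does ((b , s) ≟ᴱ next e)
    flip s = does-cong (prev (b , s) ≟ᴱ e) ((b , s) ≟ᴱ next e)
               (λ q → trans (sym (next-prev (b , s))) (cong next q)) (λ q → trans (cong prev q) (prev-next e))

  -- A spanning forest of the link projection: every crossing is joined by a chain to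
  -- the root of its component.
  record Forest (es : List End) : Set where
    field
      root     : Crossing → Crossing
      chain    : Crossing → End → Bool
      root²    : ∀ c → root (root c) ≡ root c
      boundary : ∀ c b → ∂ (chain c) b ≡ does (b ≟ₓ c) xor does (b ≟ₓ root c)
      merged   : ∀ {e} → e ∈ es → root (tgt e) ≡ root (src e)

  forest : ∀ es → Forest es
  forest [] = record { root = id ; chain = λ _ _ → false ; root² = λ _ → refl
                     ; boundary = λ c b → sym (Bool.xor-same (does (b ≟ₓ c))) ; merged = λ () }
  forest (e ∷ es) = extend (forest es) (Forest.root (forest es) (src e) ≟ₓ Forest.root (forest es) (tgt e))
    where
    extend : (F : Forest es) → Dec (Forest.root F (src e) ≡ Forest.root F (tgt e)) → Forest (e ∷ es)
    extend F (yes q) = record { Forest F ; merged = λ { (here refl) → sym q ; (there i) → Forest.merged F i } }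
    extend F (no ne) = record { root = root′ ; chain = chain′ ; root² = λ c → idem c (root c ≟ₓ S)
                              ; boundary = λ c b → bound c b (root c ≟ₓ S)
                              ; merged = λ { (here refl) → trans (if-no (root (tgt e) ≟ₓ S) (ne ∘ sym)) (sym (if-yes (root (src e) ≟ₓ S) refl))
                                           ; (there i) → cong (λ r → if does (r ≟ₓ S) then T′ else r) (merged i) } }
      where
      open Forest F
      S  = root (src e)
      T′ = root (tgt e)
      root′ : Crossing → Crossing
      root′ c = if does (root c ≟ₓ S) then T′ else root c
      detour : Crossing → End → Bool
      detour c x = (chain c x xor chain (src e) x) xor (single e x xor chain (tgt e) x)
      chain′ : Crossing → End → Bool
      chain′ c = if does (root c ≟ₓ S) then detour c else chain c
      idem : ∀ c → Dec (root c ≡ S) → root′ (root′ c) ≡ root′ c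
      idem c (yes q) = trans (cong root′ (if-yes (root c ≟ₓ S) q))
        (trans (if-no (root T′ ≟ₓ S) (λ f → ne (sym (trans (sym (root² (tgt e))) f))))
               (trans (root² (tgt e)) (sym (if-yes (root c ≟ₓ S) q))))
      idem c (no n) = trans (cong root′ (if-no (root c ≟ₓ S) n))
        (trans (if-no (root (root c) ≟ₓ S) (n ∘ trans (sym (root² c))))
               (trans (root² c) (sym (if-no (root c ≟ₓ S) n))))
      cancel : ∀ c s u t v → ((c xor s) xor (u xor s)) xor ((t xor u) xor (t xor v)) ≡ c xor v
      cancel c s u t v = trans (cong₂ _xor_ (trans (cong ((c xor s) xor_) (Bool.xor-comm u s)) (tri c s u))
           (trans (cong (_xor (t xor v)) (Bool.xor-comm t u)) (tri u t v))) (tri c u v)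
      bound : ∀ c b → Dec (root c ≡ S) → ∂ (chain′ c) b ≡ does (b ≟ₓ c) xor does (b ≟ₓ root′ c)
      bound c b (yes q) = trans (cong (λ f → ∂ f b) (if-yes (root c ≟ₓ S) q))
        (trans (∂-xor (λ x → chain c x xor chain (src e) x) (λ x → single e x xor chain (tgt e) x) b)
        (trans (cong₂ _xor_ (∂-xor (chain c) (chain (src e)) b) (∂-xor (single e) (chain (tgt e)) b))
        (trans (cong₂ _xor_ (cong₂ _xor_ (trans (boundary c b) (cong (λ r → does (b ≟ₓ c) xor does (b ≟ₓ r)) q)) (boundary (src e) b))
                            (cong₂ _xor_ (∂-single e b) (boundary (tgt e) b)))
        (trans (cancel (does (b ≟ₓ c)) (does (b ≟ₓ S)) (does (b ≟ₓ src e)) (does (b ≟ₓ tgt e)) (does (b ≟ₓ T′)))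
               (cong (λ r → does (b ≟ₓ c) xor does (b ≟ₓ r)) (sym (if-yes (root c ≟ₓ S) q)))))))
      bound c b (no n) = trans (cong (λ f → ∂ f b) (if-no (root c ≟ₓ S) n))
        (trans (boundary c b) (cong (λ r → does (b ≟ₓ c) xor does (b ≟ₓ r)) (sym (if-no (root c ≟ₓ S) n))))

  open Forest (forest Es) public using (root; chain; root²; boundary)

  root-next : ∀ e → root (tgt e) ≡ root (src e)
  root-next e = Forest.merged (forest Es) (E-complete e)

  -- The first cohomology of the sphere vanishes.  If z were no coboundary, the linear
  -- map sending (p₁ , p₂ , x , w , ε) to the values of the functionals below would be
  -- injective, whereas by Euler's formula there is one functional less than unknowns.
  module Potentials (c₀ : Crossing) (z : End → Bool) (z-strand : ∀ e → z (next e) ≡ z e) where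

    Potential : (Region → Bool) → Set
    Potential p = (∀ e → p (lo e) xor p (ro e) ≡ z e) × (∀ o → p (circleLeft o) xor p (circleRight o) ≡ false)

    private
      Unknowns : FinSet
      Unknowns = regionᶠ ⊎ᶠ regionᶠ ⊎ᶠ crossingᶠ ⊎ᶠ circleᶠ ⊎ᶠ ⊤ᶠ

      Vector : Set
      Vector = FinSet.Carrier Unknowns → Bool

      r₀ = corner c₀ top

      p₁ p₂ : Vector → Region → Bool
      p₁ u r = u (inj₁ r)
      p₂ u r = u (inj₂ (inj₁ r))
      x : Vector → Crossing → Bool
      x u c = u (inj₂ (inj₂ (inj₁ c)))
      w : Vector → Circle → Bool
      w u o = u (inj₂ (inj₂ (inj₂ (inj₁ o))))
      eps : Vector → Bool
      eps u = u (inj₂ (inj₂ (inj₂ (inj₂ tt))))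

      -- Roots are left out: their values of x serve as constants of the components in `φ-curve`,
      -- while the other values weight the chains in `φ-end`.
      chains : (Crossing → Bool) → End → Bool
      chains x e = ⊕ Cs (λ c → (x c ∧ not (does (root c ≟ₓ c))) ∧ chain c e)

      φ-curve : Crossing × Corner → Vector → Bool
      φ-curve (c , k) u = p₁ u (corner c k) xor x u (root c)
      φ-left φ-right φ-circle : Circle → Vector → Bool
      φ-left   o u = p₁ u (circleLeft o) xor w u o
      φ-right  o u = p₁ u (circleRight o) xor w u o
      φ-circle o u = p₂ u (circleLeft o) xor p₂ u (circleRight o)
      φ-end : End → Vector → Bool
      φ-end e u = (p₂ u (lo e) xor p₂ u (ro e)) xor (chains (x u) e xor (eps u ∧ z e))

      functionals : List (Vector → Bool)
      functionals = map φ-curve representatives ++ map φ-left Os ++ map φ-right Os ++ map φ-end Es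
                    ++ map φ-circle Os ++ (λ u → p₁ u r₀) ∷ (λ u → p₂ u r₀) ∷ []

      m = length representatives
      o = length Os
      n = length Cs
      k = length Rs

      length-functionals : length functionals ≡ m ℕ.+ (o ℕ.+ (o ℕ.+ (n ℕ.* 2 ℕ.+ (o ℕ.+ 2))))
      length-functionals = trans (List.length-++ (map φ-curve representatives)) (cong₂ ℕ._+_ (List.length-map φ-curve representatives)
        (trans (List.length-++ (map φ-left Os)) (cong₂ ℕ._+_ (List.length-map φ-left Os)
        (trans (List.length-++ (map φ-right Os)) (cong₂ ℕ._+_ (List.length-map φ-right Os)
        (trans (List.length-++ (map φ-end Es)) (cong₂ ℕ._+_ (trans (List.length-map φ-end Es) (length-product Cs))
        (trans (List.length-++ (map φ-circle Os)) (cong (ℕ._+ 2) (List.length-map φ-circle Os))))))))))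
        where
        length-product : ∀ (xs : List Crossing) → length (cartesianProduct xs sides) ≡ length xs ℕ.* 2
        length-product []       = refl
        length-product (y ∷ ys) = cong (2 ℕ.+_) (length-product ys)

      size-⊎ : ∀ A B → size (A ⊎ᶠ B) ≡ size A ℕ.+ size B
      size-⊎ A B = trans (List.length-++ (map inj₁ (FinSet.elements A)))
        (cong₂ ℕ._+_ (List.length-map inj₁ (FinSet.elements A)) (List.length-map inj₂ (FinSet.elements B)))

      size-unknowns : size Unknowns ≡ k ℕ.+ (k ℕ.+ (n ℕ.+ (o ℕ.+ 1)))
      size-unknowns = trans (size-⊎ regionᶠ (regionᶠ ⊎ᶠ crossingᶠ ⊎ᶠ circleᶠ ⊎ᶠ ⊤ᶠ)) (cong (k ℕ.+_)
        (trans (size-⊎ regionᶠ (crossingᶠ ⊎ᶠ circleᶠ ⊎ᶠ ⊤ᶠ)) (cong (k ℕ.+_)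
        (trans (size-⊎ crossingᶠ (circleᶠ ⊎ᶠ ⊤ᶠ)) (cong (n ℕ.+_) (size-⊎ circleᶠ ⊤ᶠ))))))

      fewer : length functionals ℕ.< size Unknowns
      fewer = subst₂ ℕ._<_ (sym length-functionals) (sym size-unknowns)
        (ℕ.≤-reflexive (sym (trans (regroup k n o) (trans (cong (ℕ._+ (n ℕ.+ o ℕ.+ 1)) euler) (count m n o)))))
        where
        regroup : ∀ k n o → k ℕ.+ (k ℕ.+ (n ℕ.+ (o ℕ.+ 1))) ≡ 2 ℕ.* k ℕ.+ (n ℕ.+ o ℕ.+ 1)
        regroup = solveℕ
        count : ∀ m n o → n ℕ.+ (m ℕ.+ 2 ℕ.* o) ℕ.+ 2 ℕ.+ (n ℕ.+ o ℕ.+ 1) ≡ suc (m ℕ.+ (o ℕ.+ (o ℕ.+ (n ℕ.* 2 ℕ.+ (o ℕ.+ 2)))))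
        count = solveℕ

      module _ (u v : Vector) (agree : ∀ {φ} → φ ∈ functionals → φ u ≡ φ v) where

        d : Vector
        d a = u a xor v a

        in-curve : ∀ {q} → q ∈ representatives → φ-curve q u ≡ φ-curve q v
        in-curve i = agree (Mem.∈-++⁺ˡ (Mem.∈-map⁺ φ-curve i))
        rest₁ : ∀ {φ} → φ ∈ _ → φ u ≡ φ v
        rest₁ i = agree (Mem.∈-++⁺ʳ (map φ-curve representatives) i)
        rest₂ : ∀ {φ} → φ ∈ _ → φ u ≡ φ v
        rest₂ i = rest₁ (Mem.∈-++⁺ʳ (map φ-left Os) i)
        rest₃ : ∀ {φ} → φ ∈ _ → φ u ≡ φ v
        rest₃ i = rest₂ (Mem.∈-++⁺ʳ (map φ-right Os) i)
        rest₄ : ∀ {φ} → φ ∈ _ → φ u ≡ φ v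
        rest₄ i = rest₃ (Mem.∈-++⁺ʳ (map φ-end Es) i)
        rest₅ : ∀ {φ} → φ ∈ _ → φ u ≡ φ v
        rest₅ i = rest₄ (Mem.∈-++⁺ʳ (map φ-circle Os) i)

        -- One functional per boundary curve is enough, since both the region and the root of the
        -- component are constant along the curve.
        curve-d : ∀ c k → p₁ d (corner c k) ≡ x d (root c)
        curve-d c k = xor-cancel _ _ (trans (sym (invariant F F-step (proj₂ (proj₂ rep)))) (at-rep (proj₁ rep) (proj₁ (proj₂ rep))))
          where
          F : Crossing × Corner → Bool
          F (c , k) = p₁ d (corner c k) xor x d (root c)
          F-step : ∀ q → F (boundaryStep q) ≡ F q
          F-step q = cong₂ (λ r c → p₁ d r xor x d c) (region-step q) (crossing-step root root-next q)
          rep = represented (c , k)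
          at-rep : ∀ q → q ∈ representatives → F q ≡ false
          at-rep (c , k) i = xor-zero (xor-move (p₁ u (corner c k)) (x u (root c)) (p₁ v (corner c k)) (x v (root c)) (in-curve i))

        left-d : ∀ o → p₁ d (circleLeft o) ≡ w d o
        left-d o = xor-move (p₁ u (circleLeft o)) (w u o) (p₁ v (circleLeft o)) (w v o) (rest₁ (Mem.∈-++⁺ˡ (Mem.∈-map⁺ φ-left (O-complete o))))

        right-d : ∀ o → p₁ d (circleRight o) ≡ w d o
        right-d o = xor-move (p₁ u (circleRight o)) (w u o) (p₁ v (circleRight o)) (w v o) (rest₂ (Mem.∈-++⁺ˡ (Mem.∈-map⁺ φ-right (O-complete o))))

        circle-d : ∀ o → p₂ d (circleLeft o) ≡ p₂ d (circleRight o)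
        circle-d o = xor-move (p₂ u (circleLeft o)) (p₂ u (circleRight o)) (p₂ v (circleLeft o)) (p₂ v (circleRight o)) (rest₄ (Mem.∈-++⁺ˡ (Mem.∈-map⁺ φ-circle (O-complete o))))

        p₁-zero : ∀ r → p₁ d r ≡ false
        p₁-zero r = joined-induction (λ r → p₁ d r ≡ false) (λ s _ → step s) (connected r₀ r) (xor-zero (rest₅ (here refl)))
          where
          side : ∀ e → p₁ d (lo e) ≡ p₁ d (ro e)
          side (c , left)  = trans (curve-d c left) (sym (curve-d c top))
          side (c , right) = trans (curve-d c top) (sym (curve-d c right))
          step : ∀ s → (p₁ d (leftOf s) ≡ false → p₁ d (rightOf s) ≡ false) × (p₁ d (rightOf s) ≡ false → p₁ d (leftOf s) ≡ false)
          step (inj₁ e) = trans (sym (side e)) , trans (side e)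
          step (inj₂ o) = trans (trans (right-d o) (sym (left-d o))) , trans (trans (left-d o) (sym (right-d o)))

        x-root : ∀ c → x d (root c) ≡ false
        x-root c = trans (sym (curve-d c top)) (p₁-zero (corner c top))

        chains-d : ∀ e → chains (x u) e xor chains (x v) e ≡ chains (x d) e
        chains-d e = trans (sym (⊕-xor Cs (λ c → (x u c ∧ not (does (root c ≟ₓ c))) ∧ chain c e) (λ c → (x v c ∧ not (does (root c ≟ₓ c))) ∧ chain c e))) (⊕-cong Cs (λ c →
          sym (trans (cong (_∧ chain c e) (Bool.∧-distribʳ-xor (not (does (root c ≟ₓ c))) (x u c) (x v c)))
                     (Bool.∧-distribʳ-xor (chain c e) (x u c ∧ not (does (root c ≟ₓ c))) (x v c ∧ not (does (root c ≟ₓ c)))))))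

        end-d : ∀ e → p₂ d (lo e) xor p₂ d (ro e) ≡ chains (x d) e xor (eps d ∧ z e)
        end-d e = trans (Xor.interchange (p₂ u (lo e)) (p₂ v (lo e)) (p₂ u (ro e)) (p₂ v (ro e)))
          (trans (xor-move (p₂ u (lo e) xor p₂ u (ro e)) (chains (x u) e xor (eps u ∧ z e)) (p₂ v (lo e) xor p₂ v (ro e)) (chains (x v) e xor (eps v ∧ z e))
                   (rest₃ (Mem.∈-++⁺ˡ (Mem.∈-map⁺ φ-end (E-complete e)))))
          (trans (Xor.interchange (chains (x u) e) (eps u ∧ z e) (chains (x v) e) (eps v ∧ z e))
                 (cong₂ _xor_ (chains-d e) (sym (Bool.∧-distribʳ-xor (z e) (eps u) (eps v))))))

        -- By `end-d` the chain is the sum of a coboundary and a multiple of z, both of which are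
        -- cycles.
        ∂-chains : ∀ b → ∂ (chains (x d)) b ≡ false
        ∂-chains b = trans (sym (Bool.xor-identityʳ (∂ (chains (x d)) b)))
          (trans (cong (∂ (chains (x d)) b xor_) (sym (trans (∂-∧ (eps d) z b) (trans (cong (eps d ∧_) (∂-strand z z-strand b)) (Bool.∧-zeroʳ (eps d))))))
          (trans (sym (∂-xor (chains (x d)) (λ e → eps d ∧ z e) b))
          (trans (sym (∂-cong end-d b)) (∂-coboundary (p₂ d) b))))

        -- At a crossing that is not a root only its own chain has boundary; all other chains end
        -- elsewhere or at roots.
        x-zero : ∀ c → x d c ≡ false
        x-zero c = go (root c ≟ₓ c)
          where
          go : Dec (root c ≡ c) → x d c ≡ false
          go (yes e) = trans (cong (x d) (sym e)) (x-root c)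
          go (no ne) = trans (sym at-c) (trans (sym (⊕-single f (C-complete c) C-unique others))
            (trans (sym (trans (∂-⊕ Cs (λ c′ e → (x d c′ ∧ not (does (root c′ ≟ₓ c′))) ∧ chain c′ e) c)
                   (⊕-cong Cs (λ c′ → trans (∂-∧ (x d c′ ∧ not (does (root c′ ≟ₓ c′))) (chain c′) c)
                                             (cong ((x d c′ ∧ not (does (root c′ ≟ₓ c′))) ∧_) (boundary c′ c))))))
                   (∂-chains c)))
            where
            f : Crossing → Bool
            f c′ = (x d c′ ∧ not (does (root c′ ≟ₓ c′))) ∧ (does (c ≟ₓ c′) xor does (c ≟ₓ root c′))
            not-root : ∀ c′ → does (c ≟ₓ root c′) ≡ false
            not-root c′ = dec-false (c ≟ₓ root c′) (λ e → ne (trans (cong root e) (trans (root² c′) (sym e))))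
            at-c : f c ≡ x d c
            at-c = trans (cong₂ (λ r s → (x d c ∧ not r) ∧ s) (dec-false (root c ≟ₓ c) ne)
                           (cong₂ _xor_ (dec-true (c ≟ₓ c) refl) (not-root c)))
                         (trans (Bool.∧-identityʳ (x d c ∧ true)) (Bool.∧-identityʳ (x d c)))
            others : ∀ {c′} → c′ ≢ c → f c′ ≡ false
            others {c′} n = trans (cong ((x d c′ ∧ not (does (root c′ ≟ₓ c′))) ∧_)
                (cong₂ _xor_ (dec-false (c ≟ₓ c′) (n ∘ sym)) (not-root c′))) (Bool.∧-zeroʳ _)

        chains-zero : ∀ e → chains (x d) e ≡ false
        chains-zero e = ⊕-false Cs (λ c → cong (λ b → (b ∧ not (does (root c ≟ₓ c))) ∧ chain c e) (x-zero c))

        conclude : ¬ (∀ a → u a ≡ v a) → ∃ Potential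
        conclude ne = go (eps d) refl
          where
          go : ∀ b → eps d ≡ b → ∃ Potential
          go true  q = p₂ d , (λ e → trans (end-d e) (cong₂ (λ a b → a xor (b ∧ z e)) (chains-zero e) q)) , xor-zero ∘ circle-d
          go false q = contradiction all-equal ne
            where
            ends : ∀ e → p₂ d (lo e) ≡ p₂ d (ro e)
            ends e = xor-cancel _ _ (trans (end-d e) (cong₂ (λ a b → a xor (b ∧ z e)) (chains-zero e) q))
            step : ∀ s → (p₂ d (leftOf s) ≡ false → p₂ d (rightOf s) ≡ false) × (p₂ d (rightOf s) ≡ false → p₂ d (leftOf s) ≡ false)
            step (inj₁ e) = trans (sym (ends e)) , trans (ends e)
            step (inj₂ o) = trans (sym (circle-d o)) , trans (circle-d o)
            p₂-zero : ∀ r → p₂ d r ≡ false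
            p₂-zero r = joined-induction (λ r → p₂ d r ≡ false) (λ s _ → step s) (connected r₀ r) (xor-zero (rest₅ (there (here refl))))
            all-equal : ∀ a → u a ≡ v a
            all-equal (inj₁ r) = xor-cancel _ _ (p₁-zero r)
            all-equal (inj₂ (inj₁ r)) = xor-cancel _ _ (p₂-zero r)
            all-equal (inj₂ (inj₂ (inj₁ c))) = xor-cancel _ _ (x-zero c)
            all-equal (inj₂ (inj₂ (inj₂ (inj₁ o)))) = xor-cancel _ _ (trans (sym (left-d o)) (p₁-zero (circleLeft o)))
            all-equal (inj₂ (inj₂ (inj₂ (inj₂ tt)))) = xor-cancel _ _ q

    potential : ∃ Potential
    potential = let u , v , agree , ne = bool-pigeonhole Unknowns functionals fewer in conclude u v agree ne

-- Euler's formula and connected projections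

module _ (D : Diagram) where
  open Diagram D

  state-or-empty : ∀ i → (∃[ σ ] IsState D i σ) ⊎ Δ̃ D i ≡ []
  state-or-empty i = go (filter (isState? D i) (assignments D (FinSet.elements crossingᶠ))) refl
    where
    go : ∀ xs → filter (isState? D i) (assignments D (FinSet.elements crossingᶠ)) ≡ xs → (∃[ σ ] IsState D i σ) ⊎ Δ̃ D i ≡ []
    go []      e = inj₂ (cong (map (stateWeight D)) e)
    go (σ ∷ _) e = inj₁ (σ , proj₂ (Mem.∈-filter⁻ (isState? D i) {xs = assignments D (FinSet.elements crossingᶠ)} (subst (σ ∈_) (sym e) (here refl))))

  -- Every region is adjacent to the base segment or used, and each crossing uses one region.
  state-size : ∀ {i σ} → IsState D i σ → size regionᶠ ℕ.≤ 2 ℕ.+ size crossingᶠ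
  state-size {i} {σ} (_ , once) = ℤ.drop‿+≤+ (subst₂ ℤ._≤_ (∑-length Rs) total (∑-mono Rs bound))
    where
    open Finite regionᶠ using () renaming (elements to Rs; complete to R-complete)
    open Finite regionᶠ using (δ; ∑-δ1)
    Cs = FinSet.elements crossingᶠ
    u : Region → ℤ
    u r = + usesOf D σ r
    bound : ∀ r → 1ℤ ℤ.≤ u r + (δ r (leftOf i) + δ r (rightOf i))
    bound r = go (r ≟ᴿ leftOf i) (r ≟ᴿ rightOf i)
      where
      go : Dec (r ≡ leftOf i) → Dec (r ≡ rightOf i) → 1ℤ ℤ.≤ u r + (δ r (leftOf i) + δ r (rightOf i))
      go (yes e) _ = ℤ.+-mono-≤ {0ℤ} {u r} (ℤ.+≤+ z≤n) (ℤ.+-mono-≤ {1ℤ} (ℤ.≤-reflexive (sym (⟦⟧-yes (r ≟ᴿ leftOf i) e))) (⟦⟧-nonneg (r ≟ᴿ rightOf i)))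
      go (no _) (yes e) = ℤ.+-mono-≤ {0ℤ} {u r} (ℤ.+≤+ z≤n) (ℤ.+-mono-≤ {0ℤ} {_} {1ℤ} (⟦⟧-nonneg (r ≟ᴿ leftOf i)) (ℤ.≤-reflexive (sym (⟦⟧-yes (r ≟ᴿ rightOf i) e))))
      go (no n) (no m) = ℤ.+-mono-≤ {1ℤ} (ℤ.≤-reflexive (cong +_ (sym (All.lookup once (R-complete r) [ n , m ]′))))
        (ℤ.+-mono-≤ {0ℤ} {_} {0ℤ} (⟦⟧-nonneg (r ≟ᴿ leftOf i)) (⟦⟧-nonneg (r ≟ᴿ rightOf i)))
    total : ∑ Rs (λ r → u r + (δ r (leftOf i) + δ r (rightOf i))) ≡ + (2 ℕ.+ length Cs)
    total = trans (∑-+ Rs u (λ r → δ r (leftOf i) + δ r (rightOf i)))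
      (trans (cong₂ _+_ sum-u (trans (∑-+ Rs (λ r → δ r (leftOf i)) (λ r → δ r (rightOf i))) (cong₂ _+_ (∑-δ1 (leftOf i)) (∑-δ1 (rightOf i)))))
             (ℤ.+-comm (+ length Cs) (+ 2)))
      where
      sum-u : ∑ Rs u ≡ + length Cs
      sum-u = trans (∑-cong Rs (λ r → ∑-count (λ c → corner c (σ c) ≟ᴿ r) Cs))
        (trans (∑-swap Rs Cs (λ r c → δ (corner c (σ c)) r))
        (trans (∑-cong Cs (λ c → trans (∑-cong Rs (λ r → Finite.δ-sym regionᶠ (corner c (σ c)) r)) (∑-δ1 (corner c (σ c))))) (∑-length Cs)))

module Counting (D : Diagram) (sphere : OnSphere D) (c₀ : Diagram.Crossing D) where
  open Sphere D sphere

  -- One entry for each boundary curve, namely the region it bounds; a repeated entry is a region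
  -- with several boundary curves.
  boundaries : List Region
  boundaries = map regionAt representatives ++ map circleLeft Os ++ map circleRight Os

  corner-bounded : ∀ c k → ∃[ x ] x ∈ representatives × Reach x (c , k) × regionAt x ≡ corner c k
  corner-bounded c k = let x , i , r = represented (c , k) in x , i , r , invariant regionAt region-step r

  bounded-corner : ∀ c k → corner c k ∈ boundaries
  bounded-corner c k = let x , i , _ , e = corner-bounded c k in subst (_∈ boundaries) e (Mem.∈-++⁺ˡ (Mem.∈-map⁺ regionAt i))

  bounded-left : ∀ o → circleLeft o ∈ boundaries
  bounded-left o = Mem.∈-++⁺ʳ (map regionAt representatives) (Mem.∈-++⁺ˡ (Mem.∈-map⁺ circleLeft (O-complete o)))

  bounded-right : ∀ o → circleRight o ∈ boundaries
  bounded-right o = Mem.∈-++⁺ʳ (map regionAt representatives) (Mem.∈-++⁺ʳ (map circleLeft Os) (Mem.∈-map⁺ circleRight (O-complete o)))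

  bounded : ∀ r → r ∈ boundaries
  bounded r = joined-induction (_∈ boundaries) (λ s _ → (λ _ → on-right s) , (λ _ → on-left s)) (connected (corner c₀ top) r) (bounded-corner c₀ top)
    where
    on-left : ∀ s → leftOf s ∈ boundaries
    on-left (inj₁ (c , left))  = bounded-corner c left
    on-left (inj₁ (c , right)) = bounded-corner c top
    on-left (inj₂ o)           = bounded-left o
    on-right : ∀ s → rightOf s ∈ boundaries
    on-right (inj₁ (c , left))  = bounded-corner c top
    on-right (inj₁ (c , right)) = bounded-corner c right
    on-right (inj₂ o)           = bounded-right o

  length-boundaries : length boundaries ≡ length representatives ℕ.+ 2 ℕ.* length Os
  length-boundaries = trans (List.length-++ (map regionAt representatives)) (cong₂ ℕ._+_ (List.length-map regionAt representatives)
    (trans (List.length-++ (map circleLeft Os)) (cong₂ ℕ._+_ (List.length-map circleLeft Os)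
      (trans (List.length-map circleRight Os) (sym (ℕ.+-identityʳ (length Os)))))))

  private
    n = length Cs
    k = length Rs
    b = length boundaries

    euler′ : k ℕ.+ k ≡ (2 ℕ.+ n) ℕ.+ b
    euler′ = trans (cong (k ℕ.+_) (sym (ℕ.+-identityʳ k))) (trans euler (trans (cong (λ z → n ℕ.+ z ℕ.+ 2) (sym length-boundaries)) (alg n b)))
      where
      alg : ∀ n b → n ℕ.+ b ℕ.+ 2 ≡ (2 ℕ.+ n) ℕ.+ b
      alg = solveℕ

  -- With b boundary curves and k regions Euler's formula reads 2k = (2 + n) + b, and b is at least
  -- k. Together with `state-size`, the existence of a state forces equality.
  crossings-bound : 2 ℕ.+ length Cs ℕ.≤ length Rs
  crossings-bound = ℕ.+-cancelʳ-≤ k (2 ℕ.+ n) k (ℕ.≤-trans (ℕ.+-monoʳ-≤ (2 ℕ.+ n) (unique-⊆-length R-unique (λ {r} _ → bounded r)))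
    (ℕ.≤-reflexive (sym euler′)))

  -- Equality means that every region has a single boundary curve.
  module Tight (tight : 2 ℕ.+ length Cs ≡ length Rs) where

    private
      unique-boundaries : Unique boundaries
      unique-boundaries = covered-unique _≟ᴿ_ R-unique (λ {r} _ → bounded r)
        (ℕ.≤-reflexive (sym (ℕ.+-cancelˡ-≡ k k b (trans euler′ (cong (ℕ._+ b) tight)))))

    one-curve : ∀ q q′ → regionAt q ≡ regionAt q′ → ∃[ x ] Reach x q × Reach x q′
    one-curve (c , k) (c′ , k′) e =
      let x , i , r , f = corner-bounded c k
          x′ , i′ , r′ , f′ = corner-bounded c′ k′
          x≡x′ = unique-map-injective regionAt (unique-++ˡ (map regionAt representatives) unique-boundaries) i i′ (trans f (trans e (sym f′)))
      in x , r , subst (λ y → Reach y (c′ , k′)) (sym x≡x′) r′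

    private
      circle-region : ∀ {r} → r ∈ map circleLeft Os ++ map circleRight Os → ∀ c k → corner c k ≢ r
      circle-region {r} i c k e = let x , j , _ , f = corner-bounded c k in
        unique-++-disjoint (map regionAt representatives) unique-boundaries (Mem.∈-map⁺ regionAt j) i (trans f e)

    -- A circle without crossings would be the only boundary curve of each of its two regions, which
    -- would thus be cut off from the crossings.
    no-circle : Circle → ⊥
    no-circle o = circle-at (joined-induction On (λ s _ → step s) (connected (circleLeft o) (corner c₀ top)) (inj₁ refl))
      where
      On : Region → Set
      On r = r ≡ circleLeft o ⊎ r ≡ circleRight o
      circle-at : ∀ {c k} → On (corner c k) → ⊥
      circle-at {c} {k} (inj₁ e) = circle-region (Mem.∈-++⁺ˡ (Mem.∈-map⁺ circleLeft (O-complete o))) c k e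
      circle-at {c} {k} (inj₂ e) = circle-region (Mem.∈-++⁺ʳ (map circleLeft Os) (Mem.∈-map⁺ circleRight (O-complete o))) c k e
      u = unique-++ʳ (map regionAt representatives) unique-boundaries
      same-left : ∀ {o′} → On (circleLeft o′) → o′ ≡ o
      same-left (inj₁ e) = unique-map-injective circleLeft (unique-++ˡ (map circleLeft Os) u) (O-complete _) (O-complete _) e
      same-left (inj₂ e) = contradiction e (unique-++-disjoint (map circleLeft Os) u (Mem.∈-map⁺ circleLeft (O-complete _)) (Mem.∈-map⁺ circleRight (O-complete _)))
      same-right : ∀ {o′} → On (circleRight o′) → o′ ≡ o
      same-right (inj₂ e) = unique-map-injective circleRight (unique-++ʳ (map circleLeft Os) u) (O-complete _) (O-complete _) e
      same-right (inj₁ e) = contradiction (sym e) (unique-++-disjoint (map circleLeft Os) u (Mem.∈-map⁺ circleLeft (O-complete _)) (Mem.∈-map⁺ circleRight (O-complete _)))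
      step : ∀ s → (On (leftOf s) → On (rightOf s)) × (On (rightOf s) → On (leftOf s))
      step (inj₁ (c , left))  = (λ h → ⊥-elim (circle-at {c} h)) , (λ h → ⊥-elim (circle-at {c} h))
      step (inj₁ (c , right)) = (λ h → ⊥-elim (circle-at {c} h)) , (λ h → ⊥-elim (circle-at {c} h))
      step (inj₂ o′) = (λ h → inj₂ (cong circleRight (same-left h))) , (λ h → inj₁ (cong circleLeft (same-right h)))

    region-crossings : ∀ (Q : Crossing → Set) → (∀ e → Q (src e) → Q (tgt e)) → (∀ e → Q (tgt e) → Q (src e)) →
                       ∀ q q′ → regionAt q ≡ regionAt q′ → Q (proj₁ q) → Q (proj₁ q′)
    region-crossings Q fw bw q q′ e h = let x , r , r′ = one-curve q q′ e in forward r′ (backward r h)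
      where
      in-crossing : ∀ e → proj₁ (leftOfIn e) ≡ proj₁ e
      in-crossing (_ , left)  = refl
      in-crossing (_ , right) = refl
      out-crossing : ∀ e → proj₁ (rightOfOut e) ≡ proj₁ e
      out-crossing (_ , left)  = refl
      out-crossing (_ , right) = refl
      ahead : ∀ e → (Q (proj₁ e) → Q (proj₁ (leftOfIn (next e)))) × (Q (proj₁ (leftOfIn (next e))) → Q (proj₁ e))
      ahead e = (subst Q (sym (in-crossing (next e))) ∘ fw e) , (bw e ∘ subst Q (in-crossing (next e)))
      behind : ∀ e → (Q (proj₁ e) → Q (proj₁ (rightOfOut (prev e)))) × (Q (proj₁ (rightOfOut (prev e))) → Q (proj₁ e))
      behind e = (subst Q (sym (out-crossing (prev e))) ∘ bw (prev e) ∘ subst Q (cong proj₁ (sym (next-prev e))))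
               , (subst Q (cong proj₁ (next-prev e)) ∘ fw (prev e) ∘ subst Q (out-crossing (prev e)))
      step : ∀ q → (Q (proj₁ q) → Q (proj₁ (boundaryStep q))) × (Q (proj₁ (boundaryStep q)) → Q (proj₁ q))
      step (c , left)   = ahead (c , left)
      step (c , top)    = ahead (c , right)
      step (c , right)  = behind (c , right)
      step (c , bottom) = behind (c , left)
      forward : ∀ {x y} → Reach x y → Q (proj₁ x) → Q (proj₁ y)
      forward (zero , refl)      h = h
      forward {x} (suc m , refl) h = forward (m , refl) (proj₁ (step x) h)
      backward : ∀ {x y} → Reach x y → Q (proj₁ y) → Q (proj₁ x)
      backward (zero , refl)      h = h
      backward {x} (suc m , refl) h = proj₂ (step x) (backward (m , refl) h)

    -- Q passes around the single boundary curve of each region, and neighbouring regions share a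
    -- crossing. In effect, the projection is connected.
    all-crossings : ∀ (Q : Crossing → Set) → (∀ e → Q (src e) → Q (tgt e)) → (∀ e → Q (tgt e) → Q (src e)) →
                    ∀ c c′ → Q c → Q c′
    all-crossings Q fw bw c c′ h = joined-induction R (λ s _ → step s) (connected (corner c top) (corner c′ top))
        (λ q e → region-crossings Q fw bw (c , top) q (sym e) h) (c′ , top) refl
      where
      R : Region → Set
      R r = ∀ q → regionAt q ≡ r → Q (proj₁ q)
      move : ∀ c k j → R (corner c k) → R (corner c j)
      move c k j f q e = region-crossings Q fw bw (c , j) q (sym e) (f (c , k) refl)
      step : ∀ s → (R (leftOf s) → R (rightOf s)) × (R (rightOf s) → R (leftOf s))
      step (inj₁ (c , left))  = move c left top , move c top left
      step (inj₁ (c , right)) = move c top right , move c right top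
      step (inj₂ o)           = ⊥-elim (no-circle o)

    module _ (alternating : Alternating D) where

      shadeAt : Crossing × Corner → Bool
      shadeAt (c , k) = shade (over c) k

      atIn atOut : End → Bool
      atIn  (c , s) = overAtIn  (over c) s
      atOut (c , s) = overAtOut (over c) s

      private
        in-left-shade : ∀ e → shadeAt (leftOfIn e) ≡ not (atIn e)
        in-left-shade (c , left)  with over c
        ... | bl→tr = refl
        ... | br→tl = refl
        in-left-shade (c , right) with over c
        ... | bl→tr = refl
        ... | br→tl = refl
        in-right-shade : ∀ e → shadeAt (rightOfIn e) ≡ atIn e
        in-right-shade (c , left)  with over c
        ... | bl→tr = refl
        ... | br→tl = refl
        in-right-shade (c , right) with over c
        ... | bl→tr = refl
        ... | br→tl = refl
        out-right-shade : ∀ e → shadeAt (rightOfOut e) ≡ not (atOut e)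
        out-right-shade (c , left)  with over c
        ... | bl→tr = refl
        ... | br→tl = refl
        out-right-shade (c , right) with over c
        ... | bl→tr = refl
        ... | br→tl = refl
        ahead : ∀ e → shadeAt (leftOfIn (next e)) ≡ atOut e
        ahead e = trans (in-left-shade (next e)) (trans (cong not (alternating e)) (Bool.not-involutive (atOut e)))
        behind : ∀ e → shadeAt (rightOfOut (prev e)) ≡ shadeAt (rightOfIn e)
        behind e = trans (out-right-shade (prev e)) (trans (sym (alternating (prev e)))
                   (trans (cong atIn (next-prev e)) (sym (in-right-shade e))))
        out-left : ∀ o → overAtOut o left ≡ shade o left
        out-left bl→tr = refl
        out-left br→tl = refl
        out-top : ∀ o → overAtOut o right ≡ shade o top
        out-top bl→tr = refl
        out-top br→tl = refl

      shade-step : ∀ q → shadeAt (boundaryStep q) ≡ shadeAt q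
      shade-step (c , left)   = trans (ahead (c , left)) (out-left (over c))
      shade-step (c , top)    = trans (ahead (c , right)) (out-top (over c))
      shade-step (c , right)  = behind (c , right)
      shade-step (c , bottom) = behind (c , left)

      -- By alternation the shade does not change along a boundary curve, and a region has only one
      -- such curve.
      coloured : ∀ c k c′ k′ → corner c k ≡ corner c′ k′ → shade (over c) k ≡ shade (over c′) k′
      coloured c k c′ k′ e = let x , r , r′ = one-curve (c , k) (c′ , k′) e in
        trans (sym (invariant shadeAt shade-step r)) (invariant shadeAt shade-step r′)

      spreading : ∀ (Θ : Region → Region → Set) →
        (∀ c i j → Θ (corner c (lf i)) (corner c (rt i)) → Θ (corner c (lf j)) (corner c (rt j))) →
        ∀ c i c′ j → Θ (corner c (lf i)) (corner c (rt i)) → Θ (corner c′ (lf j)) (corner c′ (rt j))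
      spreading Θ h c i c′ j θ = h c′ top j (all-crossings Q fw bw c c′ (h c i top θ))
        where
        Q : Crossing → Set
        Q c = Θ (corner c (lf top)) (corner c (rt top))
        out : ∀ e → (Q (src e) → Θ (lo e) (ro e)) × (Θ (lo e) (ro e) → Q (src e))
        out (c , left)  = id , id
        out (c , right) = h c top right , h c right top
        in′ : ∀ e → (Q (src e) → Θ (regionAt (leftOfIn e)) (regionAt (rightOfIn e))) × (Θ (regionAt (leftOfIn e)) (regionAt (rightOfIn e)) → Q (src e))
        in′ (c , left)  = h c top left , h c left top
        in′ (c , right) = h c top bottom , h c bottom top
        fw : ∀ e → Q (src e) → Q (tgt e)
        fw e q = proj₂ (in′ (next e)) (subst₂ Θ (sym (left-ok e)) (sym (right-ok e)) (proj₁ (out e) q))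
        bw : ∀ e → Q (tgt e) → Q (src e)
        bw e q = proj₂ (out e) (subst₂ Θ (left-ok e) (right-ok e) (proj₁ (in′ (next e)) q))

      coherent : Coherent D
      coherent = record { seg = ∑-segments ; connected = λ Θ h c i c′ j θ ¬θ → ¬θ (spreading Θ h c i c′ j θ) ; coloured = coloured }

-- Orbits of a permutation

module Permutation (A : FinSet) (f g : FinSet.Carrier A → FinSet.Carrier A)
                   (fg : ∀ x → f (g x) ≡ x) (gf : ∀ x → g (f x) ≡ x) where
  open FinSet A
  open Iteration A f using (repeats)

  f-injective : ∀ {x y} → f x ≡ f y → x ≡ y
  f-injective {x} {y} e = trans (sym (gf x)) (trans (cong g e) (gf y))

  iter-injective : ∀ n {x y} → iter f n x ≡ iter f n y → x ≡ y
  iter-injective zero    e = e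
  iter-injective (suc n) e = f-injective (iter-injective n e)

  period : ∀ x → ∃[ d ] suc d ℕ.≤ size A × iter f (suc d) x ≡ x
  period x = let i , j , i<j , j≤ , e = repeats x in go i j i<j j≤ e
    where
    go : ∀ i j → i ℕ.< j → j ℕ.≤ size A → iter f i x ≡ iter f j x → ∃[ d ] suc d ℕ.≤ size A × iter f (suc d) x ≡ x
    go i j i<j j≤ e = d , ℕ.≤-trans (subst (suc d ℕ.≤_) j≡ (ℕ.m≤n+m (suc d) i)) j≤ ,
        sym (iter-injective i (trans e (trans (cong (λ m → iter f m x) (trans (sym j≡) (ℕ.+-comm i (suc d)))) (iter-+ f (suc d) i x))))
      where
      d = j ℕ.∸ suc i
      j≡ : i ℕ.+ suc d ≡ j
      j≡ = trans (ℕ.+-suc i d) (ℕ.m+[n∸m]≡n i<j)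

  iterate-∈ : ∀ x {m n} → m ℕ.< n → iter f m x ∈ iterate f x n
  iterate-∈ x {zero}  (s≤s _) = here refl
  iterate-∈ x {suc m} (s≤s h) = there (iterate-∈ (f x) h)

  iterate-⁻ : ∀ {y} x n → y ∈ iterate f x n → ∃[ m ] m ℕ.< n × iter f m x ≡ y
  iterate-⁻ x (suc n) (here e)  = 0 , s≤s z≤n , sym e
  iterate-⁻ x (suc n) (there i) = let m , h , e = iterate-⁻ (f x) n i in suc m , s≤s h , e

  -- The period is at most the number of elements, so a list of that length, as in `circleThrough`,
  -- exhausts the orbit.
  orbit-∈ : ∀ x m → iter f m x ∈ iterate f x (size A)
  orbit-∈ x m = go m m ℕ.≤-refl
    where
    d = proj₁ (period x)
    go : ∀ fuel m → m ℕ.≤ fuel → iter f m x ∈ iterate f x (size A)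
    go fuel m m≤ with m ℕ.<? size A
    ... | yes h = iterate-∈ x h
    go zero m z≤n | no h = contradiction (ℕ.≤-trans (s≤s z≤n) (proj₁ (proj₂ (period x)))) h
    go (suc fuel) m m≤ | no h = subst (_∈ iterate f x (size A)) same (go fuel (m ℕ.∸ suc d) (ℕ.≤-pred (ℕ.≤-trans smaller m≤)))
      where
      d≤m : suc d ℕ.≤ m
      d≤m = ℕ.≤-trans (proj₁ (proj₂ (period x))) (ℕ.≮⇒≥ h)
      smaller : suc (m ℕ.∸ suc d) ℕ.≤ m
      smaller = ℕ.≤-trans (s≤s (ℕ.m≤n+m (m ℕ.∸ suc d) d)) (ℕ.≤-reflexive (ℕ.m+[n∸m]≡n d≤m))
      same : iter f (m ℕ.∸ suc d) x ≡ iter f m x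
      same = trans (cong (iter f (m ℕ.∸ suc d)) (sym (proj₂ (proj₂ (period x)))))
            (trans (sym (iter-+ f (suc d) (m ℕ.∸ suc d) x)) (cong (λ k → iter f k x) (ℕ.m+[n∸m]≡n d≤m)))

  orbit-back : ∀ x m → ∃[ m′ ] iter f m′ (iter f m x) ≡ x
  orbit-back x zero    = 0 , refl
  orbit-back x (suc m) = let m′ , e = orbit-back (f x) m ; d , _ , p = period x in
    m′ ℕ.+ d , trans (iter-+ f m′ d (iter f m (f x))) (trans (cong (iter f d) e) p)

-- The two sides of C

module Sides (L : Diagram) (sphere : OnSphere L) (C : Diagram.End L) (S : SeifertCircle.Complement L C) where
  open Sphere L sphere public
  open SeifertCircle L C public using (OnC; BelongsTo; belongsTo?; In; in?; Connecting; connecting?)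
  open SeifertCircle.Complement S public
  open Permutation endᶠ next prev next-prev prev-next public
  open import Data.List.Membership.DecPropositional _≟ᴱ_ public using (_∈?_)

  On : End → Set
  On e = e ∈ circleThrough L C

  on? : ∀ e → Dec (On e)
  on? e = e ∈? circleThrough L C

  C-on : On C
  C-on = orbit-∈ C 0

  on-next : ∀ {e} → On e → On (next e)
  on-next i = let m , _ , q = iterate-⁻ C (size endᶠ) i in
    subst On (trans (iter-suc next m C) (cong next q)) (orbit-∈ C (suc m))

  on-induction : ∀ (P : End → Set) → (∀ {e} → On e → P e → P (next e)) → P C → ∀ {e} → On e → P e
  on-induction P h base i = let m , _ , q = iterate-⁻ C (size endᶠ) i in subst P q (go m C-on base)
    where
    go : ∀ m {e} → On e → P e → P (iter next m e)
    go zero    o x = x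
    go (suc m) o x = go m (on-next o) (h o x)

  on-reach : ∀ {e e′} → On e → On e′ → ∃[ m ] iter next m e ≡ e′
  on-reach i j = let m , _ , q = iterate-⁻ C (size endᶠ) i ; n , _ , q′ = iterate-⁻ C (size endᶠ) j
                     k , back = orbit-back C m in
    k ℕ.+ n , trans (iter-+ next k n _) (trans (cong (iter next n) (trans (cong (iter next k) (sym q)) back)) q′)

  on-next⁻ : ∀ {e} → On (next e) → On e
  on-next⁻ {e} i = let d , _ , p = period e in subst On p (go d i)
    where
    go : ∀ m {x} → On x → On (iter next m x)
    go zero    o = o
    go (suc m) o = go m (on-next o)

  on-prev : ∀ {e} → On (prev e) → On e
  on-prev {e} i = subst On (next-prev e) (on-next i)

  on-prev⁻ : ∀ {e} → On e → On (prev e)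
  on-prev⁻ {e} i = on-next⁻ (subst On (sym (next-prev e)) i)

  private
    z : End → Bool
    z e = does (on? e)

    -- The indicator of C is constant along `next`, hence a coboundary: p changes exactly on
    -- crossing C.
    potential-of-C = Potentials.potential (src C) z (λ e → does-cong (on? (next e)) (on? e) on-next⁻ on-next)
    p = proj₁ potential-of-C

    p-end : ∀ e → p (lo e) xor p (ro e) ≡ z e
    p-end = proj₁ (proj₂ potential-of-C)

    p-joined : ∀ {r r′} → Joined (¬_ ∘ OnC) r r′ → p r ≡ p r′
    p-joined {r} j = joined-induction (λ r′ → p r ≡ p r′) step j refl
      where
      step : ∀ s → ¬ OnC s → (p r ≡ p (leftOf s) → p r ≡ p (rightOf s)) × (p r ≡ p (rightOf s) → p r ≡ p (leftOf s))
      step (inj₁ e) n = (λ h → trans h eq) , (λ h → trans h (sym eq))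
        where
        eq : p (lo e) ≡ p (ro e)
        eq = xor-cancel _ _ (trans (p-end e) (dec-false (on? e) n))
      step (inj₂ o) n = (λ h → trans h eq) , (λ h → trans h (sym eq))
        where
        eq : p (circleLeft o) ≡ p (circleRight o)
        eq = xor-cancel _ _ (proj₂ (proj₂ potential-of-C) o)

  side-off : ∀ {e} → ¬ On e → side (lo e) ≡ side (ro e)
  side-off {e} n = Equivalence.from (component (lo e) (ro e)) (fwd (inj₁ e , n , refl , refl) ◅ ε)

  private
    p-on : ∀ {e} → On e → p (lo e) ≢ p (ro e)
    p-on {e} i q = true≢false (trans (sym (trans (p-end e) (dec-true (on? e) i))) (xor-zero q))
      where
      true≢false : true ≢ false
      true≢false ()

  -- The separation statement for C: p is constant on the components of the complement but differs
  -- on the two sides of e.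
  side-on : ∀ {e} → On e → side (lo e) ≢ side (ro e)
  side-on {e} i q = p-on i (p-joined (Equivalence.to (component (lo e) (ro e)) q))

  private
    p-top-bottom : ∀ c → p (corner c bottom) ≡ p (corner c top)
    p-top-bottom c = cancel (p (corner c left)) _ _ (trans
        (trans (sym (cong₂ (λ x y → p x xor p y) (in-left (c , left)) (in-right (c , left))))
               (trans (p-end (prev (c , left))) (does-cong (on? _) (on? _) on-prev on-prev⁻)))
        (sym (p-end (c , left))))
      where
      cancel : ∀ a x y → a xor x ≡ a xor y → x ≡ y
      cancel true  x y e = trans (sym (Bool.not-involutive x)) (trans (cong not e) (Bool.not-involutive y))
      cancel false x y e = e

    p-left : ∀ e → p (lo (next e)) ≡ p (lo e)
    p-left e = trans (same (next e)) (cong p (left-ok e))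
      where
      same : ∀ e → p (lo e) ≡ p (regionAt (leftOfIn e))
      same (c , left)  = refl
      same (c , right) = sym (p-top-bottom c)

    p-left-C : ∀ {e} → On e → p (lo e) ≡ p (lo C)
    p-left-C = on-induction (λ e → p (lo e) ≡ p (lo C)) (λ {e} _ h → trans (p-left e) h) refl

  -- Along C the value of p on its left is constant. Two strands of C at the same crossing would
  -- have the left and the top corner on their left, where p differs.
  no-double : ∀ c → On (c , left) → On (c , right) → ⊥
  no-double c i j = p-on i (trans (p-left-C i) (sym (p-left-C j)))

  -- C can separate only the left or the right corner from the rest, so top and bottom lie on the
  -- side to which the crossing belongs.
  own : Crossing → Bool
  own c = side (corner c top)

  private
    off-left : ∀ c → ¬ On (c , left) → side (corner c left) ≡ side (corner c top) × side (corner c left) ≡ side (corner c bottom)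
    off-left c n = side-off n , trans (cong side (sym (in-left (c , left))))
      (trans (side-off (n ∘ on-prev)) (cong side (in-right (c , left))))

    off-right : ∀ c → ¬ On (c , right) → side (corner c top) ≡ side (corner c right) × side (corner c bottom) ≡ side (corner c right)
    off-right c n = side-off n , trans (cong side (sym (in-left (c , right))))
      (trans (side-off (n ∘ on-prev)) (cong side (in-right (c , right))))

  own-bottom : ∀ c → side (corner c bottom) ≡ own c
  own-bottom c = go (on? (c , left))
    where
    go : Dec (On (c , left)) → side (corner c bottom) ≡ own c
    go (yes i) = let e , f = off-right c (no-double c i) in trans f (sym e)
    go (no n)  = let e , f = off-left c n in trans (sym f) e

  own-left : ∀ c → ¬ On (c , left) → side (corner c left) ≡ own c
  own-left c n = proj₁ (off-left c n)

  own-right : ∀ c → ¬ On (c , right) → side (corner c right) ≡ own c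
  own-right c n = sym (proj₁ (off-right c n))

  strand : Side → Corner
  strand left  = left
  strand right = right

  own-strand : ∀ c s → ¬ On (c , s) → side (corner c (strand s)) ≡ own c
  own-strand c left  = own-left c
  own-strand c right = own-right c

  foreign-strand : ∀ {c s} → On (c , s) → side (corner c (strand s)) ≢ own c
  foreign-strand {c} {left}  i e = side-on i e
  foreign-strand {c} {right} i e = side-on i (sym e)

  data CornerSide (c : Crossing) : Corner → Set where
    owned   : ∀ {k} → side (corner c k) ≡ own c → CornerSide c k
    foreign : ∀ {s} → On (c , s) → side (corner c (strand s)) ≢ own c → CornerSide c (strand s)

  corner-side : ∀ c k → CornerSide c k
  corner-side c top    = owned refl
  corner-side c bottom = owned (own-bottom c)
  corner-side c left with on? (c , left)
  ... | yes i = foreign {s = left} i (foreign-strand i)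
  ... | no n  = owned (own-left c n)
  corner-side c right with on? (c , right)
  ... | yes i = foreign {s = right} i (foreign-strand i)
  ... | no n  = owned (own-right c n)

  not-eq : ∀ {a b} → a ≢ b → a ≡ not b
  not-eq {true}  {true}  n = contradiction refl n
  not-eq {true}  {false} n = refl
  not-eq {false} {true}  n = refl
  not-eq {false} {false} n = contradiction refl n

  not-≢ : ∀ {b} → b ≢ not b
  not-≢ {true}  ()
  not-≢ {false} ()

  belongs : ∀ {b c} → own c ≡ b → BelongsTo S b c
  belongs {b} {c} e = ℤ.drop‿+≤+ (subst (+ 2 ℤ.≤_) (sym (∑-count (λ k → in? S b (corner c k)) corners))
    (ℤ.+-mono-≤ {1ℤ} (ℤ.≤-reflexive (sym (⟦⟧-yes (in? S b (corner c top)) e)))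
      (ℤ.+-mono-≤ {1ℤ} (ℤ.≤-reflexive (sym (⟦⟧-yes (in? S b (corner c bottom)) (trans (own-bottom c) e))))
        (ℤ.+-mono-≤ {0ℤ} {_} {0ℤ} (⟦⟧-nonneg (in? S b (corner c left))) (ℤ.+-mono-≤ {0ℤ} {_} {0ℤ} (⟦⟧-nonneg (in? S b (corner c right))) ℤ.≤-refl)))))

  belongs⁻ : ∀ {b c} → BelongsTo S b c → own c ≡ b
  belongs⁻ {b} {c} h = decidable-stable (own c Bool.≟ b) (λ n → ℤ.<-irrefl refl (ℤ.≤-<-trans
      (ℤ.≤-trans (ℤ.+≤+ h) (ℤ.≤-reflexive (∑-count (λ k → in? S b (corner c k)) corners))) (small n)))
    where
    small : own c ≢ b → ∑ corners (λ k → ⟦ in? S b (corner c k) ⟧) ℤ.< + 2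
    small n = subst (ℤ._< + 2) (sym (cong₂ _+_ (⟦⟧-no (in? S b (corner c top)) n)
        (cong₂ _+_ (⟦⟧-no (in? S b (corner c bottom)) (λ q → n (trans (sym (own-bottom c)) q))) refl)))
        (go (on? (c , left)) (on? (c , right)))
      where
      le1 : ∀ {P : Set} (d : Dec P) → ⟦ d ⟧ ℤ.≤ 1ℤ
      le1 (yes _) = ℤ.≤-refl
      le1 (no _)  = ℤ.+≤+ z≤n
      goal = 0ℤ + (0ℤ + (⟦ in? S b (corner c left) ⟧ + (⟦ in? S b (corner c right) ⟧ + 0ℤ))) ℤ.< + 2
      bound : ⟦ in? S b (corner c left) ⟧ + ⟦ in? S b (corner c right) ⟧ ℤ.≤ 1ℤ → goal
      bound h = ℤ.≤-<-trans (ℤ.≤-reflexive (alg ⟦ in? S b (corner c left) ⟧ ⟦ in? S b (corner c right) ⟧)) (ℤ.≤-<-trans h (ℤ.+<+ (s≤s (s≤s z≤n))))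
        where
        alg : ∀ x y → 0ℤ + (0ℤ + (x + (y + 0ℤ))) ≡ x + y
        alg = solve-∀
      go : Dec (On (c , left)) → Dec (On (c , right)) → goal
      go (yes i) (yes j) = ⊥-elim (no-double c i j)
      go (no m) _ = bound (subst (ℤ._≤ 1ℤ) (sym (trans (cong (_+ ⟦ in? S b (corner c right) ⟧) (⟦⟧-no (in? S b (corner c left)) (λ q → n (trans (sym (own-left c m)) q)))) (ℤ.+-identityˡ _)))
                              (le1 (in? S b (corner c right))))
      go (yes _) (no m) = bound (subst (ℤ._≤ 1ℤ) (sym (trans (cong (_+_ ⟦ in? S b (corner c left) ⟧) (⟦⟧-no (in? S b (corner c right)) (λ q → n (trans (sym (own-right c m)) q)))) (ℤ.+-identityʳ _)))
                              (le1 (in? S b (corner c left))))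

  off-own : ∀ {e} → ¬ On e → own (src e) ≡ own (tgt e)
  off-own {e} n = trans (at-src e n) (trans (cong side (sym (left-ok e))) (at-tgt (next e) (n ∘ on-next⁻)))
    where
    at-src : ∀ e → ¬ On e → own (src e) ≡ side (lo e)
    at-src (c , left)  n = sym (side-off n)
    at-src (c , right) n = refl
    at-tgt : ∀ e → ¬ On e → side (regionAt (leftOfIn e)) ≡ own (src e)
    at-tgt (c , left)  n = own-left c n
    at-tgt (c , right) n = own-bottom c

  changes-on : ∀ {e} → own (src e) ≢ own (tgt e) → On e
  changes-on {e} n = decidable-stable (on? e) (n ∘ off-own)

  bank : Bool → End → Region
  bank b e = if does (side (lo e) Bool.≟ b) then lo e else ro e

  bank-side : ∀ {b e} → On e → side (bank b e) ≡ b
  bank-side {b} {e} i = go (side (lo e) Bool.≟ b)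
    where
    go : Dec (side (lo e) ≡ b) → side (bank b e) ≡ b
    go (yes q) = trans (cong side (if-yes (side (lo e) Bool.≟ b) q)) q
    go (no n) = trans (cong side (if-no (side (lo e) Bool.≟ b) n)) (lemma n (side-on i))
      where
      lemma : ∀ {x y b} → x ≢ b → x ≢ y → y ≡ b
      lemma {x} {y} {b} n m = trans (not-eq (m ∘ sym)) (trans (cong not (not-eq n)) (Bool.not-involutive b))

  bank-unique : ∀ {b e r} → On e → r ≡ lo e ⊎ r ≡ ro e → side r ≡ b → r ≡ bank b e
  bank-unique {b} {e} i (inj₁ refl) q = sym (if-yes (side (lo e) Bool.≟ b) q)
  bank-unique {b} {e} i (inj₂ refl) q = sym (if-no (side (lo e) Bool.≟ b) (λ h → side-on i (trans h (sym q))))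

  bank-adjacent : ∀ b e → bank b e ≡ lo e ⊎ bank b e ≡ ro e
  bank-adjacent b e = go (side (lo e) Bool.≟ b)
    where
    go : Dec (side (lo e) ≡ b) → bank b e ≡ lo e ⊎ bank b e ≡ ro e
    go (yes q) = inj₁ (if-yes (side (lo e) Bool.≟ b) q)
    go (no n) = inj₂ (if-no (side (lo e) Bool.≟ b) n)

  bank-out : ∀ {c s b} → On (c , s) → own c ≡ b → bank (not b) (c , s) ≡ corner c (strand s)
  bank-out {c} {left}  i refl = sym (bank-unique i (inj₁ refl) (not-eq (foreign-strand i)))
  bank-out {c} {right} i refl = sym (bank-unique i (inj₂ refl) (not-eq (foreign-strand i)))

  bank-in : ∀ {e b} → On e → own (tgt e) ≡ b → bank (not b) e ≡ corner (tgt e) (strand (proj₂ (next e)))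
  bank-in {e} i refl = sym (bank-unique i (adj (next e) (left-ok e) (right-ok e)) (not-eq (foreign-strand (on-next i))))
    where
    adj : ∀ e′ {x y} → regionAt (leftOfIn e′) ≡ x → regionAt (rightOfIn e′) ≡ y →
          corner (proj₁ e′) (strand (proj₂ e′)) ≡ x ⊎ corner (proj₁ e′) (strand (proj₂ e′)) ≡ y
    adj (c , left)  p q = inj₁ p
    adj (c , right) p q = inj₂ q

  -- When C turns at a crossing of side b, the region on the other side occupies the single foreign
  -- corner there and so is the same before and after.
  bank-next : ∀ {e b} → On e → own (tgt e) ≡ b → bank (not b) (next e) ≡ bank (not b) e
  bank-next i q = trans (bank-out (on-next i) q) (sym (bank-in i q))

  bearing : ∀ {e} → On e → side (lo e) ≡ side (lo C)
  bearing = on-induction (λ e → side (lo e) ≡ side (lo C)) (λ {e} i h → trans (same (next e)) (trans (cong side (left-ok e)) h)) refl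
    where
    same : ∀ e → side (lo e) ≡ side (regionAt (leftOfIn e))
    same (c , left)  = refl
    same (c , right) = sym (own-bottom c)

  on-induction-from : ∀ {e₀} → On e₀ → (P : End → Set) → (∀ {e} → On e → P e → P (next e)) → P e₀ → ∀ {e} → On e → P e
  on-induction-from i P h base j = let m , q = on-reach i j in subst P q (go m i base)
    where
    go : ∀ m {e} → On e → P e → P (iter next m e)
    go zero    o x = x
    go (suc m) o x = go m (on-next o) (h o x)

  -- A directed notion: C leaves side β here. The cuts with β equal to b are the separating segments
  -- of `factor` on side b.
  Cut : Bool → End → Set
  Cut β e = own (src e) ≡ β × own (tgt e) ≢ β

  cut-on : ∀ {β e} → Cut β e → On e
  cut-on (p , n) = changes-on (λ q → n (trans (sym q) p))

  bank-next′ : ∀ {e β} → On e → own (tgt e) ≢ β → bank β (next e) ≡ bank β e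
  bank-next′ {e} {β} i n = subst (λ z → bank z (next e) ≡ bank z e) (sym (not-eq (n ∘ sym))) (bank-next i refl)

  bank-out′ : ∀ {c s β} → On (c , s) → own c ≢ β → bank β (c , s) ≡ corner c (strand s)
  bank-out′ {c} {s} {β} i n = subst (λ z → bank z (c , s) ≡ corner c (strand s)) (sym (not-eq (n ∘ sym))) (bank-out i refl)

  cut? : ∀ β e → Dec (Cut β e)
  cut? β e = (own (src e) Bool.≟ β) ×-dec ¬? (own (tgt e) Bool.≟ β)

-- The summands and the regions of the swapped diagrams

T-does : ∀ {P : Set} (d : Dec P) → T (does d) → P
T-does (yes p) _ = p

does-T : ∀ {P : Set} (d : Dec P) → P → T (does d)
does-T (yes _) _ = tt
does-T (no n)  p = contradiction p n

module _ {A : Set} (p : A → Bool) where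

  toSubset-yes : ∀ {x} (t : T (p x)) → toSubset p x ≡ just (x , t)
  toSubset-yes {x} t with T? (p x)
  ... | yes t′ = cong (λ t → just (x , t)) (Bool.T-irrelevant t′ t)
  ... | no n   = contradiction t n

  toSubset-no : ∀ {x} → ¬ T (p x) → toSubset p x ≡ nothing
  toSubset-no {x} n with T? (p x)
  ... | yes t = contradiction t n
  ... | no _  = refl

  subset-ext : ∀ {x y : Σ A (T ∘ p)} → proj₁ x ≡ proj₁ y → x ≡ y
  subset-ext {x , t} {.x , t′} refl = cong (x ,_) (Bool.T-irrelevant t t′)

  ∑-subset : ∀ xs (F : A → ℤ) → ∑ (subset-elements p xs) (F ∘ proj₁) ≡ ∑ xs (λ x → (if p x then 1ℤ else 0ℤ) * F x)
  ∑-subset []       F = refl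
  ∑-subset (x ∷ xs) F with T? (p x)
  ... | yes t = cong₂ _+_ (sym (trans (cong (_* F x) (⟦⟧-yes (T? (p x)) t)) (ℤ.*-identityˡ (F x)))) (∑-subset xs F)
  ... | no n  = trans (∑-subset xs F) (sym (trans (cong (λ z → z * F x + ∑ xs (λ x → (if p x then 1ℤ else 0ℤ) * F x)) (⟦⟧-no (T? (p x)) n)) (ℤ.+-identityˡ _)))

module Factor (L : Diagram) (sphere : OnSphere L) (C : Diagram.End L) (S : SeifertCircle.Complement L C) where
  open Sides L sphere C S public

  module Half (b : Bool) where
    D : Diagram
    D = SeifertCircle.factor L C S b

    Kept : Set
    Kept = Diagram.Crossing D

    keep : ∀ {c} → own c ≡ b → Kept
    keep {c} e = c , does-T (belongsTo? S b c) (belongs e)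

    kept-own : ∀ (x : Kept) → own (proj₁ x) ≡ b
    kept-own (c , t) = belongs⁻ (T-does (belongsTo? S b c) t)

    kept-ext : ∀ {x y : Kept} → proj₁ x ≡ proj₁ y → x ≡ y
    kept-ext = subset-ext (λ c → does (belongsTo? S b c))

    Xs : List Kept
    Xs = FinSet.elements (Diagram.crossingᶠ D)

    kept⟦⟧ : ∀ c → (if does (belongsTo? S b c) then 1ℤ else 0ℤ) ≡ ⟦ own c Bool.≟ b ⟧
    kept⟦⟧ c = ⟦⟧-cong (belongsTo? S b c) (own c Bool.≟ b) belongs⁻ belongs

    ∑-kept : ∀ (F : Crossing → ℤ) → ∑ Xs (F ∘ proj₁) ≡ ∑ Cs (λ c → ⟦ own c Bool.≟ b ⟧ * F c)
    ∑-kept F = trans (∑-subset (λ c → does (belongsTo? S b c)) Cs F) (∑-cong Cs (λ c → cong (_* F c) (kept⟦⟧ c)))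

    lift : Diagram.End D → End
    lift ((c , _) , s) = c , s

    Region′ : Set
    Region′ = Diagram.Region D

    face : Region′
    face = inj₂ tt

    π : Region → Region′
    π r = maybe′ inj₁ (inj₂ tt) (toSubset (λ r → does (in? S b r)) r)

    inside : ∀ {r} → side r ≡ b → Region′
    inside {r} e = inj₁ (r , does-T (in? S b r) e)

    π-in : ∀ {r} (e : side r ≡ b) → π r ≡ inside e
    π-in e = cong (maybe′ inj₁ (inj₂ tt)) (toSubset-yes (λ r → does (in? S b r)) (does-T (in? S b _) e))

    π-out : ∀ {r} → side r ≢ b → π r ≡ face
    π-out n = cong (maybe′ inj₁ (inj₂ tt)) (toSubset-no (λ r → does (in? S b r)) (n ∘ T-does (in? S b _)))

    region-of : ∀ {r} {y : Σ Region (λ r → T (does (in? S b r)))} → π r ≡ inj₁ y → side r ≡ b × r ≡ proj₁ y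
    region-of {r} {y} e = go (side r Bool.≟ b)
      where
      go : Dec (side r ≡ b) → side r ≡ b × r ≡ proj₁ y
      go (yes q) with trans (sym (π-in q)) e
      ... | refl = q , refl
      go (no n) with () ← trans (sym (π-out n)) e

    face-side : ∀ {r} → π r ≡ face → side r ≢ b
    face-side e q with () ← trans (sym (π-in q)) e

    π-top-bottom : ∀ {c} → own c ≢ b → π (corner c bottom) ≡ π (corner c top)
    π-top-bottom {c} n = trans (π-out (n ∘ trans (sym (own-bottom c)))) (sym (π-out n))

    ∑-half : ∀ (F : Crossing → ℤ) → (∀ c → own c ≢ b → F c ≡ 0ℤ) → ∑ Cs F ≡ 0ℤ → ∑ Xs (F ∘ proj₁) ≡ 0ℤ
    ∑-half F z e = trans (∑-kept F) (trans (∑-cong Cs (λ c → go c (own c Bool.≟ b))) e)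
      where
      go : ∀ c (d : Dec (own c ≡ b)) → ⟦ d ⟧ * F c ≡ F c
      go c (yes _) = ℤ.*-identityˡ (F c)
      go c (no n)  = sym (z c n)

    -- At a smoothed crossing top and bottom both go to the new face, so its incoming and outgoing
    -- terms agree and the identity for L restricts to the kept crossings.
    seg : ∀ (G : Region′ → Region′ → ℤ) →
          ∑ Xs (λ x → G (Diagram.corner D x left) (Diagram.corner D x bottom) + G (Diagram.corner D x bottom) (Diagram.corner D x right))
        ≡ ∑ Xs (λ x → G (Diagram.corner D x left) (Diagram.corner D x top) + G (Diagram.corner D x top) (Diagram.corner D x right))
    seg G = ℤ.i-j≡0⇒i≡j _ _ (trans (sym (∑-- Xs (arr ∘ proj₁) (dep ∘ proj₁)))
        (∑-half (λ c → arr c - dep c) (λ c n → ℤ.i≡j⇒i-j≡0 (cong (λ z → G (π (corner c left)) z + G z (π (corner c right))) (π-top-bottom n)))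
          (trans (∑-- Cs arr dep) (ℤ.i≡j⇒i-j≡0 (∑-segments (λ x y → G (π x) (π y)))))))
      where
      arr dep : Crossing → ℤ
      arr c = G (π (corner c left)) (π (corner c bottom)) + G (π (corner c bottom)) (π (corner c right))
      dep c = G (π (corner c left)) (π (corner c top)) + G (π (corner c top)) (π (corner c right))

    cutᴰ : Diagram.End D → Bool
    cutᴰ = SeifertCircle.separating L C S b

    End′ : FinSet
    End′ = Diagram.endᶠ D

    nextᴰ : Diagram.End D → Diagram.End D
    nextᴰ = Diagram.next D

    cut⇒ : ∀ {g} → T (cutᴰ g) → Cut b (lift g)
    cut⇒ {g} t = kept-own (proj₁ g) , λ q → not-≢ {b} (trans (sym q) (belongs⁻ (T-does (belongsTo? S (not b) (tgt (lift g))) t)))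

    cut⇐ : ∀ {g} → own (tgt (lift g)) ≢ b → T (cutᴰ g)
    cut⇐ {g} n = does-T (belongsTo? S (not b) (tgt (lift g))) (belongs (not-eq n))

    uncut : ∀ {g} → ¬ T (cutᴰ g) → own (tgt (lift g)) ≡ b
    uncut {g} n = decidable-stable (own (tgt (lift g)) Bool.≟ b) (λ m → n (cut⇐ {g} m))

    lift-injective : ∀ {g g′} → lift g ≡ lift g′ → g ≡ g′
    lift-injective {x , s} {x′ , s′} e = cong₂ _,_ (kept-ext {x} {x′} (cong proj₁ e)) (cong proj₂ e)

    raise : ∀ e → own (src e) ≡ b → Diagram.End D
    raise e q = keep q , proj₂ e

    private
      toKept : End → Maybe (Diagram.End D)
      toKept (c , s) = maybe′ (λ c′ → just (c′ , s)) nothing (toSubset (λ c → does (belongsTo? S b c)) c)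

      head-kept : ∀ n e → 1 ℕ.≤ n → (q : own (src e) ≡ b) → head (mapMaybe toKept (iterate next e n)) ≡ just (raise e q)
      head-kept (suc n) (c , s) h q = first (toKept (c , s)) (iterate next (next (c , s)) n)
          (cong (maybe′ (λ c′ → just (c′ , s)) nothing) (toSubset-yes (λ c → does (belongsTo? S b c)) (does-T (belongsTo? S b c) (belongs q))))
        where
        first : ∀ m es → m ≡ just (raise (c , s) q) → head (maybe′ _∷_ id m (mapMaybe toKept es)) ≡ just (raise (c , s) q)
        first _ es refl = refl

      nonempty : ∀ {A : Set} {x : A} {xs} → x ∈ xs → 1 ℕ.≤ length xs
      nonempty (here _)  = s≤s z≤n
      nonempty (there _) = s≤s z≤n

    next-lift : ∀ g → own (tgt (lift g)) ≡ b → lift (nextᴰ g) ≡ next (lift g)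
    next-lift g q = cong (lift ∘ fromMaybe g) (head-kept (size endᶠ) (next (lift g)) (nonempty (E-complete (lift g))) q)

    Region~ : Set
    Region~ = Diagram.Region (tilde L C S b)

    survives : Region′ → Bool
    survives r = does (¬? (Diagram._≟ᴿ_ D r face)
      ×-dec all? (λ e → T? (cutᴰ e) →-dec ¬? (Diagram.adjacent? D (inj₁ e) r)) (FinSet.elements End′))

    toRegion~ : Region′ → Region~
    toRegion~ r = maybe′ inj₁ (inj₂ (inj₁ tt)) (toSubset survives r)

    merged : Region~
    merged = inj₂ (inj₁ tt)

    disk : ∀ g → T (cutᴰ g) → Region~
    disk g t = inj₂ (inj₂ (g , t))

    firstCut : Diagram.End D → Maybe (Σ (Diagram.End D) (T ∘ cutᴰ))
    firstCut e = head (mapMaybe (toSubset cutᴰ) (iterate nextᴰ e (size End′)))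

    newFace : Diagram.End D → Region~
    newFace e = maybe′ (inj₂ ∘ inj₂) (inj₂ (inj₁ tt)) (firstCut e)

    -- A region of L from which the given one arises. The value `lo C` is a default, in particular
    -- for the merged region, which has several preimages.
    back : Region~ → Region
    back (inj₁ (inj₁ (r , _) , _)) = r
    back (inj₁ (inj₂ tt , _))      = lo C
    back (inj₂ (inj₁ tt))          = lo C
    back (inj₂ (inj₂ (g , _)))     = bank (not b) (lift g)

    corner~ : Kept → Corner → Region~
    corner~ = Diagram.corner (tilde L C S b)

    corner~-owned : ∀ x k → side (corner (proj₁ x) k) ≡ b → corner~ x k ≡ toRegion~ (π (corner (proj₁ x) k))
    corner~-owned x top    q = refl
    corner~-owned x bottom q = refl
    corner~-owned x left   q = if-no (Diagram._≟ᴿ_ D (Diagram.corner D x left) face) (λ f → face-side f q)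
    corner~-owned x right  q = if-no (Diagram._≟ᴿ_ D (Diagram.corner D x right) face) (λ f → face-side f q)

    corner~-foreign : ∀ x s → side (corner (proj₁ x) (strand s)) ≢ b → corner~ x (strand s) ≡ newFace (x , s)
    corner~-foreign x left  n = if-yes (Diagram._≟ᴿ_ D (Diagram.corner D x left) face) (π-out n)
    corner~-foreign x right n = if-yes (Diagram._≟ᴿ_ D (Diagram.corner D x right) face) (π-out n)

    -- The regions on side b that the swap moves merge into one.
    Rim : Region → Set
    Rim r = ∃[ e ] Cut b e × bank b e ≡ r

    rim? : ∀ r → Dec (Rim r)
    rim? r = map′ (λ i → let e , _ , p = find i in e , p) (λ (e , p) → lose (E-complete e) p)
                  (any? (λ e → cut? b e ×-dec (bank b e ≟ᴿ r)) Es)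

    adjacent-lift : ∀ g {r} → Diagram.Adjacent D (inj₁ g) r → r ≡ π (lo (lift g)) ⊎ r ≡ π (ro (lift g))
    adjacent-lift (x , left)  a = a
    adjacent-lift (x , right) a = a

    lift-adjacent : ∀ g {r} → r ≡ π (lo (lift g)) ⊎ r ≡ π (ro (lift g)) → Diagram.Adjacent D (inj₁ g) r
    lift-adjacent (x , left)  a = a
    lift-adjacent (x , right) a = a

    survives-intro : ∀ {r} (q : side r ≡ b) → ¬ Rim r → T (survives (inside q))
    survives-intro {r} q n = does-T (¬? (Diagram._≟ᴿ_ D (inside q) face) ×-dec all? (λ e → T? (cutᴰ e) →-dec ¬? (Diagram.adjacent? D (inj₁ e) (inside q))) (FinSet.elements End′))
      ((λ ()) , All.tabulate (λ {g} _ t a → n (lift g , cut⇒ {g} t , sym (bank-unique (cut-on (cut⇒ {g} t)) (adj g (adjacent-lift g a)) q))))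
      where
      adj : ∀ g → inside q ≡ π (lo (lift g)) ⊎ inside q ≡ π (ro (lift g)) → r ≡ lo (lift g) ⊎ r ≡ ro (lift g)
      adj g (inj₁ e) = inj₁ (sym (proj₂ (region-of (sym e))))
      adj g (inj₂ e) = inj₂ (sym (proj₂ (region-of (sym e))))

    survives-elim : ∀ {r} (q : side r ≡ b) → T (survives (inside q)) → ¬ Rim r
    survives-elim {r} q t (e , (p , n) , refl) =
      All.lookup (proj₂ (T-does (¬? (Diagram._≟ᴿ_ D (inside q) face) ×-dec all? (λ e → T? (cutᴰ e) →-dec ¬? (Diagram.adjacent? D (inj₁ e) (inside q))) (FinSet.elements End′)) t))
        (FinSet.complete End′ (raise e p)) (cut⇐ {raise e p} n)
        (lift-adjacent (raise e p) (adj (bank-adjacent b e)))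
      where
      adj : bank b e ≡ lo e ⊎ bank b e ≡ ro e → inside q ≡ π (lo e) ⊎ inside q ≡ π (ro e)
      adj (inj₁ f) = inj₁ (trans (sym (π-in q)) (cong π f))
      adj (inj₂ f) = inj₂ (trans (sym (π-in q)) (cong π f))

    toRegion~-survivor : ∀ {r} (q : side r ≡ b) (n : ¬ Rim r) → toRegion~ (π r) ≡ inj₁ (inside q , survives-intro q n)
    toRegion~-survivor q n = trans (cong toRegion~ (π-in q)) (cong (maybe′ inj₁ (inj₂ (inj₁ tt))) (toSubset-yes survives {x = inside q} (survives-intro q n)))

    toRegion~-merged : ∀ {r} → side r ≡ b → Rim r → toRegion~ (π r) ≡ merged
    toRegion~-merged q m = trans (cong toRegion~ (π-in q)) (cong (maybe′ inj₁ (inj₂ (inj₁ tt))) (toSubset-no survives {x = inside q} (λ t → survives-elim q t m)))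

-- Shading and connectedness of the summands

module Coloured (L : Diagram) (sphere : OnSphere L) (alternating : Alternating L) (C : Diagram.End L)
                (S : SeifertCircle.Complement L C)
                (tight : 2 ℕ.+ size (Diagram.crossingᶠ L) ≡ size (Diagram.regionᶠ L)) where
  open Factor L sphere C S public
  open Counting.Tight L sphere (proj₁ C) tight public

  coherentᴸ : Coherent L
  coherentᴸ = coherent alternating

  open Coefficients L coherentᴸ public using (colour; colour-κ)

  colour-opp : ∀ c k → colour (corner c (opp k)) ≡ colour (corner c k)
  colour-opp c k = trans (colour-κ c (opp k)) (trans (shade-opp (over c) k) (sym (colour-κ c k)))

  colour-lo : ∀ e → colour (lo (next e)) ≡ colour (lo e)
  colour-lo e = trans (go (next e)) (cong colour (left-ok e))
    where
    go : ∀ e → colour (lo e) ≡ colour (regionAt (leftOfIn e))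
    go (c , left)  = refl
    go (c , right) = colour-opp c bottom

  colour-ro : ∀ e → colour (ro (next e)) ≡ colour (ro e)
  colour-ro e = trans (go (next e)) (cong colour (right-ok e))
    where
    go : ∀ e → colour (ro e) ≡ colour (regionAt (rightOfIn e))
    go (c , left)  = colour-opp c bottom
    go (c , right) = refl

  -- Where C turns at a crossing, the region on either hand stays the same or changes to the
  -- opposite one there, which has the same colour.
  colour-bank : ∀ {b e e′} → On e → On e′ → colour (bank b e) ≡ colour (bank b e′)
  colour-bank {b} i j = trans (base i) (sym (base j))
    where
    β = side (lo C)
    base : ∀ {e} → On e → colour (bank b e) ≡ (if does (β Bool.≟ b) then colour (lo C) else colour (ro C))
    base {e} i = go (β Bool.≟ b)
      where
      go : (d : Dec (β ≡ b)) → colour (bank b e) ≡ (if does d then colour (lo C) else colour (ro C))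
      go (yes q) = trans (cong colour (if-yes (side (lo e) Bool.≟ b) (trans (bearing i) q)))
                         (on-induction (λ e → colour (lo e) ≡ colour (lo C)) (λ {e} _ h → trans (colour-lo e) h) refl i)
      go (no n) = trans (cong colour (if-no (side (lo e) Bool.≟ b) (n ∘ trans (sym (bearing i)))))
                        (on-induction (λ e → colour (ro e) ≡ colour (ro C)) (λ {e} _ h → trans (colour-ro e) h) refl i)

  module CoherentHalf (b : Bool) where
    open Half b

    foreign-bank : ∀ {c k} → own c ≡ b → side (corner c k) ≢ b → ∃[ e ] On e × src e ≡ c × strand (proj₂ e) ≡ k × corner c k ≡ bank (not b) e
    foreign-bank {c} {k} o n = go (corner-side c k) n
      where
      go : ∀ {k} → CornerSide c k → side (corner c k) ≢ b → ∃[ e ] On e × src e ≡ c × strand (proj₂ e) ≡ k × corner c k ≡ bank (not b) e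
      go (owned e) n = contradiction (trans e o) n
      go (foreign {s} i _) n = (c , s) , i , refl , refl , sym (bank-out i o)

    shade-colour : ∀ c k → shade (over c) k ≡ colour (corner c k)
    shade-colour c k = sym (colour-κ c k)

    -- The new face collects the foreign corners of all kept crossings; these regions of L lie along
    -- C on one side and so have one colour.
    coloured′ : ∀ x k x′ k′ → Diagram.corner D x k ≡ Diagram.corner D x′ k′ → shade (over (proj₁ x)) k ≡ shade (over (proj₁ x′)) k′
    coloured′ x k x′ k′ e = trans (shade-colour _ k) (trans (go (side (corner (proj₁ x) k) Bool.≟ b)) (sym (shade-colour _ k′)))
      where
      go : Dec (side (corner (proj₁ x) k) ≡ b) → colour (corner (proj₁ x) k) ≡ colour (corner (proj₁ x′) k′)
      go (yes q) = cong colour (sym (proj₂ (region-of (trans (sym e) (π-in q)))))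
      go (no n) = let _ , i , _ , _ , f = foreign-bank (kept-own x) n
                      _ , j , _ , _ , g = foreign-bank (kept-own x′) (face-side (trans (sym e) (π-out n)))
                  in trans (cong colour f) (trans (colour-bank i j) (cong colour (sym g)))

    -- Smoothed crossings do not change the pair of regions along C, so Θ is carried around the
    -- whole of C. For crossings outside the summand Q records Θ on C only, as paths can leave and
    -- re-enter the summand only along C.
    spreading′ : ∀ (Θ : Region′ → Region′ → Set) →
      (∀ x i j → Θ (Diagram.corner D x (lf i)) (Diagram.corner D x (rt i)) → Θ (Diagram.corner D x (lf j)) (Diagram.corner D x (rt j))) →
      ∀ x i x′ j → Θ (Diagram.corner D x (lf i)) (Diagram.corner D x (rt i)) → Θ (Diagram.corner D x′ (lf j)) (Diagram.corner D x′ (rt j))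
    spreading′ Θ h x i x′ j θ = h x′ top j (proj₁ (all-crossings Q fw bw (proj₁ x) (proj₁ x′) (q-kept x (h x i top θ))) (kept-own x′) x′ refl)
      where
      Θᴱ : End → Set
      Θᴱ e = Θ (π (lo e)) (π (ro e))
      P : Kept → Set
      P x = Θ (Diagram.corner D x left) (Diagram.corner D x top)
      Q : Crossing → Set
      Q c = (own c ≡ b → ∀ x → proj₁ x ≡ c → P x) × (own c ≢ b → Θᴱ C)
      q-kept : ∀ x → P x → Q (proj₁ x)
      q-kept x p = (λ _ y e → subst P (kept-ext {x} {y} (sym e)) p) , (λ n → contradiction (kept-own x) n)
      out : ∀ x s → (P x → Θᴱ (proj₁ x , s)) × (Θᴱ (proj₁ x , s) → P x)
      out x left  = id , id
      out x right = h x top right , h x right top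
      arrive : ∀ e (x : Kept) → proj₁ x ≡ tgt e → (P x → Θᴱ e) × (Θᴱ e → P x)
      arrive e x q = go x (proj₂ (next e)) (cong₂ _,_ (sym q) refl)
        where
        go : ∀ x s → next e ≡ (proj₁ x , s) → (P x → Θᴱ e) × (Θᴱ e → P x)
        go x left n = (λ p → subst₂ (λ u v → Θ (π u) (π v)) lq rq (h x top left p)) , (λ t → h x left top (subst₂ (λ u v → Θ (π u) (π v)) (sym lq) (sym rq) t))
          where
          lq : corner (proj₁ x) left ≡ lo e
          lq = trans (cong (regionAt ∘ leftOfIn) (sym n)) (left-ok e)
          rq : corner (proj₁ x) bottom ≡ ro e
          rq = trans (cong (regionAt ∘ rightOfIn) (sym n)) (right-ok e)
        go x right n = (λ p → subst₂ (λ u v → Θ (π u) (π v)) lq rq (h x top bottom p)) , (λ t → h x bottom top (subst₂ (λ u v → Θ (π u) (π v)) (sym lq) (sym rq) t))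
          where
          lq : corner (proj₁ x) bottom ≡ lo e
          lq = trans (cong (regionAt ∘ leftOfIn) (sym n)) (left-ok e)
          rq : corner (proj₁ x) right ≡ ro e
          rq = trans (cong (regionAt ∘ rightOfIn) (sym n)) (right-ok e)
      pass : ∀ e → own (tgt e) ≢ b → (Θᴱ (next e) ≡ Θᴱ e)
      pass e n = trans (go (next e) n) (cong₂ (λ u v → Θ (π u) (π v)) (left-ok e) (right-ok e))
        where
        go : ∀ e → own (src e) ≢ b → Θᴱ e ≡ Θ (π (regionAt (leftOfIn e))) (π (regionAt (rightOfIn e)))
        go (c , left)  n = cong (Θ (π (corner c left))) (sym (π-top-bottom n))
        go (c , right) n = cong (λ z → Θ z (π (corner c right))) (sym (π-top-bottom n))
      forward : ∀ e → (Θᴱ e → Θᴱ (next e)) × (Θᴱ (next e) → Θᴱ e)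
      forward e = go (own (tgt e) Bool.≟ b)
        where
        go : Dec (own (tgt e) ≡ b) → (Θᴱ e → Θᴱ (next e)) × (Θᴱ (next e) → Θᴱ e)
        go (yes q) = (proj₁ (out (keep q) (proj₂ (next e))) ∘ proj₂ (arrive e (keep q) refl)) , (proj₁ (arrive e (keep q) refl) ∘ proj₂ (out (keep q) (proj₂ (next e))))
        go (no n) = subst id (sym (pass e n)) , subst id (pass e n)
      along : ∀ {e} → On e → (Θᴱ C → Θᴱ e) × (Θᴱ e → Θᴱ C)
      along = on-induction (λ e → (Θᴱ C → Θᴱ e) × (Θᴱ e → Θᴱ C))
        (λ {e} _ (f , g) → (proj₁ (forward e) ∘ f) , (g ∘ proj₂ (forward e))) (id , id)
      to-end : ∀ e → own (src e) ≡ b → Q (src e) → Θᴱ e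
      to-end e q (f , _) = proj₁ (out (keep q) (proj₂ e)) (f q (keep q) refl)
      from-end : ∀ e → own (src e) ≡ b → Θᴱ e → Q (src e)
      from-end e q t = q-kept (keep q) (proj₂ (out (keep q) (proj₂ e)) t)
      to-end′ : ∀ e → own (tgt e) ≡ b → Q (tgt e) → Θᴱ e
      to-end′ e q (f , _) = proj₁ (arrive e (keep q) refl) (f q (keep q) refl)
      from-end′ : ∀ e → own (tgt e) ≡ b → Θᴱ e → Q (tgt e)
      from-end′ e q t = q-kept (keep q) (proj₂ (arrive e (keep q) refl) t)
      off : ∀ {c} → own c ≢ b → Θᴱ C → Q c
      off n t = (λ q → contradiction q n) , (λ _ → t)
      fw : ∀ e → Q (src e) → Q (tgt e)
      fw e q = go (own (src e) Bool.≟ b) (own (tgt e) Bool.≟ b)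
        where
        go : Dec (own (src e) ≡ b) → Dec (own (tgt e) ≡ b) → Q (tgt e)
        go (yes s) (yes t) = from-end′ e t (to-end e s q)
        go (yes s) (no t)  = off t (proj₂ (along (changes-on (λ f → t (trans (sym f) s)))) (to-end e s q))
        go (no s)  (yes t) = from-end′ e t (proj₁ (along (changes-on (λ f → s (trans f t)))) (proj₂ q s))
        go (no s)  (no t)  = off t (proj₂ q s)
      bw : ∀ e → Q (tgt e) → Q (src e)
      bw e q = go (own (src e) Bool.≟ b) (own (tgt e) Bool.≟ b)
        where
        go : Dec (own (src e) ≡ b) → Dec (own (tgt e) ≡ b) → Q (src e)
        go (yes s) (yes t) = from-end e s (to-end′ e t q)
        go (yes s) (no t)  = from-end e s (proj₁ (along (changes-on (λ f → t (trans (sym f) s)))) (proj₂ q t))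
        go (no s)  (yes t) = off s (proj₂ (along (changes-on (λ f → s (trans f t)))) (to-end′ e t q))
        go (no s)  (no t)  = off s (proj₂ q t)

    coherent-half : Coherent D
    coherent-half = record { seg = seg ; connected = λ Θ h x i x′ j θ ¬θ → ¬θ (spreading′ Θ h x i x′ j θ) ; coloured = coloured′ }

-- In the swapped diagrams a property has to become an integer-valued indicator, in order to apply
-- `∑-jumps`; this is permitted under a double negation.
finite-¬¬-dec : ∀ (A : FinSet) (R : FinSet.Carrier A → Set) → ¬ ¬ (∀ x → Dec (R x))
finite-¬¬-dec A R k = go (FinSet.elements A) (λ f → k (λ x → f (FinSet.complete A x)))
  where
  go : ∀ xs → ¬ ¬ (∀ {x} → x ∈ xs → Dec (R x))
  go []       k = k (λ ())
  go (x ∷ xs) k = go xs (λ f → (λ nd → nd (no (λ r → nd (yes r))))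
                               (λ d → k (λ { (here refl) → d ; (there i) → f i })))

-- Swap moves

module Tilde (L : Diagram) (sphere : OnSphere L) (alternating : Alternating L) (C : Diagram.End L)
             (S : SeifertCircle.Complement L C)
             (tight : 2 ℕ.+ size (Diagram.crossingᶠ L) ≡ size (Diagram.regionᶠ L)) (b : Bool) where
  open Coloured L sphere alternating C S tight public
  open Half b public
  open CoherentHalf b public using (foreign-bank)

  -- By `apart` different new faces stand for different regions of L. By `apart-rim` and
  -- `apart-back` a merged region is left by one cut and returned to by one, which is what makes
  -- `cross` conclusive.
  module Cuts (g₀ : End) (cut₀ : Cut b g₀)
    (apart : ∀ {g g′} → Cut b g → Cut b g′ → bank (not b) g ≡ bank (not b) g′ → g ≡ g′)
    (apart-rim : ∀ {g g′} → Cut b g → Cut b g′ → bank b g ≡ bank b g′ → g ≡ g′)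
    (apart-back : ∀ {g g′} → Cut (not b) g → Cut (not b) g′ → bank b g ≡ bank b g′ → g ≡ g′)
    (rim : ∀ {c s} → On (c , s) → own c ≢ b → Rim (corner c (strand s))) where

    -- Following the circle from a kept end one leaves the kept crossings at some point,
    -- and by periodicity within the bound used in the definition.
    cut-ahead : ∀ g → On (lift g) → Any.Any (T ∘ cutᴰ) (iterate nextᴰ g (size End′))
    cut-ahead g i = go (any? (T? ∘ cutᴰ) (iterate nextᴰ g (size End′)))
      where
      go : Dec (Any.Any (T ∘ cutᴰ) (iterate nextᴰ g (size End′))) → Any.Any (T ∘ cutᴰ) (iterate nextᴰ g (size End′))
      go (yes a) = a
      go (no n) = contradiction (trans (cong (own ∘ src) (sym (proj₂ (proj₂ inOrbit))))
                     (trans (cong (own ∘ src) (sym (lifts (proj₁ inOrbit) (ℕ.≤-trans (ℕ.<⇒≤ (proj₁ (proj₂ inOrbit))) d≤)))) (kept-own (proj₁ (iter nextᴰ (proj₁ inOrbit) g)))))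
                     (proj₂ cut₀)
        where
        none : ∀ m → m ℕ.< size End′ → ¬ T (cutᴰ (iter nextᴰ m g))
        none m h t = n (lose′ m (size End′) g h t)
          where
          lose′ : ∀ m k g → m ℕ.< k → T (cutᴰ (iter nextᴰ m g)) → Any.Any (T ∘ cutᴰ) (iterate nextᴰ g k)
          lose′ zero    (suc k) g h t = here t
          lose′ (suc m) (suc k) g (s≤s h) t = there (lose′ m k (nextᴰ g) h t)
        lifts : ∀ m → m ℕ.≤ size End′ → lift (iter nextᴰ m g) ≡ iter next m (lift g)
        lifts zero    h = refl
        lifts (suc m) h = trans (cong lift (iter-suc nextᴰ m g))
          (trans (next-lift (iter nextᴰ m g) (uncut {iter nextᴰ m g} (none m h)))
          (trans (cong next (lifts m (ℕ.<⇒≤ h))) (sym (iter-suc next m (lift g)))))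
        rep = Iteration.repeats End′ nextᴰ g
        i₁ = proj₁ rep
        j₁ = proj₁ (proj₂ rep)
        i<j = proj₁ (proj₂ (proj₂ rep))
        j≤ = proj₁ (proj₂ (proj₂ (proj₂ rep)))
        d = j₁ ℕ.∸ i₁
        d≤ : d ℕ.≤ size End′
        d≤ = ℕ.≤-trans (ℕ.m∸n≤m j₁ i₁) j≤
        periodic : iter next d (lift g) ≡ lift g
        periodic = iter-injective i₁ (trans (sym (iter-+ next d i₁ (lift g))) (trans (cong (λ m → iter next m (lift g)) (ℕ.m∸n+n≡m (ℕ.<⇒≤ i<j)))
          (trans (sym (lifts j₁ j≤)) (trans (cong lift (sym (proj₂ (proj₂ (proj₂ (proj₂ rep)))))) (lifts i₁ (ℕ.≤-trans (ℕ.<⇒≤ i<j) j≤))))))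
        Near : End → Set
        Near e = ∃[ m ] m ℕ.< d × iter next m (lift g) ≡ e
        near-next : ∀ {e} → Near e → Near (next e)
        near-next {e} (m , h , q) = step (suc m ℕ.<? d)
          where
          q′ : iter next (suc m) (lift g) ≡ next e
          q′ = trans (iter-suc next m (lift g)) (cong next q)
          step : Dec (suc m ℕ.< d) → Near (next e)
          step (yes h′) = suc m , h′ , q′
          step (no h′) = 0 , ℕ.m<n⇒0<n∸m i<j , trans (sym periodic) (trans (cong (λ m → iter next m (lift g)) (ℕ.≤-antisym (ℕ.≮⇒≥ h′) h)) q′)
        near-all : ∀ m {e} → Near e → Near (iter next m e)
        near-all zero    x = x
        near-all (suc m) x = near-all m (near-next x)
        inOrbit : Near (next g₀)
        inOrbit = let m , q = on-reach i (on-next (cut-on cut₀)) in subst Near q (near-all m (0 , ℕ.m<n⇒0<n∸m i<j , refl))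

    -- Until the first cut the circle passes kept crossings only, so by `bank-next` the region on
    -- the far side stays the same: the new face takes its place.
    firstCut-bank : ∀ g → On (lift g) → ∃[ h ] Σ (T (cutᴰ h)) λ t → firstCut g ≡ just (h , t) × bank (not b) (lift h) ≡ bank (not b) (lift g)
    firstCut-bank g i = go (size End′) g i (cut-ahead g i)
      where
      go : ∀ n g → On (lift g) → Any.Any (T ∘ cutᴰ) (iterate nextᴰ g n) →
           ∃[ h ] Σ (T (cutᴰ h)) λ t → head (mapMaybe (toSubset cutᴰ) (iterate nextᴰ g n)) ≡ just (h , t) × bank (not b) (lift h) ≡ bank (not b) (lift g)
      go (suc n) g i a = split (T? (cutᴰ g)) a
        where
        first : ∀ m es {z} → m ≡ just z → head (maybe′ _∷_ id m (mapMaybe (toSubset cutᴰ) es)) ≡ just z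
        first _ es refl = refl
        skip : ∀ m es → m ≡ nothing → head (maybe′ _∷_ id m (mapMaybe (toSubset cutᴰ) es)) ≡ head (mapMaybe (toSubset cutᴰ) es)
        skip _ es refl = refl
        split : Dec (T (cutᴰ g)) → Any.Any (T ∘ cutᴰ) (iterate nextᴰ g (suc n)) →
           ∃[ h ] Σ (T (cutᴰ h)) λ t → head (mapMaybe (toSubset cutᴰ) (iterate nextᴰ g (suc n))) ≡ just (h , t) × bank (not b) (lift h) ≡ bank (not b) (lift g)
        split (yes t) _ = g , t , first (toSubset cutᴰ g) (iterate nextᴰ (nextᴰ g) n) (toSubset-yes cutᴰ t) , refl
        split (no ¬t) (here t) = contradiction t ¬t
        split (no ¬t) (there a) =
          let q = uncut {g} ¬t
              e = next-lift g q
              h , t , f , f′ = go n (nextᴰ g) (subst On (sym e) (on-next i)) a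
          in h , t , trans (skip (toSubset cutᴰ g) (iterate nextᴰ (nextᴰ g) n) (toSubset-no cutᴰ ¬t)) f ,
             trans f′ (trans (cong (bank (not b)) e) (bank-next i q))

    newFace-disk : ∀ x s → On (proj₁ x , s) → ∃[ h ] Σ (T (cutᴰ h)) λ t → newFace (x , s) ≡ disk h t × bank (not b) (lift h) ≡ corner (proj₁ x) (strand s)
    newFace-disk x s i = let h , t , e , f = firstCut-bank (x , s) i in
      h , t , cong (maybe′ (inj₂ ∘ inj₂) (inj₂ (inj₁ tt))) e , trans f (bank-out i (kept-own x))

    -- How a region of L seen from a kept crossing enters the swapped diagram. Since this is
    -- single-valued (`kind-unique`), the new corners are the old ones composed with one map φ.
    data Kind (r : Region) : Region~ → Set where
      survivor : (q : side r ≡ b) (n : ¬ Rim r) → Kind r (inj₁ (inside q , survives-intro q n))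
      rimmed   : side r ≡ b → Rim r → Kind r merged
      opened   : side r ≢ b → ∀ g t → bank (not b) (lift g) ≡ r → Kind r (disk g t)

    kind : ∀ x k → Kind (corner (proj₁ x) k) (corner~ x k)
    kind x k = go (side (corner (proj₁ x) k) Bool.≟ b)
      where
      go : Dec (side (corner (proj₁ x) k) ≡ b) → Kind (corner (proj₁ x) k) (corner~ x k)
      go (yes q) = split (rim? (corner (proj₁ x) k))
        where
        split : Dec (Rim (corner (proj₁ x) k)) → Kind (corner (proj₁ x) k) (corner~ x k)
        split (yes m) = subst (Kind _) (sym (trans (corner~-owned x k q) (toRegion~-merged q m))) (rimmed q m)
        split (no n)  = subst (Kind _) (sym (trans (corner~-owned x k q) (toRegion~-survivor q n))) (survivor q n)
      go (no n) = at (corner-side (proj₁ x) k) n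
        where
        at : ∀ {k} → CornerSide (proj₁ x) k → side (corner (proj₁ x) k) ≢ b → Kind (corner (proj₁ x) k) (corner~ x k)
        at (owned e) n = contradiction (trans e (kept-own x)) n
        at (foreign {s} i _) n = let h , t , e , f = newFace-disk x s i in
          subst (Kind _) (sym (trans (corner~-foreign x s n) e)) (opened n h t f)

    disk-ext : ∀ {g t g′ t′} → g ≡ g′ → disk g t ≡ disk g′ t′
    disk-ext {t = t} {t′ = t′} refl = cong (λ t → disk _ t) (Bool.T-irrelevant t t′)

    kind-unique : ∀ {r y y′} → Kind r y → Kind r y′ → y ≡ y′
    kind-unique (survivor q n) (survivor q′ n′) = cong inj₁ (subset-ext survives (cong inj₁ (subset-ext (λ r → does (in? S b r)) refl)))
    kind-unique (survivor q n) (rimmed _ m) = contradiction m n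
    kind-unique (survivor q n) (opened m _ _ _) = contradiction q m
    kind-unique (rimmed _ m) (survivor q n) = contradiction m n
    kind-unique (rimmed _ _) (rimmed _ _) = refl
    kind-unique (rimmed q _) (opened m _ _ _) = contradiction q m
    kind-unique (opened m _ _ _) (survivor q _) = contradiction q m
    kind-unique (opened m _ _ _) (rimmed q _) = contradiction q m
    kind-unique (opened _ g t e) (opened _ g′ t′ e′) =
      disk-ext (lift-injective (apart (cut⇒ {g} t) (cut⇒ {g′} t′) (trans e (sym e′))))

    private
      cuts : List (Σ (Diagram.End D) (T ∘ cutᴰ))
      cuts = FinSet.elements (subsetᶠ End′ cutᴰ)

      pick : Region → List (Σ (Diagram.End D) (T ∘ cutᴰ)) → Region~
      pick r []             = merged
      pick r ((g , t) ∷ gs) = if does (bank (not b) (lift g) ≟ᴿ r) then disk g t else pick r gs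

    -- The region of the new diagram that takes the place of r.
    φ : Region → Region~
    φ r = if does (side r Bool.≟ b) then toRegion~ (π r) else pick r cuts

    kind-φ : ∀ {r y} → Kind r y → φ r ≡ y
    kind-φ {r} (survivor q n) = trans (if-yes (side r Bool.≟ b) q) (toRegion~-survivor q n)
    kind-φ {r} (rimmed q m)   = trans (if-yes (side r Bool.≟ b) q) (toRegion~-merged q m)
    kind-φ {r} (opened n g t e) = trans (if-no (side r Bool.≟ b) n) (go cuts (FinSet.complete (subsetᶠ End′ cutᴰ) (g , t)))
      where
      go : ∀ gs → (g , t) ∈ gs → pick r gs ≡ disk g t
      go ((h , u) ∷ gs) i = split (bank (not b) (lift h) ≟ᴿ r) i
        where
        split : Dec (bank (not b) (lift h) ≡ r) → (g , t) ∈ (h , u) ∷ gs → pick r ((h , u) ∷ gs) ≡ disk g t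
        split (yes f) _ = trans (if-yes (bank (not b) (lift h) ≟ᴿ r) f) (kind-unique (opened n h u f) (opened n g t e))
        split (no f) (here refl) = contradiction e f
        split (no f) (there j) = trans (if-no (bank (not b) (lift h) ≟ᴿ r) f) (go gs j)

    corner-φ : ∀ x k → corner~ x k ≡ φ (corner (proj₁ x) k)
    corner-φ x k = sym (kind-φ (kind x k))

    φ-rim : ∀ {r} → side r ≡ b → Rim r → φ r ≡ merged
    φ-rim q m = kind-φ (rimmed q m)

    arr~ dep~ : (Region~ → Region~ → ℤ) → Crossing → ℤ
    arr~ G c = G (φ (corner c left)) (φ (corner c bottom)) + G (φ (corner c bottom)) (φ (corner c right))
    dep~ G c = G (φ (corner c left)) (φ (corner c top)) + G (φ (corner c top)) (φ (corner c right))

    -- On segments of C the value for the merged region is subtracted.  This does not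
    -- change the difference between the two sides at a kept crossing, and makes it
    -- vanish at the others.
    module _ (G : Region~ → Region~ → ℤ) where
      private
        G̃ : Region → Region → ℤ
        G̃ r r′ = if does (side r Bool.≟ b)
          then (if does (side r′ Bool.≟ b) then G (φ r) (φ r′) else G (φ r) (φ r′) - G merged (φ r′))
          else (if does (side r′ Bool.≟ b) then G (φ r) (φ r′) - G (φ r) merged else 0ℤ)

        yy : ∀ {r r′} → side r ≡ b → side r′ ≡ b → G̃ r r′ ≡ G (φ r) (φ r′)
        yy {r} {r′} p q = trans (if-yes (side r Bool.≟ b) p) (if-yes (side r′ Bool.≟ b) q)
        yn : ∀ {r r′} → side r ≡ b → side r′ ≢ b → G̃ r r′ ≡ G (φ r) (φ r′) - G merged (φ r′)
        yn {r} {r′} p q = trans (if-yes (side r Bool.≟ b) p) (if-no (side r′ Bool.≟ b) q)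
        ny : ∀ {r r′} → side r ≢ b → side r′ ≡ b → G̃ r r′ ≡ G (φ r) (φ r′) - G (φ r) merged
        ny {r} {r′} p q = trans (if-no (side r Bool.≟ b) p) (if-yes (side r′ Bool.≟ b) q)
        nn : ∀ {r r′} → side r ≢ b → side r′ ≢ b → G̃ r r′ ≡ 0ℤ
        nn {r} {r′} p q = trans (if-no (side r Bool.≟ b) p) (if-no (side r′ Bool.≟ b) q)

        H : Crossing → ℤ
        H c = (G̃ (corner c left) (corner c bottom) + G̃ (corner c bottom) (corner c right))
              - (G̃ (corner c left) (corner c top) + G̃ (corner c top) (corner c right))

        H-kept : ∀ c → own c ≡ b → arr~ G c - dep~ G c ≡ H c
        H-kept c o = go (side (corner c left) Bool.≟ b) (side (corner c right) Bool.≟ b)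
          where
          t : side (corner c top) ≡ b
          t = o
          u : side (corner c bottom) ≡ b
          u = trans (own-bottom c) o
          l′ = φ (corner c left)
          r′ = φ (corner c right)
          t′ = φ (corner c top)
          u′ = φ (corner c bottom)
          four : ∀ {a₁ a₂ a₃ a₄} → G̃ (corner c left) (corner c bottom) ≡ a₁ → G̃ (corner c bottom) (corner c right) ≡ a₂ →
                 G̃ (corner c left) (corner c top) ≡ a₃ → G̃ (corner c top) (corner c right) ≡ a₄ → H c ≡ (a₁ + a₂) - (a₃ + a₄)
          four p q r s = cong₂ _-_ (cong₂ _+_ p q) (cong₂ _+_ r s)
          go : Dec (side (corner c left) ≡ b) → Dec (side (corner c right) ≡ b) → arr~ G c - dep~ G c ≡ H c
          go (yes l) (yes r) = sym (four (yy l u) (yy u r) (yy l t) (yy t r))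
          go (no l) (yes r) = trans (alg (G l′ u′) (G u′ r′) (G l′ t′) (G t′ r′) (G l′ merged)) (sym (four (ny l u) (yy u r) (ny l t) (yy t r)))
            where
            alg : ∀ a b c d m → (a + b) - (c + d) ≡ ((a - m) + b) - ((c - m) + d)
            alg = solve-∀
          go (yes l) (no r) = trans (alg (G l′ u′) (G u′ r′) (G l′ t′) (G t′ r′) (G merged r′)) (sym (four (yy l u) (yn u r) (yy l t) (yn t r)))
            where
            alg : ∀ a b c d m → (a + b) - (c + d) ≡ (a + (b - m)) - (c + (d - m))
            alg = solve-∀
          go (no l) (no r) = trans (alg (G l′ u′) (G u′ r′) (G l′ t′) (G t′ r′) (G l′ merged) (G merged r′)) (sym (four (ny l u) (yn u r) (ny l t) (yn t r)))
            where
            alg : ∀ a b c d m k → (a + b) - (c + d) ≡ ((a - m) + (b - k)) - ((c - m) + (d - k))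
            alg = solve-∀

        H-other : ∀ c → own c ≢ b → H c ≡ 0ℤ
        H-other c o = cong₂ _-_ (cong₂ _+_ (at-left u) (at-right u)) (cong₂ _+_ (at-left o) (at-right o))
          where
          u : side (corner c bottom) ≢ b
          u q = o (trans (sym (own-bottom c)) q)
          strand-rim : ∀ s → side (corner c (strand s)) ≡ b → Rim (corner c (strand s))
          strand-rim s q = rim (decidable-stable (on? (c , s)) (λ n → o (trans (sym (own-strand c s n)) q))) o
          at-left : ∀ {r} → side r ≢ b → G̃ (corner c left) r ≡ 0ℤ
          at-left {r} n = go (side (corner c left) Bool.≟ b)
            where
            go : Dec (side (corner c left) ≡ b) → G̃ (corner c left) r ≡ 0ℤ
            go (yes q) = trans (yn q n) (ℤ.i≡j⇒i-j≡0 (cong (λ y → G y (φ r)) (φ-rim q (strand-rim left q))))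
            go (no m)  = nn m n
          at-right : ∀ {r} → side r ≢ b → G̃ r (corner c right) ≡ 0ℤ
          at-right {r} n = go (side (corner c right) Bool.≟ b)
            where
            go : Dec (side (corner c right) ≡ b) → G̃ r (corner c right) ≡ 0ℤ
            go (yes q) = trans (ny n q) (ℤ.i≡j⇒i-j≡0 (cong (G (φ r)) (φ-rim q (strand-rim right q))))
            go (no m)  = nn n m

      seg~-φ : ∑ Xs (arr~ G ∘ proj₁) ≡ ∑ Xs (dep~ G ∘ proj₁)
      seg~-φ = ℤ.i-j≡0⇒i≡j _ _ (trans (sym (∑-- Xs (arr~ G ∘ proj₁) (dep~ G ∘ proj₁)))
        (trans (∑-cong Xs (λ x → H-kept (proj₁ x) (kept-own x)))
        (∑-half H H-other (trans (∑-- Cs (λ c → G̃ (corner c left) (corner c bottom) + G̃ (corner c bottom) (corner c right)) _) (ℤ.i≡j⇒i-j≡0 (∑-segments G̃))))))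

      seg~ : ∑ Xs (λ x → G (corner~ x left) (corner~ x bottom) + G (corner~ x bottom) (corner~ x right))
           ≡ ∑ Xs (λ x → G (corner~ x left) (corner~ x top) + G (corner~ x top) (corner~ x right))
      seg~ = trans (∑-cong Xs (λ x → cong₂ _+_ (cong₂ G (corner-φ x left) (corner-φ x bottom)) (cong₂ G (corner-φ x bottom) (corner-φ x right))))
            (trans seg~-φ (sym (∑-cong Xs (λ x → cong₂ _+_ (cong₂ G (corner-φ x left) (corner-φ x top)) (cong₂ G (corner-φ x top) (corner-φ x right))))))

    coloured~ : ∀ x k x′ k′ → corner~ x k ≡ corner~ x′ k′ → shade (over (proj₁ x)) k ≡ shade (over (proj₁ x′)) k′
    coloured~ x k x′ k′ e = trans (sym (colour-κ (proj₁ x) k)) (trans (go (kind x k) (kind x′ k′) e) (colour-κ (proj₁ x′) k′))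
      where
      go : ∀ {r r′ y y′} → Kind r y → Kind r′ y′ → y ≡ y′ → colour r ≡ colour r′
      go (survivor _ _) (survivor _ _) e = cong (colour ∘ back) e
      go (survivor _ _) (rimmed _ _) ()
      go (survivor _ _) (opened _ _ _ _) ()
      go (rimmed _ _) (survivor _ _) ()
      go (rimmed _ (_ , c , refl)) (rimmed _ (_ , c′ , refl)) _ = colour-bank (cut-on c) (cut-on c′)
      go (rimmed _ _) (opened _ _ _ _) ()
      go (opened _ _ _ _) (survivor _ _) ()
      go (opened _ _ _ _) (rimmed _ _) ()
      go (opened _ _ _ f) (opened _ _ _ f′) e = cong colour (trans (sym f) (trans (cong back e) f′))

    -- Between kept crossings Θ follows the segments of L. A stretch of C through removed crossings
    -- is no longer a segment; it is bridged by `cross`, around the rim region that accompanies it.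
    spreading~ : ∀ (Θ : Region~ → Region~ → Set) →
      (∀ x i j → Θ (corner~ x (lf i)) (corner~ x (rt i)) → Θ (corner~ x (lf j)) (corner~ x (rt j))) →
      ∀ x i x′ j → Θ (corner~ x (lf i)) (corner~ x (rt i)) → ¬ ¬ Θ (corner~ x′ (lf j)) (corner~ x′ (rt j))
    spreading~ Θ h x₀ i x₁ j θ ¬θ = finite-¬¬-dec crossingᶠ R (λ R? → ¬θ (conclude R?))
      where
      P : Kept → Set
      P x = Θ (corner~ x left) (corner~ x top)
      R : Crossing → Set
      R c = ∃[ x ] proj₁ x ≡ c × P x
      Θᴱ : End → Set
      Θᴱ e = Θ (φ (lo e)) (φ (ro e))

      _⇄_ : Set → Set → Set
      A ⇄ B = (A → B) × (B → A)
      _then_ : ∀ {A B C : Set} → A ⇄ B → B ⇄ C → A ⇄ C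
      (f , f′) then (g , g′) = g ∘ f , f′ ∘ g′
      flip′ : ∀ {A B : Set} → A ⇄ B → B ⇄ A
      flip′ (f , g) = g , f
      relabel : ∀ x k k′ → Θ (corner~ x k) (corner~ x k′) ⇄ Θ (φ (corner (proj₁ x) k)) (φ (corner (proj₁ x) k′))
      relabel x k k′ = subst₂ Θ (corner-φ x k) (corner-φ x k′) , subst₂ Θ (sym (corner-φ x k)) (sym (corner-φ x k′))
      renamed : ∀ {r r′ s s′} → r ≡ s → r′ ≡ s′ → Θ (φ r) (φ r′) ⇄ Θ (φ s) (φ s′)
      renamed refl refl = id , id
      pair : ∀ x i j → Θ (corner~ x (lf i)) (corner~ x (rt i)) ⇄ Θ (corner~ x (lf j)) (corner~ x (rt j))
      pair x i j = h x i j , h x j i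

      out : ∀ x s → P x ⇄ Θᴱ (proj₁ x , s)
      out x left  = relabel x left top
      out x right = pair x top right then relabel x top right

      arrive : ∀ e (x : Kept) → proj₁ x ≡ tgt e → P x ⇄ Θᴱ e
      arrive e x q = go x (proj₂ (next e)) (cong₂ _,_ (sym q) refl)
        where
        go : ∀ x s → next e ≡ (proj₁ x , s) → P x ⇄ Θᴱ e
        go x left n = pair x top left then (relabel x left bottom then
          renamed (trans (cong (regionAt ∘ leftOfIn) (sym n)) (left-ok e)) (trans (cong (regionAt ∘ rightOfIn) (sym n)) (right-ok e)))
        go x right n = pair x top bottom then (relabel x bottom right then
          renamed (trans (cong (regionAt ∘ leftOfIn) (sym n)) (left-ok e)) (trans (cong (regionAt ∘ rightOfIn) (sym n)) (right-ok e)))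

      kept : ∀ {c} (q : own c ≡ b) → R c ⇄ P (keep q)
      kept q = (λ (x , e , p) → subst P (kept-ext {x} {keep q} e) p) , (λ p → keep q , refl , p)

      link : ∀ e → own (src e) ≡ b → own (tgt e) ≡ b → R (src e) ⇄ R (tgt e)
      link e s t = kept s then (out (keep s) (proj₂ e) then (flip′ (arrive e (keep t) refl) then flip′ (kept t)))

      conclude : (∀ c → Dec (R c)) → Θ (corner~ x₁ (lf j)) (corner~ x₁ (rt j))
      conclude R? = proj₁ (pair x₁ top j) (subst P (kept-ext {keep (kept-own x₁)} {x₁} refl)
          (proj₁ (kept (kept-own x₁)) (proj₁ (all-crossings Q fw bw (proj₁ x₀) (proj₁ x₁) start) (kept-own x₁))))
        where
        val : Crossing → ℤ
        val c = ⟦ R? c ⟧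

        val-eq : ∀ {c c′} → R c ⇄ R c′ → val c ≡ val c′
        val-eq {c} {c′} (f , g) = ⟦⟧-cong (R? c) (R? c′) f g

        eq-val : ∀ {c c′} → val c ≡ val c′ → R c ⇄ R c′
        eq-val {c} {c′} e = (λ r → ⟦⟧-1 (R? c′) (trans (sym e) (⟦⟧-yes (R? c) r))) , (λ r → ⟦⟧-1 (R? c) (trans e (⟦⟧-yes (R? c′) r)))

        -- Around the region at g the indicator of R can only jump where the circle
        -- returns to the kept crossings, which happens once.
        cross : ∀ {g e} → Cut b g → Cut (not b) e → bank b e ≡ bank b g → R (src g) ⇄ R (tgt e)
        cross {g} {e} cg ce same-bank = eq-val (sym (trans (sym (q-in (tgt e) te)) (trans (ℤ.i-j≡0⇒i≡j _ _ jump-zero) (q-out (src e) se))))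
          where
          r = bank b g
          se : own (src e) ≢ b
          se q = not-≢ {b} (trans (sym q) (proj₁ ce))
          te : own (tgt e) ≡ b
          te = trans (not-eq (proj₂ ce)) (Bool.not-involutive b)
          q : Crossing → ℤ
          q c = if does (own c Bool.≟ b) then val c else val (src g)
          q-in : ∀ c → own c ≡ b → q c ≡ val c
          q-in c o = if-yes (own c Bool.≟ b) o
          q-out : ∀ c → own c ≢ b → q c ≡ val (src g)
          q-out c o = if-no (own c Bool.≟ b) o
          coefficient jump : End → ℤ
          coefficient e = δᵣ (lo e) r - δᵣ (ro e) r
          jump e = q (tgt e) - q (src e)
          flat : ∀ {e} → jump e ≡ 0ℤ → coefficient e * jump e ≡ 0ℤ
          flat {e} z = trans (cong (coefficient e *_) z) (ℤ.*-zeroʳ (coefficient e))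
          away : ∀ {e} → ¬ (r ≡ lo e ⊎ r ≡ ro e) → coefficient e * jump e ≡ 0ℤ
          away {e} n = cong (_* jump e) (cong₂ _-_ (⟦⟧-no (lo e ≟ᴿ r) (n ∘ inj₁ ∘ sym)) (⟦⟧-no (ro e ≟ᴿ r) (n ∘ inj₂ ∘ sym)))
          near? : ∀ e → Dec (r ≡ lo e ⊎ r ≡ ro e)
          near? e = (r ≟ᴿ lo e) ⊎-dec (r ≟ᴿ ro e)
          r-side : side r ≡ b
          r-side = bank-side (cut-on cg)
          other-zero : ∀ e′ → e′ ≢ e → coefficient e′ * jump e′ ≡ 0ℤ
          other-zero e′ ne = go (own (src e′) Bool.≟ b) (own (tgt e′) Bool.≟ b) (near? e′)
            where
            go : Dec (own (src e′) ≡ b) → Dec (own (tgt e′) ≡ b) → Dec (r ≡ lo e′ ⊎ r ≡ ro e′) → coefficient e′ * jump e′ ≡ 0ℤ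
            go _ _ (no n) = away n
            go (yes s) (yes t) _ = flat {e′} (ℤ.i≡j⇒i-j≡0 (trans (q-in _ t) (trans (val-eq (flip′ (link e′ s t))) (sym (q-in _ s)))))
            go (no s) (no t) _ = flat {e′} (ℤ.i≡j⇒i-j≡0 (trans (q-out _ t) (sym (q-out _ s))))
            go (yes s) (no t) (yes n) = flat {e′} (ℤ.i≡j⇒i-j≡0 (trans (q-out _ t)
              (trans (cong (val ∘ src) (apart-rim cg (s , t) (bank-unique (cut-on (s , t)) n r-side))) (sym (q-in _ s)))))
            go (no s) (yes t) (yes n) = contradiction (apart-back ce′ ce (trans (sym (bank-unique (cut-on ce′) n r-side)) (sym same-bank))) ne
              where
              ce′ : Cut (not b) e′
              ce′ = not-eq s , λ q → not-≢ {b} (trans (sym t) q)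
          only : ∀ e′ → coefficient e′ * jump e′ ≡ ⟦ e′ ≟ᴱ e ⟧ * (coefficient e′ * jump e′)
          only e′ = go (e′ ≟ᴱ e)
            where
            go : (d : Dec (e′ ≡ e)) → coefficient e′ * jump e′ ≡ ⟦ d ⟧ * (coefficient e′ * jump e′)
            go (yes _) = sym (ℤ.*-identityˡ _)
            go (no n)  = other-zero e′ n
          total : coefficient e * jump e ≡ 0ℤ
          total = trans (sym (trans (∑-cong Es only) (Finite.∑-δ endᶠ e (λ e → coefficient e * jump e)))) (∑-jumps q r)
          oe = cut-on ce
          jump-zero : jump e ≡ 0ℤ
          jump-zero = go (bank-adjacent b e)
            where
            go : bank b e ≡ lo e ⊎ bank b e ≡ ro e → jump e ≡ 0ℤ
            go (inj₁ f) = trans (sym (ℤ.*-identityˡ (jump e))) (trans (cong (_* jump e) (sym (cong₂ _-_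
                (⟦⟧-yes (lo e ≟ᴿ r) (trans (sym f) same-bank))
                (⟦⟧-no (ro e ≟ᴿ r) (λ z → side-on oe (cong side (trans (trans (sym f) same-bank) (sym z)))))))) total)
            go (inj₂ f) = ℤ.neg-injective (trans (sym (ℤ.-1*i≡-i (jump e))) (trans (cong (_* jump e) (sym (cong₂ _-_
                (⟦⟧-no (lo e ≟ᴿ r) (λ z → side-on oe (cong side (trans z (trans (sym same-bank) f)))))
                (⟦⟧-yes (ro e ≟ᴿ r) (trans (sym f) same-bank))))) total))

        R₀ : Set
        R₀ = R (src g₀)

        -- On a stretch through removed crossings the cut g that opened it is remembered, together
        -- with their common rim region, for comparison at the return.
        Along : End → Set
        Along e = (own (src e) ≡ b → R (src e) ⇄ R₀)
                × (own (src e) ≢ b → ∃[ g ] Cut b g × bank b g ≡ bank b e × (R (src g) ⇄ R₀))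

        along : ∀ {e} → On e → Along e
        along = on-induction-from (cut-on cut₀) Along step
            ((λ _ → id , id) , (λ n → contradiction (proj₁ cut₀) n))
          where
          step : ∀ {e} → On e → Along e → Along (next e)
          step {e} i (f , f′) = (λ t → to-kept t (own (src e) Bool.≟ b)) , (λ t → to-other t (own (src e) Bool.≟ b))
            where
            to-kept : own (tgt e) ≡ b → Dec (own (src e) ≡ b) → R (tgt e) ⇄ R₀
            to-kept t (yes s) = flip′ (link e s t) then f s
            to-kept t (no s) = let g , cg , same-bank , rg = f′ s in
              flip′ (cross cg (not-eq s , λ q → not-≢ {b} (trans (sym t) q)) (sym same-bank)) then rg
            to-other : own (tgt e) ≢ b → Dec (own (src e) ≡ b) → ∃[ g ] Cut b g × bank b g ≡ bank b (next e) × (R (src g) ⇄ R₀)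
            to-other t (yes s) = e , (s , t) , sym (bank-next′ i t) , f s
            to-other t (no s) = let g , cg , same-bank , rg = f′ s in g , cg , trans same-bank (sym (bank-next′ i t)) , rg

        Q : Crossing → Set
        Q c = (own c ≡ b → R c) × (own c ≢ b → R₀)

        start : Q (proj₁ x₀)
        start = (λ _ → x₀ , refl , h x₀ i top θ) , (λ n → contradiction (kept-own x₀) n)

        leaving : ∀ e → own (src e) ≡ b → own (tgt e) ≢ b → R (src e) ⇄ R₀
        leaving e s t = proj₁ (along (cut-on (s , t))) s

        returning : ∀ e → own (src e) ≢ b → own (tgt e) ≡ b → R (tgt e) ⇄ R₀
        returning e s t = proj₁ (along (on-next (changes-on (λ q → s (trans q t))))) t

        fw : ∀ e → Q (src e) → Q (tgt e)
        fw e (f , g) = (λ t → to-kept t (own (src e) Bool.≟ b)) , (λ t → to-other t (own (src e) Bool.≟ b))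
          where
          to-kept : own (tgt e) ≡ b → Dec (own (src e) ≡ b) → R (tgt e)
          to-kept t (yes s) = proj₁ (link e s t) (f s)
          to-kept t (no s)  = proj₂ (returning e s t) (g s)
          to-other : own (tgt e) ≢ b → Dec (own (src e) ≡ b) → R₀
          to-other t (yes s) = proj₁ (leaving e s t) (f s)
          to-other t (no s)  = g s
        bw : ∀ e → Q (tgt e) → Q (src e)
        bw e (f , g) = (λ s → to-kept s (own (tgt e) Bool.≟ b)) , (λ s → to-other s (own (tgt e) Bool.≟ b))
          where
          to-kept : own (src e) ≡ b → Dec (own (tgt e) ≡ b) → R (src e)
          to-kept s (yes t) = proj₂ (link e s t) (f t)
          to-kept s (no t)  = proj₂ (leaving e s t) (g t)
          to-other : own (src e) ≢ b → Dec (own (tgt e) ≡ b) → R₀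
          to-other s (yes t) = proj₁ (returning e s t) (f t)
          to-other s (no t)  = g t

    coherent~ : Coherent (tilde L C S b)
    coherent~ = record { seg = seg~ ; connected = spreading~ ; coloured = coloured~ }

-- Counting regions and cuts

size-⊎ᶠ : ∀ A B → size (A ⊎ᶠ B) ≡ size A ℕ.+ size B
size-⊎ᶠ A B = trans (List.length-++ (map inj₁ (FinSet.elements A)))
  (cong₂ ℕ._+_ (List.length-map inj₁ (FinSet.elements A)) (List.length-map inj₂ (FinSet.elements B)))

⟦⟧-complement : ∀ x → ⟦ x Bool.≟ true ⟧ + ⟦ x Bool.≟ false ⟧ ≡ 1ℤ
⟦⟧-complement true  = refl
⟦⟧-complement false = refl

size-subset : ∀ A p → + size (subsetᶠ A p) ≡ ∑ (FinSet.elements A) (λ x → if p x then 1ℤ else 0ℤ)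
size-subset A p = trans (sym (∑-length (subset-elements p (FinSet.elements A))))
  (trans (∑-subset p (FinSet.elements A) (λ _ → 1ℤ)) (∑-cong (FinSet.elements A) (λ x → ℤ.*-identityʳ (if p x then 1ℤ else 0ℤ))))

count-unique : ∀ {P : A → Set} (P? : ∀ x → Dec (P x)) (xs : List A) → Unique xs →
               (∀ {x y} → P x → P y → x ≡ y) → ∑ xs (λ x → ⟦ P? x ⟧) ≡ 0ℤ ⊎ ∑ xs (λ x → ⟦ P? x ⟧) ≡ 1ℤ
count-unique {P = P} P? xs u h with any? P? xs
... | yes i = let x , j , p = find i in
      inj₂ (trans (∑-cong xs (λ x → sym (ℤ.*-identityʳ ⟦ P? x ⟧))) (∑-single P? (λ _ → 1ℤ) j p (λ _ q → h q p) u))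
... | no n = inj₁ (absent xs (λ j p → n (lose j p)))
  where
  absent : ∀ ys → (∀ {y} → y ∈ ys → ¬ P y) → ∑ ys (λ x → ⟦ P? x ⟧) ≡ 0ℤ
  absent []       g = refl
  absent (y ∷ ys) g = cong₂ _+_ (⟦⟧-no (P? y) (g (here refl))) (absent ys (g ∘ there))

module Counts (L : Diagram) (sphere : OnSphere L) (C : Diagram.End L) (S : SeifertCircle.Complement L C) where
  open Factor L sphere C S public
  private
    module H = Half
    n = length Cs

  open Counting L sphere (proj₁ C) public using (crossings-bound)

  halves : size (Diagram.crossingᶠ (H.D true)) ℕ.+ size (Diagram.crossingᶠ (H.D false)) ≡ n
  halves = ℤ.+-injective (trans (cong₂ _+_ (size-half true) (size-half false))
    (trans (sym (∑-+ Cs (λ c → ⟦ own c Bool.≟ true ⟧) (λ c → ⟦ own c Bool.≟ false ⟧)))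
    (trans (∑-cong Cs (λ c → ⟦⟧-complement (own c))) (∑-length Cs))))
    where
    size-half : ∀ b → + size (Diagram.crossingᶠ (H.D b)) ≡ ∑ Cs (λ c → ⟦ own c Bool.≟ b ⟧)
    size-half b = trans (size-subset crossingᶠ (λ c → does (belongsTo? S b c))) (∑-cong Cs (H.kept⟦⟧ b))

  module _ (b : Bool) where
    open H b

    -- The survivors, and one region for each cut. The swapped diagram has just one region more, the
    -- merged one, so a state of it bounds the length of this list.
    zone : List Region
    zone = map (back ∘ inj₁) (subset-elements survives (FinSet.elements (Diagram.regionᶠ D)))
        ++ map (bank b ∘ lift ∘ proj₁) (subset-elements cutᴰ (FinSet.elements End′))

    zone-covers : ∀ {r} → side r ≡ b → r ∈ zone
    zone-covers {r} q = go (rim? r)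
      where
      survivors = subset-elements survives (FinSet.elements (Diagram.regionᶠ D))
      go : Dec (Rim r) → r ∈ zone
      go (no n) = Mem.∈-++⁺ˡ (Mem.∈-map⁺ (back ∘ inj₁) {xs = survivors}
        (FinSet.complete (subsetᶠ (Diagram.regionᶠ D) survives) (inside q , survives-intro q n)))
      go (yes (e , (p , m) , refl)) = Mem.∈-++⁺ʳ (map (back ∘ inj₁) survivors)
        (Mem.∈-map⁺ (bank b ∘ lift ∘ proj₁) (FinSet.complete (subsetᶠ End′ cutᴰ) (raise e p , cut⇐ {raise e p} m)))

    zone-size : suc (length zone) ≡ size (Diagram.regionᶠ (tilde L C S b))
    zone-size = sym (trans (size-⊎ᶠ U (⊤ᶠ ⊎ᶠ V)) (trans (cong (size U ℕ.+_) (size-⊎ᶠ ⊤ᶠ V)) (trans (ℕ.+-suc (size U) (size V))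
      (cong suc (sym (trans (List.length-++ (map (back ∘ inj₁) (FinSet.elements U)))
        (cong₂ ℕ._+_ (List.length-map (back ∘ inj₁) (FinSet.elements U)) (List.length-map (bank b ∘ lift ∘ proj₁) (FinSet.elements V)))))))))
      where
      U = subsetᶠ (Diagram.regionᶠ D) survives
      V = subsetᶠ End′ cutᴰ

    zone-bound : ∀ {i σ} → IsState (tilde L C S b) i σ → length zone ℕ.≤ 1 ℕ.+ size (Diagram.crossingᶠ D)
    zone-bound {i} {σ} st = ℕ.≤-pred (subst (ℕ._≤ 2 ℕ.+ size (Diagram.crossingᶠ D)) (sym zone-size) (state-size (tilde L C S b) {i} {σ} st))

    half-regions : ∀ {i σ} → IsState D i σ → ∑ Rs (λ r → ⟦ side r Bool.≟ b ⟧) ℤ.≤ + (1 ℕ.+ size (Diagram.crossingᶠ D))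
    half-regions {i} {σ} st = subst (ℤ._≤ + (1 ℕ.+ size (Diagram.crossingᶠ D))) (size-subset regionᶠ (λ r → does (in? S b r)))
      (ℤ.+≤+ (ℕ.≤-pred (subst (ℕ._≤ 2 ℕ.+ size (Diagram.crossingᶠ D))
        (trans (size-⊎ᶠ (subsetᶠ regionᶠ (λ r → does (in? S b r))) ⊤ᶠ) (ℕ.+-comm (size (subsetᶠ regionᶠ (λ r → does (in? S b r)))) 1)) (state-size D {i} {σ} st))))

  private
    add-bounds : ∀ {x y} → x ℕ.≤ 1 ℕ.+ size (Diagram.crossingᶠ (H.D true)) → y ℕ.≤ 1 ℕ.+ size (Diagram.crossingᶠ (H.D false)) → x ℕ.+ y ℕ.≤ 2 ℕ.+ n
    add-bounds p q = ℕ.≤-trans (ℕ.+-mono-≤ p q) (ℕ.≤-reflexive (trans (alg (size (Diagram.crossingᶠ (H.D true))) (size (Diagram.crossingᶠ (H.D false)))) (cong (2 ℕ.+_) halves)))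
      where
      alg : ∀ a b → (1 ℕ.+ a) ℕ.+ (1 ℕ.+ b) ≡ 2 ℕ.+ (a ℕ.+ b)
      alg = solveℕ

  tight-factors : ∀ {i σ i′ σ′} → IsState (H.D true) i σ → IsState (H.D false) i′ σ′ → 2 ℕ.+ n ≡ length Rs
  tight-factors {i} {σ} {i′} {σ′} st st′ = ℕ.≤-antisym crossings-bound (ℤ.drop‿+≤+ (subst₂ ℤ._≤_
      (trans (sym (∑-+ Rs (λ r → ⟦ side r Bool.≟ true ⟧) (λ r → ⟦ side r Bool.≟ false ⟧))) (trans (∑-cong Rs (λ r → ⟦⟧-complement (side r))) (∑-length Rs)))
      (trans (cong +_ (alg (size (Diagram.crossingᶠ (H.D true))) (size (Diagram.crossingᶠ (H.D false))))) (cong (λ z → + (2 ℕ.+ z)) halves))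
      (ℤ.+-mono-≤ (half-regions true {i} {σ} st) (half-regions false {i′} {σ′} st′))))
    where
    alg : ∀ a b → (1 ℕ.+ a) ℕ.+ (1 ℕ.+ b) ≡ 2 ℕ.+ (a ℕ.+ b)
    alg = solveℕ

  tight-state : ∀ {i σ} → IsState L i σ → 2 ℕ.+ n ≡ length Rs
  tight-state {i} {σ} st = ℕ.≤-antisym crossings-bound (state-size L {i} {σ} st)

  module Tildes {i σ i′ σ′} (st : IsState (tilde L C S true) i σ) (st′ : IsState (tilde L C S false) i′ σ′) where
    private
      zones = zone true ++ zone false

      covered : ∀ r → r ∈ zones
      covered r = go (side r) refl
        where
        go : ∀ b → side r ≡ b → r ∈ zones
        go true  q = Mem.∈-++⁺ˡ (zone-covers true q)
        go false q = Mem.∈-++⁺ʳ (zone true) (zone-covers false q)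

      zones-length : length zones ℕ.≤ 2 ℕ.+ n
      zones-length = subst (ℕ._≤ 2 ℕ.+ n) (sym (List.length-++ (zone true))) (add-bounds (zone-bound true {i} {σ} st) (zone-bound false {i′} {σ′} st′))

    tight-tildes : 2 ℕ.+ n ≡ length Rs
    tight-tildes = ℕ.≤-antisym crossings-bound (ℕ.≤-trans (unique-⊆-length R-unique (λ {r} _ → covered r)) zones-length)

    private
      unique-zones : Unique zones
      unique-zones = covered-unique _≟ᴿ_ R-unique (λ {r} _ → covered r) (ℕ.≤-trans zones-length crossings-bound)

      unique-zone : ∀ b → Unique (zone b)
      unique-zone true  = unique-++ˡ (zone true) unique-zones
      unique-zone false = unique-++ʳ (zone true) unique-zones

    -- The two lists cover all regions of L and are together no longer than their number, so no
    -- region is listed for two cuts.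
    cut-bank-injective : ∀ b {g g′} → Cut b g → Cut b g′ → bank b g ≡ bank b g′ → g ≡ g′
    cut-bank-injective b {g} {g′} (p , m) (p′ , m′) e = cong (lift ∘ proj₁) (unique-map-injective (bank b ∘ lift ∘ proj₁)
        (unique-++ʳ (map (back ∘ inj₁) (subset-elements survives (FinSet.elements (Diagram.regionᶠ D)))) (unique-zone b))
        (FinSet.complete (subsetᶠ End′ cutᴰ) (raise g p , cut⇐ {raise g p} m)) (FinSet.complete (subsetᶠ End′ cutᴰ) (raise g′ p′ , cut⇐ {raise g′ p′} m′)) e)
      where open H b

  flux : Bool → Bool → Region → ℤ
  flux β γ r = ∑ Es (λ e → ⟦ cut? β e ×-dec (bank γ e ≟ᴿ r) ⟧)

  -- `∑-jumps` for the indicator of the crossings on side γ, which changes only at cuts. The region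
  -- r always lies on the same hand of C, whence the common sign s.
  flux-balanced : ∀ γ {r} → side r ≡ γ → flux (not γ) γ r ≡ flux γ γ r
  flux-balanced γ {r} rs = ℤ.i-j≡0⇒i≡j _ _ (cancel-sign (trans (sym (∑-*ˡ Es s (λ e → back-flux e - out-flux e)))
      (trans (sym (∑-cong Es term)) (∑-jumps q r))))
    where
    q : Crossing → ℤ
    q c = ⟦ own c Bool.≟ γ ⟧
    s : ℤ
    s = if does (side (lo C) Bool.≟ γ) then 1ℤ else -1ℤ
    back-flux out-flux : End → ℤ
    back-flux e = ⟦ cut? (not γ) e ×-dec (bank γ e ≟ᴿ r) ⟧
    out-flux e = ⟦ cut? γ e ×-dec (bank γ e ≟ᴿ r) ⟧
    cancel-sign : s * ∑ Es (λ e → back-flux e - out-flux e) ≡ 0ℤ → ∑ Es back-flux - ∑ Es out-flux ≡ 0ℤ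
    cancel-sign h = trans (sym (∑-- Es back-flux out-flux)) (go (does (side (lo C) Bool.≟ γ)) h)
      where
      go : ∀ b {z} → (if b then 1ℤ else -1ℤ) * z ≡ 0ℤ → z ≡ 0ℤ
      go true  {z} h = trans (sym (ℤ.*-identityˡ z)) h
      go false {z} h = ℤ.neg-injective (trans (sym (ℤ.-1*i≡-i z)) h)
    coefficient : ∀ {e} → On e → δᵣ (lo e) r - δᵣ (ro e) r ≡ s * ⟦ bank γ e ≟ᴿ r ⟧
    coefficient {e} i = go (side (lo C) Bool.≟ γ)
      where
      go : (d : Dec (side (lo C) ≡ γ)) → δᵣ (lo e) r - δᵣ (ro e) r ≡ (if does d then 1ℤ else -1ℤ) * ⟦ bank γ e ≟ᴿ r ⟧
      go (yes p) = trans (cong₂ (λ x y → x - y) (cong (λ z → δᵣ z r) (bank-unique {γ} i (inj₁ refl) (trans (bearing i) p)))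
                     (⟦⟧-no (ro e ≟ᴿ r) (λ z → side-on i (trans (bearing i) (trans p (trans (sym rs) (cong side (sym z))))))))
                   (alg ⟦ bank γ e ≟ᴿ r ⟧)
        where
        alg : ∀ x → x - 0ℤ ≡ 1ℤ * x
        alg = solve-∀
      go (no n) = trans (cong₂ (λ x y → x - y) (⟦⟧-no (lo e ≟ᴿ r) (λ z → n (trans (sym (bearing i)) (trans (cong side z) rs))))
                     (cong (λ z → δᵣ z r) (bank-unique {γ} i (inj₂ refl) (trans (not-eq (side-on i ∘ sym)) (trans (cong not (trans (bearing i) (not-eq n))) (Bool.not-involutive γ))))))
                   (alg ⟦ bank γ e ≟ᴿ r ⟧)
        where
        alg : ∀ x → 0ℤ - x ≡ -1ℤ * x
        alg = solve-∀
    term : ∀ e → (δᵣ (lo e) r - δᵣ (ro e) r) * (q (tgt e) - q (src e)) ≡ s * (back-flux e - out-flux e)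
    term e = go (on? e)
      where
      jump : ∀ (x y : Bool) → ⟦ y Bool.≟ γ ⟧ - ⟦ x Bool.≟ γ ⟧ ≡ ⟦ (x Bool.≟ not γ) ×-dec ¬? (y Bool.≟ not γ) ⟧ - ⟦ (x Bool.≟ γ) ×-dec ¬? (y Bool.≟ γ) ⟧
      jump x y = cases γ x y
        where
        cases : ∀ γ x y → ⟦ y Bool.≟ γ ⟧ - ⟦ x Bool.≟ γ ⟧ ≡ ⟦ (x Bool.≟ not γ) ×-dec ¬? (y Bool.≟ not γ) ⟧ - ⟦ (x Bool.≟ γ) ×-dec ¬? (y Bool.≟ γ) ⟧
        cases true  true  true  = refl
        cases true  true  false = refl
        cases true  false true  = refl
        cases true  false false = refl
        cases false true  true  = refl
        cases false true  false = refl
        cases false false true  = refl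
        cases false false false = refl
      go : Dec (On e) → (δᵣ (lo e) r - δᵣ (ro e) r) * (q (tgt e) - q (src e)) ≡ s * (back-flux e - out-flux e)
      go (yes i) = trans (cong₂ _*_ (coefficient i) (jump (own (src e)) (own (tgt e))))
        (trans (alg s ⟦ bank γ e ≟ᴿ r ⟧ ⟦ cut? (not γ) e ⟧ ⟦ cut? γ e ⟧)
               (cong (s *_) (sym (cong₂ _-_ (⟦⟧-× (cut? (not γ) e) (bank γ e ≟ᴿ r)) (⟦⟧-× (cut? γ e) (bank γ e ≟ᴿ r))))))
        where
        alg : ∀ s x c d → (s * x) * (c - d) ≡ s * (c * x - d * x)
        alg = solve-∀
      go (no n) = trans (cong ((δᵣ (lo e) r - δᵣ (ro e) r) *_) (ℤ.i≡j⇒i-j≡0 (cong (λ x → ⟦ x Bool.≟ γ ⟧) (sym (off-own n)))))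
        (trans (ℤ.*-zeroʳ (δᵣ (lo e) r - δᵣ (ro e) r)) (sym (trans (cong (s *_) (cong₂ _-_
          (⟦⟧-no (cut? (not γ) e ×-dec (bank γ e ≟ᴿ r)) (n ∘ cut-on ∘ proj₁)) (⟦⟧-no (cut? γ e ×-dec (bank γ e ≟ᴿ r)) (n ∘ cut-on ∘ proj₁)))) (ℤ.*-zeroʳ s))))

  -- An injective bank is met equally often by the cuts in both directions.
  module Transfer (γ : Bool) (inj : ∀ {g g′} → Cut γ g → Cut γ g′ → bank γ g ≡ bank γ g′ → g ≡ g′) where

    private
      Hits : Bool → Region → End → Set
      Hits β r e = Cut β e × bank γ e ≡ r
      hits? : ∀ β r e → Dec (Hits β r e)
      hits? β r e = cut? β e ×-dec (bank γ e ≟ᴿ r)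

    transfer : ∀ {g g′} → Cut (not γ) g → Cut (not γ) g′ → bank γ g ≡ bank γ g′ → g ≡ g′
    transfer {g} {g′} cg cg′ e = go (count-unique (hits? γ r) Es E-unique (λ (c , f) (c′ , f′) → inj c c′ (trans f (sym f′))))
      where
      r = bank γ g
      bal : flux (not γ) γ r ≡ flux γ γ r
      bal = flux-balanced γ (bank-side (cut-on cg))
      go : flux γ γ r ≡ 0ℤ ⊎ flux γ γ r ≡ 1ℤ → g ≡ g′
      go (inj₁ z) = contradiction (cg , refl) (count-none (hits? (not γ) r) Es (trans bal z) (E-complete g))
      go (inj₂ o) = let x , _ , _ , u = count-one (hits? (not γ) r) Es (trans bal o) in
        trans (u (E-complete g) (cg , refl)) (sym (u (E-complete g′) (cg′ , sym e)))

  reflect : ∀ γ {g} → Cut (not γ) g → ∃[ g′ ] Cut γ g′ × bank γ g′ ≡ bank γ g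
  reflect γ {g} cg = go (any? (λ e → cut? γ e ×-dec (bank γ e ≟ᴿ bank γ g)) Es)
    where
    go : Dec (Any.Any (λ e → Cut γ e × bank γ e ≡ bank γ g) Es) → ∃[ g′ ] Cut γ g′ × bank γ g′ ≡ bank γ g
    go (yes i) = let e , _ , p = find i in e , p
    go (no n) = contradiction (cg , refl) (count-none (λ e → cut? (not γ) e ×-dec (bank γ e ≟ᴿ bank γ g)) Es
      (trans (flux-balanced γ (bank-side (cut-on cg))) (∑-zero Es (λ e → ⟦⟧-no (cut? γ e ×-dec (bank γ e ≟ᴿ bank γ g)) (λ p → n (lose (E-complete e) p)))))
      (E-complete g))

  reflect⁻ : ∀ γ {g} → Cut γ g → ∃[ g′ ] Cut (not γ) g′ × bank γ g′ ≡ bank γ g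
  reflect⁻ γ {g} cg = go (any? (λ e → cut? (not γ) e ×-dec (bank γ e ≟ᴿ bank γ g)) Es)
    where
    go : Dec (Any.Any (λ e → Cut (not γ) e × bank γ e ≡ bank γ g) Es) → ∃[ g′ ] Cut (not γ) g′ × bank γ g′ ≡ bank γ g
    go (yes i) = let e , _ , p = find i in e , p
    go (no n) = contradiction (cg , refl) (count-none (λ e → cut? γ e ×-dec (bank γ e ≟ᴿ bank γ g)) Es
      (trans (sym (flux-balanced γ (bank-side (cut-on cg)))) (∑-zero Es (λ e → ⟦⟧-no (cut? (not γ) e ×-dec (bank γ e ≟ᴿ bank γ g)) (λ p → n (lose (E-complete e) p)))))
      (E-complete g))

  -- Going back along C to the last cut out of side b; the region on side b is unchanged in between.
  rim-behind : ∀ {b g₀ c s} → Cut b g₀ → On (c , s) → own c ≢ b → ∃[ g ] Cut b g × bank b g ≡ corner c (strand s)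
  rim-behind {b} {g₀} c₀ i n = let g , cg , e = on-induction-from (cut-on c₀) Behind step (λ m → contradiction (proj₁ c₀) m) i n in
      g , cg , trans e (bank-out′ i n)
    where
    Behind : End → Set
    Behind e = own (src e) ≢ b → ∃[ g ] Cut b g × bank b g ≡ bank b e
    step : ∀ {e} → On e → Behind e → Behind (next e)
    step {e} i f t = go (own (src e) Bool.≟ b)
      where
      go : Dec (own (src e) ≡ b) → ∃[ g ] Cut b g × bank b g ≡ bank b (next e)
      go (yes s) = e , (s , t) , sym (bank-next′ i t)
      go (no s)  = let g , cg , q = f s in g , cg , trans q (sym (bank-next′ i t))

  #cuts : Bool → ℤ
  #cuts β = ∑ Es (λ e → ⟦ cut? β e ⟧)

  cuts-balanced : #cuts true ≡ #cuts false
  cuts-balanced = ℤ.i-j≡0⇒i≡j _ _ (trans (sym (∑-- Es (λ e → ⟦ cut? true e ⟧) (λ e → ⟦ cut? false e ⟧)))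
      (trans (∑-cong Es (λ e → change (own (src e)) (own (tgt e))))
      (trans (∑-- Es (λ e → q (src e)) (λ e → q (tgt e))) (ℤ.i≡j⇒i-j≡0 (sym (reindex-next (λ e → q (src e))))))))
    where
    q : Crossing → ℤ
    q c = ⟦ own c Bool.≟ true ⟧
    change : ∀ x y → ⟦ (x Bool.≟ true) ×-dec ¬? (y Bool.≟ true) ⟧ - ⟦ (x Bool.≟ false) ×-dec ¬? (y Bool.≟ false) ⟧ ≡ ⟦ x Bool.≟ true ⟧ - ⟦ y Bool.≟ true ⟧
    change true  true  = refl
    change true  false = refl
    change false true  = refl
    change false false = refl

  -- C leaves a side as often as it enters it, so the number of connecting segments is even and the
  -- halving in `len` loses nothing.
  len-cuts : ∀ β → + SeifertCircle.len L C S ≡ #cuts β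
  len-cuts β = trans (cong +_ len≡) (trans k≡ (both β))
    where
    open SeifertCircle L C using (len)
    k : ℕ
    k = length (filter (cut? true) Es)
    k≡ : + k ≡ #cuts true
    k≡ = ∑-count (cut? true) Es
    both : ∀ β → #cuts true ≡ #cuts β
    both true  = refl
    both false = cuts-balanced
    connecting-cuts : ∀ e → ⟦ connecting? S e ⟧ ≡ ⟦ cut? true e ⟧ + ⟦ cut? false e ⟧
    connecting-cuts e = go (cut? true e) (cut? false e)
      where
      from : Connecting S e → Cut true e ⊎ Cut false e
      from (_ , inj₁ (x , y)) = inj₁ (belongs⁻ x , λ q → not-≢ (trans (sym q) (belongs⁻ y)))
      from (_ , inj₂ (x , y)) = inj₂ (belongs⁻ x , λ q → not-≢ (trans (sym q) (belongs⁻ y)))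
      go : (d : Dec (Cut true e)) (d′ : Dec (Cut false e)) → ⟦ connecting? S e ⟧ ≡ ⟦ d ⟧ + ⟦ d′ ⟧
      go (yes (p , m)) (yes (p′ , _)) = contradiction (trans (sym p) p′) (λ ())
      go (yes (p , m)) (no _) = ⟦⟧-yes (connecting? S e) (cut-on (p , m) , inj₁ (belongs p , belongs (not-eq m)))
      go (no _) (yes (p , m)) = ⟦⟧-yes (connecting? S e) (cut-on (p , m) , inj₂ (belongs p , belongs (not-eq m)))
      go (no n) (no m) = ⟦⟧-no (connecting? S e) ([ n , m ]′ ∘ from)
    twice : length (filter (connecting? S) Es) ≡ k ℕ.+ k
    twice = ℤ.+-injective (trans (∑-count (connecting? S) Es) (trans (∑-cong Es connecting-cuts)
      (trans (∑-+ Es (λ e → ⟦ cut? true e ⟧) (λ e → ⟦ cut? false e ⟧)) (cong₂ _+_ (sym k≡) (trans (sym cuts-balanced) (sym k≡))))))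
    len≡ : len S ≡ k
    len≡ = trans (cong ℕ.⌊_/2⌋ twice) (sym (ℕ.n≡⌊n+n/2⌋ k))

  ∑-halves : ∀ (F : Crossing → ℤ) → ∑ Cs F ≡ ∑ (H.Xs true) (F ∘ proj₁) + ∑ (H.Xs false) (F ∘ proj₁)
  ∑-halves F = sym (trans (cong₂ _+_ (H.∑-kept true F) (H.∑-kept false F))
    (trans (sym (∑-+ Cs (λ c → ⟦ own c Bool.≟ true ⟧ * F c) (λ c → ⟦ own c Bool.≟ false ⟧ * F c)))
    (∑-cong Cs (λ c → trans (sym (ℤ.*-distribʳ-+ (F c) ⟦ own c Bool.≟ true ⟧ ⟦ own c Bool.≟ false ⟧))
      (trans (cong (_* F c) (⟦⟧-complement (own c))) (ℤ.*-identityˡ (F c)))))))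

-- Splitting assignments and multiplying polynomials

module _ (X : FinSet) (p p′ : FinSet.Carrier X → Bool)
         (either : ∀ x → ¬ T (p x) → T (p′ x)) (exclusive : ∀ x → T (p x) → ¬ T (p′ x)) where

  private
    module A  = Assignments X
    module A₁ = Assignments (subsetᶠ X p)
    module A₂ = Assignments (subsetᶠ X p′)

  S-split : ∀ xs (Φ : A₁.Asg → A₂.Asg → ℤ) → (∀ {σ₁ τ₁ σ₂ τ₂} → σ₁ A₁.≗ₐ τ₁ → σ₂ A₂.≗ₐ τ₂ → Φ σ₁ σ₂ ≡ Φ τ₁ τ₂) →
            A.S xs (λ σ → Φ (σ ∘ proj₁) (σ ∘ proj₁)) ≡
            A₂.S (subset-elements p′ xs) (λ σ₂ → A₁.S (subset-elements p xs) (λ σ₁ → Φ σ₁ σ₂))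
  S-split []       Φ ext = ext (λ _ → refl) (λ _ → refl)
  S-split (x ∷ xs) Φ ext with T? (p x) | T? (p′ x)
  ... | yes t | yes t′ = contradiction t′ (exclusive x t)
  ... | no n  | no n′  = contradiction (either x n) n′
  ... | yes t | no n′  =
    trans (A.S-cong xs (λ σ → ∑-cong corners (λ k → ext {τ₁ = A₁.upd (σ ∘ proj₁) (x , t) k} {τ₂ = σ ∘ proj₁} (λ _ → refl)
              (λ y → A.upd-there σ k (λ e → n′ (subst (T ∘ p′) e (proj₂ y)))))))
          (S-split xs (λ σ₁ σ₂ → ∑ₖ (λ k → Φ (A₁.upd σ₁ (x , t) k) σ₂)) (λ h h′ → ∑-cong corners (λ k → ext (A₁.upd-cong (x , t) k h) h′)))
  ... | no n  | yes t′ =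
    trans (A.S-cong xs (λ σ → ∑-cong corners (λ k → ext {τ₁ = σ ∘ proj₁} {τ₂ = A₂.upd (σ ∘ proj₁) (x , t′) k}
              (λ y → A.upd-there σ k (λ e → n (subst (T ∘ p) e (proj₂ y)))) (λ _ → refl))))
   (trans (S-split xs (λ σ₁ σ₂ → ∑ₖ (λ k → Φ σ₁ (A₂.upd σ₂ (x , t′) k))) (λ h h′ → ∑-cong corners (λ k → ext h (A₂.upd-cong (x , t′) k h′))))
          (A₂.S-cong (subset-elements p′ xs) (λ σ₂ → A₁.S-∑ (subset-elements p xs) corners (λ σ₁ k → Φ σ₁ (A₂.upd σ₂ (x , t′) k)))))

coeff-⊛ : ∀ p q n → coeff (p ⊛ q) n ≡ ∑ p (λ t → proj₁ t * coeff q (n - proj₂ t))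
coeff-⊛ []            q n = refl
coeff-⊛ ((a , m) ∷ p) q n = trans (coeff-∑ (map ((a , m) ·_) q ++ p ⊛ q) n)
  (trans (∑-++ (map ((a , m) ·_) q) (p ⊛ q) (λ t → ⟦ proj₂ t ℤ.≟ n ⟧ * proj₁ t))
  (cong₂ _+_ (trans (∑-map ((a , m) ·_) q (λ t → ⟦ proj₂ t ℤ.≟ n ⟧ * proj₁ t))
      (trans (∑-cong q (λ (b , k) → trans (alg ⟦ m + k ℤ.≟ n ⟧ a b) (cong (λ z → a * (z * b))
          (⟦⟧-cong (m + k ℤ.≟ n) (k ℤ.≟ n - m) (λ { refl → alg₁ m k }) (λ { refl → alg₂ m n })))))
      (trans (∑-*ˡ q a (λ (b , k) → ⟦ k ℤ.≟ n - m ⟧ * b)) (cong (a *_) (sym (coeff-∑ q (n - m)))))))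
    (trans (sym (coeff-∑ (p ⊛ q) n)) (coeff-⊛ p q n))))
  where
  alg : ∀ x a b → x * (a * b) ≡ a * (x * b)
  alg = solve-∀
  alg₁ : ∀ m k → k ≡ (m + k) - m
  alg₁ = solve-∀
  alg₂ : ∀ m n → m + (n - m) ≡ n
  alg₂ = solve-∀

module _ {X X′ : FinSet} (w e : Assignments.Asg X → ℤ) (w′ e′ : Assignments.Asg X′ → ℤ)
         (xs : List (FinSet.Carrier X)) (xs′ : List (FinSet.Carrier X′)) where

  private
    module A  = Assignments X
    module A′ = Assignments X′

  coeff-product : ∀ p q → (∀ m → coeff p m ≡ A.S xs (λ σ → w σ * ⟦ e σ ℤ.≟ m ⟧)) →
                  (∀ m → coeff q m ≡ A′.S xs′ (λ σ′ → w′ σ′ * ⟦ e′ σ′ ℤ.≟ m ⟧)) →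
                  ∀ n → coeff (p ⊛ q) n ≡ A′.S xs′ (λ σ′ → A.S xs (λ σ → (w σ * w′ σ′) * ⟦ e σ + e′ σ′ ℤ.≟ n ⟧))
  coeff-product p q hp hq n = trans (coeff-⊛ p q n)
    (trans (∑-cong p (λ (a , m) → trans (cong (a *_) (hq (n - m))) (sym (A′.S-*ˡ xs′ a (λ σ′ → w′ σ′ * ⟦ e′ σ′ ℤ.≟ n - m ⟧)))))
    (trans (sym (A′.S-∑ xs′ p (λ σ′ (a , m) → a * (w′ σ′ * ⟦ e′ σ′ ℤ.≟ n - m ⟧))))
    (A′.S-cong xs′ (λ σ′ → trans (∑-cong p (λ (a , m) → trans (alg a (w′ σ′) ⟦ e′ σ′ ℤ.≟ n - m ⟧)
          (cong (λ z → w′ σ′ * (z * a)) (⟦⟧-cong (e′ σ′ ℤ.≟ n - m) (m ℤ.≟ n - e′ σ′) (λ r → trans (alg₁ n m) (cong (_-_ n) (sym r))) (λ r → trans (alg₁ n (e′ σ′)) (cong (_-_ n) (sym r)))))))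
      (trans (∑-*ˡ p (w′ σ′) (λ (a , m) → ⟦ m ℤ.≟ n - e′ σ′ ⟧ * a))
      (trans (cong (w′ σ′ *_) (trans (sym (coeff-∑ p (n - e′ σ′))) (hp (n - e′ σ′))))
      (trans (sym (A.S-*ˡ xs (w′ σ′) (λ σ → w σ * ⟦ e σ ℤ.≟ n - e′ σ′ ⟧)))
      (A.S-cong xs (λ σ → trans (alg₂ (w′ σ′) (w σ) ⟦ e σ ℤ.≟ n - e′ σ′ ⟧)
        (cong ((w σ * w′ σ′) *_) (⟦⟧-cong (e σ ℤ.≟ n - e′ σ′) (e σ + e′ σ′ ℤ.≟ n)
          (λ r → trans (cong (_+ e′ σ′) r) (alg₃ n (e′ σ′))) (λ r → trans (alg₄ (e σ) (e′ σ′)) (cong (_- e′ σ′) r)))))))))))))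
    where
    alg : ∀ a w z → a * (w * z) ≡ w * (z * a)
    alg = solve-∀
    alg₁ : ∀ n m → m ≡ n - (n - m)
    alg₁ = solve-∀
    alg₂ : ∀ w′ w z → w′ * (w * z) ≡ (w * w′) * z
    alg₂ = solve-∀
    alg₃ : ∀ n x → (n - x) + x ≡ n
    alg₃ = solve-∀
    alg₄ : ∀ x y → x ≡ (x + y) - y
    alg₄ = solve-∀

module _ (D : Diagram) (co : Coherent D) (no-circle : Diagram.Circle D → ⊥) where
  open Coefficients D co

  coeff-at : ∀ i c j n → coeff ∣ Δ̃ D i ∣ n ≡ #states (κ c (lf j)) (κ c (rt j)) n
  coeff-at (inj₁ (c′ , left))  c j n = trans (coeff-∣Δ̃∣ (inj₁ (c′ , left)) n) (states-invariant c′ top c j n)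
  coeff-at (inj₁ (c′ , right)) c j n = trans (coeff-∣Δ̃∣ (inj₁ (c′ , right)) n) (states-invariant c′ right c j n)
  coeff-at (inj₂ o)            c j n = ⊥-elim (no-circle o)

-- Combining states

module Main (L : Diagram) (sphere : OnSphere L) (alternating : Alternating L) (C : Diagram.End L)
            (S : SeifertCircle.Complement L C)
            (tight : 2 ℕ.+ size (Diagram.crossingᶠ L) ≡ size (Diagram.regionᶠ L))
            (g₀ : Diagram.End L) (cut₀ : Sides.Cut L sphere C S true g₀) where
  open Counts L sphere C S
  private
    module Col = Coloured L sphere alternating C S tight
    module KL = Independence (skeleton L Col.coherentᴸ)

    x₀ y₀ : Region
    x₀ = lo g₀
    y₀ = ro g₀

    -- Adjacency to the base segment, phrased by the side of r so that it can be treated separately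
    -- on the two sides.
    Absent : Region → Set
    Absent r = r ≡ bank (side r) g₀

    absent? : ∀ r → Dec (Absent r)
    absent? r = r ≟ᴿ bank (side r) g₀

    on₀ : On g₀
    on₀ = cut-on cut₀

    absent-base : ∀ {r} → Absent r → r ≡ x₀ ⊎ r ≡ y₀
    absent-base {r} e = go (bank-adjacent (side r) g₀)
      where
      go : bank (side r) g₀ ≡ x₀ ⊎ bank (side r) g₀ ≡ y₀ → r ≡ x₀ ⊎ r ≡ y₀
      go (inj₁ f) = inj₁ (trans e f)
      go (inj₂ f) = inj₂ (trans e f)

    base-absent : ∀ {r} → r ≡ x₀ ⊎ r ≡ y₀ → Absent r
    base-absent h = bank-unique on₀ h refl

    target-L : ∀ r → KL.target (KL.base x₀ y₀) r ≡ ⟦ ¬? (absent? r) ⟧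
    target-L r = go (absent? r)
      where
      go : (d : Dec (Absent r)) → KL.target (KL.base x₀ y₀) r ≡ ⟦ ¬? d ⟧
      go (yes a) = cong (if_then 0ℤ else 1ℤ) (in-base (absent-base a))
        where
        in-base : r ≡ x₀ ⊎ r ≡ y₀ → KL.base x₀ y₀ r ≡ true
        in-base (inj₁ refl) = KL.base-left x₀ y₀
        in-base (inj₂ refl) = KL.base-right x₀ y₀
      go (no n) = cong (if_then 0ℤ else 1ℤ) (KL.base-neither x₀ y₀ r (n ∘ base-absent ∘ inj₁) (n ∘ base-absent ∘ inj₂))

    Rimmed : Region → Set
    Rimmed r = ∃[ e ] Cut (side r) e × bank (side r) e ≡ r

    rimmed? : ∀ r → Dec (Rimmed r)
    rimmed? r = Half.rim? (side r) r

    absent-rimmed : ∀ {r} → Absent r → Rimmed r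
    absent-rimmed {r} a = go (side r) refl
      where
      go : ∀ b → side r ≡ b → Rimmed r
      go true  q = g₀ , subst (λ b → Cut b g₀) (sym q) cut₀ , sym a
      go false q = let g , cg , e = reflect false {g₀} cut₀ in
        g , subst (λ b → Cut b g) (sym q) cg , trans (cong (λ b → bank b g) q) (trans e (trans (cong (λ b → bank b g₀) (sym q)) (sym a)))

  -- One of the two halves, with the segment g₀ as base; the first or the second crossing
  -- at the ends of g₀ belongs to it.
  module HalfStates (b : Bool) where
    open Half b
    open Col.CoherentHalf b using (coherent-half; foreign-bank)

    base-crossing : ∃[ x ] ∃[ j ] corner (proj₁ {B = λ c → T (does (belongsTo? S b c))} x) (lf j) ≡ x₀ × corner (proj₁ x) (rt j) ≡ y₀
    base-crossing = go (own (src g₀) Bool.≟ b)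
      where
      go : Dec (own (src g₀) ≡ b) → ∃[ x ] ∃[ j ] corner (proj₁ {B = λ c → T (does (belongsTo? S b c))} x) (lf j) ≡ x₀ × corner (proj₁ x) (rt j) ≡ y₀
      go (yes q) = keep q , out g₀
        where
        out : ∀ e → ∃[ j ] corner (src e) (lf j) ≡ lo e × corner (src e) (rt j) ≡ ro e
        out (c , left)  = top , refl , refl
        out (c , right) = right , refl , refl
      go (no n) = keep (trans (not-eq (λ q → proj₂ cut₀ q)) (sym (not-eq (λ q → n (trans (proj₁ cut₀) (sym q)))))) ,
          (let j , p , q = arrive (next g₀) in j , trans p (left-ok g₀) , trans q (right-ok g₀))
        where
        arrive : ∀ e → ∃[ j ] corner (src e) (lf j) ≡ regionAt (leftOfIn e) × corner (src e) (rt j) ≡ regionAt (rightOfIn e)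
        arrive (c , left)  = left , refl , refl
        arrive (c , right) = bottom , refl , refl

    xᵇ = proj₁ base-crossing
    jᵇ = proj₁ (proj₂ base-crossing)

    Asgᵇ : Set
    Asgᵇ = Kept → Corner

    u : Asgᵇ → Region → ℤ
    u σ r = ∑ Xs (λ x → ⟦ corner (proj₁ x) (σ x) ≟ᴿ r ⟧)

    exᵇ : Asgᵇ → ℤ
    exᵇ σ = ∑ Xs (λ x → 1ℤ * exponent (over (proj₁ x)) (σ x))

    u-zero : ∀ {σ r} → (∀ x → corner (proj₁ x) (σ x) ≢ r) → u σ r ≡ 0ℤ
    u-zero {σ} {r} h = ∑-zero Xs (λ x → ⟦⟧-no (corner (proj₁ x) (σ x) ≟ᴿ r) (h x))

    module Co = Independence (skeleton D coherent-half)

    I : Region → ℤ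
    I r = ⟦ (side r Bool.≟ b) ×-dec ¬? (absent? r) ⟧

    Ideal : Asgᵇ → Set
    Ideal σ = ∀ r → u σ r ≡ I r

    stateᶠ? : ∀ σ → Dec (Co.State (π x₀) (π y₀) σ)
    stateᶠ? = Co.state? (π x₀) (π y₀)

    -- The base segment lies on C, so its region on the far side becomes the new face.
    face-base : Co.base (π x₀) (π y₀) face ≡ true
    face-base = go (side x₀ Bool.≟ b)
      where
      go : Dec (side x₀ ≡ b) → Co.base (π x₀) (π y₀) face ≡ true
      go (yes q) = subst (λ z → Co.base (π x₀) (π y₀) z ≡ true) (π-out {y₀} (λ q′ → side-on on₀ (trans q (sym q′)))) (Co.base-right (π x₀) (π y₀))
      go (no n) = subst (λ z → Co.base (π x₀) (π y₀) z ≡ true) (π-out {x₀} n) (Co.base-left (π x₀) (π y₀))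

    inside-target : ∀ {r} (q : side r ≡ b) → Co.target (Co.base (π x₀) (π y₀)) (inside q) ≡ I r
    inside-target {r} q = go (absent? r)
      where
      back-in : ∀ {z} → inside q ≡ π z → r ≡ z
      back-in e = sym (proj₂ (region-of (sym e)))
      go : (d : Dec (Absent r)) → Co.target (Co.base (π x₀) (π y₀)) (inside q) ≡ ⟦ (side r Bool.≟ b) ×-dec ¬? d ⟧
      go (yes a) = trans (cong (if_then 0ℤ else 1ℤ) (in-base (absent-base a))) (sym (⟦⟧-no ((side r Bool.≟ b) ×-dec ¬? (yes a)) (λ (_ , n) → n a)))
        where
        in-base : r ≡ x₀ ⊎ r ≡ y₀ → Co.base (π x₀) (π y₀) (inside q) ≡ true
        in-base (inj₁ e) = subst (λ z → Co.base (π x₀) (π y₀) z ≡ true) (trans (cong π (sym e)) (π-in q)) (Co.base-left (π x₀) (π y₀))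
        in-base (inj₂ e) = subst (λ z → Co.base (π x₀) (π y₀) z ≡ true) (trans (cong π (sym e)) (π-in q)) (Co.base-right (π x₀) (π y₀))
      go (no n) = trans (cong (if_then 0ℤ else 1ℤ) (Co.base-neither (π x₀) (π y₀) (inside q)
          (n ∘ base-absent ∘ inj₁ ∘ back-in) (n ∘ base-absent ∘ inj₂ ∘ back-in)))
        (sym (⟦⟧-yes ((side r Bool.≟ b) ×-dec ¬? (no n)) (q , n)))

    uses-inside : ∀ σ {r} (q : side r ≡ b) → Co.uses Co.full σ (inside q) ≡ u σ r
    uses-inside σ {r} q = ∑-cong Xs (λ x → ⟦⟧-cong (Co.points? Co.full σ (inside q) x) (corner (proj₁ x) (σ x) ≟ᴿ r)
      (λ (_ , e) → proj₂ (region-of e)) (λ e → refl , trans (cong π e) (π-in q)))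

    I-outside : ∀ {r} → side r ≢ b → I r ≡ 0ℤ
    I-outside {r} n = ⟦⟧-no ((side r Bool.≟ b) ×-dec ¬? (absent? r)) (n ∘ proj₁)

    state⇒ideal : ∀ {σ} → Co.State (π x₀) (π y₀) σ → Ideal σ
    state⇒ideal {σ} st r = go (side r Bool.≟ b)
      where
      go : Dec (side r ≡ b) → u σ r ≡ I r
      go (yes q) = trans (sym (uses-inside σ q)) (trans (st (inside q)) (inside-target q))
      go (no n) = trans (u-zero {σ} (λ x e → Co.state-avoids {k = σ x} refl (subst (λ z → Co.base (π x₀) (π y₀) z ≡ true)
          (sym (π-out (n ∘ trans (sym (cong side e))))) face-base) st)) (sym (I-outside n))

    ideal⇒state : ∀ {σ} → Ideal σ → Co.State (π x₀) (π y₀) σ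
    ideal⇒state {σ} id′ (inj₁ (r , t)) = subst (λ y → Co.uses Co.full σ y ≡ Co.target (Co.base (π x₀) (π y₀)) y)
      (cong inj₁ (subset-ext (λ r → does (in? S b r)) {inside-pair} {r , t} refl))
      (trans (uses-inside σ q) (trans (id′ r) (sym (inside-target q))))
      where
      q : side r ≡ b
      q = T-does (in? S b r) t
      inside-pair : Σ Region (λ r → T (does (in? S b r)))
      inside-pair = r , does-T (in? S b r) q
    ideal⇒state {σ} id′ (inj₂ tt) = trans (∑-zero Xs (λ x → ⟦⟧-no (Co.points? Co.full σ face x) (λ (_ , e) →
        count-none (λ x′ → corner (proj₁ x′) (σ x′) ≟ᴿ corner (proj₁ x) (σ x)) Xs (trans (id′ _) (I-outside (face-side e))) (FinSet.complete (Diagram.crossingᶠ D) x) refl)))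
      (sym (cong (if_then 0ℤ else 1ℤ) face-base))

    coeff-factor : ∀ i m → coeff ∣ Δ̃ D i ∣ m ≡ Co.#states (π x₀) (π y₀) m
    coeff-factor i m = trans (coeff-at D coherent-half (λ o → Col.no-circle (proj₁ o)) i xᵇ jᵇ m)
      (cong₂ (λ x y → Co.#states (π x) (π y) m) (proj₁ (proj₂ (proj₂ base-crossing))) (proj₂ (proj₂ (proj₂ base-crossing))))

  private
    module HT = HalfStates true
    module HF = HalfStates false

    restrict₁ : KL.Asg → HT.Asgᵇ
    restrict₁ σ x = σ (proj₁ x)
    restrict₂ : KL.Asg → HF.Asgᵇ
    restrict₂ σ x = σ (proj₁ x)

    uses-halves : ∀ σ r → KL.uses KL.full σ r ≡ HT.u (restrict₁ σ) r + HF.u (restrict₂ σ) r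
    uses-halves σ r = ∑-halves (λ c → ⟦ corner c (σ c) ≟ᴿ r ⟧)

    ex-halves : ∀ σ → KL.ex KL.full σ ≡ HT.exᵇ (restrict₁ σ) + HF.exᵇ (restrict₂ σ)
    ex-halves σ = ∑-halves (λ c → 1ℤ * exponent (over c) (σ c))

    I-total : ∀ r → HT.I r + HF.I r ≡ KL.target (KL.base x₀ y₀) r
    I-total r = trans (cong₂ _+_ (⟦⟧-× (side r Bool.≟ true) (¬? (absent? r))) (⟦⟧-× (side r Bool.≟ false) (¬? (absent? r))))
      (trans (sym (ℤ.*-distribʳ-+ ⟦ ¬? (absent? r) ⟧ ⟦ side r Bool.≟ true ⟧ ⟦ side r Bool.≟ false ⟧))
      (trans (cong (_* ⟦ ¬? (absent? r) ⟧) (⟦⟧-complement (side r))) (trans (ℤ.*-identityˡ ⟦ ¬? (absent? r) ⟧) (sym (target-L r)))))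

    stateᴸ? : ∀ σ → Dec (KL.State x₀ y₀ σ)
    stateᴸ? = KL.state? x₀ y₀

    ideals⇒state : ∀ σ → HT.Ideal (restrict₁ σ) → HF.Ideal (restrict₂ σ) → KL.State x₀ y₀ σ
    ideals⇒state σ h h′ r = trans (uses-halves σ r) (trans (cong₂ _+_ (h r) (h′ r)) (I-total r))

    module A₁ = Assignments (Diagram.crossingᶠ (Half.D true))
    module A₂ = Assignments (Diagram.crossingᶠ (Half.D false))

    Xs₁ = Half.Xs true
    Xs₂ = Half.Xs false

    split : ∀ (Φ : HT.Asgᵇ → HF.Asgᵇ → ℤ) → (∀ {σ₁ τ₁ σ₂ τ₂} → σ₁ A₁.≗ₐ τ₁ → σ₂ A₂.≗ₐ τ₂ → Φ σ₁ σ₂ ≡ Φ τ₁ τ₂) →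
            KL.S KL.Xs (λ σ → Φ (restrict₁ σ) (restrict₂ σ)) ≡ A₂.S Xs₂ (λ σ₂ → A₁.S Xs₁ (λ σ₁ → Φ σ₁ σ₂))
    split = S-split crossingᶠ (λ c → does (belongsTo? S true c)) (λ c → does (belongsTo? S false c))
      (λ c n → does-T (belongsTo? S false c) (belongs (not-eq (n ∘ does-T (belongsTo? S true c) ∘ belongs)))) (λ c t t′ →
        true≢false (trans (sym (belongs⁻ (T-does (belongsTo? S true c) t))) (belongs⁻ (T-does (belongsTo? S false c) t′)))) KL.Xs
      where
      true≢false : true ≢ false
      true≢false ()

    coeffᴸ : ∀ i n → coeff ∣ Δ̃ L i ∣ n ≡ KL.#states x₀ y₀ n
    coeffᴸ i n = let j , p , q = out g₀ in trans (coeff-at L Col.coherentᴸ Col.no-circle i (src g₀) j n) (cong₂ (λ x y → KL.#states x y n) p q)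
      where
      out : ∀ e → ∃[ j ] corner (src e) (lf j) ≡ lo e × corner (src e) (rt j) ≡ ro e
      out (c , left)  = top , refl , refl
      out (c , right) = right , refl , refl

    term₁ : ℤ → HT.Asgᵇ → HF.Asgᵇ → ℤ
    term₁ n σ₁ σ₂ = (⟦ HT.stateᶠ? σ₁ ⟧ * ⟦ HF.stateᶠ? σ₂ ⟧) * ⟦ HT.exᵇ σ₁ + HF.exᵇ σ₂ ℤ.≟ n ⟧

    ext₁ : ∀ n {σ₁ τ₁ σ₂ τ₂} → σ₁ A₁.≗ₐ τ₁ → σ₂ A₂.≗ₐ τ₂ → term₁ n σ₁ σ₂ ≡ term₁ n τ₁ τ₂
    ext₁ n {σ₁} {τ₁} {σ₂} {τ₂} h h′ = cong₂ _*_ (cong₂ _*_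
        (⟦⟧-cong (HT.stateᶠ? σ₁) (HT.stateᶠ? τ₁) (HT.Co.covers-agree {HT.Co.full} (HT.Co.agree-ext h)) (HT.Co.covers-agree {HT.Co.full} (HT.Co.agree-ext (sym ∘ h))))
        (⟦⟧-cong (HF.stateᶠ? σ₂) (HF.stateᶠ? τ₂) (HF.Co.covers-agree {HF.Co.full} (HF.Co.agree-ext h′)) (HF.Co.covers-agree {HF.Co.full} (HF.Co.agree-ext (sym ∘ h′)))))
      (cong (λ z → ⟦ z ℤ.≟ n ⟧) (cong₂ _+_ (HT.Co.ex-agree {HT.Co.full} (HT.Co.agree-ext h)) (HF.Co.ex-agree {HF.Co.full} (HF.Co.agree-ext h′))))

    product₁ : ∀ i i′ n → coeff (∣ Δ̃ (Half.D true) i ∣ ⊛ ∣ Δ̃ (Half.D false) i′ ∣) n ≡ KL.S KL.Xs (λ σ → term₁ n (restrict₁ σ) (restrict₂ σ))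
    product₁ i i′ n = trans (coeff-product (λ σ → ⟦ HT.stateᶠ? σ ⟧) HT.exᵇ (λ σ → ⟦ HF.stateᶠ? σ ⟧) HF.exᵇ Xs₁ Xs₂
        ∣ Δ̃ (Half.D true) i ∣ ∣ Δ̃ (Half.D false) i′ ∣ (HT.coeff-factor i) (HF.coeff-factor i′) n) (sym (split (term₁ n) (ext₁ n)))

  -- If each half has a single cut, the regions on the far side met by its crossings on C
  -- all coincide with the absent one.
  module LengthOne (single : ∀ {b g g′} → Cut b g → Cut b g′ → g ≡ g′) where

    private
      cut-of : ∀ b → ∃[ g ] Cut b g × bank b g ≡ bank b g₀
      cut-of true  = g₀ , cut₀ , refl
      cut-of false = reflect false cut₀

      foreign-absent : ∀ b (x : Half.Kept b) k → side (corner (proj₁ x) k) ≢ b → Absent (corner (proj₁ x) k)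
      foreign-absent b x k n = at (corner-side (proj₁ x) k) n
        where
        at : ∀ {k} → CornerSide (proj₁ x) k → side (corner (proj₁ x) k) ≢ b → Absent (corner (proj₁ x) k)
        at (owned e) n = contradiction (trans e (Half.kept-own b x)) n
        at (foreign {s} i m) n =
          let g₁ , c₁ , e₁ = cut-of (not b)
              g , cg , e = rim-behind c₁ i (λ q → not-≢ {b} (trans (sym (Half.kept-own b x)) q))
          in trans (sym e) (trans (cong (bank (not b)) (single cg c₁)) (trans e₁ (cong (λ z → bank z g₀) (sym (not-eq n)))))

    state⇒ideals : ∀ σ → KL.State x₀ y₀ σ → HT.Ideal (restrict₁ σ) × HF.Ideal (restrict₂ σ)
    state⇒ideals σ st = (λ r → proj₁ (both r)) , (λ r → proj₂ (both r))
      where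
      avoid : ∀ c r → corner c (σ c) ≡ r → Absent r → ⊥
      avoid c r e a = KL.state-avoids {k = σ c} refl (go (absent-base (subst Absent (sym e) a))) st
        where
        go : corner c (σ c) ≡ x₀ ⊎ corner c (σ c) ≡ y₀ → KL.base x₀ y₀ (corner c (σ c)) ≡ true
        go (inj₁ f) = subst (λ z → KL.base x₀ y₀ z ≡ true) (sym f) (KL.base-left x₀ y₀)
        go (inj₂ f) = subst (λ z → KL.base x₀ y₀ z ≡ true) (sym f) (KL.base-right x₀ y₀)
      total : ∀ r → HT.u (restrict₁ σ) r + HF.u (restrict₂ σ) r ≡ HT.I r + HF.I r
      total r = trans (sym (uses-halves σ r)) (trans (st r) (sym (I-total r)))
      far₁ : ∀ {r} → side r ≢ true → HT.u (restrict₁ σ) r ≡ 0ℤ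
      far₁ {r} n = HT.u-zero {restrict₁ σ} (λ x e → avoid (proj₁ x) r e (subst Absent e (foreign-absent true x (σ (proj₁ x)) (n ∘ trans (sym (cong side e))))))
      far₂ : ∀ {r} → side r ≢ false → HF.u (restrict₂ σ) r ≡ 0ℤ
      far₂ {r} n = HF.u-zero {restrict₂ σ} (λ x e → avoid (proj₁ x) r e (subst Absent e (foreign-absent false x (σ (proj₁ x)) (n ∘ trans (sym (cong side e))))))
      both : ∀ r → HT.u (restrict₁ σ) r ≡ HT.I r × HF.u (restrict₂ σ) r ≡ HF.I r
      both r = go (side r Bool.≟ true)
        where
        cancel : ∀ {a b c d} → a + b ≡ c + d → b ≡ 0ℤ → d ≡ 0ℤ → a ≡ c
        cancel {a} {c = c} e refl refl = trans (sym (ℤ.+-identityʳ a)) (trans e (ℤ.+-identityʳ c))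
        go : Dec (side r ≡ true) → HT.u (restrict₁ σ) r ≡ HT.I r × HF.u (restrict₂ σ) r ≡ HF.I r
        go (yes q) = cancel (total r) f i , trans f (sym i)
          where
          n : side r ≢ false
          n q′ = case trans (sym q) q′ of λ ()
          f = far₂ n
          i = HF.I-outside n
        go (no n) = trans f (sym i) , cancel (trans (ℤ.+-comm (HF.u (restrict₂ σ) r) (HT.u (restrict₁ σ) r)) (trans (total r) (ℤ.+-comm (HT.I r) (HF.I r)))) f i
          where
          f = far₁ n
          i = HT.I-outside n

    equality : ∀ i i′ i″ → ∣ Δ̃ L i ∣ ≈ ∣ Δ̃ (Half.D true) i′ ∣ ⊛ ∣ Δ̃ (Half.D false) i″ ∣
    equality i i′ i″ n = trans (coeffᴸ i n) (trans (KL.S-cong KL.Xs (λ σ → cong₂ _*_ (states σ) (cong (λ z → ⟦ z ℤ.≟ n ⟧) (ex-halves σ))))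
                               (sym (product₁ i′ i″ n)))
      where
      states : ∀ σ → ⟦ stateᴸ? σ ⟧ ≡ ⟦ HT.stateᶠ? (restrict₁ σ) ⟧ * ⟦ HF.stateᶠ? (restrict₂ σ) ⟧
      states σ = trans (⟦⟧-cong (stateᴸ? σ) (HT.stateᶠ? (restrict₁ σ) ×-dec HF.stateᶠ? (restrict₂ σ))
          (λ st → let h , h′ = state⇒ideals σ st in HT.ideal⇒state h , HF.ideal⇒state h′)
          (λ (s , s′) → ideals⇒state σ (HT.state⇒ideal s) (HF.state⇒ideal s′)))
        (⟦⟧-× (HT.stateᶠ? (restrict₁ σ)) (HF.stateᶠ? (restrict₂ σ)))

  first-bound : ∀ i i′ i″ n → coeff (∣ Δ̃ (Half.D true) i′ ∣ ⊛ ∣ Δ̃ (Half.D false) i″ ∣) n ℤ.≤ coeff ∣ Δ̃ L i ∣ n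
  first-bound i i′ i″ n = subst₂ ℤ._≤_ (sym (product₁ i′ i″ n)) (sym (coeffᴸ i n)) (KL.S-mono KL.Xs bound)
    where
    bound : ∀ σ → term₁ n (restrict₁ σ) (restrict₂ σ) ℤ.≤ ⟦ stateᴸ? σ ⟧ * ⟦ KL.ex KL.full σ ℤ.≟ n ⟧
    bound σ = go (HT.stateᶠ? (restrict₁ σ) ×-dec HF.stateᶠ? (restrict₂ σ))
      where
      e≡ : ⟦ HT.exᵇ (restrict₁ σ) + HF.exᵇ (restrict₂ σ) ℤ.≟ n ⟧ ≡ ⟦ KL.ex KL.full σ ℤ.≟ n ⟧
      e≡ = cong (λ z → ⟦ z ℤ.≟ n ⟧) (sym (ex-halves σ))
      both = HT.stateᶠ? (restrict₁ σ) ×-dec HF.stateᶠ? (restrict₂ σ)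
      rewritten : term₁ n (restrict₁ σ) (restrict₂ σ) ≡ ⟦ both ⟧ * ⟦ KL.ex KL.full σ ℤ.≟ n ⟧
      rewritten = cong₂ _*_ (sym (⟦⟧-× (HT.stateᶠ? (restrict₁ σ)) (HF.stateᶠ? (restrict₂ σ)))) e≡
      go : Dec (HT.Co.State (Half.π true x₀) (Half.π true y₀) (restrict₁ σ) × HF.Co.State (Half.π false x₀) (Half.π false y₀) (restrict₂ σ)) →
           term₁ n (restrict₁ σ) (restrict₂ σ) ℤ.≤ ⟦ stateᴸ? σ ⟧ * ⟦ KL.ex KL.full σ ℤ.≟ n ⟧
      go (yes (s , s′)) = ℤ.≤-reflexive (trans rewritten (cong (_* ⟦ KL.ex KL.full σ ℤ.≟ n ⟧) (trans (⟦⟧-yes both (s , s′))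
          (sym (⟦⟧-yes (stateᴸ? σ) (ideals⇒state σ (HT.state⇒ideal s) (HF.state⇒ideal s′)))))))
      go (no m) = ℤ.≤-trans (ℤ.≤-reflexive (trans rewritten (cong (_* ⟦ KL.ex KL.full σ ℤ.≟ n ⟧) (⟦⟧-no both m))))
          (subst (0ℤ ℤ.≤_) (⟦⟧-× (stateᴸ? σ) (KL.ex KL.full σ ℤ.≟ n)) (⟦⟧-nonneg (stateᴸ? σ ×-dec (KL.ex KL.full σ ℤ.≟ n))))

  module LengthTwo (injective : ∀ γ {g g′} → Cut γ g → Cut γ g′ → bank γ g ≡ bank γ g′ → g ≡ g′) where

    module TildeStates (b : Bool) where
      open Half b
      open HalfStates b using (xᵇ; jᵇ; base-crossing; Asgᵇ; u; u-zero; exᵇ)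

      private
        cut-of : ∀ b → ∃[ g ] Cut b g
        cut-of true  = g₀ , cut₀
        cut-of false = let g , cg , _ = reflect false cut₀ in g , cg

        flipped : ∀ {β γ g} → β ≡ not γ → Cut β g → Cut (not γ) g
        flipped refl c = c

        not-not : b ≡ not (not b)
        not-not = sym (Bool.not-involutive b)

      module Ti = Tilde.Cuts L sphere alternating C S tight b (proj₁ (cut-of b)) (proj₂ (cut-of b))
        (λ c c′ → Transfer.transfer (not b) (injective (not b)) (flipped not-not c) (flipped not-not c′))
        (injective b) (Transfer.transfer b (injective b)) (rim-behind (proj₂ (cut-of b)))
      open Ti

      module Co = Independence (skeleton (tilde L C S b) Ti.coherent~)

      -- Rim regions on the own side are merged with a base region and hence given up. In exchange
      -- the foreign rim regions, which have become new faces, are used, apart from the absent one.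
      I : Region → ℤ
      I r = if does (side r Bool.≟ b) then ⟦ ¬? (rimmed? r) ⟧ else ⟦ rimmed? r ×-dec ¬? (absent? r) ⟧

      Ideal : Asgᵇ → Set
      Ideal σ = ∀ r → u σ r ≡ I r

      state? : ∀ σ → Dec (Co.State (φ x₀) (φ y₀) σ)
      state? = Co.state? (φ x₀) (φ y₀)

      private
        rimmed⇒rim : ∀ {r} → side r ≡ b → Rimmed r → Rim r
        rimmed⇒rim refl m = m

        rim⇒rimmed : ∀ {r} → side r ≡ b → Rim r → Rimmed r
        rim⇒rimmed refl m = m

        in-base : ∀ {r} → r ≡ x₀ ⊎ r ≡ y₀ → Co.base (φ x₀) (φ y₀) (φ r) ≡ true
        in-base (inj₁ refl) = Co.base-left (φ x₀) (φ y₀)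
        in-base (inj₂ refl) = Co.base-right (φ x₀) (φ y₀)

        kind-base : ∀ {r} → r ≡ x₀ ⊎ r ≡ y₀ → Kind r (φ r)
        kind-base {r} h = go h
          where
          at : ∀ k {z} → corner (proj₁ xᵇ) k ≡ z → Kind z (φ z)
          at k refl = subst (Kind _) (corner-φ xᵇ k) (kind xᵇ k)
          go : r ≡ x₀ ⊎ r ≡ y₀ → Kind r (φ r)
          go (inj₁ refl) = at (lf jᵇ) (proj₁ (proj₂ (proj₂ base-crossing)))
          go (inj₂ refl) = at (rt jᵇ) (proj₂ (proj₂ (proj₂ base-crossing)))

        -- The region of the base on the own side is a rim region by `absent-rimmed`, so the merged
        -- region is absent as a whole.
        merged-base : Co.base (φ x₀) (φ y₀) merged ≡ true
        merged-base = go (side x₀ Bool.≟ b)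
          where
          at : ∀ {r} → r ≡ x₀ ⊎ r ≡ y₀ → side r ≡ b → Co.base (φ x₀) (φ y₀) merged ≡ true
          at h q = subst (λ z → Co.base (φ x₀) (φ y₀) z ≡ true) (φ-rim q (rimmed⇒rim q (absent-rimmed (base-absent h)))) (in-base h)
          go : Dec (side x₀ ≡ b) → Co.base (φ x₀) (φ y₀) merged ≡ true
          go (yes q) = at (inj₁ refl) q
          go (no n) = at (inj₂ refl) (trans (not-eq (side-on on₀ ∘ sym)) (trans (cong not (not-eq n)) (Bool.not-involutive b)))

        kind-back : ∀ {r y} → Kind r y → y ≢ merged → back y ≡ r
        kind-back (survivor q n) _   = refl
        kind-back (rimmed q m) ne    = contradiction refl ne
        kind-back (opened n g t e) _ = e

        kinds-equal : ∀ {r r′ y y′} → Kind r y → Kind r′ y′ → y ≢ merged → y′ ≡ y → r′ ≡ r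
        kinds-equal k k′ ne refl = trans (sym (kind-back k′ ne)) (kind-back k ne)

        uses-kind : ∀ σ {r y} → Kind r y → y ≢ merged → Co.uses Co.full σ y ≡ u σ r
        uses-kind σ {r} {y} k ne = ∑-cong Xs (λ x → ⟦⟧-cong (Co.points? Co.full σ y x) (corner (proj₁ x) (σ x) ≟ᴿ r)
          (λ (_ , e) → kinds-equal k (kind x (σ x)) ne e)
          (λ e → refl , kind-unique (subst (λ z → Kind z (corner~ x (σ x))) e (kind x (σ x))) k))

        target-absent : ∀ {r y} → Kind r y → Absent r → Co.target (Co.base (φ x₀) (φ y₀)) y ≡ 0ℤ
        target-absent {r} k a = cong (if_then 0ℤ else 1ℤ) (subst (λ z → Co.base (φ x₀) (φ y₀) z ≡ true) (kind-φ k) (in-base (absent-base a)))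

        target-present : ∀ {r y} → Kind r y → y ≢ merged → ¬ Absent r → Co.target (Co.base (φ x₀) (φ y₀)) y ≡ 1ℤ
        target-present {r} {y} k ne n = cong (if_then 0ℤ else 1ℤ) (Co.base-neither (φ x₀) (φ y₀) y
          (λ e → n (base-absent (inj₁ (sym (kinds-equal k (kind-base (inj₁ refl)) ne (sym e))))))
          (λ e → n (base-absent (inj₂ (sym (kinds-equal k (kind-base (inj₂ refl)) ne (sym e)))))))

        I-in : ∀ {r} → side r ≡ b → I r ≡ ⟦ ¬? (rimmed? r) ⟧
        I-in {r} q = if-yes (side r Bool.≟ b) q

        I-out : ∀ {r} → side r ≢ b → I r ≡ ⟦ rimmed? r ×-dec ¬? (absent? r) ⟧
        I-out {r} n = if-no (side r Bool.≟ b) n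

      state⇒ideal : ∀ {σ} → Co.State (φ x₀) (φ y₀) σ → Ideal σ
      state⇒ideal {σ} st r = go (side r Bool.≟ b) (rimmed? r)
        where
        go : Dec (side r ≡ b) → Dec (Rimmed r) → u σ r ≡ I r
        go (yes q) (yes m) = trans (u-zero {σ} (λ x e → Co.state-avoids {σ = σ} {c = x} {k = σ x} refl
            (subst (λ z → Co.base (φ x₀) (φ y₀) z ≡ true) (sym (trans (corner-φ x (σ x)) (trans (cong φ e) (φ-rim q (rimmed⇒rim q m))))) merged-base) st))
          (sym (trans (I-in q) (⟦⟧-no (¬? (rimmed? r)) (λ n → n m))))
        go (yes q) (no n) = trans (sym (uses-kind σ k λ ())) (trans (st _) (trans (target-present k (λ ()) (n ∘ absent-rimmed)) (sym (trans (I-in q) (⟦⟧-yes (¬? (rimmed? r)) n)))))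
          where
          k = survivor q (n ∘ rim⇒rimmed q)
        -- The cut g given by the rim leaves the other side. Its partner from `reflect⁻` leaves side
        -- b along the same region and names the new face.
        go (no n) (yes (g , cg , e)) = trans (sym (uses-kind σ k λ ())) (trans (st _) (trans (value (absent? r)) (sym (I-out n))))
          where
          s≡ : side r ≡ not b
          s≡ = not-eq n
          found = reflect⁻ (side r) cg
          h = proj₁ found
          ch : Cut b h
          ch = subst (λ z → Cut z h) (trans (cong not s≡) (Bool.not-involutive b)) (proj₁ (proj₂ found))
          k : Kind r (disk (raise h (proj₁ ch)) (cut⇐ {raise h (proj₁ ch)} (proj₂ ch)))
          k = opened n (raise h (proj₁ ch)) (cut⇐ {raise h (proj₁ ch)} (proj₂ ch)) (trans (cong (λ z → bank z h) (sym s≡)) (trans (proj₂ (proj₂ found)) e))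
          value : (d : Dec (Absent r)) → Co.target (Co.base (φ x₀) (φ y₀)) (disk (raise h (proj₁ ch)) (cut⇐ {raise h (proj₁ ch)} (proj₂ ch))) ≡ ⟦ rimmed? r ×-dec ¬? d ⟧
          value (yes a) = trans (target-absent k a) (sym (⟦⟧-no (rimmed? r ×-dec ¬? (yes a)) (λ (_ , na) → na a)))
          value (no na) = trans (target-present k (λ ()) na) (sym (⟦⟧-yes (rimmed? r ×-dec ¬? (no na)) ((g , cg , e) , na)))
        go (no n) (no m) = trans (u-zero {σ} (λ x e → impossible (subst (λ z → Kind z (corner~ x (σ x))) e (kind x (σ x)))))
            (sym (trans (I-out n) (⟦⟧-no (rimmed? r ×-dec ¬? (absent? r)) (m ∘ proj₁))))
          where
          impossible : ∀ {y} → Kind r y → ⊥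
          impossible (survivor q _) = n q
          impossible (rimmed q _)   = n q
          impossible (opened _ g t e) =
            let s≡ = not-eq n
                g′ , cg′ , e′ = reflect (side r) (subst (λ z → Cut z (lift g)) (sym (trans (cong not s≡) (Bool.not-involutive b))) (cut⇒ {g} t))
            in m (g′ , cg′ , trans e′ (trans (cong (λ z → bank z (lift g)) s≡) e))

      coeff-tilde : ∀ j m → coeff ∣ Δ̃ (tilde L C S b) j ∣ m ≡ Co.#states (φ x₀) (φ y₀) m
      coeff-tilde j m = trans (coeff-at (tilde L C S b) Ti.coherent~ (λ o → Col.no-circle (proj₁ o)) j xᵇ jᵇ m)
        (cong₂ (λ x y → Co.#states x y m) (trans (corner-φ xᵇ (lf jᵇ)) (cong φ (proj₁ (proj₂ (proj₂ base-crossing)))))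
                                          (trans (corner-φ xᵇ (rt jᵇ)) (cong φ (proj₂ (proj₂ (proj₂ base-crossing))))))

      I-owned : ∀ {r} → side r ≡ b → I r ≡ ⟦ ¬? (rimmed? r) ⟧
      I-owned = I-in

      I-foreign : ∀ {r} → side r ≢ b → I r ≡ ⟦ rimmed? r ×-dec ¬? (absent? r) ⟧
      I-foreign = I-out

    private
      module TT = TildeStates true
      module TF = TildeStates false

      I~-total : ∀ r → TT.I r + TF.I r ≡ KL.target (KL.base x₀ y₀) r
      I~-total r = trans (go (side r Bool.≟ true)) (trans (value (rimmed? r) (absent? r)) (sym (target-L r)))
        where
        go : Dec (side r ≡ true) → TT.I r + TF.I r ≡ ⟦ ¬? (rimmed? r) ⟧ + ⟦ rimmed? r ×-dec ¬? (absent? r) ⟧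
        go (yes q) = cong₂ _+_ (TT.I-owned q) (TF.I-foreign (λ q′ → case trans (sym q) q′ of λ ()))
        go (no n) = trans (cong₂ _+_ (TT.I-foreign n) (TF.I-owned (not-eq n))) (ℤ.+-comm ⟦ rimmed? r ×-dec ¬? (absent? r) ⟧ ⟦ ¬? (rimmed? r) ⟧)
        value : (d : Dec (Rimmed r)) (a : Dec (Absent r)) → ⟦ ¬? d ⟧ + ⟦ d ×-dec ¬? a ⟧ ≡ ⟦ ¬? a ⟧
        value (yes _) (yes _) = refl
        value (yes _) (no _)  = refl
        value (no n)  (yes a) = contradiction (absent-rimmed a) n
        value (no _)  (no _)  = refl

      ideals~⇒state : ∀ σ → TT.Ideal (restrict₁ σ) → TF.Ideal (restrict₂ σ) → KL.State x₀ y₀ σ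
      ideals~⇒state σ h h′ r = trans (uses-halves σ r) (trans (cong₂ _+_ (h r) (h′ r)) (I~-total r))

      term₂ : ℤ → HT.Asgᵇ → HF.Asgᵇ → ℤ
      term₂ n σ₁ σ₂ = (⟦ TT.state? σ₁ ⟧ * ⟦ TF.state? σ₂ ⟧) * ⟦ HT.exᵇ σ₁ + HF.exᵇ σ₂ ℤ.≟ n ⟧

      ext₂ : ∀ n {σ₁ τ₁ σ₂ τ₂} → σ₁ A₁.≗ₐ τ₁ → σ₂ A₂.≗ₐ τ₂ → term₂ n σ₁ σ₂ ≡ term₂ n τ₁ τ₂
      ext₂ n {σ₁} {τ₁} {σ₂} {τ₂} h h′ = cong₂ _*_ (cong₂ _*_
          (⟦⟧-cong (TT.state? σ₁) (TT.state? τ₁) (TT.Co.covers-agree {TT.Co.full} (TT.Co.agree-ext h)) (TT.Co.covers-agree {TT.Co.full} (TT.Co.agree-ext (sym ∘ h))))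
          (⟦⟧-cong (TF.state? σ₂) (TF.state? τ₂) (TF.Co.covers-agree {TF.Co.full} (TF.Co.agree-ext h′)) (TF.Co.covers-agree {TF.Co.full} (TF.Co.agree-ext (sym ∘ h′)))))
        (cong (λ z → ⟦ z ℤ.≟ n ⟧) (cong₂ _+_ (HT.Co.ex-agree {HT.Co.full} (HT.Co.agree-ext h)) (HF.Co.ex-agree {HF.Co.full} (HF.Co.agree-ext h′))))

      product₂ : ∀ j j′ n → coeff (∣ Δ̃ (tilde L C S true) j ∣ ⊛ ∣ Δ̃ (tilde L C S false) j′ ∣) n ≡ KL.S KL.Xs (λ σ → term₂ n (restrict₁ σ) (restrict₂ σ))
      product₂ j j′ n = trans (coeff-product (λ σ → ⟦ TT.state? σ ⟧) HT.exᵇ (λ σ → ⟦ TF.state? σ ⟧) HF.exᵇ Xs₁ Xs₂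
          ∣ Δ̃ (tilde L C S true) j ∣ ∣ Δ̃ (tilde L C S false) j′ ∣ (TT.coeff-tilde j) (TF.coeff-tilde j′) n) (sym (split (term₂ n) (ext₂ n)))

    -- A second cut leads to a region used only by the states of the second kind.
    module _ (g₁ : End) (cut₁ : Cut false g₁) (other : bank false g₁ ≢ bank false g₀) where

      private
        r₁ = bank false g₁

        side₁ : side r₁ ≡ false
        side₁ = bank-side (cut-on cut₁)

        0≢1 : 0ℤ ≢ 1ℤ
        0≢1 ()

        disjoint : ∀ σ → HT.Ideal σ → TT.Ideal σ → ⊥
        disjoint σ h h′ = 0≢1 (trans (sym (trans (h r₁) (HT.I-outside far)))
            (trans (h′ r₁) (trans (TT.I-foreign far) (⟦⟧-yes (rimmed? r₁ ×-dec ¬? (absent? r₁)) (rm , na)))))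
          where
          far : side r₁ ≢ true
          far q = case trans (sym q) side₁ of λ ()
          rm : Rimmed r₁
          rm = g₁ , subst (λ z → Cut z g₁) (sym side₁) cut₁ , cong (λ z → bank z g₁) side₁
          na : ¬ Absent r₁
          na a = other (trans a (cong (λ z → bank z g₀) side₁))

      both-bound : ∀ i i′ i″ j j′ n →
        coeff (∣ Δ̃ (Half.D true) i′ ∣ ⊛ ∣ Δ̃ (Half.D false) i″ ∣) n + coeff (∣ Δ̃ (tilde L C S true) j ∣ ⊛ ∣ Δ̃ (tilde L C S false) j′ ∣) n
          ℤ.≤ coeff ∣ Δ̃ L i ∣ n
      both-bound i i′ i″ j j′ n = subst₂ ℤ._≤_ (trans (KL.S-+ KL.Xs (λ σ → term₁ n (restrict₁ σ) (restrict₂ σ)) (λ σ → term₂ n (restrict₁ σ) (restrict₂ σ)))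
            (sym (cong₂ _+_ (product₁ i′ i″ n) (product₂ j j′ n)))) (sym (coeffᴸ i n)) (KL.S-mono KL.Xs bound)
        where
        bound : ∀ σ → term₁ n (restrict₁ σ) (restrict₂ σ) + term₂ n (restrict₁ σ) (restrict₂ σ) ℤ.≤ ⟦ stateᴸ? σ ⟧ * ⟦ KL.ex KL.full σ ℤ.≟ n ⟧
        bound σ = ℤ.≤-trans (ℤ.≤-reflexive (trans (cong₂ _+_ (rewritten (HT.stateᶠ? σ₁) (HF.stateᶠ? σ₂)) (rewritten (TT.state? σ₁) (TF.state? σ₂)))
              (sym (ℤ.*-distribʳ-+ e ⟦ HT.stateᶠ? σ₁ ×-dec HF.stateᶠ? σ₂ ⟧ ⟦ TT.state? σ₁ ×-dec TF.state? σ₂ ⟧))))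
            (times-e (sum≤ (HT.stateᶠ? σ₁ ×-dec HF.stateᶠ? σ₂) (TT.state? σ₁ ×-dec TF.state? σ₂) (stateᴸ? σ)
              (λ (s , s′) → ideals⇒state σ (HT.state⇒ideal s) (HF.state⇒ideal s′))
              (λ (s , s′) → ideals~⇒state σ (TT.state⇒ideal {σ₁} s) (TF.state⇒ideal {σ₂} s′))
              (λ (s , _) (s′ , _) → disjoint σ₁ (HT.state⇒ideal s) (TT.state⇒ideal {σ₁} s′))))
          where
          σ₁ = restrict₁ σ
          σ₂ = restrict₂ σ
          e = ⟦ KL.ex KL.full σ ℤ.≟ n ⟧
          e≡ : ⟦ HT.exᵇ σ₁ + HF.exᵇ σ₂ ℤ.≟ n ⟧ ≡ e
          e≡ = cong (λ z → ⟦ z ℤ.≟ n ⟧) (sym (ex-halves σ))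
          rewritten : ∀ {P Q : Set} (d : Dec P) (d′ : Dec Q) → (⟦ d ⟧ * ⟦ d′ ⟧) * ⟦ HT.exᵇ σ₁ + HF.exᵇ σ₂ ℤ.≟ n ⟧ ≡ ⟦ d ×-dec d′ ⟧ * e
          rewritten d d′ = cong₂ _*_ (sym (⟦⟧-× d d′)) e≡
          sum≤ : ∀ {P Q R : Set} (d : Dec P) (d′ : Dec Q) (d″ : Dec R) → (P → R) → (Q → R) → (P → Q → ⊥) → ⟦ d ⟧ + ⟦ d′ ⟧ ℤ.≤ ⟦ d″ ⟧
          sum≤ (yes p) (yes q) _ f g h = ⊥-elim (h p q)
          sum≤ (yes p) (no _) d″ f g h = ℤ.≤-reflexive (sym (⟦⟧-yes d″ (f p)))
          sum≤ (no _) (yes q) d″ f g h = ℤ.≤-reflexive (sym (⟦⟧-yes d″ (g q)))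
          sum≤ (no _) (no _) d″ f g h = ⟦⟧-nonneg d″
          times-e : ∀ {a c} → a ℤ.≤ c → a * e ℤ.≤ c * e
          times-e {a} {c} h = go (KL.ex KL.full σ ℤ.≟ n)
            where
            go : (d : Dec (KL.ex KL.full σ ≡ n)) → a * ⟦ d ⟧ ℤ.≤ c * ⟦ d ⟧
            go (yes _) = subst₂ ℤ._≤_ (sym (ℤ.*-identityʳ a)) (sym (ℤ.*-identityʳ c)) h
            go (no _)  = ℤ.≤-reflexive (trans (ℤ.*-zeroʳ a) (sym (ℤ.*-zeroʳ c)))

-- Conclusion, including disconnected projections

module Sum (L : Diagram) (sphere : OnSphere L) (alternating : Alternating L) (C : Diagram.End L)
           (S : SeifertCircle.Complement L C) where
  open Counts L sphere C S

  private
    Q : ∀ b → Diagram.Segment (Half.D b) → Laurent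
    Q b j = ∣ Δ̃ (Half.D b) j ∣

    Q~ : ∀ b → Diagram.Segment (tilde L C S b) → Laurent
    Q~ b j = ∣ Δ̃ (tilde L C S b) j ∣

    ⊛-emptyʳ : ∀ p {q} → q ≡ [] → ∀ n → coeff (p ⊛ ∣ q ∣) n ≡ 0ℤ
    ⊛-emptyʳ p refl n = trans (coeff-⊛ p [] n) (∑-zero p (λ t → ℤ.*-zeroʳ (proj₁ t)))

    product-or-zero : ∀ D D′ j j′ → ((∃[ σ ] IsState D j σ) × (∃[ σ ] IsState D′ j′ σ)) ⊎
                      (∀ n → coeff (∣ Δ̃ D j ∣ ⊛ ∣ Δ̃ D′ j′ ∣) n ≡ 0ℤ)
    product-or-zero D D′ j j′ = go (state-or-empty D j) (state-or-empty D′ j′)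
      where
      go : (∃[ σ ] IsState D j σ) ⊎ Δ̃ D j ≡ [] → (∃[ σ ] IsState D′ j′ σ) ⊎ Δ̃ D′ j′ ≡ [] →
           ((∃[ σ ] IsState D j σ) × (∃[ σ ] IsState D′ j′ σ)) ⊎ (∀ n → coeff (∣ Δ̃ D j ∣ ⊛ ∣ Δ̃ D′ j′ ∣) n ≡ 0ℤ)
      go (inj₁ s) (inj₁ s′) = inj₁ (s , s′)
      go (inj₂ e) _         = inj₂ (λ n → cong (λ p → coeff (∣ p ∣ ⊛ ∣ Δ̃ D′ j′ ∣) n) e)
      go (inj₁ _) (inj₂ e)  = inj₂ (⊛-emptyʳ ∣ Δ̃ D j ∣ e)

    Tight : Set
    Tight = 2 ℕ.+ size crossingᶠ ≡ size regionᶠ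

    tight? : Dec Tight
    tight? = 2 ℕ.+ size crossingᶠ ℕ.≟ size regionᶠ

    loose-zero : ¬ Tight → ∀ i n → coeff ∣ Δ̃ L i ∣ n ≡ 0ℤ
    loose-zero n i m = go (state-or-empty L i)
      where
      go : (∃[ σ ] IsState L i σ) ⊎ Δ̃ L i ≡ [] → coeff ∣ Δ̃ L i ∣ m ≡ 0ℤ
      go (inj₁ (σ , st)) = contradiction (tight-state {i} {σ} st) n
      go (inj₂ e)        = cong (λ p → coeff ∣ p ∣ m) e

    loose-product : ¬ Tight → ∀ i i′ n → coeff (Q true i ⊛ Q false i′) n ≡ 0ℤ
    loose-product n i i′ = go (product-or-zero (Half.D true) (Half.D false) i i′)
      where
      go : ((∃[ σ ] IsState (Half.D true) i σ) × (∃[ σ ] IsState (Half.D false) i′ σ)) ⊎ (∀ n → coeff (Q true i ⊛ Q false i′) n ≡ 0ℤ) →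
           ∀ n → coeff (Q true i ⊛ Q false i′) n ≡ 0ℤ
      go (inj₁ ((σ , st) , (σ′ , st′))) = contradiction (tight-factors {i} {σ} {i′} {σ′} st st′) n
      go (inj₂ z)                       = z

    a-cut : SeifertCircle.len L C S ≢ 0 → ∀ b → ∃[ g ] Cut b g
    a-cut n b = let g , _ , h = ∑≢0 Es (λ e → ⟦ cut? b e ⟧) (λ z → n (ℤ.+-injective (trans (len-cuts b) z))) in
      g , decidable-stable (cut? b g) (λ m → h (⟦⟧-no (cut? b g) m))

  equality : SeifertCircle.len L C S ≡ 1 → ∀ i i′ i″ → ∣ Δ̃ L i ∣ ≈ Q true i′ ⊛ Q false i″
  equality one i i′ i″ = go tight?
    where
    only-cut : ∀ {b g g′} → Cut b g → Cut b g′ → g ≡ g′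
    only-cut {b} {g} {g′} c c′ = let x , _ , _ , u = count-one (cut? b) Es (trans (sym (len-cuts b)) (cong +_ one)) in
      trans (u (E-complete g) c) (sym (u (E-complete g′) c′))
    first = a-cut (λ z → case trans (sym one) z of λ ()) true
    go : Dec Tight → ∣ Δ̃ L i ∣ ≈ Q true i′ ⊛ Q false i″
    go (yes t) = Main.LengthOne.equality L sphere alternating C S t (proj₁ first) (proj₂ first) only-cut i i′ i″
    go (no n) m = trans (loose-zero n i m) (sym (loose-product n i′ i″ m))

  module _ (two : 2 ℕ.≤ SeifertCircle.len L C S) where
    private
      first = a-cut (λ z → ℕ.<⇒≢ (ℕ.≤-trans (s≤s z≤n) two) (sym z)) true
      g₀ = proj₁ first
      cut₀ = proj₂ first

    -- If all cuts had the same region as g₀ on this side, injectivity would leave at most one of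
    -- them.
    second-cut : (∀ {g g′} → Cut false g → Cut false g′ → bank false g ≡ bank false g′ → g ≡ g′) →
                 ∃[ g ] Cut false g × bank false g ≢ bank false g₀
    second-cut inj = go (any? (λ g → cut? false g ×-dec ¬? (bank false g ≟ᴿ bank false g₀)) Es)
      where
      go : Dec (Any.Any (λ g → Cut false g × bank false g ≢ bank false g₀) Es) → ∃[ g ] Cut false g × bank false g ≢ bank false g₀
      go (yes i) = let g , _ , p = find i in g , p
      go (no n) = ⊥-elim (small (count-unique (cut? false) Es E-unique (λ c c′ → inj c c′ (trans (at c) (sym (at c′))))))
        where
        at : ∀ {g} → Cut false g → bank false g ≡ bank false g₀
        at {g} c = decidable-stable (bank false g ≟ᴿ bank false g₀) (λ m → n (lose (E-complete g) (c , m)))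
        small : #cuts false ≡ 0ℤ ⊎ #cuts false ≡ 1ℤ → ⊥
        small (inj₁ z) = ℕ.<⇒≱ (s≤s z≤n) (subst (2 ℕ.≤_) (ℤ.+-injective (trans (len-cuts false) z)) two)
        small (inj₂ o) = ℕ.<⇒≱ (s≤s (s≤s z≤n)) (subst (2 ℕ.≤_) (ℤ.+-injective (trans (len-cuts false) o)) two)

    bound : ∀ i i′ i″ j j′ → ∣ Δ̃ L i ∣ ≽ (Q true i′ ⊛ Q false i″) ⊞ (Q~ true j ⊛ Q~ false j′)
    bound i i′ i″ j j′ n = subst (ℤ._≤ coeff ∣ Δ̃ L i ∣ n) (sym (coeff-⊞ (Q true i′ ⊛ Q false i″) (Q~ true j ⊛ Q~ false j′) n))
        (go (product-or-zero (tilde L C S true) (tilde L C S false) j j′))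
      where
      coeff-⊞ : ∀ p q n → coeff (p ⊞ q) n ≡ coeff p n + coeff q n
      coeff-⊞ p q n = trans (coeff-∑ (p ⊞ q) n) (trans (∑-++ p q (λ t → ⟦ proj₂ t ℤ.≟ n ⟧ * proj₁ t))
        (sym (cong₂ _+_ (coeff-∑ p n) (coeff-∑ q n))))
      first-bound : Dec Tight → coeff (Q true i′ ⊛ Q false i″) n ℤ.≤ coeff ∣ Δ̃ L i ∣ n
      first-bound (yes t) = Main.first-bound L sphere alternating C S t g₀ cut₀ i i′ i″ n
      first-bound (no m)  = ℤ.≤-reflexive (trans (loose-product m i′ i″ n) (sym (loose-zero m i n)))
      go : ((∃[ σ ] IsState (tilde L C S true) j σ) × (∃[ σ ] IsState (tilde L C S false) j′ σ)) ⊎ (∀ n → coeff (Q~ true j ⊛ Q~ false j′) n ≡ 0ℤ) →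
           coeff (Q true i′ ⊛ Q false i″) n + coeff (Q~ true j ⊛ Q~ false j′) n ℤ.≤ coeff ∣ Δ̃ L i ∣ n
      go (inj₂ z) = subst (ℤ._≤ coeff ∣ Δ̃ L i ∣ n) (sym (trans (cong (_+_ (coeff (Q true i′ ⊛ Q false i″) n)) (z n)) (ℤ.+-identityʳ _))) (first-bound tight?)
      go (inj₁ ((σ , st) , (σ′ , st′))) = Main.LengthTwo.both-bound L sphere alternating C S T.tight-tildes g₀ cut₀ T.cut-bank-injective
          (proj₁ other) (proj₁ (proj₂ other)) (proj₂ (proj₂ other)) i i′ i″ j j′ n
        where
        module T = Tildes {j} {σ} {j′} {σ′} st st′
        other = second-cut (T.cut-bank-injective false)

theorem1p3 : (L : Diagram) → OnSphere L → Alternating L →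
    (C : Diagram.End L) → SeifertCircle.Type2 L C →
    (S : SeifertCircle.Complement L C) →
    let open SeifertCircle L C
        L′  = factor S true
        L″  = factor S false
        L~′ = tilde L C S true
        L~″ = tilde L C S false
    in
    (len S ≡ 1 →
      ∀ (i : Diagram.Segment L) (i′ : Diagram.Segment L′) (i″ : Diagram.Segment L″) →
      ∣ Δ̃ L i ∣ ≈ ∣ Δ̃ L′ i′ ∣ ⊛ ∣ Δ̃ L″ i″ ∣)
    ×
    (2 ≤ len S →
      ∀ (i : Diagram.Segment L) (i′ : Diagram.Segment L′) (i″ : Diagram.Segment L″)
        (j′ : Diagram.Segment L~′) (j″ : Diagram.Segment L~″) →
      ∣ Δ̃ L i ∣ ≽ (∣ Δ̃ L′ i′ ∣ ⊛ ∣ Δ̃ L″ i″ ∣) ⊞ (∣ Δ̃ L~′ j′ ∣ ⊛ ∣ Δ̃ L~″ j″ ∣))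
theorem1p3 L sphere alternating C _ S = Sum.equality L sphere alternating C S , Sum.bound L sphere alternating C S
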